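{- Fix $k,j \in \mathbb{N}_{>0}$. The $\Sigma^{k\textsc{ExpTime}}_j$-prenex TM problem is $\Sigma^{k\textsc{ExpTime}}_j$-complete.
   Context: Tetration: $\mathrm{tetra}(0,n)=n$ and $\mathrm{tetra}(k,n)=2^{\mathrm{tetra}(k-1,n)}$. $\Sigma^{k\textsc{ExpTime}}_j$ is the class of problems decidable by an alternating Turing machine in time $\mathrm{tetra}(k,f(n))$ for some polynomial $f$, starting in an existential state and performing at most $j-1$ alternations, on every input of length $n$. A deterministic $n$-tape Turing machine ($n$DTM) is $\mathcal{T}=(n,\Sigma,S,q_{init},q_{acc},q_{rej},\delta)$ where $\Sigma$ is a finite alphabet containing a blank symbol, $S$ is a finite set of states containing $q_{init},q_{acc},q_{rej}$, the machine has $n$ tapes numbered $1..n$, each with cells indexed by $\mathbb{N}$, and one read/write head shared by all tapes. The transition function is $\delta: S\times\Sigma \to (S\times\Sigma\times\{ -1,+1\})\cup(S\times[1,n])$ with $\delta(q_{acc},a)=(q_{acc},1)$ and $\delta(q_{rej},a)=(q_{rej},1)$ for all $a$. A positional state is $(q,j,k)$: state $q$, head on cell $k$ of tape $j$. If the head reads $a$ and $\delta(q,a)=(q',b,i)$: if $k+i\in\mathbb{N}$ the machine writes $b$ on cell $(j,k)$ and moves to $(q',j,k+i)$; otherwise the tapes are unchanged and the positional state becomes $(q_{rej},1,0)$. If $\delta(q,a)=(q',j')$: the positional state becomes $(q',j',k)$ and tapes are unchanged. An input is $(w_1,\dots,w_n)\in(\Sigma^*)^n$, $w_j$ written on tape $j$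 from position $0$; $\mathcal{T}(w_1,\dots,w_n)$ is the run from $(q_{init},1,0)$, accepting in time $t$ if $q_{acc}$ is reached within $t$ steps. The $k\textsc{AExp}_{\textsc{Pol}}$-prenex TM problem: Input: $(n,\vec Q,\mathcal{T})$ with $n$ in unary, $\vec Q=(Q_1,\dots,Q_n)\in\{\exists,\forall\}^n$ with $Q_1=\exists$, and $\mathcal{T}$ an $n$DTM over $\Sigma$. Question: does $Q_1 w_1\in\Sigma^{\mathrm{tetra}(k,n)},\dots,Q_n w_n\in\Sigma^{\mathrm{tetra}(k,n)}$ : $\mathcal{T}(w_1,\dots,w_n)$ accepts in time $\mathrm{tetra}(k,n)$ hold? For $\vec Q\in\{\exists,\forall\}^n$ let $\mathrm{alt}(\vec Q)=1+|\{i\in[2,n]: Q_i\neq Q_{i-1}\}|$. The $\Sigma^{k\textsc{ExpTime}}_j$-prenex TM problem is the $k\textsc{AExp}_{\textsc{Pol}}$-prenex TM problem restricted to instances with $\mathrm{alt}(\vec Q)=j$. -}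

module Defs where

open import Data.Nat using (ℕ; zero; suc; _+_; _*_; _∸_; _^_; _≤_; _<_; _≟_; _<?_)
open import Data.Fin using (Fin; zero; suc; toℕ; fromℕ<)
import Data.Fin as F
open import Data.Bool using (Bool; true; false; if_then_else_; _∧_)
open import Data.List using (List; []; _∷_; _++_; length; replicate; map; concat; allFin)
open import Data.Vec using (Vec; []; _∷_; lookup; toList; head)
open import Data.Maybe using (Maybe; just; nothing)
open import Data.Product using (Σ; _×_; _,_)
open import Data.Unit using (⊤)
open import Data.Empty using (⊥)
open import Relation.Nullary using (does; yes; no)
open import Relation.Binary.PropositionalEquality using (_≡_)
open import Function.Bundles using (_⇔_)
open import Data.List.Relation.Unary.Any using (Any)
open import Data.List.Relation.Unary.All using (All)

tetra : ℕ → ℕ → ℕ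
tetra zero    n = n
tetra (suc k) n = 2 ^ tetra k n

Poly : Set
Poly = List ℕ

evalPoly : Poly → ℕ → ℕ
evalPoly []       n = 0
evalPoly (c ∷ cs) n = c + n * evalPoly cs n

data Quant : Set where
  exQ allQ : Quant

sameQ : Quant → Quant → Bool
sameQ exQ  exQ  = true
sameQ allQ allQ = true
sameQ _    _    = false

Problem : Set₁
Problem = List Bool → Set

-- Single-tape machines with tape alphabet Fin (3 + g):
-- symbol 0 is the blank, symbols 1 and 2 encode the input bits false/true.

Sym : ℕ → Set
Sym g = Fin (3 + g)

bitSym : ∀ {g} → Bool → Sym g
bitSym false = suc zero
bitSym true  = suc (suc zero)

decodeSym : ∀ {g} → Sym g → Maybe Bool
decodeSym zero             = nothing
decodeSym (suc zero)       = just false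
decodeSym (suc (suc zero)) = just true
decodeSym _                = nothing

data Move : Set where
  left right : Move

record Conf (g s : ℕ) : Set where
  constructor conf
  field
    state : Fin s
    hd    : ℕ
    tape  : ℕ → Sym g

writeTape : ∀ {g} → (ℕ → Sym g) → ℕ → Sym g → ℕ → Sym g
writeTape t pos b p = if does (p ≟ pos) then b else t p

moveHead : Move → ℕ → ℕ
moveHead left  zero    = zero
moveHead left  (suc p) = p
moveHead right p       = suc p

applyMove : ∀ {g s} → Fin s × Sym g × Move → Conf g s → Conf g s
applyMove (q' , b , m) (conf q h t) = conf q' (moveHead m h) (writeTape t h b)

inputTape : ∀ {g} → List Bool → ℕ → Sym g
inputTape []      _       = zero
inputTape (b ∷ w) zero    = bitSym b
inputTape (b ∷ w) (suc p) = inputTape w p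

data Kind : Set where
  quant : Quant → Kind
  accK rejK : Kind

record ATM : Set where
  field
    g s  : ℕ
    init : Fin s
    kind : Fin s → Kind
    δ    : Fin s → Sym g → List (Fin s × Sym g × Move)

module ATMSem (M : ATM) where
  open ATM M

  initConf : List Bool → Conf g s
  initConf w = conf init 0 (inputTape w)

  succs : Conf g s → List (Fin s × Sym g × Move)
  succs c = δ (Conf.state c) (Conf.tape c (Conf.hd c))

  isAcc : Kind → Set
  isAcc accK = ⊤
  isAcc _    = ⊥

  isHalt : Kind → Set
  isHalt (quant _) = ⊥
  isHalt _         = ⊤

  Acc : ℕ → Conf g s → Set
  Acc zero    c = isAcc (kind (Conf.state c))
  Acc (suc t) c with kind (Conf.state c)
  ... | accK        = ⊤
  ... | rejK        = ⊥
  ... | quant exQ  = Any (λ m → Acc t (applyMove m c)) (succs c)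
  ... | quant allQ = All (λ m → Acc t (applyMove m c)) (succs c)

  Halts : ℕ → Conf g s → Set
  Halts zero    c = isHalt (kind (Conf.state c))
  Halts (suc t) c with kind (Conf.state c)
  ... | quant _ = All (λ m → Halts t (applyMove m c)) (succs c)
  ... | accK    = ⊤
  ... | rejK    = ⊤

  mutual
    AltOK : ℕ → ℕ → Quant → Conf g s → Set
    AltOK t b q c = AltK t b q c (kind (Conf.state c))

    AltK : ℕ → ℕ → Quant → Conf g s → Kind → Set
    AltK t b q c accK = ⊤
    AltK t b q c rejK = ⊤
    AltK t b q c (quant q') with sameQ q q'
    ... | true  = AltCont t b q' c
    ... | false = AltSwitch t b q' c

    AltSwitch : ℕ → ℕ → Quant → Conf g s → Set
    AltSwitch t zero    q c = ⊥
    AltSwitch t (suc b) q c = AltCont t b q c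

    AltCont : ℕ → ℕ → Quant → Conf g s → Set
    AltCont zero    b q c = ⊤
    AltCont (suc t) b q c = All (λ m → AltOK t b q (applyMove m c)) (succs c)

InSigma : ℕ → ℕ → Problem → Set
InSigma k j L =
  Σ ATM λ M → Σ Poly λ p →
    (ATM.kind M (ATM.init M) ≡ quant exQ) ×
    ((w : List Bool) →
       ATMSem.Halts M (tetra k (evalPoly p (length w))) (ATMSem.initConf M w) ×
       ATMSem.AltOK M (tetra k (evalPoly p (length w))) (j ∸ 1) exQ (ATMSem.initConf M w) ×
       (L w ⇔ ATMSem.Acc M (tetra k (evalPoly p (length w))) (ATMSem.initConf M w)))

record DTM : Set where
  field
    g s       : ℕ
    init halt : Fin s
    δ         : Fin s → Sym g → Fin s × Sym g × Move

module DTMSem (M : DTM) where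
  open DTM M

  initConf : List Bool → Conf g s
  initConf w = conf init 0 (inputTape w)

  step : Conf g s → Conf g s
  step c = if does (Conf.state c F.≟ halt) then c
           else applyMove (δ (Conf.state c) (Conf.tape c (Conf.hd c))) c

  run : ℕ → Conf g s → Conf g s
  run zero    c = c
  run (suc t) c = run t (step c)

  OutputIs : (ℕ → Sym g) → List Bool → Set
  OutputIs t []       = decodeSym (t 0) ≡ nothing
  OutputIs t (b ∷ bs) = (decodeSym (t 0) ≡ just b) × OutputIs (λ p → t (suc p)) bs

PolyTimeComputable : (List Bool → List Bool) → Set
PolyTimeComputable f =
  Σ DTM λ M → Σ Poly λ p → (w : List Bool) →
    Σ ℕ λ t → (t ≤ evalPoly p (length w)) ×
      (Conf.state (DTMSem.run M t (DTMSem.initConf M w)) ≡ DTM.halt M) ×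
      DTMSem.OutputIs M (Conf.tape (DTMSem.run M t (DTMSem.initConf M w))) (f w)

_≤p_ : Problem → Problem → Set
L ≤p L' = Σ (List Bool → List Bool) λ f → PolyTimeComputable f × ((w : List Bool) → L w ⇔ L' (f w))

Complete : ℕ → ℕ → Problem → Set₁
Complete k j L = InSigma k j L × ((L' : Problem) → InSigma k j L' → L' ≤p L)

-- n-tape DTMs (nDTM) with a shared head.  Tape i ∈ [1,n] is Fin n (index i-1),
-- alphabet Σ = Fin (suc σ') with blank symbol zero.

data Dir : Set where
  minus1 plus1 : Dir

data Action (n σ s : ℕ) : Set where
  write  : Fin s → Fin σ → Dir → Action n σ s
  switch : Fin s → Fin n → Action n σ s

record NDTM (n : ℕ) : Set where
  field
    σ' s             : ℕ
    qinit qacc qrej  : Fin s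
    δ                : Fin s → Fin (suc σ') → Action n (suc σ') s

module NSem {n' : ℕ} (T : NDTM (suc n')) where
  open NDTM T

  record PConf : Set where
    constructor pconf
    field
      state : Fin s
      tp    : Fin (suc n')
      pos   : ℕ
      tapes : Fin (suc n') → ℕ → Fin (suc σ')

  upd : (Fin (suc n') → ℕ → Fin (suc σ')) → Fin (suc n') → ℕ → Fin (suc σ') →
        Fin (suc n') → ℕ → Fin (suc σ')
  upd ts i p b i' p' = if does (i' F.≟ i) ∧ does (p' ≟ p) then b else ts i' p'

  stepN : PConf → PConf
  stepN (pconf q j k ts) with δ q (ts j k)
  ... | switch q' j'          = pconf q' j' k ts
  ... | write q' b plus1      = pconf q' j (suc k) (upd ts j k b)
  ... | write q' b minus1 with k
  ...   | zero   = pconf qrej zero 0 ts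
  ...   | suc k' = pconf q' j k' (upd ts j k b)

  iter : ℕ → PConf → PConf
  iter zero    c = c
  iter (suc t) c = iter t (stepN c)

  initTapes : (len : ℕ) → (Fin (suc n') → Vec (Fin (suc σ')) len) →
              Fin (suc n') → ℕ → Fin (suc σ')
  initTapes len ws i p with p <? len
  ... | yes lt = lookup (ws i) (fromℕ< lt)
  ... | no  _  = zero

  AcceptsIn : (t len : ℕ) → (Fin (suc n') → Vec (Fin (suc σ')) len) → Set
  AcceptsIn t len ws =
    Σ ℕ λ i → (i ≤ t) × (PConf.state (iter i (pconf qinit zero 0 (initTapes len ws))) ≡ qacc)

consF : ∀ {W : Set} {m} → W → (Fin m → W) → Fin (suc m) → W
consF w ws zero    = w
consF w ws (suc i) = ws i

evalQ : ∀ {W : Set} {m} → Vec Quant m → ((Fin m → W) → Set) → Set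
evalQ             []           P = P (λ ())
evalQ {W}         (exQ  ∷ qs) P = Σ W λ w → evalQ qs (λ ws → P (consF w ws))
evalQ {W}         (allQ ∷ qs) P = (w : W) → evalQ qs (λ ws → P (consF w ws))

alt : ∀ {m} → Vec Quant (suc m) → ℕ
alt (q ∷ [])          = 1
alt (q ∷ (q' ∷ qs))   = (if sameQ q q' then 0 else 1) + alt (q' ∷ qs)

record Instance : Set where
  field
    n' : ℕ                       -- n = suc n'
    Q  : Vec Quant (suc n')
    T  : NDTM (suc n')

Valid : Instance → Set
Valid I =
  (head Q ≡ exQ) ×
  ((a : Fin (suc (NDTM.σ' T))) → NDTM.δ T (NDTM.qacc T) a ≡ switch (NDTM.qacc T) zero) ×
  ((a : Fin (suc (NDTM.σ' T))) → NDTM.δ T (NDTM.qrej T) a ≡ switch (NDTM.qrej T) zero)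
  where open Instance I

Holds : ℕ → Instance → Set
Holds k I =
  evalQ {Vec (Fin (suc (NDTM.σ' T))) (tetra k (suc n'))} Q
        (λ ws → NSem.AcceptsIn T (tetra k (suc n')) (tetra k (suc n')) ws)
  where open Instance I

unary : ℕ → List Bool
unary m = replicate m true ++ (false ∷ [])

encFin : ∀ {m} → Fin m → List Bool
encFin i = unary (toℕ i)

encQ : Quant → Bool
encQ exQ  = true
encQ allQ = false

encAction : ∀ {n σ s} → Action n σ s → List Bool
encAction (write q b minus1) = true ∷ (encFin q ++ encFin b ++ (false ∷ []))
encAction (write q b plus1)  = true ∷ (encFin q ++ encFin b ++ (true ∷ []))
encAction (switch q i)       = false ∷ (encFin q ++ encFin i)

encode : Instance → List Bool
encode I =
  unary n' ++ map encQ (toList Q) ++ unary σ' ++ unary s ++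
  encFin qinit ++ encFin qacc ++ encFin qrej ++
  concat (map (λ q → concat (map (λ a → encAction (δ q a)) (allFin (suc σ')))) (allFin s))
  where
    open Instance I
    open NDTM T

PrenexTM : ℕ → ℕ → Problem
PrenexTM k j w =
  Σ Instance λ I → (encode I ≡ w) × Valid I × (alt (Instance.Q I) ≡ j) × Holds k I

{-# OPTIONS --safe #-}
module Submission where

-- Membership: an alternating machine parses the instance, computes N = tetra k n in unary, guesses
-- the n words bit by bit, switching its mode exactly where the prefix alternates, and then
-- simulates the nDTM for N steps.  As k ≥ 1, a polynomial in a tower is at most a tower over a
-- polynomial, so a crude unary simulation on one tape fits into the time bound.
--
-- Hardness: let M be an alternating machine with j quantifier blocks.  The choice that M makes at
-- time t in its i-th block is read at position t + const of the i-th word; choices of different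
-- blocks live in different words, so they can all be quantified in advance.  The nDTM writes the
-- input (wired into a chain of states) on a further tape and simulates M there, carrying the shared
-- head back and forth between a clock mark, which shows t, and a mark for the head of M.  The clock
-- also delimits the initialised part of that tape, so its arbitrary initial content is never seen.
--
-- The machines are compiled in two stages: a small total language on binary trees is executed by
-- stack programs, and stacks are kept on the tracks of a single tape.  Polynomial-time functions
-- are then closed under primitive recursion as soon as the values have polynomial size.

open import Defs
open import Data.Nat using (ℕ; zero; suc; _+_; _*_; _∸_; _^_; _≤_; _<_; z≤n; s≤s; s≤s⁻¹; _≟_; _<?_; pred; _≡ᵇ_)
open import Data.Nat.Properties using (≤-refl; ≤-trans; ≤-reflexive; +-comm; +-assoc; +-identityʳ; +-suc; *-suc; *-zeroʳ; *-identityʳ; +-mono-≤; +-monoˡ-≤; +-monoʳ-≤; *-mono-≤; *-monoˡ-≤; *-monoʳ-≤; m≤m+n; m≤n+m; n≤1+n; m≤n⇒m≤1+n; <⇒≤; ≤∧≢⇒<; <-irrefl; *-distribʳ-+; module ≤-Reasoning)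
import Data.Nat.Properties as ℕP using (^-distribˡ-+-*; ^-monoʳ-≤; m+[n∸m]≡n; m^n>0; m∸n≡0⇒m≤n; m∸n≤m; m≤n⇒m∸n≡0; pred[m∸n]≡m∸[1+n]; pred[n]≤n; suc-injective; ≤-antisym)
open import Data.Nat.Tactic.RingSolver using (solve-∀)
open import Data.Fin using (Fin; zero; suc; toℕ; fromℕ<; _↑ˡ_; _↑ʳ_; splitAt; combine; remQuot)
import Data.Fin as F using (fromℕ; inject₁; _≟_)
import Data.Fin.Properties as FP using (fromℕ<-cong; fromℕ≢inject₁; remQuot-combine; splitAt-↑ʳ; splitAt-↑ˡ; toℕ-fromℕ; toℕ-fromℕ<; toℕ-injective; toℕ-inject₁; toℕ-↑ʳ; toℕ-↑ˡ; toℕ<n; ↑ˡ-injective)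
open import Data.Bool using (Bool; true; false; if_then_else_; _∧_)
open import Data.List using (List; []; _∷_; _++_; _ʳ++_; length; replicate; map; concat; allFin; reverse; tabulate)
import Data.List.Properties as LP using (++-assoc; ++-identityʳ; ++-ʳ++; concat-++; length-++; length-map; length-replicate; length-reverse; length-tabulate; length-ʳ++; map-cong; map-tabulate; map-∘; reverse-involutive; tabulate-cong; ʳ++-defn; ʳ++-ʳ++)
open import Data.Vec using (Vec; []; _∷_; lookup; toList; head; _[_]≔_)
import Data.Vec as V using (_++_; drop; map; replicate; take)
import Data.Vec.Properties as VP using ([]≔-lookup; length-toList; lookup-map; lookup∘update; lookup∘update′; map-[]≔)
open import Data.Maybe using (Maybe; just; nothing; maybe)
open import Data.Product using (Σ; _×_; _,_; proj₁; proj₂; map₁; map₂)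
open import Data.Sum using (_⊎_; inj₁; inj₂; [_,_])
open import Data.Unit using (⊤; tt)
open import Data.Empty using (⊥; ⊥-elim)
open import Relation.Nullary using (does; yes; no)
open import Relation.Nullary.Decidable using (dec-true; dec-false)
open import Relation.Binary.PropositionalEquality using (_≡_; refl; sym; trans; cong; cong₂; subst; subst₂; _≢_)
open import Function using (_∘_; id; case_of_)
open import Function.Bundles using (_⇔_; mk⇔; Equivalence)
open import Data.List.Relation.Unary.Any using (Any; here; there)
open import Data.List.Relation.Unary.All using (All; []; _∷_)

-- Alternations are the tight resource. Whatever is computed after a guess has to run in the mode in
-- which the guess ended, so every working state carries a `Quant`, and a deterministic step is a
-- pair of equal successors: `P ⊎ P` and `P × P` are both equivalent to `P`. Only a change of block
-- is charged. In the reduction every tape is quantified, the work tape included. The first j tapes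
-- alternate and hold the choices; the work tape and the padding tapes repeat the last quantifier.
-- The padding raises n until `tetra k n` exceeds the simulation time. The outcome depends on the
-- choice tapes alone, so the remaining quantifiers are vacuous. `PrenexTM` asks for some instance
-- with the given code, and instances contain functions. They are therefore compared through `Raw`,
-- a description by numbers and lists: equal codes give equal `Raw` values, and the truth of an
-- instance is a property of its `Raw` value.

record Finite (A : Set) : Set where
  field
    size    : ℕ
    enc     : A → Fin size
    dec     : Fin size → A
    dec-enc : ∀ a → dec (enc a) ≡ a
open Finite public

fin-Fin : ∀ n → Finite (Fin n)
fin-Fin n = record { size = n ; enc = id ; dec = id ; dec-enc = λ _ → refl }

fin-⊤ : Finite ⊤
fin-⊤ = record { size = 1 ; enc = λ _ → zero ; dec = λ _ → tt ; dec-enc = λ _ → refl }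

fin-⊎ : ∀ {A B} → Finite A → Finite B → Finite (A ⊎ B)
fin-⊎ {A} {B} a b = record
  { size = size a + size b ; enc = e ; dec = d ; dec-enc = de }
  where
  e : A ⊎ B → Fin (size a + size b)
  e (inj₁ x) = enc a x ↑ˡ size b
  e (inj₂ y) = size a ↑ʳ enc b y
  d : Fin (size a + size b) → A ⊎ B
  d i with splitAt (size a) i
  ... | inj₁ x = inj₁ (dec a x)
  ... | inj₂ y = inj₂ (dec b y)
  de : ∀ x → d (e x) ≡ x
  de (inj₁ x) rewrite FP.splitAt-↑ˡ (size a) (enc a x) (size b) = cong inj₁ (dec-enc a x)
  de (inj₂ y) rewrite FP.splitAt-↑ʳ (size a) (size b) (enc b y) = cong inj₂ (dec-enc b y)

fin-× : ∀ {A B} → Finite A → Finite B → Finite (A × B)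
fin-× {A} {B} a b = record
  { size = size a * size b
  ; enc = λ p → combine (enc a (proj₁ p)) (enc b (proj₂ p))
  ; dec = d ; dec-enc = de }
  where
  d : Fin (size a * size b) → A × B
  d i = dec a (proj₁ (remQuot {size a} (size b) i)) , dec b (proj₂ (remQuot {size a} (size b) i))
  de : ∀ x → d (combine (enc a (proj₁ x)) (enc b (proj₂ x))) ≡ x
  de (x , y) = cong₂ _,_
    (trans (cong (dec a ∘ proj₁) (FP.remQuot-combine (enc a x) (enc b y))) (dec-enc a x))
    (trans (cong (dec b ∘ proj₂) (FP.remQuot-combine (enc a x) (enc b y))) (dec-enc b y))

fin-retract : ∀ {A B : Set} (f : A → B) (g : B → A) → (∀ a → g (f a) ≡ a) → Finite B → Finite A
fin-retract f g gf b = record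
  { size = size b ; enc = enc b ∘ f ; dec = g ∘ dec b
  ; dec-enc = λ a → trans (cong g (dec-enc b (f a))) (gf a) }

fin-Maybe : ∀ {A} → Finite A → Finite (Maybe A)
fin-Maybe a = fin-retract (λ { nothing → inj₁ tt ; (just x) → inj₂ x })
  (λ { (inj₁ _) → nothing ; (inj₂ x) → just x }) (λ { nothing → refl ; (just _) → refl }) (fin-⊎ fin-⊤ a)

fin-Bool : Finite Bool
fin-Bool = fin-retract (λ { false → inj₁ tt ; true → inj₂ tt })
  (λ { (inj₁ _) → false ; (inj₂ _) → true }) (λ { false → refl ; true → refl }) (fin-⊎ fin-⊤ fin-⊤)

fin-Quant : Finite Quant
fin-Quant = fin-retract (λ { exQ → false ; allQ → true })
  (λ { false → exQ ; true → allQ }) (λ { exQ → refl ; allQ → refl }) fin-Bool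

fin-Vec : ∀ {A} n → Finite A → Finite (Vec A n)
fin-Vec zero    a = fin-retract (λ _ → tt) (λ _ → []) (λ { [] → refl }) fin-⊤
fin-Vec (suc n) a = fin-retract (λ { (x ∷ xs) → x , xs }) (λ { (x , xs) → x ∷ xs })
  (λ { (x ∷ xs) → refl }) (fin-× a (fin-Vec n a))

-- Polynomials as expressions, so that composition is substitution.

data Pol : Set where
  X       : Pol
  con     : ℕ → Pol
  _⊕_ _⊗_ : Pol → Pol → Pol

infixl 6 _⊕_
infixl 7 _⊗_

eval : Pol → ℕ → ℕ
eval X       n = n
eval (con c) n = c
eval (p ⊕ q) n = eval p n + eval q n
eval (p ⊗ q) n = eval p n * eval q n

_⊚_ : Pol → Pol → Pol
X       ⊚ r = r
con c   ⊚ r = con c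
(p ⊕ q) ⊚ r = (p ⊚ r) ⊕ (q ⊚ r)
(p ⊗ q) ⊚ r = (p ⊚ r) ⊗ (q ⊚ r)

eval-⊚ : ∀ p r n → eval (p ⊚ r) n ≡ eval p (eval r n)
eval-⊚ X       r n = refl
eval-⊚ (con c) r n = refl
eval-⊚ (p ⊕ q) r n = cong₂ _+_ (eval-⊚ p r n) (eval-⊚ q r n)
eval-⊚ (p ⊗ q) r n = cong₂ _*_ (eval-⊚ p r n) (eval-⊚ q r n)

eval-mono : ∀ p {m n} → m ≤ n → eval p m ≤ eval p n
eval-mono X       h = h
eval-mono (con c) h = ≤-refl
eval-mono (p ⊕ q) h = +-mono-≤ (eval-mono p h) (eval-mono q h)
eval-mono (p ⊗ q) h = *-mono-≤ (eval-mono p h) (eval-mono q h)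

addP : Poly → Poly → Poly
addP []       q        = q
addP (c ∷ p)  []       = c ∷ p
addP (c ∷ p)  (d ∷ q)  = c + d ∷ addP p q

addP-eval : ∀ p q n → evalPoly (addP p q) n ≡ evalPoly p n + evalPoly q n
addP-eval []      q       n = refl
addP-eval (c ∷ p) []      n = sym (+-identityʳ _)
addP-eval (c ∷ p) (d ∷ q) n rewrite addP-eval p q n = lem c d n (evalPoly p n) (evalPoly q n)
  where
  lem : ∀ c d n x y → c + d + n * (x + y) ≡ c + n * x + (d + n * y)
  lem = solve-∀

scaleP : ℕ → Poly → Poly
scaleP c = map (c *_)

scaleP-eval : ∀ c p n → evalPoly (scaleP c p) n ≡ c * evalPoly p n
scaleP-eval c []      n = sym (*-zeroʳ c)
scaleP-eval c (d ∷ p) n rewrite scaleP-eval c p n = lem c d n (evalPoly p n)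
  where
  lem : ∀ c d n x → c * d + n * (c * x) ≡ c * (d + n * x)
  lem = solve-∀

mulP : Poly → Poly → Poly
mulP []      q = []
mulP (c ∷ p) q = addP (scaleP c q) (0 ∷ mulP p q)

mulP-eval : ∀ p q n → evalPoly (mulP p q) n ≡ evalPoly p n * evalPoly q n
mulP-eval []      q n = refl
mulP-eval (c ∷ p) q n
  rewrite addP-eval (scaleP c q) (0 ∷ mulP p q) n | scaleP-eval c q n | mulP-eval p q n
  = lem c n (evalPoly p n) (evalPoly q n)
  where
  lem : ∀ c n x y → c * y + n * (x * y) ≡ (c + n * x) * y
  lem = solve-∀

abstract
  toPoly : Pol → Poly
  toPoly X       = 0 ∷ 1 ∷ []
  toPoly (con c) = c ∷ []
  toPoly (p ⊕ q) = addP (toPoly p) (toPoly q)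
  toPoly (p ⊗ q) = mulP (toPoly p) (toPoly q)

  toPoly-eval : ∀ p n → evalPoly (toPoly p) n ≡ eval p n
  toPoly-eval X       n rewrite *-zeroʳ n = *-identityʳ n
  toPoly-eval (con c) n rewrite *-zeroʳ n = +-identityʳ c
  toPoly-eval (p ⊕ q) n rewrite addP-eval (toPoly p) (toPoly q) n = cong₂ _+_ (toPoly-eval p n) (toPoly-eval q n)
  toPoly-eval (p ⊗ q) n rewrite mulP-eval (toPoly p) (toPoly q) n = cong₂ _*_ (toPoly-eval p n) (toPoly-eval q n)

fromPoly : Poly → Pol
fromPoly []      = con 0
fromPoly (c ∷ p) = con c ⊕ X ⊗ fromPoly p

fromPoly-eval : ∀ p n → eval (fromPoly p) n ≡ evalPoly p n
fromPoly-eval []      n = refl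
fromPoly-eval (c ∷ p) n rewrite fromPoly-eval p n = refl

-- Polynomials in a tower lie below towers over a polynomial

n<2^n : ∀ n → n < 2 ^ n
n<2^n zero    = s≤s z≤n
n<2^n (suc n) = ≤-trans (s≤s (n<2^n n))
  (≤-trans (+-monoˡ-≤ (2 ^ n) (≤-trans (s≤s z≤n) (n<2^n n))) (≤-reflexive (cong (2 ^ n +_) (sym (+-identityʳ _)))))

tetra-mono : ∀ k {m n} → m ≤ n → tetra k m ≤ tetra k n
tetra-mono zero    h = h
tetra-mono (suc k) h = ℕP.^-monoʳ-≤ 2 (tetra-mono k h)

n≤tetra : ∀ k n → n ≤ tetra k n
n≤tetra zero    n = ≤-refl
n≤tetra (suc k) n = ≤-trans (n≤tetra k n) (<⇒≤ (n<2^n (tetra k n)))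

m+n≤m*n : ∀ {m n} → 2 ≤ m → 2 ≤ n → m + n ≤ m * n
m+n≤m*n {suc (suc m)} {suc (suc n)} _ _ =
  ≤-trans (m≤m+n _ (m + m * n + n)) (≤-reflexive (lem m n))
  where
  lem : ∀ m n → suc (suc m) + suc (suc n) + (m + m * n + n) ≡ suc (suc m) * suc (suc n)
  lem = solve-∀
m+n≤m*n {suc zero} (s≤s ())
m+n≤m*n {suc (suc _)} {suc zero} _ (s≤s ())

-- For positive arguments a tower of positive height is at least 2. Two such numbers have a sum
-- below their product, and a product of powers of 2 is the power of the sum of the exponents, where
-- the induction applies.
tetra-+ : ∀ k {x y} → 1 ≤ x → 1 ≤ y → tetra k x + tetra k y ≤ tetra k (x + y)
tetra-+ zero    _ _ = ≤-refl
tetra-+ (suc k) {x} {y} hx hy = begin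
  2 ^ a + 2 ^ b   ≤⟨ m+n≤m*n (ℕP.^-monoʳ-≤ 2 (≤-trans hx (n≤tetra k x))) (ℕP.^-monoʳ-≤ 2 (≤-trans hy (n≤tetra k y))) ⟩
  2 ^ a * 2 ^ b   ≡⟨ sym (ℕP.^-distribˡ-+-* 2 a b) ⟩
  2 ^ (a + b)     ≤⟨ ℕP.^-monoʳ-≤ 2 (tetra-+ k hx hy) ⟩
  tetra (suc k) (x + y) ∎
  where
  open ≤-Reasoning
  a b : ℕ
  a = tetra k x
  b = tetra k y

tetra-* : ∀ k {x y} → 1 ≤ x → 1 ≤ y → tetra (suc k) x * tetra (suc k) y ≤ tetra (suc k) (x + y)
tetra-* k {x} {y} hx hy = ≤-trans (≤-reflexive (sym (ℕP.^-distribˡ-+-* 2 (tetra k x) (tetra k y))))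
  (ℕP.^-monoʳ-≤ 2 (tetra-+ k hx hy))

-- Sums and products alike become sums, since at positive height a product of two towers is at most
-- the tower of the sum. The added ones keep the summands positive, as `tetra-+` and `tetra-*`
-- demand.
tetraPol : Pol → Pol
tetraPol X       = X
tetraPol (con c) = con c
tetraPol (p ⊕ q) = (con 1 ⊕ tetraPol p) ⊕ (con 1 ⊕ tetraPol q)
tetraPol (p ⊗ q) = (con 1 ⊕ tetraPol p) ⊕ (con 1 ⊕ tetraPol q)

tetraPol-bound : ∀ k p n → eval p (tetra (suc k) n) ≤ tetra (suc k) (eval (tetraPol p) n)
tetraPol-bound k X       n = ≤-refl
tetraPol-bound k (con c) n = n≤tetra (suc k) c
tetraPol-bound k (p ⊕ q) n = ≤-trans
  (+-mono-≤ (≤-trans (tetraPol-bound k p n) (tetra-mono (suc k) (n≤1+n _)))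
            (≤-trans (tetraPol-bound k q n) (tetra-mono (suc k) (n≤1+n _))))
  (tetra-+ (suc k) (s≤s z≤n) (s≤s z≤n))
tetraPol-bound k (p ⊗ q) n = ≤-trans
  (*-mono-≤ (≤-trans (tetraPol-bound k p n) (tetra-mono (suc k) (n≤1+n _)))
            (≤-trans (tetraPol-bound k q n) (tetra-mono (suc k) (n≤1+n _))))
  (tetra-* k (s≤s z≤n) (s≤s z≤n))

-- Stack machines and their single-tape simulation

-- Five stacks: `rA` is the work stack, `rB` and `rC` are scratch, `rN` is a counter, and `rI` holds
-- the input and the output.
K : ℕ
K = 5

Reg : Set
Reg = Fin K

Env : Set
Env = Vec (List Bool) K

pattern rA = zero
pattern rB = suc zero
pattern rC = suc (suc zero)
pattern rN = suc (suc (suc zero))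
pattern rI = suc (suc (suc (suc zero)))

-- `pop` branches three ways: empty stack, `false`, `true`. `flip` is the only genuine choice and
-- `toggle` the only change of mode, so the alternations of a run are the executed `toggle`s.
data Instr (L : Set) : Set where
  push      : Reg → Bool → L → Instr L
  pop       : Reg → L → L → L → Instr L
  flip      : L → L → Instr L
  toggle    : L → Instr L
  done fail : Instr L

negQ : Quant → Quant
negQ exQ  = allQ
negQ allQ = exQ

if-≟-yes : ∀ {A : Set} {p q} {x y : A} → p ≡ q → (if does (p ≟ q) then x else y) ≡ x
if-≟-yes {p = p} {q} {x} {y} e = cong (λ b → if b then x else y) (dec-true (p ≟ q) e)

if-≟-no : ∀ {A : Set} {p q} {x y : A} → p ≢ q → (if does (p ≟ q) then x else y) ≡ y
if-≟-no {p = p} {q} {x} {y} e = cong (λ b → if b then x else y) (dec-false (p ≟ q) e)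

-- The entry of a stack at height p above its bottom (which is stored in cell 0 of the tape).
bot : ∀ {A : Set} → List A → ℕ → Maybe A
bot []      p = nothing
bot (x ∷ l) p = if does (p ≟ length l) then just x else bot l p

bot-top : ∀ {A : Set} (x : A) l → bot (x ∷ l) (length l) ≡ just x
bot-top x l = if-≟-yes {p = length l} refl

bot-below : ∀ {A : Set} (x : A) l {p} → p ≢ length l → bot (x ∷ l) p ≡ bot l p
bot-below x l h = if-≟-no h

bot-nothing : ∀ {A : Set} (l : List A) {p} → length l ≤ p → bot l p ≡ nothing
bot-nothing []      h = refl
bot-nothing (x ∷ l) {p} h = trans (bot-below x l (λ e → <-irrefl (sym e) h)) (bot-nothing l (<⇒≤ h))

bot-just : ∀ {A : Set} (l : List A) {p} → p < length l → Σ A λ x → bot l p ≡ just x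
bot-just (x ∷ l) {p} (s≤s h) with p ≟ length l
... | yes e  = x , if-≟-yes e
... | no  ne = map₂ (trans (if-≟-no ne)) (bot-just l (≤∧≢⇒< h ne))

nthM : List Bool → ℕ → Maybe Bool
nthM []      p       = nothing
nthM (x ∷ l) zero    = just x
nthM (x ∷ l) (suc p) = nthM l p

bot-ʳ++-low : ∀ (w acc : List Bool) {p} → p < length acc → bot (w ʳ++ acc) p ≡ bot acc p
bot-ʳ++-low []      acc h = refl
bot-ʳ++-low (b ∷ w) acc h =
  trans (bot-ʳ++-low w (b ∷ acc) (m≤n⇒m≤1+n h)) (bot-below b acc (λ e → <-irrefl e h))

bot-ʳ++ : ∀ w acc p → bot (w ʳ++ acc) (p + length acc) ≡ nthM w p
bot-ʳ++ []      acc p       = bot-nothing acc (m≤n+m _ p)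
bot-ʳ++ (b ∷ w) acc zero    = trans (bot-ʳ++-low w (b ∷ acc) ≤-refl) (bot-top b acc)
bot-ʳ++ (b ∷ w) acc (suc p) =
  trans (cong (bot (w ʳ++ (b ∷ acc))) (sym (+-suc p (length acc)))) (bot-ʳ++ w (b ∷ acc) p)

bot-reverse : ∀ w p → bot (reverse w) p ≡ nthM w p
bot-reverse w p = trans (cong (bot (reverse w)) (sym (+-identityʳ p))) (bot-ʳ++ w [] p)

Cell : Set
Cell = Bool × Vec (Maybe Bool) K

abstract
  finCell : Finite Cell
  finCell = fin-× fin-Bool (fin-Vec K (fin-Maybe fin-Bool))

gC : ℕ
gC = size finCell

noTracks : Vec (Maybe Bool) K
noTracks = V.replicate K nothing

-- Input symbols are read as cells that hold a bit on track rI only.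
view : Sym gC → Cell
view zero                = false , noTracks
view (suc zero)          = false , noTracks [ rI ]≔ just false
view (suc (suc zero))    = false , noTracks [ rI ]≔ just true
view (suc (suc (suc i))) = dec finCell i

wr : Cell → Sym gC
wr c = suc (suc (suc (enc finCell c)))

view-wr : ∀ c → view (wr c) ≡ c
view-wr c = dec-enc finCell c

isZero : ℕ → Bool
isZero zero    = true
isZero (suc _) = false

cellAt : Env → ℕ → Cell
cellAt ρ p = isZero p , V.map (λ l → bot l p) ρ

-- Everything is seen through `view`, so blanks and input symbols that were never rewritten already
-- count as cells. The untouched input tape is thus a representation from the start, up to the flag
-- of cell 0.
Rep : Env → (ℕ → Sym gC) → Set
Rep ρ t = ∀ p → view (t p) ≡ cellAt ρ p

-- With the bottom of each stack in cell 0, a push or a pop alters the track of `r` in one cell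
-- only, the one under the head.
Rep-upd : ∀ ρ t r l' h → Rep ρ t → (∀ {p} → p ≢ h → bot l' p ≡ bot (lookup ρ r) p) →
          Rep (ρ [ r ]≔ l') (writeTape t h (wr (isZero h , proj₂ (cellAt ρ h) [ r ]≔ bot l' h)))
Rep-upd ρ t r l' h R same p with p ≟ h
... | yes refl = trans (cong view (if-≟-yes {p = h} refl)) (trans (view-wr _) (cong (isZero h ,_) (sym (VP.map-[]≔ (λ l → bot l h) ρ r))))
... | no  ne   = trans (cong view (if-≟-no ne)) (trans (R p) (cong (isZero p ,_) (sym eq)))
  where
  eq : V.map (λ l → bot l p) (ρ [ r ]≔ l') ≡ V.map (λ l → bot l p) ρ
  eq = trans (VP.map-[]≔ (λ l → bot l p) ρ r)
      (trans (cong (V.map (λ l → bot l p) ρ [ r ]≔_) (trans (same ne) (sym (VP.lookup-map r (λ l → bot l p) ρ))))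
             (VP.[]≔-lookup _ r))

Rep-same : ∀ ρ t h → Rep ρ t → Rep ρ (writeTape t h (wr (cellAt ρ h)))
Rep-same ρ t h R p with p ≟ h
... | yes refl = trans (cong view (if-≟-yes {p = h} refl)) (view-wr _)
... | no  ne   = trans (cong view (if-≟-no ne)) (R p)

-- `at`: in cell 0, about to execute an instruction. `scan`: climbing to the first free entry of the
-- track. `take`: erasing the top entry, one cell below. `ret`: walking back to the flagged cell 0.
data Ph : Set where
  at scan take ret : Ph

-- One state set serves two machines. `out` accepts for the alternating machine; for the transducer
-- it is the phase that turns track `rI` into plain output symbols, and `fin` is its halting state.
data St (L : Set) : Set where
  start out fin rej : St L
  work : Quant → Ph → L → St L

fin-Ph : Finite Ph
fin-Ph = fin-retract to from (λ { at → refl ; scan → refl ; take → refl ; ret → refl }) (fin-× fin-Bool fin-Bool)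
  where
  to : Ph → Bool × Bool
  to at   = false , false
  to scan = false , true
  to take = true , false
  to ret  = true , true
  from : Bool × Bool → Ph
  from (false , false) = at
  from (false , true)  = scan
  from (true , false)  = take
  from (true , true)   = ret

fin-St : ∀ {L} → Finite L → Finite (St L)
fin-St {L} fl = fin-retract to from
  (λ { start → refl ; out → refl ; fin → refl ; rej → refl ; (work _ _ _) → refl })
  (fin-⊎ (fin-× fin-Bool fin-Bool) (fin-× fin-Quant (fin-× fin-Ph fl)))
  where
  to : St L → (Bool × Bool) ⊎ (Quant × (Ph × L))
  to start        = inj₁ (false , false)
  to out          = inj₁ (false , true)
  to fin          = inj₁ (true , false)
  to rej          = inj₁ (true , true)
  to (work m p l) = inj₂ (m , p , l)
  from : (Bool × Bool) ⊎ (Quant × (Ph × L)) → St L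
  from (inj₁ (false , false)) = start
  from (inj₁ (false , true))  = out
  from (inj₁ (true , false))  = fin
  from (inj₁ (true , true))   = rej
  from (inj₂ (m , p , l))     = work m p l

kindS : ∀ {L} → St L → Kind
kindS start        = quant exQ
kindS out          = accK
kindS fin          = accK
kindS rej          = rejK
kindS (work m _ _) = quant m

-- The two tables δ false and δ true differ only on flip instructions: they resolve a binary choice.
module TM {L : Set} (fl : Finite L) (instr : L → Instr L) (entry : L) where

  Out : Set
  Out = St L × Sym gC × Move

  δpush : Quant → L → L → Reg → Bool → Cell → Maybe Bool → Out
  δpush m l l' r x c nothing  = work m ret l' , wr (proj₁ c , proj₂ c [ r ]≔ just x) , left
  δpush m l l' r x c (just _) = work m scan l , wr c , right

  -- The Boolean is the flag of cell 0. A free entry there means that the stack is empty; a free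
  -- entry elsewhere means that the top lies one cell to the left.
  δpop : Quant → L → L → Cell → Bool → Maybe Bool → Out
  δpop m l l∅ c true  nothing  = work m at l∅ , wr c , left
  δpop m l l∅ c false nothing  = work m take l , wr c , left
  δpop m l l∅ c _     (just _) = work m scan l , wr c , right

  δtake : Quant → L → L → Reg → Cell → Maybe Bool → Out
  δtake m l0 l1 r c nothing  = rej , wr c , left
  δtake m l0 l1 r c (just b) = work m ret (if b then l1 else l0) , wr (proj₁ c , proj₂ c [ r ]≔ nothing) , left

  δat : Bool → Quant → L → Instr L → Cell → Out
  δat b m l (push _ _ _)  c = work m scan l , wr c , left
  δat b m l (pop _ _ _ _) c = work m scan l , wr c , left
  δat b m l (flip l0 l1)  c = work m at (if b then l1 else l0) , wr c , left
  δat b m l (toggle l')   c = work (negQ m) at l' , wr c , left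
  δat b m l done          c = out , wr c , left
  δat b m l fail          c = rej , wr c , left

  δscan : Quant → L → Instr L → Cell → Out
  δscan m l (push r x l')    c = δpush m l l' r x c (lookup (proj₂ c) r)
  δscan m l (pop r l∅ l0 l1) c = δpop m l l∅ c (proj₁ c) (lookup (proj₂ c) r)
  δscan m l _                c = rej , wr c , left

  δtk : Quant → Instr L → Cell → Out
  δtk m (pop r l∅ l0 l1) c = δtake m l0 l1 r c (lookup (proj₂ c) r)
  δtk m _                c = rej , wr c , left

  δret : Quant → L → Cell → Bool → Out
  δret m l c true  = work m at l , wr c , left
  δret m l c false = work m ret l , wr c , left

  δout : Maybe Bool → Out
  δout (just b) = out , bitSym b , right
  δout nothing  = fin , zero , left

  δS : Bool → St L → Cell → Out
  -- A left move in cell 0 stays in cell 0, so the only effect is to set the flag.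
  δS b start           c = work exQ at entry , wr (true , proj₂ c) , left
  δS b out             c = δout (lookup (proj₂ c) rI)
  δS b fin             c = fin , wr c , left
  δS b rej             c = rej , wr c , left
  δS b (work m at l)   c = δat b m l (instr l) c
  δS b (work m scan l) c = δscan m l (instr l) c
  δS b (work m take l) c = δtk m (instr l) c
  δS b (work m ret l)  c = δret m l c (proj₁ c)

  abstract
    finS : Finite (St L)
    finS = fin-St fl

  sS : ℕ
  sS = size finS

  Cf : Set
  Cf = Conf gC sS

  encOut : Out → Fin sS × Sym gC × Move
  encOut (q , a , m) = enc finS q , a , m

  δF : Bool → Fin sS → Sym gC → Fin sS × Sym gC × Move
  δF b q a = encOut (δS b (dec finS q) (view a))

  stepC : Bool → Cf → Cf
  stepC b c = applyMove (δF b (Conf.state c) (Conf.tape c (Conf.hd c))) c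

  cf : St L → ℕ → (ℕ → Sym gC) → Cf
  cf q h t = conf (enc finS q) h t

  nextC : Out → ℕ → (ℕ → Sym gC) → Cf
  nextC (q , a , m) h t = cf q (moveHead m h) (writeTape t h a)

  stepC-cf : ∀ b q h t {c o} → view (t h) ≡ c → δS b q c ≡ o → stepC b (cf q h t) ≡ nextC o h t
  stepC-cf b q h t refl refl rewrite dec-enc finS q = refl

  -- Steps on which both tables agree, all taken in states of mode `m`. For the alternating machine
  -- they are pairs of equal successors, for the transducer ordinary steps, so the stack simulation
  -- is proved once for both.
  data Det (m : Quant) : ℕ → Cf → Cf → Set where
    []   : ∀ {c} → Det m 0 c c
    step : ∀ {n h t c₁ c₂} q → kindS q ≡ quant m → (∀ b → stepC b (cf q h t) ≡ c₁) →
           Det m n c₁ c₂ → Det m (suc n) (cf q h t) c₂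

  _⊙_ : ∀ {m n n' c c' c''} → Det m n c c' → Det m n' c' c'' → Det m (n + n') c c''
  []             ⊙ e = e
  step q k s d   ⊙ e = step q k s (d ⊙ e)

  one : ∀ {m q h t c o} → kindS q ≡ quant m → view (t h) ≡ c → (∀ b → δS b q c ≡ o) → Det m 1 (cf q h t) (nextC o h t)
  one {q = q} {h} {t} k v e = step q k (λ b → stepC-cf b q h t v (e b)) []

  ret-run : ∀ m l ρ p t → Rep ρ t →
            Σ (ℕ → Sym gC) λ t' → Det m (suc p) (cf (work m ret l) p t) (cf (work m at l) 0 t') × Rep ρ t'
  ret-run m l ρ zero    t R = _ , one refl (R 0) (λ _ → refl) , Rep-same ρ t 0 R
  ret-run m l ρ (suc p) t R with ret-run m l ρ p _ (Rep-same ρ t (suc p) R)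
  ... | t' , d , R' = t' , one refl (R (suc p)) (λ _ → refl) ⊙ d , R'

  Scans : L → Reg → Set
  Scans l r = (∀ m c x → lookup (proj₂ c) r ≡ just x → δscan m l (instr l) c ≡ (work m scan l , wr c , right))

  track : ∀ ρ r p {x} → bot (lookup ρ r) p ≡ x → lookup (proj₂ (cellAt ρ p)) r ≡ x
  track ρ r p e = trans (VP.lookup-map r (λ l → bot l p) ρ) e

  scan-run : ∀ m l r ρ → Scans l r → ∀ d p t → d + p ≡ length (lookup ρ r) → Rep ρ t →
             Σ (ℕ → Sym gC) λ t' → Det m d (cf (work m scan l) p t) (cf (work m scan l) (length (lookup ρ r)) t') × Rep ρ t'
  scan-run m l r ρ S zero    p t refl R = t , [] , R
  scan-run m l r ρ S (suc d) p t e R with bot-just (lookup ρ r) (≤-trans (s≤s (m≤n+m p d)) (≤-reflexive e))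
  ... | x , bx with scan-run m l r ρ S d (suc p) _ (trans (+-suc d p) e) (Rep-same ρ t p R)
  ... | t' , D , R' = t' , one refl (R p) (λ _ → S m (cellAt ρ p) x (track ρ r p bx)) ⊙ D , R'

  Sim : Quant → L → L → Env → ℕ → (ℕ → Sym gC) → Set
  Sim m l l' ρ' w t = Σ ℕ λ n → Σ (ℕ → Sym gC) λ t' →
    n ≤ w × Det m n (cf (work m at l) 0 t) (cf (work m at l') 0 t') × Rep ρ' t'

  δS-at-push : ∀ {l r x l'} → instr l ≡ push r x l' → ∀ m c b → δS b (work m at l) c ≡ (work m scan l , wr c , left)
  δS-at-push e m c b rewrite e = refl

  δS-at-pop : ∀ {l r l∅ l0 l1} → instr l ≡ pop r l∅ l0 l1 → ∀ m c b → δS b (work m at l) c ≡ (work m scan l , wr c , left)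
  δS-at-pop e m c b rewrite e = refl

  δS-write : ∀ {l r x l'} → instr l ≡ push r x l' → ∀ m c b {y} → lookup (proj₂ c) r ≡ nothing → y ≡ just x →
    δS b (work m scan l) c ≡ (work m ret l' , wr (proj₁ c , proj₂ c [ r ]≔ y) , left)
  δS-write e m c b h refl rewrite e | h = refl

  δS-empty : ∀ {l r l∅ l0 l1} → instr l ≡ pop r l∅ l0 l1 → ∀ m v b → lookup v r ≡ nothing →
    δS b (work m scan l) (true , v) ≡ (work m at l∅ , wr (true , v) , left)
  δS-empty e m c b h rewrite e | h = refl

  δS-turn : ∀ {l r l∅ l0 l1} → instr l ≡ pop r l∅ l0 l1 → ∀ m v b → lookup v r ≡ nothing →
    δS b (work m scan l) (false , v) ≡ (work m take l , wr (false , v) , left)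
  δS-turn e m c b h rewrite e | h = refl

  δS-take : ∀ {l r l∅ l0 l1} → instr l ≡ pop r l∅ l0 l1 → ∀ m c b {x y} → lookup (proj₂ c) r ≡ just x → y ≡ nothing →
    δS b (work m take l) c ≡ (work m ret (if x then l1 else l0) , wr (proj₁ c , proj₂ c [ r ]≔ y) , left)
  δS-take e m c b h refl rewrite e | h = refl

  scans-push : ∀ {l r x l'} → instr l ≡ push r x l' → Scans l r
  scans-push e m c y h rewrite e | h = refl

  scans-pop : ∀ {l r l∅ l0 l1} → instr l ≡ pop r l∅ l0 l1 → Scans l r
  scans-pop e m (true  , _) y h rewrite e | h = refl
  scans-pop e m (false , _) y h rewrite e | h = refl

  -- The head climbs the height of the stack, writes and walks back. The 5 covers the steps spent in
  -- cell 0 and at the turning point, and is shared by all stack instructions.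
  sim-push : ∀ m l ρ t {r x l'} → instr l ≡ push r x l' → Rep ρ t →
             Sim m l l' (ρ [ r ]≔ (x ∷ lookup ρ r)) (2 * length (lookup ρ r) + 5) t
  sim-push m l ρ t {r} {x} {l'} e R
    with scan-run m l r ρ (scans-push e) (length (lookup ρ r)) 0 _ (+-identityʳ _) (Rep-same ρ t 0 R)
  ... | t₁ , D₁ , R₁ with Rep-upd ρ t₁ r (x ∷ lookup ρ r) (length (lookup ρ r)) R₁ (bot-below x (lookup ρ r))
  ... | R₂ with ret-run m l' _ (moveHead left (length (lookup ρ r))) _ R₂
  ... | t₃ , D₃ , R₃ = _ , t₃ , bound (lookup ρ r) ,
      one refl (R 0) (δS-at-push e m _) ⊙ (D₁ ⊙ (one refl (R₁ _) (λ b → δS-write e m _ b (track ρ r _ (bot-nothing (lookup ρ r) ≤-refl)) (bot-top x (lookup ρ r))) ⊙ D₃)) , R₃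
    where
    bound : ∀ (v : List Bool) → 1 + (length v + (1 + suc (moveHead left (length v)))) ≤ 2 * length v + 5
    bound []      = s≤s (s≤s (s≤s z≤n))
    bound (_ ∷ v) = ≤-trans (m≤m+n _ 3) (≤-reflexive (lem (length v)))
      where
      lem : ∀ n → 1 + (suc n + (1 + suc n)) + 3 ≡ 2 * suc n + 5
      lem = solve-∀

  sim-pop-empty : ∀ m l ρ t {r l∅ l0 l1} → instr l ≡ pop r l∅ l0 l1 → lookup ρ r ≡ [] → Rep ρ t →
                  Sim m l l∅ ρ 5 t
  sim-pop-empty m l ρ t {r} {l∅} e h R =
    _ , _ , s≤s (s≤s z≤n) ,
    one refl (R 0) (δS-at-pop e m _) ⊙ one refl (R₁ 0) (λ b → δS-empty e m _ b (track ρ r 0 (cong (λ l → bot l 0) h))) , Rep-same ρ _ 0 R₁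
    where
    R₁ : Rep ρ (writeTape t 0 (wr (cellAt ρ 0)))
    R₁ = Rep-same ρ t 0 R

  sim-pop : ∀ m l ρ t {r l∅ l0 l1 x v} → instr l ≡ pop r l∅ l0 l1 → lookup ρ r ≡ x ∷ v → Rep ρ t →
            Sim m l (if x then l1 else l0) (ρ [ r ]≔ v) (2 * length (lookup ρ r) + 5) t
  sim-pop m l ρ t {r} {l∅} {l0} {l1} {x} {v} e h R
    with scan-run m l r ρ (scans-pop e) (suc (length v)) 0 _ (trans (+-identityʳ _) (cong length (sym h))) (Rep-same ρ t 0 R)
  ... | t₁ , D₁ , R₁ with Rep-same ρ t₁ (length (lookup ρ r)) R₁
  ... | R₂ with Rep-upd ρ _ r v (length v) R₂ (λ ne → trans (sym (bot-below x v ne)) (cong (λ l → bot l _) (sym h)))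
  ... | R₃ with ret-run m (if x then l1 else l0) _ (moveHead left (length v)) _ R₃
  ... | t₄ , D₄ , R₄ = _ , t₄ , ≤-trans (bound v) (≤-reflexive (cong (λ n → 2 * length n + 5) (sym h))) ,
      one refl (R 0) (δS-at-pop e m _) ⊙
      (D₁ ⊙ (turn (length (lookup ρ r)) (cong length h) t₁ R₁ ⊙
             (one refl (R₂ _) (λ b → δS-take e m _ b (track ρ r _ (trans (cong (λ l → bot l (length v)) h) (bot-top x v)) ) (bot-nothing v ≤-refl)) ⊙ D₄))) , R₄
    where
    turn : ∀ n → n ≡ suc (length v) → ∀ t → Rep ρ t →
      Det m 1 (cf (work m scan l) n t) (cf (work m take l) (length v) (writeTape t n (wr (cellAt ρ n))))
    turn n refl t R = one refl (R n) (λ b → δS-turn e m _ b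
      (track ρ r n (trans (cong (λ l → bot l n) h) (bot-nothing (x ∷ v) ≤-refl))))
    bound : ∀ (v : List Bool) → 1 + (suc (length v) + (1 + (1 + suc (moveHead left (length v))))) ≤ 2 * suc (length v) + 5
    bound []      = s≤s (s≤s (s≤s (s≤s (s≤s z≤n))))
    bound (_ ∷ v) = ≤-trans (m≤m+n _ 3) (≤-reflexive (lem (length v)))
      where
      lem : ∀ n → 1 + (suc (suc n) + (1 + (1 + suc n))) + 3 ≡ 2 * suc (suc n) + 5
      lem = solve-∀

  -- Cell 0 is the bottom of a stack, so the first input bit lies at the bottom and the last one on
  -- top.
  initEnv : List Bool → Env
  initEnv w = [] ∷ [] ∷ [] ∷ [] ∷ reverse w ∷ []

  view-input : ∀ w p → view (inputTape w p) ≡ (false , noTracks [ rI ]≔ nthM w p)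
  view-input []          p       = refl
  view-input (false ∷ w) zero    = refl
  view-input (true ∷ w)  zero    = refl
  view-input (b ∷ w)     (suc p) = view-input w p

  sim-start : ∀ w → Σ (ℕ → Sym gC) λ t' →
    Det exQ 1 (cf start 0 (inputTape w)) (cf (work exQ at entry) 0 t') × Rep (initEnv w) t'
  sim-start w = _ , one refl (view-input w 0) (λ _ → refl) , R
    where
    R : Rep (initEnv w) (writeTape (inputTape w) 0 (wr (true , noTracks [ rI ]≔ nthM w 0)))
    R zero    = trans (view-wr _) (cong (λ x → true , noTracks [ rI ]≔ x) (sym (bot-reverse w 0)))
    R (suc p) = trans (view-input w (suc p)) (cong (λ x → false , noTracks [ rI ]≔ x) (sym (bot-reverse w (suc p))))

-- Games of stack programs and the alternating machine that plays them

length-push : ∀ {n} (ρ : Vec (List Bool) n) r r' x →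
  length (lookup (ρ [ r ]≔ (x ∷ lookup ρ r)) r') ≤ suc (length (lookup ρ r'))
length-push ρ r r' x with r F.≟ r'
... | yes refl rewrite VP.lookup∘update r ρ (x ∷ lookup ρ r) = ≤-refl
... | no  ne   rewrite VP.lookup∘update′ (ne ∘ sym) ρ (x ∷ lookup ρ r) = n≤1+n _

length-pop : ∀ {n} (ρ : Vec (List Bool) n) r r' {x v} → lookup ρ r ≡ x ∷ v →
  length (lookup (ρ [ r ]≔ v) r') ≤ length (lookup ρ r')
length-pop ρ r r' {x} {v} e with r F.≟ r'
... | yes refl rewrite VP.lookup∘update r ρ v | e = n≤1+n _
... | no  ne   rewrite VP.lookup∘update′ (ne ∘ sym) ρ v = ≤-refl

module Machine {L : Set} (fl : Finite L) (instr : L → Instr L) (entry : L) where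
  open TM fl instr entry public

  data Run : ℕ → L → Env → L → Env → Set where
    []        : ∀ {l ρ} → Run 0 l ρ l ρ
    r-push    : ∀ {n l ρ l₂ ρ₂ r x l'} → instr l ≡ push r x l' →
                Run n l' (ρ [ r ]≔ (x ∷ lookup ρ r)) l₂ ρ₂ → Run (suc n) l ρ l₂ ρ₂
    r-pop∅    : ∀ {n l ρ l₂ ρ₂ r l∅ l0 l1} → instr l ≡ pop r l∅ l0 l1 → lookup ρ r ≡ [] →
                Run n l∅ ρ l₂ ρ₂ → Run (suc n) l ρ l₂ ρ₂
    r-pop     : ∀ {n l ρ l₂ ρ₂ r l∅ l0 l1 x v} → instr l ≡ pop r l∅ l0 l1 → lookup ρ r ≡ x ∷ v →
                Run n (if x then l1 else l0) (ρ [ r ]≔ v) l₂ ρ₂ → Run (suc n) l ρ l₂ ρ₂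

  _⊙R_ : ∀ {n n' l ρ l₁ ρ₁ l₂ ρ₂} → Run n l ρ l₁ ρ₁ → Run n' l₁ ρ₁ l₂ ρ₂ → Run (n + n') l ρ l₂ ρ₂
  []             ⊙R s = s
  r-push e r     ⊙R s = r-push e (r ⊙R s)
  r-pop∅ e h r   ⊙R s = r-pop∅ e h (r ⊙R s)
  r-pop e h r    ⊙R s = r-pop e h (r ⊙R s)

  -- Game m l ρ t b P: from label l and stacks ρ in mode m, every branch halts within t
  -- instructions and changes mode at most b times, and the machine accepts iff P.
  data Game : Quant → L → Env → ℕ → ℕ → Set → Set₁ where
    g-done   : ∀ {m l ρ t b} → instr l ≡ done → Game m l ρ t b ⊤
    g-fail   : ∀ {m l ρ t b} → instr l ≡ fail → Game m l ρ t b ⊥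
    g-push   : ∀ {m l ρ t b P r x l'} → instr l ≡ push r x l' →
               Game m l' (ρ [ r ]≔ (x ∷ lookup ρ r)) t b P → Game m l ρ (suc t) b P
    g-pop∅   : ∀ {m l ρ t b P r l∅ l0 l1} → instr l ≡ pop r l∅ l0 l1 → lookup ρ r ≡ [] →
               Game m l∅ ρ t b P → Game m l ρ (suc t) b P
    g-pop    : ∀ {m l ρ t b P r l∅ l0 l1 x v} → instr l ≡ pop r l∅ l0 l1 → lookup ρ r ≡ x ∷ v →
               Game m (if x then l1 else l0) (ρ [ r ]≔ v) t b P → Game m l ρ (suc t) b P
    g-toggle : ∀ {m l ρ t b P l'} → instr l ≡ toggle l' →
               Game (negQ m) l' ρ t b P → Game m l ρ (suc t) (suc b) P
    g-ex     : ∀ {l ρ t b P₀ P₁ l0 l1} → instr l ≡ flip l0 l1 →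
               Game exQ l0 ρ t b P₀ → Game exQ l1 ρ t b P₁ → Game exQ l ρ (suc t) b (P₀ ⊎ P₁)
    g-all    : ∀ {l ρ t b P₀ P₁ l0 l1} → instr l ≡ flip l0 l1 →
               Game allQ l0 ρ t b P₀ → Game allQ l1 ρ t b P₁ → Game allQ l ρ (suc t) b (P₀ × P₁)
    g-weaken : ∀ {m l ρ t t' b b' P} → t ≤ t' → b ≤ b' → Game m l ρ t b P → Game m l ρ t' b' P
    g-equiv  : ∀ {m l ρ t b P P'} → P' ⇔ P → Game m l ρ t b P → Game m l ρ t b P'

  run-game : ∀ {n l ρ l' ρ' m t b P} → Run n l ρ l' ρ' → Game m l' ρ' t b P → Game m l ρ (n + t) b P
  run-game []            g = g
  run-game (r-push e r)  g = g-push e (run-game r g)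
  run-game (r-pop∅ e h r) g = g-pop∅ e h (run-game r g)
  run-game (r-pop e h r) g = g-pop e h (run-game r g)

  atm : ATM
  atm = record { g = gC ; s = sS ; init = enc finS start ; kind = λ q → kindS (dec finS q)
               ; δ = λ q a → δF false q a ∷ δF true q a ∷ [] }

  open ATMSem atm using (Acc; Halts; AltOK; AltCont)

  kind-cf : ∀ q → kindS (dec finS (enc finS q)) ≡ kindS q
  kind-cf q = cong kindS (dec-enc finS q)

  Good : ℕ → ℕ → Quant → Cf → Set → Set
  Good u b m c P = Halts u c × AltOK u b m c × (P ⇔ Acc u c)

  -- Quantifying over all larger budgets makes monotonicity in time and in alternations part of the
  -- notion, so branches of different length can share one budget.
  Ok : Cf → Quant → ℕ → ℕ → Set → Set
  Ok c m T b P = ∀ u b' → T ≤ u → b ≤ b' → Good u b' m c P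

  ok-acc : ∀ {q h t m b P} T → kindS q ≡ accK → P → Ok (cf q h t) m T b P
  ok-acc {q} T k p zero    b' _ _ rewrite trans (kind-cf q) k = tt , tt , mk⇔ (λ _ → tt) (λ _ → p)
  ok-acc {q} T k p (suc u) b' _ _ rewrite trans (kind-cf q) k = tt , tt , mk⇔ (λ _ → tt) (λ _ → p)

  ok-rej : ∀ {q h t m b P} T → kindS q ≡ rejK → (P → ⊥) → Ok (cf q h t) m T b P
  ok-rej {q} T k p zero    b' _ _ rewrite trans (kind-cf q) k = tt , tt , mk⇔ p ⊥-elim
  ok-rej {q} T k p (suc u) b' _ _ rewrite trans (kind-cf q) k = tt , tt , mk⇔ p ⊥-elim

  ok-ex : ∀ {q h t T b P₀ P₁} → kindS q ≡ quant exQ →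
    Ok (stepC false (cf q h t)) exQ T b P₀ → Ok (stepC true (cf q h t)) exQ T b P₁ →
    Ok (cf q h t) exQ (suc T) b (P₀ ⊎ P₁)
  ok-ex {q} k o₀ o₁ (suc u) b' (s≤s Tu) bb
    with o₀ u b' Tu bb | o₁ u b' Tu bb
  ... | h₀ , a₀ , e₀ | h₁ , a₁ , e₁ rewrite trans (kind-cf q) k =
    (h₀ ∷ h₁ ∷ []) , (a₀ ∷ a₁ ∷ []) ,
    mk⇔ [ here ∘ Equivalence.to e₀ , there ∘ here ∘ Equivalence.to e₁ ]
        (λ { (here x) → inj₁ (Equivalence.from e₀ x) ; (there (here x)) → inj₂ (Equivalence.from e₁ x)
           ; (there (there ())) })

  ok-all : ∀ {q h t T b P₀ P₁} → kindS q ≡ quant allQ →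
    Ok (stepC false (cf q h t)) allQ T b P₀ → Ok (stepC true (cf q h t)) allQ T b P₁ →
    Ok (cf q h t) allQ (suc T) b (P₀ × P₁)
  ok-all {q} k o₀ o₁ (suc u) b' (s≤s Tu) bb
    with o₀ u b' Tu bb | o₁ u b' Tu bb
  ... | h₀ , a₀ , e₀ | h₁ , a₁ , e₁ rewrite trans (kind-cf q) k =
    (h₀ ∷ h₁ ∷ []) , (a₀ ∷ a₁ ∷ []) ,
    mk⇔ (λ { (x , y) → Equivalence.to e₀ x ∷ Equivalence.to e₁ y ∷ [] })
        (λ { (x ∷ y ∷ []) → Equivalence.from e₀ x , Equivalence.from e₁ y })

  ok-equiv : ∀ {c m T b P P'} → P' ⇔ P → Ok c m T b P → Ok c m T b P'
  ok-equiv e o u b' Tu bb with o u b' Tu bb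
  ... | h , a , e' = h , a , mk⇔ (Equivalence.to e' ∘ Equivalence.to e) (Equivalence.from e ∘ Equivalence.from e')

  ok-weaken : ∀ {c m T T' b b' P} → T ≤ T' → b ≤ b' → Ok c m T b P → Ok c m T' b' P
  ok-weaken h h' o u b'' Tu bb = o u b'' (≤-trans h Tu) (≤-trans h' bb)

  -- Two equal successors amount to `P ⊎ P` or to `P × P`, both equivalent to `P`: a deterministic
  -- step may be taken in either mode.
  ok-same : ∀ {m q h t T b P c₁} → kindS q ≡ quant m → (∀ x → stepC x (cf q h t) ≡ c₁) →
    Ok c₁ m T b P → Ok (cf q h t) m (suc T) b P
  ok-same {exQ} {P = P} k e o = ok-equiv (mk⇔ inj₁ [ id , id ])
    (ok-ex k (subst (λ c → Ok c _ _ _ P) (sym (e false)) o) (subst (λ c → Ok c _ _ _ P) (sym (e true)) o))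
  ok-same {allQ} {P = P} k e o = ok-equiv (mk⇔ (λ x → x , x) proj₁)
    (ok-all k (subst (λ c → Ok c _ _ _ P) (sym (e false)) o) (subst (λ c → Ok c _ _ _ P) (sym (e true)) o))

  ok-det : ∀ {m n c c' T b P} → Det m n c c' → Ok c' m T b P → Ok c m (n + T) b P
  ok-det []             o = o
  ok-det (step q k e d) o = ok-same k e (ok-det d o)

  alt-neg : ∀ m q h t u b → kindS q ≡ quant (negQ m) → AltOK u b (negQ m) (cf q h t) → AltOK u (suc b) m (cf q h t)
  alt-neg exQ  q h t u b k rewrite trans (kind-cf q) k = id
  alt-neg allQ q h t u b k rewrite trans (kind-cf q) k = id

  -- The alternation is charged on entering a state of the opposite mode, because `AltOK` compares
  -- the mode so far with the kind of the present state.
  ok-neg : ∀ {m q h t T b P} → kindS q ≡ quant (negQ m) → Ok (cf q h t) (negQ m) T b P → Ok (cf q h t) m T (suc b) P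
  ok-neg {m} {q} {h} {t} k o u (suc b') Tu (s≤s bb) with o u b' Tu bb
  ... | ha , a , e = ha , alt-neg m q h t u b' k a , e

  step-pos : ∀ H → 1 ≤ 2 * H + 5
  step-pos H = ≤-trans (s≤s z≤n) (m≤n+m 5 (2 * H))

  cost-pos : ∀ t H → 1 ≤ suc t * (2 * H + 5)
  cost-pos t H = ≤-trans (step-pos H) (m≤m+n _ _)

  sim-mono : ∀ H n → n ≤ H → 2 * n + 5 ≤ 2 * H + 5
  sim-mono H n h = +-monoˡ-≤ 5 (*-monoʳ-≤ 2 h)

  heights-push : ∀ (ρ : Env) r x {H n} → (∀ r' → length (lookup ρ r') + suc n ≤ H) →
    ∀ r' → length (lookup (ρ [ r ]≔ (x ∷ lookup ρ r)) r') + n ≤ H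
  heights-push ρ r x {n = n} h r' =
    ≤-trans (+-monoˡ-≤ n (length-push ρ r r' x)) (≤-trans (≤-reflexive (sym (+-suc (length (lookup ρ r')) n))) (h r'))

  heights-pop : ∀ (ρ : Env) r {x v H n} → lookup ρ r ≡ x ∷ v → (∀ r' → length (lookup ρ r') + suc n ≤ H) →
    ∀ r' → length (lookup (ρ [ r ]≔ v) r') + n ≤ H
  heights-pop ρ r {n = n} e h r' =
    ≤-trans (+-mono-≤ (length-pop ρ r r' e) (n≤1+n n)) (h r')

  ok-sim : ∀ H T {m l l' ρ' w t b P} → Sim m l l' ρ' w t → w ≤ 2 * H + 5 →
    (∀ {t'} → Rep ρ' t' → Ok (cf (work m at l') 0 t') m (suc T * (2 * H + 5)) b P) →
    Ok (cf (work m at l) 0 t) m (suc (suc T) * (2 * H + 5)) b P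
  ok-sim H T (n , t' , nw , D , R') wH k = ok-weaken (+-monoˡ-≤ _ (≤-trans nw wH)) ≤-refl (ok-det D (k R'))

  -- An instruction raises a stack by at most one and uses up one unit of `t`, so height plus
  -- remaining time stays below `H`. Hence each instruction costs at most `2 * H + 5` machine steps;
  -- `suc t` leaves room for the final `done` or `fail`.
  game-ok : ∀ {m l ρ t b P} H → Game m l ρ t b P → (∀ r → length (lookup ρ r) + t ≤ H) →
    ∀ tp → Rep ρ tp → Ok (cf (work m at l) 0 tp) m (suc t * (2 * H + 5)) b P
  game-ok {m} {l} {ρ} {t} H (g-done e) h tp R = ok-weaken (cost-pos t H) ≤-refl
    (ok-same refl (λ b → stepC-cf b _ 0 tp (R 0) (cong (λ i → δat b m l i (cellAt ρ 0)) e)) (ok-acc 0 refl tt))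
  game-ok {m} {l} {ρ} {t} H (g-fail e) h tp R = ok-weaken (cost-pos t H) ≤-refl
    (ok-same refl (λ b → stepC-cf b _ 0 tp (R 0) (cong (λ i → δat b m l i (cellAt ρ 0)) e)) (ok-rej 0 refl (λ ())))
  game-ok {m} {l} {ρ} {suc t} H (g-push {r = r} {x} e g) h tp R =
    ok-sim H t (sim-push m l ρ tp e R) (sim-mono H (length (lookup ρ r)) (≤-trans (m≤m+n _ _) (h r))) (game-ok H g (heights-push ρ r x h) _)
  game-ok {m} {l} {ρ} {suc t} H (g-pop∅ e e' g) h tp R =
    ok-sim H t (sim-pop-empty m l ρ tp e e' R) (m≤n+m 5 (2 * H))
      (game-ok H g (λ r → ≤-trans (+-monoʳ-≤ (length (lookup ρ r)) (n≤1+n t)) (h r)) _)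
  game-ok {m} {l} {ρ} {suc t} H (g-pop {r = r} e e' g) h tp R =
    ok-sim H t (sim-pop m l ρ tp e e' R) (sim-mono H (length (lookup ρ r)) (≤-trans (m≤m+n _ _) (h r))) (game-ok H g (heights-pop ρ r e' h) _)
  game-ok {m} {l} {ρ} {suc t} H (g-toggle e g) h tp R = ok-weaken (+-monoˡ-≤ _ (step-pos H)) ≤-refl
    (ok-step (ok-neg refl (game-ok H g (λ r → ≤-trans (+-monoʳ-≤ (length (lookup ρ r)) (n≤1+n t)) (h r)) _ (Rep-same ρ tp 0 R))))
    where
    c' : L → Cf
    c' l' = cf (work (negQ m) at l') 0 (writeTape tp 0 (wr (cellAt ρ 0)))
    ok-step : ∀ {T b P} → Ok (c' _) m T b P → Ok (cf (work m at l) 0 tp) m (suc T) b P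
    ok-step = ok-same refl (λ b → stepC-cf b _ 0 tp (R 0) (cong (λ i → δat b m l i (cellAt ρ 0)) e))
  game-ok {exQ} {l} {ρ} {suc t} H (g-ex {P₀ = P₀} {P₁} {l0} {l1} e g₀ g₁) h tp R = ok-weaken (+-monoˡ-≤ _ (step-pos H)) ≤-refl
    (ok-ex refl (sub false (game-ok H g₀ h' _ (Rep-same ρ tp 0 R))) (sub true (game-ok H g₁ h' _ (Rep-same ρ tp 0 R))))
    where
    h' : ∀ r → length (lookup ρ r) + t ≤ H
    h' r = ≤-trans (+-monoʳ-≤ _ (n≤1+n t)) (h r)
    sub : ∀ x {T b P} → Ok (cf (work exQ at (if x then l1 else l0)) 0 (writeTape tp 0 (wr (cellAt ρ 0)))) exQ T b P →
          Ok (stepC x (cf (work exQ at l) 0 tp)) exQ T b P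
    sub x {T} {b} {P} = subst (λ c → Ok c exQ T b P) (sym (stepC-cf x _ 0 tp (R 0) (cong (λ i → δat x exQ l i (cellAt ρ 0)) e)))
  game-ok {allQ} {l} {ρ} {suc t} H (g-all {P₀ = P₀} {P₁} {l0} {l1} e g₀ g₁) h tp R = ok-weaken (+-monoˡ-≤ _ (step-pos H)) ≤-refl
    (ok-all refl (sub false (game-ok H g₀ h' _ (Rep-same ρ tp 0 R))) (sub true (game-ok H g₁ h' _ (Rep-same ρ tp 0 R))))
    where
    h' : ∀ r → length (lookup ρ r) + t ≤ H
    h' r = ≤-trans (+-monoʳ-≤ _ (n≤1+n t)) (h r)
    sub : ∀ x {T b P} → Ok (cf (work allQ at (if x then l1 else l0)) 0 (writeTape tp 0 (wr (cellAt ρ 0)))) allQ T b P →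
          Ok (stepC x (cf (work allQ at l) 0 tp)) allQ T b P
    sub x {T} {b} {P} = subst (λ c → Ok c allQ T b P) (sym (stepC-cf x _ 0 tp (R 0) (cong (λ i → δat x allQ l i (cellAt ρ 0)) e)))
  game-ok H (g-weaken {t = t} {t'} tt' bb' g) h tp R =
    ok-weaken (*-monoˡ-≤ (2 * H + 5) (s≤s tt')) bb' (game-ok H g (λ r → ≤-trans (+-monoʳ-≤ _ tt') (h r)) tp R)
  game-ok H (g-equiv e g) h tp R = ok-equiv e (game-ok H g h tp R)

  initHeights : ∀ w t r → length (lookup (initEnv w) r) + t ≤ length w + t
  initHeights w t rA = m≤n+m _ _
  initHeights w t rB = m≤n+m _ _
  initHeights w t rC = m≤n+m _ _
  initHeights w t rN = m≤n+m _ _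
  initHeights w t rI = ≤-reflexive (cong (_+ t) (LP.length-reverse w))

  machine-time : ℕ → ℕ → ℕ
  machine-time n t = 1 + suc t * (2 * (n + t) + 5)

  game-atm : ∀ w {t b P} → Game exQ entry (initEnv w) t b P → ∀ u → machine-time (length w) t ≤ u →
    Good u b exQ (ATMSem.initConf atm w) P
  game-atm w {t} {b} g u h with sim-start w
  ... | tp , D , R = ok-det D (game-ok (length w + t) g (initHeights w t) tp R) u b h ≤-refl

  -- The same table as a deterministic transducer

  dtm : DTM
  dtm = record { g = gC ; s = sS ; init = enc finS start ; halt = enc finS fin ; δ = δF false }

  open DTMSem dtm using (run; OutputIs) renaming (step to stepD)

  stepD-cf : ∀ q h t → q ≢ fin → stepD (cf q h t) ≡ stepC false (cf q h t)
  stepD-cf q h t ne = cong (λ b → if b then cf q h t else stepC false (cf q h t))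
    (dec-false (enc finS q F.≟ enc finS fin)
      (λ e → ne (trans (sym (dec-enc finS q)) (trans (cong (dec finS) e) (dec-enc finS fin)))))

  quant≢fin : ∀ {q : St L} {m} → kindS q ≡ quant m → q ≢ fin
  quant≢fin () refl

  det-dtm : ∀ {m n c c'} → Det m n c c' → ∀ k → run (n + k) c ≡ run k c'
  det-dtm []             k = refl
  det-dtm (step {n} {h} {t} q kq e d) k = trans (cong (run (n + k)) (trans (stepD-cf q h t (quant≢fin kq)) (e false))) (det-dtm d k)

  run-det : ∀ {n l ρ l' ρ'} H → Run n l ρ l' ρ' → (∀ r → length (lookup ρ r) + n ≤ H) → ∀ t → Rep ρ t →
    Sim exQ l l' ρ' (n * (2 * H + 5)) t
  run-det H [] h t R = 0 , t , z≤n , [] , R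
  run-det {suc n} {l} {ρ} H (r-push {r = r} {x} e d) h t R with sim-push exQ l ρ t e R
  ... | n₁ , t₁ , b₁ , D₁ , R₁ with run-det H d (heights-push ρ r x h) t₁ R₁
  ... | n₂ , t₂ , b₂ , D₂ , R₂ = n₁ + n₂ , t₂ , +-mono-≤ (≤-trans b₁ (sim-mono H (length (lookup ρ r)) (≤-trans (m≤m+n _ _) (h r)))) b₂ , D₁ ⊙ D₂ , R₂
  run-det {suc n} {l} {ρ} H (r-pop∅ e e' d) h t R with sim-pop-empty exQ l ρ t e e' R
  ... | n₁ , t₁ , b₁ , D₁ , R₁ with run-det H d (λ r → ≤-trans (+-monoʳ-≤ (length (lookup ρ r)) (n≤1+n n)) (h r)) t₁ R₁
  ... | n₂ , t₂ , b₂ , D₂ , R₂ = n₁ + n₂ , t₂ , +-mono-≤ (≤-trans b₁ (m≤n+m 5 (2 * H))) b₂ , D₁ ⊙ D₂ , R₂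
  run-det {suc n} {l} {ρ} H (r-pop {r = r} e e' d) h t R with sim-pop exQ l ρ t e e' R
  ... | n₁ , t₁ , b₁ , D₁ , R₁ with run-det H d (heights-pop ρ r e' h) t₁ R₁
  ... | n₂ , t₂ , b₂ , D₂ , R₂ = n₁ + n₂ , t₂ , +-mono-≤ (≤-trans b₁ (sim-mono H (length (lookup ρ r)) (≤-trans (m≤m+n _ _) (h r)))) b₂ , D₁ ⊙ D₂ , R₂

  run-length : ∀ {n l ρ l' ρ'} → Run n l ρ l' ρ' → ∀ r → length (lookup ρ' r) ≤ length (lookup ρ r) + n
  run-length [] r = m≤m+n _ _
  run-length {suc n} {ρ = ρ} (r-push {r = r'} {x} e d) r = ≤-trans (run-length d r)
    (≤-trans (+-monoˡ-≤ n (length-push ρ r' r x)) (≤-reflexive (sym (+-suc (length (lookup ρ r)) n))))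
  run-length {suc n} (r-pop∅ e e' d) r = ≤-trans (run-length d r) (+-monoʳ-≤ _ (n≤1+n n))
  run-length {suc n} {ρ = ρ} (r-pop {r = r'} e e' d) r = ≤-trans (run-length d r) (+-mono-≤ (length-pop ρ r' r e') (n≤1+n n))

  decode-bit : ∀ (b : Bool) → decodeSym {gC} (bitSym b) ≡ just b
  decode-bit false = refl
  decode-bit true  = refl

  nthM-just : ∀ u {p} → p < length u → Σ Bool λ b → nthM u p ≡ just b
  nthM-just (b ∷ u) {zero}  h       = b , refl
  nthM-just (b ∷ u) {suc p} (s≤s h) = nthM-just u h

  nthM-end : ∀ u → nthM u (length u) ≡ nothing
  nthM-end []      = refl
  nthM-end (_ ∷ u) = nthM-end u

  Written : List Bool → ℕ → (ℕ → Sym gC) → Set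
  Written u p t = ∀ q → q < p → decodeSym (t q) ≡ nthM u q

  written-suc : ∀ {u p t a} → Written u p t → decodeSym a ≡ nthM u p → Written u (suc p) (writeTape t p a)
  written-suc {p = p} W e q (s≤s qp) with q ≟ p
  ... | yes refl = trans (cong decodeSym (if-≟-yes {p = p} refl)) e
  ... | no  ne   = trans (cong decodeSym (if-≟-no ne)) (W q (≤∧≢⇒< qp ne))

  -- One pass to the right replaces cells by bit symbols while the track lasts. The final step
  -- writes a blank behind them, which `OutputIs` reads as the end of the word.
  out-run : ∀ u d p t → d + p ≡ length u → Written u p t →
    (∀ q → p ≤ q → lookup (proj₂ (view (t q))) rI ≡ nthM u q) →
    Σ ℕ λ h' → Σ (ℕ → Sym gC) λ t' → (run (suc d) (cf out p t) ≡ cf fin h' t') × Written u (suc (length u)) t'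
  out-run u zero p t refl W V =
    _ , _ , trans (stepD-cf out p t (λ ())) (stepC-cf false out p t refl (cong δout (trans (V p ≤-refl) (nthM-end u)))) ,
    written-suc {u} W (sym (nthM-end u))
  out-run u (suc d) p t e W V with nthM-just u (≤-trans (s≤s (m≤n+m p d)) (≤-reflexive e))
  ... | b , nb with out-run u d (suc p) (writeTape t p (bitSym b)) (trans (+-suc d p) e)
                    (written-suc {u} W (trans (decode-bit b) (sym nb)))
                    (λ q pq → trans (cong (λ a → lookup (proj₂ (view a)) rI) (if-≟-no (λ e → <-irrefl (sym e) pq))) (V q (<⇒≤ pq)))
  ... | h' , t' , r , W' = h' , t' , trans (cong (run (suc d))
          (trans (stepD-cf out p t (λ ())) (stepC-cf false out p t refl (cong δout (trans (V p ≤-refl) nb))))) r , W'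

  written-output : ∀ u t → Written u (suc (length u)) t → OutputIs t u
  written-output []      t W = W 0 ≤-refl
  written-output (b ∷ u) t W = W 0 (s≤s z≤n) , written-output u (λ p → t (suc p)) (λ q h → W (suc q) (s≤s h))

  run-dtm : ∀ w u {n l ρ} → Run n entry (initEnv w) l ρ → instr l ≡ done → lookup ρ rI ≡ reverse u →
    Σ ℕ λ t → (t ≤ machine-time (length w) n + (length w + n)) ×
      (Conf.state (run t (DTMSem.initConf dtm w)) ≡ DTM.halt dtm) ×
      OutputIs (Conf.tape (run t (DTMSem.initConf dtm w))) u
  run-dtm w u {n} {l} {ρ} r e lu with sim-start w
  ... | t₀ , D₀ , R₀ with run-det (length w + n) r (initHeights w n) t₀ R₀
  ... | N , t₁ , bN , D₁ , R₁ with out-run u (length u) 0 (writeTape t₁ 0 (wr (cellAt ρ 0))) (+-identityʳ _) (λ _ ())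
          (λ q _ → trans (cong (λ c → lookup (proj₂ c) rI) (Rep-same ρ t₁ 0 R₁ q))
             (trans (VP.lookup-map rI (λ l → bot l q) ρ) (trans (cong (λ l → bot l q) lu) (bot-reverse u q))))
  ... | h' , t' , rr , W = T , bound , cong Conf.state final , subst (λ c → OutputIs (Conf.tape c) u) (sym final) (written-output u t' W)
    where
    T : ℕ
    T = 1 + (N + (1 + suc (length u)))
    final : run T (DTMSem.initConf dtm w) ≡ cf fin h' t'
    final = trans (det-dtm D₀ (N + (1 + suc (length u)))) (trans (det-dtm D₁ (1 + suc (length u)))
      (trans (cong (run (suc (length u))) (trans (stepD-cf (work exQ at l) 0 t₁ (λ ())) (stepC-cf false (work exQ at l) 0 t₁ (R₁ 0) (cong (λ i → δat false exQ l i (cellAt ρ 0)) e)))) rr))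
    ulen : length u ≤ length w + n
    ulen = ≤-trans (≤-reflexive (trans (sym (LP.length-reverse u)) (cong length (sym lu))))
      (≤-trans (run-length r rI) (≤-reflexive (cong (_+ n) (LP.length-reverse w))))
    W' : ℕ
    W' = 2 * (length w + n) + 5
    arith : ∀ a b → a + (2 + b) ≡ 2 + a + b
    arith = solve-∀
    bound : T ≤ machine-time (length w) n + (length w + n)
    bound = s≤s (≤-trans (+-mono-≤ bN (+-monoʳ-≤ 2 ulen))
      (≤-trans (≤-reflexive (arith (n * W') (length w + n)))
        (+-monoˡ-≤ (length w + n) (+-monoˡ-≤ (n * W') (≤-trans (s≤s (s≤s z≤n)) (m≤n+m 5 (2 * (length w + n))))))))

-- Structured stack programs

-- `each` pops until the stack is empty and lets the popped bit select the body. `while` stops at a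
-- popped `false`; on a serialised list it stops at the end, as `true` marks a cons cell and `false`
-- the empty list.
data Cmd : Set where
  skipC doneC failC toggleC : Cmd
  pushC : Reg → Bool → Cmd
  popC  : Reg → Cmd → Cmd → Cmd → Cmd
  _⨾_   : Cmd → Cmd → Cmd
  each  : Reg → Cmd → Cmd → Cmd
  while : Reg → Cmd → Cmd
  flipC : Cmd → Cmd → Cmd

infixr 5 _⨾_

Loc : Cmd → Set
Loc skipC          = ⊥
Loc doneC          = ⊤
Loc failC          = ⊤
Loc toggleC        = ⊤
Loc (pushC _ _)    = ⊤
Loc (popC _ a b c) = ⊤ ⊎ (Loc a ⊎ (Loc b ⊎ Loc c))
Loc (c ⨾ d)        = Loc c ⊎ Loc d
Loc (each _ b c)   = ⊤ ⊎ (Loc b ⊎ Loc c)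
Loc (while _ c)    = ⊤ ⊎ Loc c
Loc (flipC b c)    = ⊤ ⊎ (Loc b ⊎ Loc c)

fin-Loc : ∀ c → Finite (Loc c)
fin-Loc skipC          = record { size = 0 ; enc = λ () ; dec = λ () ; dec-enc = λ () }
fin-Loc doneC          = fin-⊤
fin-Loc failC          = fin-⊤
fin-Loc toggleC        = fin-⊤
fin-Loc (pushC _ _)    = fin-⊤
fin-Loc (popC _ a b c) = fin-⊎ fin-⊤ (fin-⊎ (fin-Loc a) (fin-⊎ (fin-Loc b) (fin-Loc c)))
fin-Loc (c ⨾ d)        = fin-⊎ (fin-Loc c) (fin-Loc d)
fin-Loc (each _ b c)   = fin-⊎ fin-⊤ (fin-⊎ (fin-Loc b) (fin-Loc c))
fin-Loc (while _ c)    = fin-⊎ fin-⊤ (fin-Loc c)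
fin-Loc (flipC b c)    = fin-⊎ fin-⊤ (fin-⊎ (fin-Loc b) (fin-Loc c))

module _ {L : Set} where

  -- The first label of c placed in L along e, where control leaves c to the label x.
  begin : (c : Cmd) → (Loc c → L) → L → L
  begin skipC          e x = x
  begin doneC          e x = e tt
  begin failC          e x = e tt
  begin toggleC        e x = e tt
  begin (pushC _ _)    e x = e tt
  begin (popC _ _ _ _) e x = e (inj₁ tt)
  begin (c ⨾ d)        e x = begin c (e ∘ inj₁) (begin d (e ∘ inj₂) x)
  begin (each _ _ _)   e x = e (inj₁ tt)
  begin (while _ _)    e x = e (inj₁ tt)
  begin (flipC _ _)    e x = e (inj₁ tt)

  code : (c : Cmd) (e : Loc c → L) → L → Loc c → Instr L
  code doneC          e x _ = done
  code failC          e x _ = fail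
  code toggleC        e x _ = toggle x
  code (pushC r b)    e x _ = push r b x
  code (popC r a b c) e x (inj₁ _) =
    pop r (begin a (e ∘ inj₂ ∘ inj₁) x) (begin b (e ∘ inj₂ ∘ inj₂ ∘ inj₁) x) (begin c (e ∘ inj₂ ∘ inj₂ ∘ inj₂) x)
  code (popC r a b c) e x (inj₂ (inj₁ l))        = code a (e ∘ inj₂ ∘ inj₁) x l
  code (popC r a b c) e x (inj₂ (inj₂ (inj₁ l))) = code b (e ∘ inj₂ ∘ inj₂ ∘ inj₁) x l
  code (popC r a b c) e x (inj₂ (inj₂ (inj₂ l))) = code c (e ∘ inj₂ ∘ inj₂ ∘ inj₂) x l
  code (c ⨾ d)        e x (inj₁ l) = code c (e ∘ inj₁) (begin d (e ∘ inj₂) x) l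
  code (c ⨾ d)        e x (inj₂ l) = code d (e ∘ inj₂) x l
  code (each r b c)   e x (inj₁ _) =
    pop r x (begin b (e ∘ inj₂ ∘ inj₁) (e (inj₁ tt))) (begin c (e ∘ inj₂ ∘ inj₂) (e (inj₁ tt)))
  code (each r b c)   e x (inj₂ (inj₁ l)) = code b (e ∘ inj₂ ∘ inj₁) (e (inj₁ tt)) l
  code (each r b c)   e x (inj₂ (inj₂ l)) = code c (e ∘ inj₂ ∘ inj₂) (e (inj₁ tt)) l
  code (while r c)    e x (inj₁ _) = pop r x x (begin c (e ∘ inj₂) (e (inj₁ tt)))
  code (while r c)    e x (inj₂ l) = code c (e ∘ inj₂) (e (inj₁ tt)) l
  code (flipC b c)    e x (inj₁ _) = flip (begin b (e ∘ inj₂ ∘ inj₁) x) (begin c (e ∘ inj₂ ∘ inj₂) x)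
  code (flipC b c)    e x (inj₂ (inj₁ l)) = code b (e ∘ inj₂ ∘ inj₁) x l
  code (flipC b c)    e x (inj₂ (inj₂ l)) = code c (e ∘ inj₂ ∘ inj₂) x l

-- Big-step semantics of the deterministic commands. Times are upper bounds, and updated
-- environments are tied by equations so that list identities can be absorbed in a rule.
data Exec : Cmd → Env → ℕ → Env → Set where
  x-skip   : ∀ {ρ} → Exec skipC ρ 0 ρ
  x-push   : ∀ {r b ρ ρ'} → ρ [ r ]≔ (b ∷ lookup ρ r) ≡ ρ' → Exec (pushC r b) ρ 1 ρ'
  x-pop∅   : ∀ {r a b c ρ t ρ'} → lookup ρ r ≡ [] → Exec a ρ t ρ' → Exec (popC r a b c) ρ (suc t) ρ'
  x-pop    : ∀ {r a b c ρ ρ₁ t ρ'} x {v} → lookup ρ r ≡ x ∷ v → ρ [ r ]≔ v ≡ ρ₁ →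
             Exec (if x then c else b) ρ₁ t ρ' → Exec (popC r a b c) ρ (suc t) ρ'
  x-seq    : ∀ {c d ρ ρ₁ ρ₂ t t'} → Exec c ρ t ρ₁ → Exec d ρ₁ t' ρ₂ → Exec (c ⨾ d) ρ (t + t') ρ₂
  x-each∅  : ∀ {r b c ρ} → lookup ρ r ≡ [] → Exec (each r b c) ρ 1 ρ
  x-each   : ∀ {r b c ρ ρ₁ ρ₂ ρ' t t'} x {v} → lookup ρ r ≡ x ∷ v → ρ [ r ]≔ v ≡ ρ₁ →
             Exec (if x then c else b) ρ₁ t ρ₂ → Exec (each r b c) ρ₂ t' ρ' → Exec (each r b c) ρ (suc (t + t')) ρ'
  x-exit   : ∀ {r c ρ v ρ'} → lookup ρ r ≡ false ∷ v → ρ [ r ]≔ v ≡ ρ' → Exec (while r c) ρ 1 ρ'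
  x-while  : ∀ {r c ρ ρ₁ ρ₂ ρ' t t' v} → lookup ρ r ≡ true ∷ v → ρ [ r ]≔ v ≡ ρ₁ →
             Exec c ρ₁ t ρ₂ → Exec (while r c) ρ₂ t' ρ' → Exec (while r c) ρ (suc (t + t')) ρ'
  x-weaken : ∀ {c ρ t t' ρ'} → t ≤ t' → Exec c ρ t ρ' → Exec c ρ t' ρ'

mtime-mono : ∀ n {t t'} → t ≤ t' → 1 + suc t * (2 * (n + t) + 5) ≤ 1 + suc t' * (2 * (n + t') + 5)
mtime-mono n h = s≤s (*-mono-≤ (s≤s h) (+-monoˡ-≤ 5 (*-monoʳ-≤ 2 (+-monoʳ-≤ n h))))

module Program (prog : Cmd) where

  Label : Set
  Label = Loc prog ⊎ ⊤

  instrs : Label → Instr Label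
  instrs (inj₁ l) = code prog inj₁ (inj₂ tt) l
  instrs (inj₂ _) = done

  entryL : Label
  entryL = begin prog inj₁ (inj₂ tt)

  open Machine (fin-⊎ (fin-Loc prog) fin-⊤) instrs entryL public

  -- Subcommands are reached by composing the embedding with an injection, so the hypothesis
  -- descends to them by composition; for `prog` itself it holds by computation.
  Placed : (c : Cmd) → (Loc c → Label) → Label → Set
  Placed c e x = ∀ l → instrs (e l) ≡ code c e x l

  placed-prog : Placed prog inj₁ (inj₂ tt)
  placed-prog l = refl

  Runs≤ : ℕ → Label → Env → Label → Env → Set
  Runs≤ t l ρ l' ρ' = Σ ℕ λ n → n ≤ t × Run n l ρ l' ρ'

  exec-run : ∀ {c ρ t ρ'} → Exec c ρ t ρ' → ∀ {e x} → Placed c e x → Runs≤ t (begin c e x) ρ x ρ'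
  exec-run x-skip P = 0 , z≤n , []
  exec-run (x-push refl) P = 1 , ≤-refl , r-push (P tt) []
  exec-run (x-pop∅ h d) P with exec-run d (P ∘ inj₂ ∘ inj₁)
  ... | n , b , r = suc n , s≤s b , r-pop∅ (P (inj₁ tt)) h r
  exec-run (x-pop true h refl d) P with exec-run d (P ∘ inj₂ ∘ inj₂ ∘ inj₂)
  ... | n , b , r = suc n , s≤s b , r-pop (P (inj₁ tt)) h r
  exec-run (x-pop false h refl d) P with exec-run d (P ∘ inj₂ ∘ inj₂ ∘ inj₁)
  ... | n , b , r = suc n , s≤s b , r-pop (P (inj₁ tt)) h r
  exec-run (x-seq d d') P with exec-run d (P ∘ inj₁) | exec-run d' (P ∘ inj₂)
  ... | n , b , r | n' , b' , r' = n + n' , +-mono-≤ b b' , r ⊙R r'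
  exec-run (x-each∅ h) P = 1 , ≤-refl , r-pop∅ (P (inj₁ tt)) h []
  exec-run (x-each true h refl d d') P with exec-run d (P ∘ inj₂ ∘ inj₂) | exec-run d' P
  ... | n , b , r | n' , b' , r' = suc (n + n') , s≤s (+-mono-≤ b b') , r-pop (P (inj₁ tt)) h (r ⊙R r')
  exec-run (x-each false h refl d d') P with exec-run d (P ∘ inj₂ ∘ inj₁) | exec-run d' P
  ... | n , b , r | n' , b' , r' = suc (n + n') , s≤s (+-mono-≤ b b') , r-pop (P (inj₁ tt)) h (r ⊙R r')
  exec-run (x-exit h refl) P = 1 , ≤-refl , r-pop (P (inj₁ tt)) h []
  exec-run (x-while h refl d d') P with exec-run d (P ∘ inj₂) | exec-run d' P
  ... | n , b , r | n' , b' , r' = suc (n + n') , s≤s (+-mono-≤ b b') , r-pop (P (inj₁ tt)) h (r ⊙R r')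
  exec-run (x-weaken w d) P with exec-run d P
  ... | n , b , r = n , ≤-trans b w , r

  exec-game : ∀ {c ρ t ρ' e x m u b A} → Exec c ρ t ρ' → Placed c e x →
    Game m x ρ' u b A → Game m (begin c e x) ρ (t + u) b A
  exec-game {u = u} d P g with exec-run d P
  ... | n , h , r = g-weaken (+-monoˡ-≤ u h) ≤-refl (run-game r g)

  exec-dtm : ∀ w u {t ρ} → Exec prog (initEnv w) t ρ → lookup ρ rI ≡ reverse u →
    Σ ℕ λ T → (T ≤ machine-time (length w) t + (length w + t)) ×
      (Conf.state (DTMSem.run dtm T (DTMSem.initConf dtm w)) ≡ DTM.halt dtm) ×
      DTMSem.OutputIs dtm (Conf.tape (DTMSem.run dtm T (DTMSem.initConf dtm w))) u
  exec-dtm w u d e with exec-run d placed-prog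
  ... | n , nb , r with run-dtm w u r refl e
  ... | T , tb , st , oo = T , ≤-trans tb (+-mono-≤ (mtime-mono (length w) nb) (+-monoʳ-≤ (length w) nb)) , st , oo

-- A total first-order language on binary trees, compiled to stack programs

data D : Set where
  nil : D
  _·_ : D → D → D

infixr 6 _·_

-- Preorder code. Being self-delimiting, codes can be piled up on `rA` without separators.
ser : D → List Bool
ser nil     = false ∷ []
ser (x · y) = true ∷ ser x ++ ser y

⌊_⌋ : D → ℕ
⌊ nil ⌋   = 1
⌊ x · y ⌋ = suc (⌊ x ⌋ + ⌊ y ⌋)

-- `foldF` is the only loop. It makes one round per entry of a list that is fixed beforehand, hence
-- totality; being a left fold, it needs no stack of pending calls.
data Fn : Set where
  idF nilF hdF tlF : Fn
  _∘F_   : Fn → Fn → Fn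
  ⟨_,_⟩F : Fn → Fn → Fn
  iteF   : Fn → Fn → Fn → Fn
  foldF  : Fn → Fn

hdD tlD : D → D
hdD nil     = nil
hdD (x · y) = x
tlD nil     = nil
tlD (x · y) = y

⟦_⟧ : Fn → D → D
foldD : Fn → D → D → D
iteD : D → D → D → D

iteD nil     x y = y
iteD (_ · _) x y = x

⟦ idF ⟧ x          = x
⟦ nilF ⟧ x         = nil
⟦ hdF ⟧ x          = hdD x
⟦ tlF ⟧ x          = tlD x
⟦ g ∘F f ⟧ x       = ⟦ g ⟧ (⟦ f ⟧ x)
⟦ ⟨ f , g ⟩F ⟧ x   = ⟦ f ⟧ x · ⟦ g ⟧ x
⟦ iteF c f g ⟧ x   = iteD (⟦ c ⟧ x) (⟦ f ⟧ x) (⟦ g ⟧ x)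
⟦ foldF f ⟧ nil    = nil
⟦ foldF f ⟧ (xs · s) = foldD f xs s

foldD f nil      s = s
foldD f (x · xs) s = foldD f xs (⟦ f ⟧ (x · s))

-- An upper bound on the number of stack instructions, which also bounds the size of the result.
cost : Fn → D → ℕ
costIte : D → ℕ → ℕ → ℕ
costFold : Fn → D → D → ℕ

costIte nil     a b = b
costIte (_ · _) a b = a

cost idF          x = ⌊ x ⌋
cost nilF         x = 5 * ⌊ x ⌋ + 3
cost hdF          x = 12 * ⌊ x ⌋ + 6
cost tlF          x = 12 * ⌊ x ⌋ + 6
cost (g ∘F f)     x = cost f x + cost g (⟦ f ⟧ x)
cost ⟨ f , g ⟩F   x = 20 * (⌊ x ⌋ + 1 + cost f x + cost g x)
cost (iteF c f g) x = 20 * (⌊ x ⌋ + 1 + cost c x + costIte (⟦ c ⟧ x) (cost f x) (cost g x))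
cost (foldF f)    nil      = 2
cost (foldF f)    (xs · s) = 1 + costFold f xs s

costFold f nil      s = 1 + ⌊ s ⌋
costFold f (x · xs) s = 20 * (⌊ x ⌋ + ⌊ xs ⌋ + ⌊ s ⌋ + 1 + cost f (x · s)) + costFold f xs (⟦ f ⟧ (x · s))

≤-by : ∀ {a b} d → a + d ≡ b → a ≤ b
≤-by {a} d refl = m≤m+n a d

-- The cost of moving an intermediate result can thereby be charged to the computation that produced
-- it, and one bound controls time and size at once.
size≤cost : ∀ f x → ⌊ ⟦ f ⟧ x ⌋ ≤ cost f x
size≤costFold : ∀ f xs s → ⌊ foldD f xs s ⌋ ≤ costFold f xs s
size≤cost idF x = ≤-refl
size≤cost nilF x = ≤-trans (s≤s z≤n) (m≤n+m 3 (5 * ⌊ x ⌋))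
size≤cost hdF nil = s≤s z≤n
size≤cost hdF (x · y) = ≤-by (18 + 11 * ⌊ x ⌋ + 12 * ⌊ y ⌋) (lem ⌊ x ⌋ ⌊ y ⌋)
  where
  lem : ∀ a b → a + (18 + 11 * a + 12 * b) ≡ 12 * suc (a + b) + 6
  lem = solve-∀
size≤cost tlF nil = s≤s z≤n
size≤cost tlF (x · y) = ≤-by (18 + 12 * ⌊ x ⌋ + 11 * ⌊ y ⌋) (lem ⌊ x ⌋ ⌊ y ⌋)
  where
  lem : ∀ a b → b + (18 + 12 * a + 11 * b) ≡ 12 * suc (a + b) + 6
  lem = solve-∀
size≤cost (g ∘F f) x = ≤-trans (size≤cost g (⟦ f ⟧ x)) (m≤n+m _ (cost f x))
size≤cost ⟨ f , g ⟩F x = ≤-trans (s≤s (+-mono-≤ (size≤cost f x) (size≤cost g x)))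
  (≤-by (20 * ⌊ x ⌋ + 19 + 19 * cost f x + 19 * cost g x) (lem (⌊ x ⌋) (cost f x) (cost g x)))
  where
  lem : ∀ s a b → suc (a + b) + (20 * s + 19 + 19 * a + 19 * b) ≡ 20 * (s + 1 + a + b)
  lem = solve-∀
size≤cost (iteF c f g) x = ≤-trans (branch (⟦ c ⟧ x)) (≤-trans (m≤n+m _ (⌊ x ⌋ + 1 + cost c x)) (m≤m+n _ _))
  where
  branch : ∀ d → ⌊ iteD d (⟦ f ⟧ x) (⟦ g ⟧ x) ⌋ ≤ costIte d (cost f x) (cost g x)
  branch nil     = size≤cost g x
  branch (_ · _) = size≤cost f x
size≤cost (foldF f) nil = s≤s z≤n
size≤cost (foldF f) (xs · s) = m≤n⇒m≤1+n (size≤costFold f xs s)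
size≤costFold f nil s = n≤1+n _
size≤costFold f (x · xs) s = ≤-trans (size≤costFold f xs (⟦ f ⟧ (x · s))) (m≤n+m _ _)

-- Stack routines on serialised trees

env : List Bool → List Bool → List Bool → List Bool → List Bool → Env
env a b c n i = a ∷ b ∷ c ∷ n ∷ i ∷ []

-- Leaves the target register open, so that the routines are verified once. For the concrete
-- registers all equations hold by `refl`.
record Slot (r : Reg) (E : List Bool → List Bool → List Bool → Env) : Set where
  field
    getA : ∀ a d n → lookup (E a d n) rA ≡ a
    setA : ∀ a d n a' → E a d n [ rA ]≔ a' ≡ E a' d n
    getN : ∀ a d n → lookup (E a d n) rN ≡ n
    setN : ∀ a d n n' → E a d n [ rN ]≔ n' ≡ E a d n'
    getD : ∀ a d n → lookup (E a d n) r ≡ d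
    setD : ∀ a d n d' → E a d n [ r ]≔ d' ≡ E a d' n

slotB : ∀ c i → Slot rB (λ a d n → env a d c n i)
slotB c i = record { getA = λ _ _ _ → refl ; setA = λ _ _ _ _ → refl ; getN = λ _ _ _ → refl
                   ; setN = λ _ _ _ _ → refl ; getD = λ _ _ _ → refl ; setD = λ _ _ _ _ → refl }

slotC : ∀ b i → Slot rC (λ a d n → env a b d n i)
slotC b i = record { getA = λ _ _ _ → refl ; setA = λ _ _ _ _ → refl ; getN = λ _ _ _ → refl
                   ; setN = λ _ _ _ _ → refl ; getD = λ _ _ _ → refl ; setD = λ _ _ _ _ → refl }

slotI : ∀ b c → Slot rI (λ a d n → env a b c n d)
slotI b c = record { getA = λ _ _ _ → refl ; setA = λ _ _ _ _ → refl ; getN = λ _ _ _ → refl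
                   ; setN = λ _ _ _ _ → refl ; getD = λ _ _ _ → refl ; setD = λ _ _ _ _ → refl }

-- Register rN holds one entry for every tree that is still to be read off stack rA.
mvBody : Reg → Cmd
mvBody r = popC rA skipC (pushC r false) (pushC r true ⨾ pushC rN true ⨾ pushC rN true)

mvLoop mv pour : Reg → Cmd
mvLoop r = each rN (mvBody r) (mvBody r)
mv r     = pushC rN true ⨾ mvLoop r
pour r   = each r (pushC rA false) (pushC rA true)

dropBody dropLoop drop : Cmd
dropBody = popC rA skipC skipC (pushC rN true ⨾ pushC rN true)
dropLoop = each rN dropBody dropBody
drop     = pushC rN true ⨾ dropLoop

module _ {r E} (S : Slot r E) where
  open Slot S

  x-pushA : ∀ {a d n} b → Exec (pushC rA b) (E a d n) 1 (E (b ∷ a) d n)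
  x-pushA {a} {d} {n} b = x-push (trans (cong (λ z → E a d n [ rA ]≔ (b ∷ z)) (getA a d n)) (setA a d n _))

  x-pushN : ∀ {a d n} b → Exec (pushC rN b) (E a d n) 1 (E a d (b ∷ n))
  x-pushN {a} {d} {n} b = x-push (trans (cong (λ z → E a d n [ rN ]≔ (b ∷ z)) (getN a d n)) (setN a d n _))

  x-pushD : ∀ {a d n} b → Exec (pushC r b) (E a d n) 1 (E a (b ∷ d) n)
  x-pushD {a} {d} {n} b = x-push (trans (cong (λ z → E a d n [ r ]≔ (b ∷ z)) (getD a d n)) (setD a d n _))

  -- Stated with a continuation: after the left subtree the loop is still running, and the run for
  -- the right subtree starts in its middle. The tree arrives reversed; `pour` turns it back.
  mvLoop-spec : ∀ x {a d n t ρ'} → Exec (mvLoop r) (E a (ser x ʳ++ d) n) t ρ' →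
    Exec (mvLoop r) (E (ser x ++ a) d (true ∷ n)) (5 * ⌊ x ⌋ + t) ρ'
  mvLoop-spec nil {a} {d} {n} {t} k = x-weaken (≤-by 2 (lem t))
    (x-each true (getN _ _ _) (setN _ _ _ _)
      (x-pop false (getA _ _ _) (setA _ _ _ _) (x-pushD false)) k)
    where
    lem : ∀ t → suc (2 + t) + 2 ≡ 5 + t
    lem = solve-∀
  mvLoop-spec (x · y) {a} {d} {n} {t} k = x-weaken (≤-reflexive (lem ⌊ x ⌋ ⌊ y ⌋ t))
    (x-each true (getN _ _ _) (setN _ _ _ _)
      (x-pop true (getA _ _ _) (setA _ _ _ _) (x-seq (x-pushD true) (x-seq (x-pushN true) (x-pushN true))))
      (subst (λ l → Exec (mvLoop r) (E l (true ∷ d) (true ∷ true ∷ n)) (5 * ⌊ x ⌋ + (5 * ⌊ y ⌋ + t)) _)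
        (sym (LP.++-assoc (ser x) (ser y) a))
        (mvLoop-spec x (mvLoop-spec y (subst (λ l → Exec (mvLoop r) (E a l n) t _) (LP.++-ʳ++ (ser x)) k)))))
    where
    lem : ∀ x y t → suc (suc (1 + (1 + 1)) + (5 * x + (5 * y + t))) ≡ 5 * suc (x + y) + t
    lem = solve-∀

  mv-spec : ∀ x {a d} → Exec (mv r) (E (ser x ++ a) d []) (5 * ⌊ x ⌋ + 2) (E a (ser x ʳ++ d) [])
  mv-spec x {a} {d} = x-weaken (≤-reflexive (lem ⌊ x ⌋))
    (x-seq (x-pushN true) (mvLoop-spec x (x-each∅ (getN _ _ _))))
    where
    lem : ∀ s → 1 + (5 * s + 1) ≡ 5 * s + 2
    lem = solve-∀

  pour-spec : ∀ d {a n} → Exec (pour r) (E a d n) (2 * length d + 1) (E (d ʳ++ a) [] n)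
  pour-spec []      = x-each∅ (getD _ _ _)
  pour-spec (false ∷ d) = x-weaken (≤-reflexive (lem (length d)))
    (x-each false (getD _ _ _) (setD _ _ _ _) (x-pushA false) (pour-spec d))
    where
    lem : ∀ n → suc (1 + (2 * n + 1)) ≡ 2 * suc n + 1
    lem = solve-∀
  pour-spec (true ∷ d) = x-weaken (≤-reflexive (lem (length d)))
    (x-each true (getD _ _ _) (setD _ _ _ _) (x-pushA true) (pour-spec d))
    where
    lem : ∀ n → suc (1 + (2 * n + 1)) ≡ 2 * suc n + 1
    lem = solve-∀

length-ser : ∀ x → length (ser x) ≡ ⌊ x ⌋
length-ser nil     = refl
length-ser (x · y) = cong suc (trans (LP.length-++ (ser x)) (cong₂ _+_ (length-ser x) (length-ser y)))

pour-ser : ∀ {r E} → Slot r E → ∀ x {a n} → Exec (pour r) (E a (ser x ʳ++ []) n) (2 * ⌊ x ⌋ + 1) (E (ser x ++ a) [] n)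
pour-ser {r} {E} S x {a} {n} =
  x-weaken (≤-reflexive (cong (λ k → 2 * k + 1) (trans (LP.length-ʳ++ (ser x)) (trans (+-identityʳ _) (length-ser x)))))
  (subst (λ l → Exec (pour r) (E a (ser x ʳ++ []) n) (2 * length (ser x ʳ++ []) + 1) (E l [] n))
    (LP.ʳ++-ʳ++ (ser x)) (pour-spec S (ser x ʳ++ [])))

dropLoop-spec : ∀ x {a b c i n t ρ'} → Exec dropLoop (env a b c n i) t ρ' →
  Exec dropLoop (env (ser x ++ a) b c (true ∷ n) i) (5 * ⌊ x ⌋ + t) ρ'
dropLoop-spec nil {t = t} k = x-weaken (≤-by 3 (lem t))
  (x-each true refl refl (x-pop false refl refl x-skip) k)
  where
  lem : ∀ t → suc (1 + t) + 3 ≡ 5 + t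
  lem = solve-∀
dropLoop-spec (x · y) {a} {b} {c} {i} {n} {t} k = x-weaken (≤-by 1 (lem ⌊ x ⌋ ⌊ y ⌋ t))
  (x-each true refl refl
    (x-pop true refl refl (x-seq (x-push refl) (x-push refl)))
    (subst (λ l → Exec dropLoop (env l b c (true ∷ true ∷ n) i) (5 * ⌊ x ⌋ + (5 * ⌊ y ⌋ + t)) _)
      (sym (LP.++-assoc (ser x) (ser y) a)) (dropLoop-spec x (dropLoop-spec y k))))
  where
  lem : ∀ x y t → suc (suc (1 + 1) + (5 * x + (5 * y + t))) + 1 ≡ 5 * suc (x + y) + t
  lem = solve-∀

drop-spec : ∀ x {a b c i} → Exec drop (env (ser x ++ a) b c [] i) (5 * ⌊ x ⌋ + 2) (env a b c [] i)
drop-spec x {a} = x-weaken (≤-reflexive (lem ⌊ x ⌋))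
  (x-seq (x-push refl) (dropLoop-spec x (x-each∅ refl)))
  where
  lem : ∀ s → 1 + (5 * s + 1) ≡ 5 * s + 2
  lem = solve-∀

-- `fork` leaves the second copy in `rC` in reading order, and pouring it back from there would
-- reverse it. The detour through `rI` corrects the parity of reversals.
fork move dup swap : Cmd
fork = each rB (pushC rA false ⨾ pushC rC false) (pushC rA true ⨾ pushC rC true)
move = each rC (pushC rI false) (pushC rI true)
dup  = mv rB ⨾ fork ⨾ move ⨾ pour rI
swap = mv rB ⨾ mv rC ⨾ pour rB ⨾ pour rC

fork-spec : ∀ b {a c n i} → Exec fork (env a b c n i) (3 * length b + 1) (env (b ʳ++ a) [] (b ʳ++ c) n i)
fork-spec []          = x-each∅ refl
fork-spec (x ∷ b) {a} {c} {n} {i} = x-weaken (≤-reflexive (lem (length b)))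
  (x-each x refl refl (body x) (fork-spec b))
  where
  body : ∀ x → Exec (if x then pushC rA true ⨾ pushC rC true else (pushC rA false ⨾ pushC rC false))
               (env a b c n i) 2 (env (x ∷ a) b (x ∷ c) n i)
  body true  = x-seq (x-push refl) (x-push refl)
  body false = x-seq (x-push refl) (x-push refl)
  lem : ∀ n → suc (2 + (3 * n + 1)) ≡ 3 * suc n + 1
  lem = solve-∀

move-spec : ∀ c {a b n i} → Exec move (env a b c n i) (2 * length c + 1) (env a b [] n (c ʳ++ i))
move-spec []          = x-each∅ refl
move-spec (x ∷ c) {a} {b} {n} {i} = x-weaken (≤-reflexive (lem (length c)))
  (x-each x refl refl (body x) (move-spec c))
  where
  body : ∀ x → Exec (if x then pushC rI true else pushC rI false) (env a b c n i) 1 (env a b c n (x ∷ i))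
  body true  = x-push refl
  body false = x-push refl
  lem : ∀ n → suc (1 + (2 * n + 1)) ≡ 2 * suc n + 1
  lem = solve-∀

idle : List Bool → Env
idle a = env a [] [] [] []

dup-spec : ∀ x {a} → Exec dup (idle (ser x ++ a)) (12 * ⌊ x ⌋ + 5) (idle (ser x ++ (ser x ++ a)))
dup-spec x {a} = x-weaken (≤-reflexive (lem ⌊ x ⌋))
  (x-seq (mv-spec (slotB [] []) x) (x-seq fk (x-seq mo (pour-ser (slotI [] []) x))))
  where
  lem : ∀ s → 5 * s + 2 + (3 * s + 1 + (2 * s + 1 + (2 * s + 1))) ≡ 12 * s + 5
  lem = solve-∀
  len : length (ser x ʳ++ []) ≡ ⌊ x ⌋
  len = trans (LP.length-ʳ++ (ser x)) (trans (+-identityʳ _) (length-ser x))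
  fk : Exec fork (env a (ser x ʳ++ []) [] [] []) (3 * ⌊ x ⌋ + 1) (env (ser x ++ a) [] (ser x) [] [])
  fk = subst₂ (λ k (l : List Bool × List Bool) → Exec fork (env a (ser x ʳ++ []) [] [] []) (3 * k + 1) (env (proj₁ l) [] (proj₂ l) [] []))
    len (cong₂ _,_ (LP.ʳ++-ʳ++ (ser x)) (trans (LP.ʳ++-ʳ++ (ser x)) (LP.++-identityʳ (ser x)))) (fork-spec (ser x ʳ++ []))
  mo : Exec move (env (ser x ++ a) [] (ser x) [] []) (2 * ⌊ x ⌋ + 1) (env (ser x ++ a) [] [] [] (ser x ʳ++ []))
  mo = subst (λ k → Exec move (env (ser x ++ a) [] (ser x) [] []) (2 * k + 1) (env (ser x ++ a) [] [] [] (ser x ʳ++ [])))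
    (length-ser x) (move-spec (ser x))

swap-spec : ∀ x y {a} → Exec swap (idle (ser x ++ (ser y ++ a))) (7 * (⌊ x ⌋ + ⌊ y ⌋) + 6) (idle (ser y ++ (ser x ++ a)))
swap-spec x y = x-weaken (≤-reflexive (lem ⌊ x ⌋ ⌊ y ⌋))
  (x-seq (mv-spec (slotB [] []) x) (x-seq (mv-spec (slotC _ []) y) (x-seq (pour-ser (slotB _ []) x) (pour-ser (slotC [] []) y))))
  where
  lem : ∀ x y → 5 * x + 2 + (5 * y + 2 + (2 * x + 1 + (2 * y + 1))) ≡ 7 * (x + y) + 6
  lem = solve-∀

-- After the cons bit the stack shows head, remaining list, state. The entries are rearranged to
-- head, state, remaining list; the pushed `true` pairs the first two as the argument of `c`, and
-- `swap` brings the remaining list back on top for the next round.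
spread : Cmd → Cmd
spread c = mv rB ⨾ mv rC ⨾ mv rI ⨾ pour rC ⨾ pour rI ⨾ pour rB ⨾ pushC rA true ⨾ c ⨾ swap

comp : Fn → Cmd
comp idF          = skipC
comp nilF         = drop ⨾ pushC rA false
comp hdF          = popC rA skipC (pushC rA false) (mv rB ⨾ drop ⨾ pour rB)
comp tlF          = popC rA skipC (pushC rA false) drop
comp (g ∘F f)     = comp f ⨾ comp g
comp ⟨ f , g ⟩F   = dup ⨾ comp f ⨾ swap ⨾ comp g ⨾ swap ⨾ pushC rA true
comp (iteF c f g) = dup ⨾ comp c ⨾ popC rA skipC (comp g) (drop ⨾ drop ⨾ comp f)
comp (foldF f)    = popC rA skipC (pushC rA false) (while rA (spread (comp f)))

conv : ∀ {c a a' b b' t} → a ≡ a' → b ≡ b' → Exec c (idle a) t (idle b) → Exec c (idle a') t (idle b')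
conv refl refl e = e

-- The rest `a` of the stack is a frame and the other stacks are empty before and after, so compiled
-- functions compose. The factor 20 in `cost` absorbs copying and swapping: sizes of intermediate
-- results are replaced by costs through `size≤cost`.
comp-spec : ∀ f x {a} → Exec (comp f) (idle (ser x ++ a)) (cost f x) (idle (ser (⟦ f ⟧ x) ++ a))
fold-spec : ∀ f xs s {a} → Exec (while rA (spread (comp f))) (idle (ser xs ++ (ser s ++ a)))
  (costFold f xs s) (idle (ser (foldD f xs s) ++ a))

comp-spec idF x = x-weaken z≤n x-skip
comp-spec nilF x = x-weaken (≤-reflexive (lem ⌊ x ⌋)) (x-seq (drop-spec x) (x-push refl))
  where
  lem : ∀ s → 5 * s + 2 + 1 ≡ 5 * s + 3
  lem = solve-∀
comp-spec hdF nil = x-weaken (s≤s (s≤s z≤n)) (x-pop false refl refl (x-push refl))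
comp-spec hdF (x · y) {a} = x-weaken (≤-by (12 + 5 * ⌊ x ⌋ + 7 * ⌊ y ⌋) (lem ⌊ x ⌋ ⌊ y ⌋))
  (x-pop true refl refl
    (conv (sym (LP.++-assoc (ser x) (ser y) a)) refl
      (x-seq (mv-spec (slotB [] []) x) (x-seq (drop-spec y) (pour-ser (slotB [] []) x)))))
  where
  lem : ∀ x y → suc (5 * x + 2 + (5 * y + 2 + (2 * x + 1))) + (12 + 5 * x + 7 * y) ≡ 12 * suc (x + y) + 6
  lem = solve-∀
comp-spec tlF nil = x-weaken (s≤s (s≤s z≤n)) (x-pop false refl refl (x-push refl))
comp-spec tlF (x · y) {a} = x-weaken (≤-by (15 + 7 * ⌊ x ⌋ + 12 * ⌊ y ⌋) (lem ⌊ x ⌋ ⌊ y ⌋))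
  (x-pop true refl refl (conv (sym (LP.++-assoc (ser x) (ser y) a)) refl (drop-spec x)))
  where
  lem : ∀ x y → suc (5 * x + 2) + (15 + 7 * x + 12 * y) ≡ 12 * suc (x + y) + 6
  lem = solve-∀
comp-spec (g ∘F f) x = x-seq (comp-spec f x) (comp-spec g (⟦ f ⟧ x))
comp-spec ⟨ f , g ⟩F x {a} = x-weaken
  (≤-trans (+-monoʳ-≤ (12 * ⌊ x ⌋ + 5) (+-monoʳ-≤ (cost f x) (+-mono-≤ (+-monoˡ-≤ 6 (*-monoʳ-≤ 7 (+-monoˡ-≤ ⌊ x ⌋ (size≤cost f x))))
     (+-monoʳ-≤ (cost g x) (+-monoˡ-≤ 1 (+-monoˡ-≤ 6 (*-monoʳ-≤ 7 (+-mono-≤ (size≤cost g x) (size≤cost f x)))))))))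
   (≤-by (⌊ x ⌋ + 2 + 5 * cost f x + 12 * cost g x) (lem ⌊ x ⌋ (cost f x) (cost g x))))
  (x-seq (dup-spec x) (x-seq (comp-spec f x) (x-seq (swap-spec (⟦ f ⟧ x) x) (x-seq (comp-spec g x)
    (x-seq (swap-spec (⟦ g ⟧ x) (⟦ f ⟧ x)) (x-push (cong (λ l → idle (true ∷ l)) (sym (LP.++-assoc (ser (⟦ f ⟧ x)) (ser (⟦ g ⟧ x)) a)))))))))
  where
  lem : ∀ s a b → 12 * s + 5 + (a + (7 * (a + s) + 6 + (b + (7 * (b + a) + 6 + 1)))) + (s + 2 + 5 * a + 12 * b) ≡ 20 * (s + 1 + a + b)
  lem = solve-∀
comp-spec (iteF c f g) x {a} with ⟦ c ⟧ x in eq | size≤cost c x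
... | nil | sz = x-weaken (≤-by (8 * ⌊ x ⌋ + 14 + 19 * cost c x + 19 * cost g x) (lem ⌊ x ⌋ (cost c x) (cost g x)))
  (x-seq (dup-spec x) (x-seq (subst (λ d → Exec (comp c) (idle (ser x ++ (ser x ++ a))) (cost c x) (idle (ser d ++ (ser x ++ a)))) eq (comp-spec c x))
    (x-pop false refl refl (comp-spec g x))))
  where
  lem : ∀ s c g → 12 * s + 5 + (c + suc g) + (8 * s + 14 + 19 * c + 19 * g) ≡ 20 * (s + 1 + c + g)
  lem = solve-∀
... | y · z | sz = x-weaken
  (≤-trans (≤-trans (≤-reflexive (lem₁ ⌊ x ⌋ (cost c x) (cost f x) ⌊ y ⌋ ⌊ z ⌋)) (+-monoʳ-≤ (12 * ⌊ x ⌋ + 10 + cost c x + cost f x) (*-monoʳ-≤ 5 (≤-trans (n≤1+n _) sz))))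
    (≤-by (8 * ⌊ x ⌋ + 10 + 14 * cost c x + 19 * cost f x) (lem₂ ⌊ x ⌋ (cost c x) (cost f x))))
  (x-seq (dup-spec x) (x-seq (subst (λ d → Exec (comp c) (idle (ser x ++ (ser x ++ a))) (cost c x) (idle (ser d ++ (ser x ++ a)))) eq (comp-spec c x))
    (x-pop true refl refl (conv (sym (LP.++-assoc (ser y) (ser z) (ser x ++ a))) refl
      (x-seq (drop-spec y) (x-seq (drop-spec z) (comp-spec f x)))))))
  where
  lem₁ : ∀ s c f y z → 12 * s + 5 + (c + suc (5 * y + 2 + (5 * z + 2 + f))) ≡ 12 * s + 10 + c + f + 5 * (y + z)
  lem₁ = solve-∀
  lem₂ : ∀ s c f → 12 * s + 10 + c + f + 5 * c + (8 * s + 10 + 14 * c + 19 * f) ≡ 20 * (s + 1 + c + f)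
  lem₂ = solve-∀
comp-spec (foldF f) nil = x-pop false refl refl (x-push refl)
comp-spec (foldF f) (xs · s) {a} = x-pop true refl refl
  (conv (sym (LP.++-assoc (ser xs) (ser s) a)) refl (fold-spec f xs s))

fold-spec f nil s = x-weaken (s≤s z≤n) (x-exit refl refl)
fold-spec f (x · xs) s {a} = x-weaken
  (≤-trans (≤-trans (≤-reflexive (lem₁ ⌊ x ⌋ ⌊ xs ⌋ ⌊ s ⌋ (cost f (x · s)) ⌊ ⟦ f ⟧ (x · s) ⌋ rest))
     (+-monoʳ-≤ (7 * ⌊ x ⌋ + 14 * ⌊ xs ⌋ + 7 * ⌊ s ⌋ + 17 + cost f (x · s) + rest) (*-monoʳ-≤ 7 (size≤cost f (x · s)))))
    (≤-by (13 * ⌊ x ⌋ + 6 * ⌊ xs ⌋ + 13 * ⌊ s ⌋ + 3 + 12 * cost f (x · s)) (lem₂ ⌊ x ⌋ ⌊ xs ⌋ ⌊ s ⌋ (cost f (x · s)) rest)))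
  (x-while refl refl
    (conv (sym (LP.++-assoc (ser x) (ser xs) (ser s ++ a))) refl
      (x-seq (mv-spec (slotB [] []) x) (x-seq (mv-spec (slotC _ []) xs) (x-seq (mv-spec (slotI _ _) s)
        (x-seq (pour-ser (slotC _ _) xs) (x-seq (pour-ser (slotI _ []) s) (x-seq (pour-ser (slotB [] []) x)
          (x-seq (x-push (cong (λ l → idle (true ∷ l)) (sym (LP.++-assoc (ser x) (ser s) (ser xs ++ a)))))
            (x-seq (comp-spec f (x · s)) (swap-spec (⟦ f ⟧ (x · s)) xs))))))))))
    (fold-spec f xs (⟦ f ⟧ (x · s))))
  where
  rest : ℕ
  rest = costFold f xs (⟦ f ⟧ (x · s))
  lem₁ : ∀ x xs s c s' r → suc (5 * x + 2 + (5 * xs + 2 + (5 * s + 2 + (2 * xs + 1 + (2 * s + 1 + (2 * x + 1 + (1 + (c + (7 * (s' + xs) + 6)))))))) + r)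
       ≡ 7 * x + 14 * xs + 7 * s + 17 + c + r + 7 * s'
  lem₁ = solve-∀
  lem₂ : ∀ x xs s c r → 7 * x + 14 * xs + 7 * s + 17 + c + r + 7 * c + (13 * x + 6 * xs + 13 * s + 3 + 12 * c)
       ≡ 20 * (x + xs + s + 1 + c) + r
  lem₂ = solve-∀

-- Polynomial-time functions on encoded data

-- A universe of encodable types. Numbers are coded in unary, as in `encode`, so a bound polynomial
-- in the size is polynomial in the value.
data Ty : Set where
  Un Nat Bo : Ty
  Li Ma     : Ty → Ty
  _⊠_       : Ty → Ty → Ty

infixr 5 _⊠_

El : Ty → Set
El Un      = ⊤
El Nat     = ℕ
El Bo      = Bool
El (Li A)  = List (El A)
El (Ma A)  = Maybe (El A)
El (A ⊠ B) = El A × El B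

cd : ∀ A → El A → D
cdL : ∀ A → List (El A) → D
cdℕ : ℕ → D

cd Un      _        = nil
cd Nat     n        = cdℕ n
cd Bo      false    = nil
cd Bo      true     = nil · nil
cd (Li A)  xs       = cdL A xs
cd (Ma A)  nothing  = nil
cd (Ma A)  (just x) = nil · cd A x
cd (A ⊠ B) (a , b)  = cd A a · cd B b

cdL A []       = nil
cdL A (x ∷ xs) = cd A x · cdL A xs

cdℕ zero    = nil
cdℕ (suc n) = nil · cdℕ n

sz : ∀ A → El A → ℕ
sz A a = ⌊ cd A a ⌋

-- The function is an index and the program a field, so proofs about `h` never mention programs. As
-- cost bounds size, `pol` also bounds the result, which is what composition needs.
record PT (A B : Ty) (h : El A → El B) : Set where
  constructor mkPT
  field
    fn  : Fn
    pol : Pol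
    sem : ∀ a → ⟦ fn ⟧ (cd A a) ≡ cd B (h a)
    bnd : ∀ a → cost fn (cd A a) ≤ eval pol (sz A a)
open PT public

size-bnd : ∀ {A B h} (p : PT A B h) → ∀ a → sz B (h a) ≤ eval (pol p) (sz A a)
size-bnd {A} p a = ≤-trans (≤-reflexive (cong ⌊_⌋ (sym (sem p a)))) (≤-trans (size≤cost (fn p) (cd A a)) (bnd p a))

pt-coe : ∀ {A B f} → (∀ a → cd A a ≡ cd B (f a)) → PT A B f
pt-coe e = mkPT idF X e (λ _ → ≤-refl)

pt-id : ∀ {A} → PT A A id
pt-id = pt-coe (λ _ → refl)

pt-ext : ∀ {A B f g} → (∀ a → f a ≡ g a) → PT A B f → PT A B g
pt-ext {B = B} e p = mkPT (fn p) (pol p) (λ a → trans (sem p a) (cong (cd B) (e a))) (bnd p)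

linPol : Pol
linPol = con 12 ⊗ X ⊕ con 6

infixr 9 _∙_
infixr 4 _&_

abstract
  pt-fst : ∀ {A B} → PT (A ⊠ B) A proj₁
  pt-fst = mkPT hdF linPol (λ _ → refl) (λ _ → ≤-refl)

  pt-snd : ∀ {A B} → PT (A ⊠ B) B proj₂
  pt-snd = mkPT tlF linPol (λ _ → refl) (λ _ → ≤-refl)

  _∙_ : ∀ {A B C g f} → PT B C g → PT A B f → PT A C (λ a → g (f a))
  _∙_ {A} {f = f} q p = mkPT (fn q ∘F fn p) (pol p ⊕ (pol q ⊚ pol p))
    (λ a → trans (cong ⟦ fn q ⟧ (sem p a)) (sem q (f a)))
    (λ a → +-mono-≤ (bnd p a) (≤-trans (≤-reflexive (cong (cost (fn q)) (sem p a)))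
      (≤-trans (bnd q (f a)) (≤-trans (eval-mono (pol q) (size-bnd p a)) (≤-reflexive (sym (eval-⊚ (pol q) (pol p) (sz A a))))))))

  _&_ : ∀ {A B C f g} → PT A B f → PT A C g → PT A (B ⊠ C) (λ a → f a , g a)
  _&_ {A} p q = mkPT ⟨ fn p , fn q ⟩F (con 20 ⊗ (X ⊕ con 1 ⊕ pol p ⊕ pol q)) (λ a → cong₂ _·_ (sem p a) (sem q a))
    (λ a → *-monoʳ-≤ 20 (+-mono-≤ (+-monoʳ-≤ (sz A a + 1) (bnd p a)) (bnd q a)))

constF : D → Fn
constF nil     = nilF
constF (x · y) = ⟨ constF x , constF y ⟩F

constPol : D → Pol
constPol nil     = con 5 ⊗ X ⊕ con 3
constPol (x · y) = con 20 ⊗ (X ⊕ con 1 ⊕ constPol x ⊕ constPol y)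

constF-sem : ∀ d x → ⟦ constF d ⟧ x ≡ d
constF-sem nil     x = refl
constF-sem (d · e) x = cong₂ _·_ (constF-sem d x) (constF-sem e x)

constF-bnd : ∀ d x → cost (constF d) x ≤ eval (constPol d) ⌊ x ⌋
constF-bnd nil     x = ≤-refl
constF-bnd (d · e) x = *-monoʳ-≤ 20 (+-mono-≤ (+-monoʳ-≤ (⌊ x ⌋ + 1) (constF-bnd d x)) (constF-bnd e x))

costIte≤ : ∀ d a b → costIte d a b ≤ a + b
costIte≤ nil     a b = m≤n+m b a
costIte≤ (_ · _) a b = m≤m+n a b

abstract
  pt-const : ∀ {A B} (b : El B) → PT A B (λ _ → b)
  pt-const {A} {B} b = mkPT (constF (cd B b)) (constPol (cd B b)) (λ a → constF-sem (cd B b) (cd A a)) (λ a → constF-bnd (cd B b) (cd A a))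

  pt-if : ∀ {A B c f g} → PT A Bo c → PT A B f → PT A B g → PT A B (λ a → if c a then f a else g a)
  pt-if {A} {B} {c} {f} {g} pc pf pg = mkPT (iteF (fn pc) (fn pf) (fn pg)) (con 20 ⊗ (X ⊕ con 1 ⊕ pol pc ⊕ (pol pf ⊕ pol pg)))
    (λ a → trans (cong (λ d → iteD d (⟦ fn pf ⟧ (cd A a)) (⟦ fn pg ⟧ (cd A a))) (sem pc a)) (eq a))
    (λ a → *-monoʳ-≤ 20 (+-mono-≤ (+-monoʳ-≤ (sz A a + 1) (bnd pc a))
      (≤-trans (costIte≤ (⟦ fn pc ⟧ (cd A a)) _ _) (+-mono-≤ (bnd pf a) (bnd pg a)))))
    where
    eq : ∀ a → iteD (cd Bo (c a)) (⟦ fn pf ⟧ (cd A a)) (⟦ fn pg ⟧ (cd A a)) ≡ cd B (if c a then f a else g a)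
    eq a with c a
    ... | true  = sem pf a
    ... | false = sem pg a

caseL : ∀ {E Y B : Set} → (E → B) → (E × (Y × List Y) → B) → E × List Y → B
caseL z s (e , [])     = z e
caseL z s (e , x ∷ xs) = s (e , x , xs)

caseM : ∀ {E Y B : Set} → (E → B) → (E × Y → B) → E × Maybe Y → B
caseM z s (e , nothing) = z e
caseM z s (e , just x)  = s (e , x)

itePol : Pol → Pol → Pol → Pol
itePol p q r = con 20 ⊗ (X ⊕ con 1 ⊕ p ⊕ (q ⊕ r))

iteF-bnd : ∀ (t f g : Fn) (p q r : Pol) x → cost t x ≤ eval p ⌊ x ⌋ →
  costIte (⟦ t ⟧ x) (cost f x) (cost g x) ≤ eval q ⌊ x ⌋ + eval r ⌊ x ⌋ →
  cost (iteF t f g) x ≤ eval (itePol p q r) ⌊ x ⌋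
iteF-bnd t f g p q r x h k = *-monoʳ-≤ 20 (+-mono-≤ (+-monoʳ-≤ (⌊ x ⌋ + 1) h) k)

cost-∘hd : ∀ p q x y → cost p x ≤ eval q ⌊ x ⌋ → cost (p ∘F hdF) (x · y) ≤ eval (linPol ⊕ q) ⌊ x · y ⌋
cost-∘hd p q x y h = +-monoʳ-≤ (12 * ⌊ x · y ⌋ + 6)
  (≤-trans h (eval-mono q (≤-trans (m≤m+n ⌊ x ⌋ ⌊ y ⌋) (n≤1+n _))))

abstract
  -- A nonempty list has the same code as the pair of its head and tail, so the cons branch runs on
  -- the input unchanged, and the test only looks whether the second component is `nil`.
  pt-caseL : ∀ {E Y B z s} → PT E B z → PT (E ⊠ (Y ⊠ Li Y)) B s → PT (E ⊠ Li Y) B (caseL z s)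
  pt-caseL {E} {Y} {B} {z} {s} pz ps = mkPT (iteF tlF (fn ps) (fn pz ∘F hdF))
    (itePol linPol (pol ps) (linPol ⊕ pol pz)) eq bd
    where
    eq : ∀ a → ⟦ iteF tlF (fn ps) (fn pz ∘F hdF) ⟧ (cd (E ⊠ Li Y) a) ≡ cd B (caseL z s a)
    eq (e , [])     = sem pz e
    eq (e , x ∷ xs) = sem ps (e , x , xs)
    bd : ∀ a → cost (iteF tlF (fn ps) (fn pz ∘F hdF)) (cd (E ⊠ Li Y) a) ≤ eval (itePol linPol (pol ps) (linPol ⊕ pol pz)) (sz (E ⊠ Li Y) a)
    bd (e , [])     = iteF-bnd tlF (fn ps) (fn pz ∘F hdF) linPol (pol ps) (linPol ⊕ pol pz) (cd E e · nil) ≤-refl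
      (≤-trans (cost-∘hd (fn pz) (pol pz) (cd E e) nil (bnd pz e)) (m≤n+m _ (eval (pol ps) ⌊ cd E e · nil ⌋)))
    bd (e , x ∷ xs) = iteF-bnd tlF (fn ps) (fn pz ∘F hdF) linPol (pol ps) (linPol ⊕ pol pz) (cd E e · cd (Li Y) (x ∷ xs)) ≤-refl
      (≤-trans (bnd ps (e , x , xs)) (m≤m+n _ _))

  pt-caseM : ∀ {E Y B z s} → PT E B z → PT (E ⊠ Y) B s → PT (E ⊠ Ma Y) B (caseM z s)
  pt-caseM {E} {Y} {B} {z} {s} pz ps = mkPT (iteF tlF (fn ps ∘F ⟨ hdF , tlF ∘F tlF ⟩F) (fn pz ∘F hdF))
    (itePol linPol (pr ⊕ (pol ps ⊚ pr)) (linPol ⊕ pol pz)) eq bd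
    where
    pr : Pol
    pr = con 20 ⊗ (X ⊕ con 1 ⊕ linPol ⊕ (linPol ⊕ linPol))
    eq : ∀ a → ⟦ iteF tlF (fn ps ∘F ⟨ hdF , tlF ∘F tlF ⟩F) (fn pz ∘F hdF) ⟧ (cd (E ⊠ Ma Y) a) ≡ cd B (caseM z s a)
    eq (e , nothing) = sem pz e
    eq (e , just x)  = sem ps (e , x)
    bd : ∀ a → cost (iteF tlF (fn ps ∘F ⟨ hdF , tlF ∘F tlF ⟩F) (fn pz ∘F hdF)) (cd (E ⊠ Ma Y) a) ≤ eval (itePol linPol (pr ⊕ (pol ps ⊚ pr)) (linPol ⊕ pol pz)) (sz (E ⊠ Ma Y) a)
    bd (e , nothing) = iteF-bnd tlF (fn ps ∘F ⟨ hdF , tlF ∘F tlF ⟩F) (fn pz ∘F hdF) linPol (pr ⊕ (pol ps ⊚ pr)) (linPol ⊕ pol pz) (cd E e · nil) ≤-refl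
      (≤-trans (cost-∘hd (fn pz) (pol pz) (cd E e) nil (bnd pz e)) (m≤n+m _ (eval (pr ⊕ (pol ps ⊚ pr)) ⌊ cd E e · nil ⌋)))
    bd (e , just x) = iteF-bnd tlF (fn ps ∘F ⟨ hdF , tlF ∘F tlF ⟩F) (fn pz ∘F hdF) linPol (pr ⊕ (pol ps ⊚ pr)) (linPol ⊕ pol pz) d ≤-refl
      (≤-trans (+-mono-≤ prb (≤-trans (bnd ps (e , x)) (≤-trans (eval-mono (pol ps) (≤-trans (size≤cost ⟨ hdF , tlF ∘F tlF ⟩F d) prb))
          (≤-reflexive (sym (eval-⊚ (pol ps) pr ⌊ d ⌋)))))) (m≤m+n _ (eval (linPol ⊕ pol pz) ⌊ d ⌋)))
      where
      d : D
      d = cd E e · cd (Ma Y) (just x)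
      prb : cost ⟨ hdF , tlF ∘F tlF ⟩F d ≤ eval pr ⌊ d ⌋
      prb = *-monoʳ-≤ 20 (+-monoʳ-≤ (⌊ d ⌋ + 1 + (12 * ⌊ d ⌋ + 6)) (+-monoʳ-≤ (12 * ⌊ d ⌋ + 6)
        (+-monoˡ-≤ 6 (*-monoʳ-≤ 12 (≤-trans (m≤n+m _ (sz E e)) (n≤1+n _))))))

sz-tail : ∀ Y (ys tl : List (El Y)) → sz (Li Y) tl ≤ sz (Li Y) (ys ʳ++ tl)
sz-tail Y []       tl = ≤-refl
sz-tail Y (y ∷ ys) tl = ≤-trans (≤-trans (m≤n+m (sz (Li Y) tl) (sz Y y)) (n≤1+n _)) (sz-tail Y ys (y ∷ tl))

sz-ʳ++ : ∀ Y (ys tl : List (El Y)) → sz (Li Y) (ys ʳ++ tl) + 1 ≡ sz (Li Y) ys + sz (Li Y) tl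
sz-ʳ++ Y []       tl = +-comm (sz (Li Y) tl) 1
sz-ʳ++ Y (y ∷ ys) tl = trans (sz-ʳ++ Y ys (y ∷ tl)) (lem (sz (Li Y) ys) (sz Y y) (sz (Li Y) tl))
  where
  lem : ∀ a b c → a + suc (b + c) ≡ suc (b + a) + c
  lem = solve-∀

length≤sz : ∀ Y (ys : List (El Y)) → length ys ≤ sz (Li Y) ys
length≤sz Y []       = z≤n
length≤sz Y (y ∷ ys) = s≤s (≤-trans (length≤sz Y ys) (m≤n+m _ (sz Y y)))

revF : Fn
revF = foldF idF ∘F ⟨ idF , nilF ⟩F

rev-sem : ∀ Y (ys tl : List (El Y)) → foldD idF (cdL Y ys) (cdL Y tl) ≡ cdL Y (ys ʳ++ tl)
rev-sem Y []       tl = refl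
rev-sem Y (y ∷ ys) tl = rev-sem Y ys (y ∷ tl)

rev-cost : ∀ Y N (ys tl : List (El Y)) → sz (Li Y) ys + sz (Li Y) tl ≤ N →
  costFold idF (cdL Y ys) (cdL Y tl) ≤ length ys * (20 * (2 * N + 2)) + suc N
rev-cost Y N []       tl h = s≤s (≤-trans (n≤1+n _) h)
rev-cost Y N (y ∷ ys) tl h = ≤-trans
  (+-mono-≤ (*-monoʳ-≤ 20 {a + b + c + 1 + suc (a + c)} {2 * N + 2}
      (≤-trans (≤-by b (lem a b c)) (+-monoˡ-≤ 2 (*-monoʳ-≤ 2 (≤-trans (n≤1+n _) h)))))
    (rev-cost Y N ys (y ∷ tl) (≤-trans (≤-reflexive (lem₂ a b c)) h)))
  (≤-reflexive (sym (+-assoc (20 * (2 * N + 2)) _ _)))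
  where
  a b c : ℕ
  a = sz Y y
  b = sz (Li Y) ys
  c = sz (Li Y) tl
  lem : ∀ a b c → a + b + c + 1 + suc (a + c) + b ≡ 2 * (a + b + c) + 2
  lem = solve-∀
  lem₂ : ∀ a b c → b + suc (a + c) ≡ suc (a + b) + c
  lem₂ = solve-∀

abstract
  pt-reverse : ∀ {Y} → PT (Li Y) (Li Y) reverse
  pt-reverse {Y} = mkPT revF
    (con 20 ⊗ (X ⊕ con 1 ⊕ X ⊕ (con 5 ⊗ X ⊕ con 3)) ⊕ (con 1 ⊕ (X ⊗ (con 20 ⊗ (con 2 ⊗ (X ⊕ con 1) ⊕ con 2)) ⊕ (con 1 ⊕ (X ⊕ con 1)))))
    (λ ys → rev-sem Y ys [])
    (λ ys → +-monoʳ-≤ (20 * (sz (Li Y) ys + 1 + sz (Li Y) ys + (5 * sz (Li Y) ys + 3)))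
      (s≤s (≤-trans (rev-cost Y (sz (Li Y) ys + 1) ys [] ≤-refl) (+-monoˡ-≤ _ (*-monoˡ-≤ _ (length≤sz Y ys))))))

pt-cons : ∀ {A} → PT (A ⊠ Li A) (Li A) (λ p → proj₁ p ∷ proj₂ p)
pt-cons = pt-coe (λ _ → refl)

-- Primitive recursion on lists, executed as a left fold over the reversed list
-- that keeps the parameter, the processed suffix and the value at that suffix.
module ListRec (E Y B : Ty) (h : El E × List (El Y) → El B) {z : El E → El B} {s : El E × (El Y × (List (El Y) × El B)) → El B}
         (pz : PT E B z) (ps : PT (E ⊠ (Y ⊠ (Li Y ⊠ B))) B s)
         (h-nil : ∀ e → h (e , []) ≡ z e) (h-cons : ∀ e x xs → h (e , x ∷ xs) ≡ s (e , x , xs , h (e , xs)))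
         (q : Pol) (h-size : ∀ e xs → sz B (h (e , xs)) ≤ eval q (sz E e + sz (Li Y) xs)) where

  St′ : Ty
  St′ = E ⊠ (Li Y ⊠ B)

  pBody : PT (Y ⊠ St′) St′ (λ a → proj₁ (proj₂ a) , proj₁ a ∷ proj₁ (proj₂ (proj₂ a)) , s (proj₁ (proj₂ a) , proj₁ a , proj₂ (proj₂ a)))
  pBody = (pt-fst ∙ pt-snd) & (pt-cons ∙ (pt-fst & (pt-fst ∙ pt-snd ∙ pt-snd))) & (ps ∙ ((pt-fst ∙ pt-snd) & pt-fst & (pt-snd ∙ pt-snd)))

  acc : El E → List (El Y) → El St′
  acc e xs = e , xs , h (e , xs)

  body-sem : ∀ e y tl → ⟦ fn pBody ⟧ (cd (Y ⊠ St′) (y , acc e tl)) ≡ cd St′ (acc e (y ∷ tl))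
  body-sem e y tl = trans (sem pBody (y , acc e tl)) (cong (λ b → cd St′ (e , y ∷ tl , b)) (sym (h-cons e y tl)))

  fold-sem : ∀ e ys tl → foldD (fn pBody) (cdL Y ys) (cd St′ (acc e tl)) ≡ cd St′ (acc e (ys ʳ++ tl))
  fold-sem e []       tl = refl
  fold-sem e (y ∷ ys) tl = trans (cong (foldD (fn pBody) (cdL Y ys)) (body-sem e y tl)) (fold-sem e ys (y ∷ tl))

  accPol stepPol : Pol
  accPol  = con 2 ⊕ (X ⊕ q)
  stepPol = con 20 ⊗ (X ⊕ accPol ⊕ con 1 ⊕ (pol pBody ⊚ (con 1 ⊕ (X ⊕ accPol))))

  acc-size : ∀ n e tl → sz E e + sz (Li Y) tl ≤ n → sz St′ (acc e tl) ≤ eval accPol n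
  acc-size n e tl H = ≤-trans (≤-reflexive (lem (sz E e) (sz (Li Y) tl) (sz B (h (e , tl)))))
    (+-monoʳ-≤ 2 (+-mono-≤ H (≤-trans (h-size e tl) (eval-mono q H))))
    where
    lem : ∀ a b c → suc (a + suc (b + c)) ≡ 2 + (a + b + c)
    lem = solve-∀

  -- `n` bounds the parameter together with the complete list, hence with every processed suffix. By
  -- the size bound on values all rounds obey one cost bound, and their number is the length of the
  -- list.
  fold-cost : ∀ n e ys tl → sz E e + sz (Li Y) (ys ʳ++ tl) ≤ n →
    costFold (fn pBody) (cdL Y ys) (cd St′ (acc e tl)) ≤ length ys * eval stepPol n + suc (eval accPol n)
  fold-cost n e []       tl H = s≤s (acc-size n e tl H)
  fold-cost n e (y ∷ ys) tl H = ≤-trans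
    (+-mono-≤ (*-monoʳ-≤ 20 (+-mono-≤ (+-monoˡ-≤ 1 (+-mono-≤ bys bacc))
        (≤-trans (bnd pBody (y , acc e tl)) (≤-trans (eval-mono (pol pBody) (s≤s (+-mono-≤ by bacc)))
           (≤-reflexive (sym (eval-⊚ (pol pBody) (con 1 ⊕ (X ⊕ accPol)) n)))))))
      (≤-trans (≤-reflexive (cong (costFold (fn pBody) (cdL Y ys)) (body-sem e y tl)))
        (fold-cost n e ys (y ∷ tl) H)))
    (≤-reflexive (sym (+-assoc (eval stepPol n) _ _)))
    where
    tot : sz (Li Y) (y ∷ ys) + sz (Li Y) tl ≤ suc (sz (Li Y) ((y ∷ ys) ʳ++ tl))
    tot = ≤-reflexive (trans (sym (sz-ʳ++ Y (y ∷ ys) tl)) (+-comm _ 1))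
    bys : sz Y y + sz (Li Y) ys ≤ n
    bys = ≤-trans (≤-trans (m≤m+n _ (sz (Li Y) tl)) (s≤s⁻¹ tot)) (≤-trans (m≤n+m _ (sz E e)) H)
    by : sz Y y ≤ n
    by = ≤-trans (m≤m+n _ (sz (Li Y) ys)) bys
    bacc : sz St′ (acc e tl) ≤ eval accPol n
    bacc = acc-size n e tl (≤-trans (+-monoʳ-≤ (sz E e) (sz-tail Y (y ∷ ys) tl)) H)

  pInit : PT (E ⊠ Li Y) (Li Y ⊠ St′) (λ a → reverse (proj₂ a) , proj₁ a , [] , z (proj₁ a))
  pInit = (pt-reverse ∙ pt-snd) & pt-fst & pt-const [] & (pz ∙ pt-fst)

  rev-rev : ∀ (xs : List (El Y)) → reverse xs ʳ++ [] ≡ xs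
  rev-rev xs = trans (LP.ʳ++-defn (reverse xs)) (trans (LP.++-identityʳ _) (LP.reverse-involutive xs))

  init-eq : ∀ e xs → ⟦ fn pInit ⟧ (cd (E ⊠ Li Y) (e , xs)) ≡ cdL Y (reverse xs) · cd St′ (acc e [])
  init-eq e xs = trans (sem pInit (e , xs)) (cong (λ b → cdL Y (reverse xs) · (cd E e · (nil · cd B b))) (sym (h-nil e)))

  foldPol : Pol
  foldPol = con 1 ⊕ (X ⊗ stepPol ⊕ (con 1 ⊕ accPol))

  final : ∀ e xs → foldD (fn pBody) (cdL Y (reverse xs)) (cd St′ (acc e [])) ≡ cd St′ (acc e xs)
  final e xs = trans (fold-sem e (reverse xs) []) (cong (λ l → cd St′ (acc e l)) (rev-rev xs))

  fold-bnd : ∀ e xs → cost (foldF (fn pBody)) (cdL Y (reverse xs) · cd St′ (acc e [])) ≤ eval foldPol (sz (E ⊠ Li Y) (e , xs))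
  fold-bnd e xs = s≤s (≤-trans (fold-cost (sz (E ⊠ Li Y) (e , xs)) e (reverse xs) []
      (≤-trans (≤-reflexive (cong (λ l → sz E e + sz (Li Y) l) (rev-rev xs))) (n≤1+n _)))
    (+-monoˡ-≤ _ (*-monoˡ-≤ _ (≤-trans (≤-reflexive (LP.length-reverse xs)) (≤-trans (length≤sz Y xs) (≤-trans (m≤n+m _ (sz E e)) (n≤1+n _)))))))

  proj-bnd : ∀ e xs → cost (tlF ∘F tlF) (cd St′ (acc e xs)) ≤ eval ((linPol ⊚ accPol) ⊕ (linPol ⊚ accPol)) (sz (E ⊠ Li Y) (e , xs))
  proj-bnd e xs = +-mono-≤ (+-monoˡ-≤ 6 (*-monoʳ-≤ 12 b)) (+-monoˡ-≤ 6 (*-monoʳ-≤ 12 (≤-trans (≤-trans (m≤n+m _ (sz E e)) (n≤1+n _)) b)))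
    where
    b : sz St′ (acc e xs) ≤ eval accPol (sz (E ⊠ Li Y) (e , xs))
    b = acc-size (sz (E ⊠ Li Y) (e , xs)) e xs (n≤1+n _)

  abstract
    pt-rec : PT (E ⊠ Li Y) B h
    pt-rec = mkPT (((tlF ∘F tlF) ∘F foldF (fn pBody)) ∘F fn pInit)
      (pol pInit ⊕ (foldPol ⊕ ((linPol ⊚ accPol) ⊕ (linPol ⊚ accPol))))
      (λ { (e , xs) → trans (cong (λ d → tlD (tlD (⟦ foldF (fn pBody) ⟧ d))) (init-eq e xs)) (cong (λ d → tlD (tlD d)) (final e xs)) })
      (λ { (e , xs) → +-mono-≤ (bnd pInit (e , xs))
         (≤-trans (≤-reflexive (cong (cost ((tlF ∘F tlF) ∘F foldF (fn pBody))) (init-eq e xs)))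
           (+-mono-≤ (fold-bnd e xs) (≤-trans (≤-reflexive (cong (cost (tlF ∘F tlF)) (final e xs))) (proj-bnd e xs)))) })

open ListRec using (pt-rec) public

cdℕ-replicate : ∀ n → cdℕ n ≡ cdL Un (replicate n tt)
cdℕ-replicate zero    = refl
cdℕ-replicate (suc n) = cong (nil ·_) (cdℕ-replicate n)

cd-length⊤ : ∀ l → cdL Un l ≡ cdℕ (length l)
cd-length⊤ []      = refl
cd-length⊤ (_ ∷ l) = cong (nil ·_) (cd-length⊤ l)

abstract
  -- A number and the list of that many units have the same code, so recursion on numbers is list
  -- recursion over `Un`.
  pt-recℕ : ∀ E B (h : El E × ℕ → El B) {z : El E → El B} {s : El E × (ℕ × El B) → El B} →
    PT E B z → PT (E ⊠ (Nat ⊠ B)) B s → (∀ e → h (e , 0) ≡ z e) → (∀ e n → h (e , suc n) ≡ s (e , n , h (e , n))) →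
    (q : Pol) → (∀ e n → sz B (h (e , n)) ≤ eval q (sz E e + sz Nat n)) → PT (E ⊠ Nat) B h
  pt-recℕ E B h {z} {s} pz ps h0 hs q hq = mkPT (fn p) (pol p)
    (λ { (e , n) → trans (cong (λ d → ⟦ fn p ⟧ (cd E e · d)) (cdℕ-replicate n))
         (trans (sem p (e , replicate n tt)) (cong (λ k → cd B (h (e , k))) (LP.length-replicate n))) })
    (λ { (e , n) → subst (λ d → cost (fn p) (cd E e · d) ≤ eval (pol p) ⌊ cd E e · d ⌋) (sym (cdℕ-replicate n)) (bnd p (e , replicate n tt)) })
    where
    p : PT (E ⊠ Li Un) B (λ a → h (proj₁ a , length (proj₂ a)))
    p = pt-rec E Un B (λ a → h (proj₁ a , length (proj₂ a))) {z} {λ a → s (proj₁ a , length (proj₁ (proj₂ (proj₂ a))) , proj₂ (proj₂ (proj₂ a)))}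
      pz (ps ∙ (pt-fst & (pt-coe cd-length⊤ ∙ pt-fst ∙ pt-snd ∙ pt-snd) & (pt-snd ∙ pt-snd ∙ pt-snd)))
      h0 (λ e _ xs → hs e (length xs))
      q (λ e xs → ≤-trans (hq e (length xs)) (≤-reflexive (cong (λ d → eval q (sz E e + ⌊ d ⌋)) (sym (cd-length⊤ xs)))))

-- Bit strings between stack order and tree codes

loadBit : Bool → Cmd
loadBit false = pushC rA false ⨾ pushC rA true
loadBit true  = pushC rA false ⨾ pushC rA false ⨾ pushC rA true ⨾ pushC rA true

loadLoop load : Reg → Cmd
loadLoop r = each r (loadBit false) (loadBit true)
load r     = pushC rA false ⨾ loadLoop r

unloadBody unload : Cmd
unloadBody = popC rA skipC (pushC rI false) (popC rA skipC (popC rA skipC (pushC rI true) skipC) skipC)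
unload     = while rA unloadBody

module _ {r E} (S : Slot r E) where
  open Slot S

  loadLoop-spec : ∀ d u {a n} → Exec (loadLoop r) (E (ser (cdL Bo u) ++ a) d n) (5 * length d + 1) (E (ser (cdL Bo (d ʳ++ u)) ++ a) [] n)
  loadLoop-spec []          u = x-each∅ (getD _ _ _)
  loadLoop-spec (false ∷ d) u = x-weaken (≤-by 2 (lem (length d)))
    (x-each false (getD _ _ _) (setD _ _ _ _) (x-seq (x-pushA S false) (x-pushA S true)) (loadLoop-spec d (false ∷ u)))
    where
    lem : ∀ n → suc (2 + (5 * n + 1)) + 2 ≡ 5 * suc n + 1
    lem = solve-∀
  loadLoop-spec (true ∷ d) u = x-weaken (≤-reflexive (lem (length d)))
    (x-each true (getD _ _ _) (setD _ _ _ _)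
      (x-seq (x-pushA S false) (x-seq (x-pushA S false) (x-seq (x-pushA S true) (x-pushA S true)))) (loadLoop-spec d (true ∷ u)))
    where
    lem : ∀ n → suc (4 + (5 * n + 1)) ≡ 5 * suc n + 1
    lem = solve-∀

  -- A list code is built from its end, and the last input bit is the one on top, so the orders
  -- match. Each bit pushes the code of its cons cell back to front.
  load-spec : ∀ w {a n} → Exec (load r) (E a (reverse w) n) (5 * length w + 2) (E (ser (cdL Bo w) ++ a) [] n)
  load-spec w {a} {n} = x-weaken (≤-reflexive (trans (cong (λ k → 1 + (5 * k + 1)) (LP.length-reverse w)) (lem (length w))))
    (x-seq (x-pushA S false)
      (subst (λ l → Exec (loadLoop r) (E (false ∷ a) (reverse w) n) (5 * length (reverse w) + 1) (E (ser (cdL Bo l) ++ a) [] n))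
        (trans (LP.ʳ++-defn (reverse w)) (trans (LP.++-identityʳ _) (LP.reverse-involutive w))) (loadLoop-spec (reverse w) [])))
    where
    lem : ∀ n → 1 + (5 * n + 1) ≡ 5 * n + 2
    lem = solve-∀

unload-spec : ∀ w {a i} → Exec unload (env (ser (cdL Bo w) ++ a) [] [] [] i) (5 * length w + 1) (env a [] [] [] (w ʳ++ i))
unload-spec [] = x-exit refl refl
unload-spec (false ∷ w) = x-weaken (≤-by 2 (lem (length w)))
  (x-while refl refl (x-pop false refl refl (x-push refl)) (unload-spec w))
  where
  lem : ∀ n → suc (2 + (5 * n + 1)) + 2 ≡ 5 * suc n + 1
  lem = solve-∀
unload-spec (true ∷ w) = x-weaken (≤-reflexive (lem (length w)))
  (x-while refl refl (x-pop true refl refl (x-pop false refl refl (x-pop false refl refl (x-push refl)))) (unload-spec w))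
  where
  lem : ∀ n → suc (4 + (5 * n + 1)) ≡ 5 * suc n + 1
  lem = solve-∀

sz-bits : ∀ w → sz (Li Bo) w ≤ 4 * length w + 1
sz-bits []          = ≤-refl
sz-bits (false ∷ w) = ≤-trans (s≤s (s≤s (sz-bits w))) (≤-by 2 (lem (length w)))
  where
  lem : ∀ n → suc (suc (4 * n + 1)) + 2 ≡ 4 * suc n + 1
  lem = solve-∀
sz-bits (true ∷ w) = ≤-trans (s≤s (s≤s (s≤s (s≤s (sz-bits w))))) (≤-reflexive (lem (length w)))
  where
  lem : ∀ n → suc (suc (suc (suc (4 * n + 1)))) ≡ 4 * suc n + 1
  lem = solve-∀

bitsPol : Pol
bitsPol = con 4 ⊗ X ⊕ con 1

machinePol : Pol → Pol
machinePol p = con 1 ⊕ (con 1 ⊕ p) ⊗ (con 2 ⊗ (X ⊕ p) ⊕ con 5)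

PT⇒polytime : ∀ f → PT (Li Bo) (Li Bo) f → PolyTimeComputable f
PT⇒polytime f p = dtm , toPoly (machinePol tp ⊕ (X ⊕ tp)) , result
  where
  prog : Cmd
  prog = load rI ⨾ comp (fn p) ⨾ unload
  open Program prog
  tp : Pol
  tp = (con 5 ⊗ X ⊕ con 2) ⊕ ((pol p ⊚ bitsPol) ⊕ (con 5 ⊗ (pol p ⊚ bitsPol) ⊕ con 1))
  cost-bnd : ∀ w → cost (fn p) (cdL Bo w) ≤ eval (pol p ⊚ bitsPol) (length w)
  cost-bnd w = ≤-trans (bnd p w) (≤-trans (eval-mono (pol p) (sz-bits w)) (≤-reflexive (sym (eval-⊚ (pol p) bitsPol (length w)))))
  out-bnd : ∀ w → length (f w) ≤ eval (pol p ⊚ bitsPol) (length w)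
  out-bnd w = ≤-trans (length≤sz Bo (f w)) (≤-trans (size-bnd p w) (≤-trans (eval-mono (pol p) (sz-bits w)) (≤-reflexive (sym (eval-⊚ (pol p) bitsPol (length w))))))
  exec : ∀ w → Exec prog (initEnv w) (eval tp (length w)) (env [] [] [] [] (reverse (f w)))
  exec w = x-seq (load-spec (slotI [] []) w) (x-seq
    (x-weaken (cost-bnd w) (subst (λ d → Exec (comp (fn p)) (idle (ser (cdL Bo w) ++ [])) (cost (fn p) (cdL Bo w)) (idle (ser d ++ []))) (sem p w) (comp-spec (fn p) (cdL Bo w))))
    (x-weaken (+-monoˡ-≤ 1 (*-monoʳ-≤ 5 (out-bnd w))) (unload-spec (f w))))
  result : ∀ w → Σ ℕ λ t → (t ≤ evalPoly (toPoly (machinePol tp ⊕ (X ⊕ tp))) (length w)) ×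
    (Conf.state (DTMSem.run dtm t (DTMSem.initConf dtm w)) ≡ DTM.halt dtm) ×
    DTMSem.OutputIs dtm (Conf.tape (DTMSem.run dtm t (DTMSem.initConf dtm w))) (f w)
  result w = map₂ (map₁ (λ tb → ≤-trans tb (≤-reflexive (sym (toPoly-eval (machinePol tp ⊕ (X ⊕ tp)) (length w))))))
    (exec-dtm w (f w) (exec w) refl)

-- Elementary polynomial-time functions

sz-ℕ : ∀ n → sz Nat n ≡ 1 + 2 * n
sz-ℕ zero    = refl
sz-ℕ (suc n) = trans (cong (2 +_) (sz-ℕ n)) (lem n)
  where
  lem : ∀ n → 2 + (1 + 2 * n) ≡ 1 + 2 * suc n
  lem = solve-∀

n≤sz : ∀ n → n ≤ sz Nat n
n≤sz n = ≤-trans (≤-by (1 + n) (lem n)) (≤-reflexive (sym (sz-ℕ n)))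
  where
  lem : ∀ n → n + (1 + n) ≡ 1 + 2 * n
  lem = solve-∀

pt-suc : PT Nat Nat suc
pt-suc = pt-coe {Un ⊠ Nat} {f = λ p → suc (proj₂ p)} (λ _ → refl) ∙ (pt-const tt & pt-id)

abstract
  pt-pred : PT Nat Nat pred
  pt-pred = mkPT tlF linPol (λ { zero → refl ; (suc _) → refl }) (λ _ → ≤-refl)

pt-plus : PT (Nat ⊠ Nat) Nat (λ p → proj₁ p + proj₂ p)
pt-plus = pt-recℕ Nat Nat (λ p → proj₁ p + proj₂ p) pt-id (pt-suc ∙ pt-snd ∙ pt-snd) +-identityʳ +-suc X sizes
  where
  lem : ∀ m n → 1 + 2 * (m + n) + 1 ≡ 1 + 2 * m + (1 + 2 * n)
  lem = solve-∀
  sizes : ∀ m n → sz Nat (m + n) ≤ sz Nat m + sz Nat n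
  sizes m n rewrite sz-ℕ (m + n) | sz-ℕ m | sz-ℕ n = ≤-by 1 (lem m n)

pt-times : PT (Nat ⊠ Nat) Nat (λ p → proj₁ p * proj₂ p)
pt-times = pt-recℕ Nat Nat (λ p → proj₁ p * proj₂ p) (pt-const 0) (pt-plus ∙ (pt-fst & (pt-snd ∙ pt-snd))) *-zeroʳ *-suc (X ⊗ X) sizes
  where
  lem : ∀ m n → 1 + 2 * (m * n) + (2 * (m * n) + 2 * m + 2 * n) ≡ (1 + 2 * m) * (1 + 2 * n)
  lem = solve-∀
  sizes : ∀ m n → sz Nat (m * n) ≤ (sz Nat m + sz Nat n) * (sz Nat m + sz Nat n)
  sizes m n = ≤-trans (≤-reflexive (sz-ℕ (m * n))) (≤-trans (≤-by (2 * (m * n) + 2 * m + 2 * n) (lem m n))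
    (*-mono-≤ (≤-trans (≤-reflexive (sym (sz-ℕ m))) (m≤m+n (sz Nat m) (sz Nat n)))
              (≤-trans (≤-reflexive (sym (sz-ℕ n))) (m≤n+m (sz Nat n) (sz Nat m)))))

_+P_ : ∀ {A f g} → PT A Nat f → PT A Nat g → PT A Nat (λ a → f a + g a)
p +P q = pt-plus ∙ (p & q)

_*P_ : ∀ {A f g} → PT A Nat f → PT A Nat g → PT A Nat (λ a → f a * g a)
p *P q = pt-times ∙ (p & q)

pt-eval : ∀ p → PT Nat Nat (eval p)
pt-eval X       = pt-id
pt-eval (con c) = pt-const c
pt-eval (p ⊕ q) = pt-eval p +P pt-eval q
pt-eval (p ⊗ q) = pt-eval p *P pt-eval q

sz-++ : ∀ A (xs ys : List (El A)) → sz (Li A) (xs ++ ys) + 1 ≡ sz (Li A) xs + sz (Li A) ys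
sz-++ A []       ys = +-comm _ 1
sz-++ A (x ∷ xs) ys = trans (lem (sz A x) (sz (Li A) (xs ++ ys))) (trans (cong (λ k → suc (sz A x + k)) (sz-++ A xs ys)) (lem₂ (sz A x) (sz (Li A) xs) (sz (Li A) ys)))
  where
  lem : ∀ x m → suc (x + m) + 1 ≡ suc (x + (m + 1))
  lem = solve-∀
  lem₂ : ∀ x a b → suc (x + (a + b)) ≡ suc (x + a) + b
  lem₂ = solve-∀

pt-append : ∀ {A} → PT (Li A ⊠ Li A) (Li A) (λ p → proj₁ p ++ proj₂ p)
pt-append {A} = pt-rec (Li A) A (Li A) (λ p → proj₂ p ++ proj₁ p) pt-id
    (pt-cons ∙ ((pt-fst ∙ pt-snd) & (pt-snd ∙ pt-snd ∙ pt-snd)))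
    (λ _ → refl) (λ _ _ _ → refl) X
    (λ ys xs → ≤-trans (≤-by 1 (sz-++ A xs ys)) (≤-reflexive (+-comm (sz (Li A) xs) _)))
  ∙ (pt-snd & pt-fst)

_++P_ : ∀ {A B f g} → PT A (Li B) f → PT A (Li B) g → PT A (Li B) (λ a → f a ++ g a)
p ++P q = pt-append ∙ (p & q)

infixr 5 _++P_ _∷P_
infixl 6 _+P_
infixl 7 _*P_

_∷P_ : ∀ {A B f g} → PT A B f → PT A (Li B) g → PT A (Li B) (λ a → f a ∷ g a)
p ∷P q = pt-cons ∙ (p & q)

pt-length : ∀ {A} → PT (Li A) Nat length
pt-length {A} = pt-rec Un A Nat (λ p → length (proj₂ p)) (pt-const 0) (pt-suc ∙ pt-snd ∙ pt-snd ∙ pt-snd)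
    (λ _ → refl) (λ _ _ _ → refl) (con 1 ⊕ con 2 ⊗ X) sizes
  ∙ (pt-const tt & pt-id)
  where
  sizes : ∀ e xs → sz Nat (length xs) ≤ 1 + 2 * (1 + sz (Li A) xs)
  sizes e xs rewrite sz-ℕ (length xs) = +-monoʳ-≤ 1 (*-monoʳ-≤ 2 (≤-trans (length≤sz A xs) (n≤1+n _)))

sz-replicate : ∀ A (x : El A) n → sz (Li A) (replicate n x) ≡ 1 + n * suc (sz A x)
sz-replicate A x zero    = refl
sz-replicate A x (suc n) = cong suc (trans (cong (sz A x +_) (sz-replicate A x n)) (+-suc (sz A x) (n * suc (sz A x))))

pt-replicate : ∀ {A} → PT (A ⊠ Nat) (Li A) (λ p → replicate (proj₂ p) (proj₁ p))
pt-replicate {A} = pt-recℕ A (Li A) (λ p → replicate (proj₂ p) (proj₁ p)) (pt-const []) (pt-fst ∷P (pt-snd ∙ pt-snd))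
    (λ _ → refl) (λ _ _ → refl) (con 1 ⊕ X ⊗ (con 1 ⊕ X)) sizes
  where
  sizes : ∀ x n → sz (Li A) (replicate n x) ≤ 1 + (sz A x + sz Nat n) * (1 + (sz A x + sz Nat n))
  sizes x n rewrite sz-replicate A x n =
    s≤s (*-mono-≤ (≤-trans (n≤sz n) (m≤n+m _ (sz A x))) (s≤s (m≤m+n (sz A x) _)))

pt-unary : PT Nat (Li Bo) unary
pt-unary = (pt-replicate ∙ (pt-const true & pt-id)) ++P pt-const (false ∷ [])

-- The machine of the reduction

sumFin : ∀ n → (Fin n → ℕ) → ℕ
sumFin zero    f = 0
sumFin (suc n) f = f zero + sumFin n (f ∘ suc)

≤sumFin : ∀ {n} (f : Fin n → ℕ) i → f i ≤ sumFin n f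
≤sumFin f zero    = m≤m+n _ _
≤sumFin f (suc i) = ≤-trans (≤sumFin (f ∘ suc) i) (m≤n+m _ (f zero))

-- Saturates at the last block; the alternation budget keeps the simulation from advancing beyond
-- it.
nextB : ∀ {n} → Fin (suc n) → Fin (suc n)
nextB {zero}  i       = i
nextB {suc n} zero    = suc zero
nextB {suc n} (suc i) = suc (nextB i)

toℕ-nextB : ∀ {n} (i : Fin (suc n)) → toℕ i < n → toℕ (nextB i) ≡ suc (toℕ i)
toℕ-nextB {suc n} zero    h       = refl
toℕ-nextB {suc n} (suc i) (s≤s h) = cong suc (toℕ-nextB i h)

qpar : ℕ → Quant
qpar zero    = exQ
qpar (suc n) = negQ (qpar n)

-- Total in the index: past the end it returns the last entry. Every symbol on a choice tape
-- therefore names a legal successor, and a universally quantified word cannot contain an illegal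
-- choice.
pick : ∀ {A : Set} → A → List A → ℕ → A
pick x ys       zero    = x
pick x []       (suc i) = x
pick x (y ∷ ys) (suc i) = pick y ys i

dirOf : Move → Dir
dirOf left  = minus1
dirOf right = plus1

sameQ-true : ∀ {q κ} → sameQ q κ ≡ true → κ ≡ q
sameQ-true {exQ}  {exQ}  _ = refl
sameQ-true {allQ} {allQ} _ = refl

sameQ-false : ∀ {q κ} → sameQ q κ ≡ false → κ ≡ negQ q
sameQ-false {exQ}  {allQ} _ = refl
sameQ-false {allQ} {exQ}  _ = refl

pick-All : ∀ {A : Set} {Pr : A → Set} {x ys} → All Pr (x ∷ ys) → ∀ n → Pr (pick x ys n)
pick-All (p ∷ ps)      zero    = p
pick-All (p ∷ [])      (suc n) = p
pick-All (p ∷ p' ∷ ps) (suc n) = pick-All (p' ∷ ps) n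

module Hard (M : ATM) (j' : ℕ) where
  open ATM M renaming (g to gM; s to sM; init to qM; δ to δM)

  -- Cells of the work tape.  A cell of M carries a flag for the head of M; sent marks position 0.
  data WSym : Set where
    sent clk : WSym
    cell     : Bool → Sym gM → WSym

  abstract
    finW : Finite WSym
    finW = fin-retract to from (λ { sent → refl ; clk → refl ; (cell _ _) → refl }) (fin-⊎ fin-Bool (fin-× fin-Bool (fin-Fin (3 + gM))))
      where
      to : WSym → Bool ⊎ (Bool × Sym gM)
      to sent       = inj₁ false
      to clk        = inj₁ true
      to (cell b a) = inj₂ (b , a)
      from : Bool ⊎ (Bool × Sym gM) → WSym
      from (inj₁ false)   = sent
      from (inj₁ true)    = clk
      from (inj₂ (b , a)) = cell b a

  -- The alphabet is large enough to index the transitions available in any situation.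
  branching σW : ℕ
  branching = sumFin sM (λ q → sumFin (3 + gM) (λ a → length (δM q a)))
  σW        = size finW + branching

  Symb : Set
  Symb = Fin (suc σW)

  symW : WSym → Symb
  symW w = suc (enc finW w ↑ˡ branching)

  -- Symbols that code nothing are read as `clk`. Such readings are harmless, because the simulation
  -- invariant speaks of the initialised prefix of the work tape only.
  viewW : Symb → WSym
  viewW zero    = clk
  viewW (suc i) = [ dec finW , (λ _ → clk) ] (splitAt (size finW) i)

  viewW-symW : ∀ w → viewW (symW w) ≡ w
  viewW-symW w = trans (cong [ dec finW , (λ _ → clk) ] (FP.splitAt-↑ˡ (size finW) (enc finW w) branching)) (dec-enc finW w)

  Blk : Set
  Blk = Fin (suc j')

  -- One step of M: fwd walks right to the clock, rd reads the choice there, got and ext advance the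
  -- clock, seek walks left to the head of M and executes the step, put marks the new head position.
  data Main : Set where
    accM rejM : Main
    two       : Fin 3 → Fin sM → Blk → Main
    three     : Fin 3 → Fin sM → Blk → Symb → Main

  pattern fwd  q i   = two zero q i
  pattern rd   q i   = two (suc zero) q i
  pattern put  q i   = two (suc (suc zero)) q i
  pattern got  q i c = three zero q i c
  pattern ext  q i c = three (suc zero) q i c
  pattern seek q i c = three (suc (suc zero)) q i c

  abstract
    finMain : Finite Main
    finMain = fin-retract to from
      (λ { accM → refl ; rejM → refl ; (two _ _ _) → refl ; (three _ _ _ _) → refl })
      (fin-⊎ fin-Bool (fin-⊎ (fin-× (fin-Fin 3) (fin-× (fin-Fin sM) (fin-Fin (suc j'))))
                             (fin-× (fin-Fin 3) (fin-× (fin-Fin sM) (fin-× (fin-Fin (suc j')) (fin-Fin (suc σW)))))))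
      where
      Code : Set
      Code = Bool ⊎ ((Fin 3 × (Fin sM × Blk)) ⊎ (Fin 3 × (Fin sM × (Blk × Symb))))
      to : Main → Code
      to accM            = inj₁ true
      to rejM            = inj₁ false
      to (two t q i)     = inj₂ (inj₁ (t , q , i))
      to (three t q i c) = inj₂ (inj₂ (t , q , i , c))
      from : Code → Main
      from (inj₁ true)                   = accM
      from (inj₁ false)                  = rejM
      from (inj₂ (inj₁ (t , q , i)))     = two t q i
      from (inj₂ (inj₂ (t , q , i , c))) = three t q i c

  Tape : Set
  Tape = Fin (suc (suc j'))

  WT : Tape
  WT = F.fromℕ (suc j')

  blkT : Blk → Tape
  blkT = F.inject₁

  Act : Set → Set → Set
  Act S τ = (S × Symb × Dir) ⊎ (S × τ)

  -- The parity of a block number is its mode, so comparing it with the kind of the present state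
  -- detects an alternation.
  blockOf : Blk → Quant → Blk
  blockOf i κ = if sameQ (qpar (toℕ i)) κ then i else nextB i

  -- All tapes share one head: switching tapes at the clock keeps the position, so the cell reached
  -- on the choice tape has the clock position as its address.
  clkδ : Fin sM → Blk → Kind → Act Main Tape
  clkδ q i accK      = inj₂ (accM , WT)
  clkδ q i rejK      = inj₂ (rejM , WT)
  clkδ q i (quant κ) = inj₂ (rd q (blockOf i κ) , blkT (blockOf i κ))

  fwdδ : Fin sM → Blk → Symb → WSym → Act Main Tape
  fwdδ q i a clk        = clkδ q i (kind q)
  fwdδ q i a sent       = inj₁ (fwd q i , a , plus1)
  fwdδ q i a (cell _ _) = inj₁ (fwd q i , a , plus1)

  -- Without successors an existential state rejects and a universal one accepts, as `Any` and `All`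
  -- of the empty list do.
  stuckδ : Kind → Act Main Tape
  stuckδ (quant allQ) = inj₂ (accM , WT)
  stuckδ _            = inj₂ (rejM , WT)

  moveδ : Blk → Fin sM × Sym gM × Move → Act Main Tape
  moveδ i (q' , b , mv) = inj₁ (put q' i , symW (cell false b) , dirOf mv)

  headδ : Fin sM → Blk → Symb → List (Fin sM × Sym gM × Move) → Act Main Tape
  headδ q i c []       = stuckδ (kind q)
  headδ q i c (m ∷ ms) = moveδ i (pick m ms (toℕ c))

  seekδ : Fin sM → Blk → Symb → Symb → WSym → Act Main Tape
  seekδ q i c a (cell true y) = headδ q i c (δM q y)
  seekδ q i c a _             = inj₁ (seek q i c , a , minus1)

  -- On the sentinel, `put` moves right once more. This is how a left move of `M` in cell 0 ends in
  -- cell 0.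
  putδ : Fin sM → Blk → Symb → WSym → Act Main Tape
  putδ q i a (cell _ y) = inj₁ (fwd q i , symW (cell true y) , plus1)
  putδ q i a _          = inj₁ (put q i , a , plus1)

  mainδ : Main → Symb → Act Main Tape
  mainδ accM         a = inj₂ (accM , zero)
  mainδ rejM         a = inj₂ (rejM , zero)
  mainδ (fwd q i)    a = fwdδ q i a (viewW a)
  mainδ (rd q i)     a = inj₂ (got q i a , WT)
  mainδ (put q i)    a = putδ q i a (viewW a)
  mainδ (got q i c)  a = inj₁ (ext q i c , symW (cell false zero) , plus1)
  mainδ (ext q i c)  a = inj₁ (seek q i c , symW clk , minus1)
  mainδ (seek q i c) a = seekδ q i c a (viewW a)

  -- The outcome of M when its choices are read from ch: row 0 of ch serves the current
  -- quantifier block, and the rows shift by one at an alternation.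
  mutual
    play : ℕ → Quant → (ℕ → ℕ → Symb) → ℕ → Conf gM sM → Bool
    play t q ch n c = playK t q ch n c (kind (Conf.state c))

    playK : ℕ → Quant → (ℕ → ℕ → Symb) → ℕ → Conf gM sM → Kind → Bool
    playK t q ch n c accK = true
    playK t q ch n c rejK = false
    playK t q ch n c (quant κ) with sameQ q κ
    ... | true  = playB t κ ch n c
    ... | false = playB t κ (ch ∘ suc) n c

    playB : ℕ → Quant → (ℕ → ℕ → Symb) → ℕ → Conf gM sM → Bool
    playB zero    κ ch n c = false
    playB (suc t) κ ch n c = playS t κ ch n c (δM (Conf.state c) (Conf.tape c (Conf.hd c)))

    playS : ℕ → Quant → (ℕ → ℕ → Symb) → ℕ → Conf gM sM → List (Fin sM × Sym gM × Move) → Bool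
    playS t exQ  ch n c []       = false
    playS t allQ ch n c []       = true
    playS t κ    ch n c (m ∷ ms) = play t κ ch (suc n) (applyMove (pick m ms (toℕ (ch 0 n))) c)

  -- The choice at clock position `n` is read in column `n`, and columns only increase, so `play`
  -- ignores the columns before `n`. This allows a past column to be overwritten.
  play-ext : ∀ t q ch ch' n c → (∀ b p → n ≤ p → ch b p ≡ ch' b p) → play t q ch n c ≡ play t q ch' n c
  playK-ext : ∀ t q ch ch' n c k → (∀ b p → n ≤ p → ch b p ≡ ch' b p) → playK t q ch n c k ≡ playK t q ch' n c k
  playB-ext : ∀ t q ch ch' n c → (∀ b p → n ≤ p → ch b p ≡ ch' b p) → playB t q ch n c ≡ playB t q ch' n c
  playS-ext : ∀ t q ch ch' n c l → (∀ b p → n ≤ p → ch b p ≡ ch' b p) → playS t q ch n c l ≡ playS t q ch' n c l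
  play-ext t q ch ch' n c e = playK-ext t q ch ch' n c (kind (Conf.state c)) e
  playK-ext t q ch ch' n c accK      e = refl
  playK-ext t q ch ch' n c rejK      e = refl
  playK-ext t q ch ch' n c (quant κ) e with sameQ q κ
  ... | true  = playB-ext t κ ch ch' n c e
  ... | false = playB-ext t κ (ch ∘ suc) (ch' ∘ suc) n c (λ b → e (suc b))
  playB-ext zero    q ch ch' n c e = refl
  playB-ext (suc t) q ch ch' n c e = playS-ext t q ch ch' n c _ e
  playS-ext t exQ  ch ch' n c []       e = refl
  playS-ext t allQ ch ch' n c []       e = refl
  playS-ext t exQ  ch ch' n c (m ∷ ms) e rewrite e 0 n ≤-refl = play-ext t exQ ch ch' (suc n) _ (λ b p h → e b p (<⇒≤ h))
  playS-ext t allQ ch ch' n c (m ∷ ms) e rewrite e 0 n ≤-refl = play-ext t allQ ch ch' (suc n) _ (λ b p h → e b p (<⇒≤ h))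

  move-play : ∀ κ t ch n c m ms → playS t κ ch n c (m ∷ ms) ≡ play t κ ch (suc n) (applyMove (pick m ms (toℕ (ch 0 n))) c)
  move-play exQ  t ch n c m ms = refl
  move-play allQ t ch n c m ms = refl

  open ATMSem M using (Acc; Halts; AltOK; AltCont)

  Halts-inv : ∀ {t c κ} → kind (Conf.state c) ≡ quant κ → Halts (suc t) c → All (λ m → Halts t (applyMove m c)) (δM (Conf.state c) (Conf.tape c (Conf.hd c)))
  Halts-inv e h rewrite e = h

  -- The multi-tape machine with a given word wired in

  module Loaded (P : List WSym) (x : ℕ) where

    m : ℕ
    m = length P

    S : Set
    S = Main ⊎ (⊤ ⊎ (Fin m ⊎ ⊤))

    finS : Finite S
    finS = fin-⊎ finMain (fin-⊎ fin-⊤ (fin-⊎ (fin-Fin m) fin-⊤))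

    -- Choice tapes, then the work tape, then `x` padding tapes. With the padding last, the numbers
    -- of the other tapes do not depend on `x`.
    τ : Set
    τ = Fin (suc (suc j') + x)

    tp : Tape → τ
    tp i = i ↑ˡ x

    back initS : S
    back  = inj₂ (inj₁ tt)
    initS = inj₂ (inj₂ (inj₂ tt))

    -- chain r is the state with r symbols left to write.
    chain : ∀ {m} → Fin (suc m) → ⊤ ⊎ (Fin m ⊎ ⊤)
    chain zero    = inj₁ tt
    chain (suc i) = inj₂ (inj₁ i)

    -- Chain states count the symbols still to be written, hence `bot`, which indexes a list from
    -- its end. The rows of the table then arise by recursion on the word, as `chainRows` does.
    chainSym : ℕ → WSym
    chainSym r = maybe id clk (bot P r)

    liftA : Act Main Tape → Act S τ
    liftA (inj₁ (q , b , d)) = inj₁ (inj₁ q , b , d)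
    liftA (inj₂ (q , i))     = inj₂ (inj₁ q , tp i)

    δ' : S → Symb → Act S τ
    δ' (inj₁ q)                a = liftA (mainδ q a)
    δ' (inj₂ (inj₁ _))         a = inj₁ (inj₁ (fwd qM zero) , a , minus1)
    δ' (inj₂ (inj₂ (inj₁ i)))  a = inj₁ (inj₂ (chain (F.inject₁ i)) , symW (chainSym (toℕ i)) , plus1)
    δ' (inj₂ (inj₂ (inj₂ _)))  a = inj₂ (inj₂ (chain (F.fromℕ m)) , tp WT)

    encAct : Act S τ → Action (suc (suc j') + x) (suc σW) (size finS)
    encAct (inj₁ (q , b , d)) = write (enc finS q) b d
    encAct (inj₂ (q , i))     = switch (enc finS q) i

    T : NDTM (suc (suc j') + x)
    T = record { σ' = σW ; s = size finS ; qinit = enc finS initS ; qacc = enc finS (inj₁ accM)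
               ; qrej = enc finS (inj₁ rejM) ; δ = λ q a → encAct (δ' (dec finS q) a) }

    open NSem T

    δ-stay : ∀ q a → mainδ q a ≡ inj₂ (q , zero) → NDTM.δ T (enc finS (inj₁ q)) a ≡ switch (enc finS (inj₁ q)) zero
    δ-stay q a e = trans (cong (λ z → encAct (δ' z a)) (dec-enc finS (inj₁ q))) (cong (λ z → encAct (liftA z)) e)

    Tapes : Set
    Tapes = τ → ℕ → Symb

    pc : S → τ → ℕ → Tapes → PConf
    pc q = pconf (enc finS q)

    next : Act S τ → τ → ℕ → Tapes → PConf
    next (inj₂ (q , i))          t k       ts = pc q i k ts
    next (inj₁ (q , b , plus1))  t k       ts = pc q t (suc k) (upd ts t k b)
    next (inj₁ (q , b , minus1)) t zero    ts = pc (inj₁ rejM) zero 0 ts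
    next (inj₁ (q , b , minus1)) t (suc k) ts = pc q t k (upd ts t (suc k) b)

    stepN-pc : ∀ q t k ts {a} → δ' q (ts t k) ≡ a → stepN (pc q t k ts) ≡ next a t k ts
    stepN-pc q t k ts refl rewrite dec-enc finS q with δ' q (ts t k)
    ... | inj₂ (q' , i) = refl
    ... | inj₁ (q' , b , plus1) = refl
    ... | inj₁ (q' , b , minus1) with k
    ...   | zero  = refl
    ...   | suc _ = refl

    iter-+ : ∀ a b c → iter (a + b) c ≡ iter b (iter a c)
    iter-+ zero    b c = refl
    iter-+ (suc a) b c = iter-+ a b (stepN c)

    module Simulation (ts₀ : Tapes) where

      -- The work tape is described up to `n` only: beyond lies its initial content, which is
      -- quantified and so arbitrary. The choice tapes are never written.
      TapeOK : Tapes → (ℕ → WSym) → ℕ → Set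
      TapeOK ts cs n = (∀ p → p ≤ n → viewW (ts (tp WT) p) ≡ cs p) × (∀ i p → ts (tp (blkT i)) p ≡ ts₀ (tp (blkT i)) p)

      WT≢blk : ∀ i → tp (blkT i) ≢ tp WT
      WT≢blk i e = FP.fromℕ≢inject₁ (sym (FP.↑ˡ-injective x (blkT i) WT e))

      upd-same : ∀ ts t k b → upd ts t k b t k ≡ b
      upd-same ts t k b = cong (λ z → if z then b else ts t k) (cong₂ _∧_ (dec-true (t F.≟ t) refl) (dec-true (k ≟ k) refl))

      upd-pos : ∀ ts t k b {p} → p ≢ k → upd ts t k b t p ≡ ts t p
      upd-pos ts t k b {p} ne = cong (λ z → if z then b else ts t p)
        (trans (cong (does (t F.≟ t) ∧_) (dec-false (p ≟ k) ne)) (∧-false (does (t F.≟ t))))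
        where
        ∧-false : ∀ b → b ∧ false ≡ false
        ∧-false true  = refl
        ∧-false false = refl

      upd-tape : ∀ ts t k b {t' p} → t' ≢ t → upd ts t k b t' p ≡ ts t' p
      upd-tape ts t k b {t'} {p} ne = cong (λ z → if z then b else ts t' p)
        (cong (_∧ does (p ≟ k)) (dec-false (t' F.≟ t) ne))

      tape-write : ∀ ts {cs n cs' n'} k b → TapeOK ts cs n → viewW b ≡ cs' k →
        (∀ p → p ≤ n' → p ≢ k → p ≤ n × cs p ≡ cs' p) → TapeOK (upd ts (tp WT) k b) cs' n'
      tape-write ts {cs} {n} {cs'} {n'} k b (w , bl) e same = on-work , (λ i p → trans (upd-tape ts (tp WT) k b (WT≢blk i)) (bl i p))
        where
        on-work : ∀ p → p ≤ n' → viewW (upd ts (tp WT) k b (tp WT) p) ≡ cs' p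
        on-work p h with p ≟ k
        ... | yes refl = trans (cong viewW (upd-same ts (tp WT) k b)) e
        ... | no  ne   = trans (cong viewW (upd-pos ts (tp WT) k b ne)) (trans (w p (proj₁ (same p h ne))) (proj₂ (same p h ne)))

      tape-rewrite : ∀ ts {cs n} k → TapeOK ts cs n → TapeOK (upd ts (tp WT) k (ts (tp WT) k)) cs n
      tape-rewrite ts {cs} {n} k (w , bl) = on-work , (λ i p → trans (upd-tape ts (tp WT) k _ (WT≢blk i)) (bl i p))
        where
        on-work : ∀ p → p ≤ n → viewW (upd ts (tp WT) k (ts (tp WT) k) (tp WT) p) ≡ cs p
        on-work p h with p ≟ k
        ... | yes refl = trans (cong viewW (upd-same ts (tp WT) k _)) (w p h)
        ... | no  ne   = trans (cong viewW (upd-pos ts (tp WT) k _ ne)) (w p h)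

      data Arrives (n : ℕ) (q : S) (t : τ) (k : ℕ) (ts : Tapes) (q' : S) (t' : τ) (k' : ℕ) (cs : ℕ → WSym) (L : ℕ) : Set where
        arr : ∀ r ts' → r ≤ n → iter r (pc q t k ts) ≡ pc q' t' k' ts' → TapeOK ts' cs L → Arrives n q t k ts q' t' k' cs L

      arrive-via : ∀ {a b q₀ t₀ k₀ ts₁ q t k cs L q' t' k' cs' L'} → Arrives a q₀ t₀ k₀ ts₁ q t k cs L →
        (∀ {ts} → TapeOK ts cs L → Arrives b q t k ts q' t' k' cs' L') → Arrives (a + b) q₀ t₀ k₀ ts₁ q' t' k' cs' L'
      arrive-via {q₀ = q₀} {t₀} {k₀} {ts₁} (arr r ts ra R ok) f with f ok
      ... | arr r' ts' rb R' ok' = arr (r + r') ts' (+-mono-≤ ra rb) (trans (iter-+ r r' (pc q₀ t₀ k₀ ts₁)) (trans (cong (iter r') R) R')) ok'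

      arrive-weaken : ∀ {a b q₀ t₀ k₀ ts₁ q t k cs L} → a ≤ b → Arrives a q₀ t₀ k₀ ts₁ q t k cs L → Arrives b q₀ t₀ k₀ ts₁ q t k cs L
      arrive-weaken h (arr r ts ra R ok) = arr r ts (≤-trans ra h) R ok

      once-switch : ∀ {q t k ts q' t' cs L} → δ' q (ts t k) ≡ inj₂ (q' , t') → TapeOK ts cs L → Arrives 1 q t k ts q' t' k cs L
      once-switch {q} {t} {k} {ts} e ok = arr 1 ts ≤-refl (stepN-pc q t k ts e) ok

      once-right : ∀ {q t k ts q' b cs L} → δ' q (ts t k) ≡ inj₁ (q' , b , plus1) → TapeOK (upd ts t k b) cs L → Arrives 1 q t k ts q' t (suc k) cs L
      once-right {q} {t} {k} {ts} {b = b} e ok = arr 1 (upd ts t k b) ≤-refl (stepN-pc q t k ts e) ok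

      once-left : ∀ {q t k ts q' b cs L} → δ' q (ts t (suc k)) ≡ inj₁ (q' , b , minus1) → TapeOK (upd ts t (suc k) b) cs L → Arrives 1 q t (suc k) ts q' t k cs L
      once-left {q} {t} {k} {ts} {b = b} e ok = arr 1 (upd ts t (suc k) b) ≤-refl (stepN-pc q t (suc k) ts e) ok

      walk-right : ∀ q cs L d k ts → (∀ a p → k ≤ p → p < k + d → viewW a ≡ cs p → mainδ q a ≡ inj₁ (q , a , plus1)) →
        k + d ≤ suc L → TapeOK ts cs L → Arrives d (inj₁ q) (tp WT) k ts (inj₁ q) (tp WT) (k + d) cs L
      walk-right q cs L zero k ts f h ok = arr 0 ts z≤n (cong (λ z → pc (inj₁ q) (tp WT) z ts) (sym (+-identityʳ k))) ok
      walk-right q cs L (suc d) k ts f h ok = subst (λ z → Arrives (suc d) (inj₁ q) (tp WT) k ts (inj₁ q) (tp WT) z cs L) (sym (+-suc k d))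
        (arrive-via (once-right (cong liftA (f _ k ≤-refl (≤-trans (s≤s (m≤m+n k d)) (≤-reflexive (sym (+-suc k d)))) (proj₁ ok k kL))) (tape-rewrite ts k ok))
          (walk-right q cs L d (suc k) _ (λ a p lo hi → f a p (<⇒≤ lo) (≤-trans hi (≤-reflexive (sym (+-suc k d))))) (≤-trans (≤-reflexive (sym (+-suc k d))) h)))
        where
        kL : k ≤ L
        kL = s≤s⁻¹ (≤-trans (≤-trans (s≤s (m≤m+n k d)) (≤-reflexive (sym (+-suc k d)))) h)

      walk-left : ∀ q cs L d k ts → (∀ a p → k < p → p ≤ k + d → viewW a ≡ cs p → mainδ q a ≡ inj₁ (q , a , minus1)) →
        k + d ≤ L → TapeOK ts cs L → Arrives d (inj₁ q) (tp WT) (k + d) ts (inj₁ q) (tp WT) k cs L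
      walk-left q cs L zero k ts f h ok = arr 0 ts z≤n (cong (λ z → pc (inj₁ q) (tp WT) z ts) (+-identityʳ k)) ok
      walk-left q cs L (suc d) k ts f h ok = subst (λ z → Arrives (suc d) (inj₁ q) (tp WT) z ts (inj₁ q) (tp WT) k cs L) (sym (+-suc k d))
        (arrive-via (once-left (cong liftA (f _ (suc (k + d)) (s≤s (m≤m+n k d)) (≤-reflexive (sym (+-suc k d))) (proj₁ ok (suc (k + d)) kL))) (tape-rewrite ts (suc (k + d)) ok))
          (walk-left q cs L d k _ (λ a p lo hi → f a p lo (≤-trans hi (+-monoʳ-≤ k (n≤1+n d)))) (≤-trans (+-monoʳ-≤ k (n≤1+n d)) h)))
        where
        kL : suc (k + d) ≤ L
        kL = ≤-trans (≤-reflexive (sym (+-suc k d))) h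

      -- Layout of the work tape: the sentinel at 0, cell `p` of `M` at `suc p`, the clock at `n`.
      wcell : (ℕ → Bool) → (ℕ → Sym gM) → ℕ → ℕ → WSym
      wcell hp tape n zero    = sent
      wcell hp tape n (suc p) = if does (suc p ≟ n) then clk else cell (hp p) (tape p)

      headAt : ℕ → ℕ → Bool
      headAt h p = does (p ≟ h)

      noHead : ℕ → Bool
      noHead _ = false

      wcell-clk : ∀ hp tape n → 1 ≤ n → wcell hp tape n n ≡ clk
      wcell-clk hp tape (suc n) _ = if-≟-yes {p = suc n} refl

      wcell-in : ∀ hp tape n p → suc p ≢ n → wcell hp tape n (suc p) ≡ cell (hp p) (tape p)
      wcell-in hp tape n p ne = if-≟-no ne

      fwd-moves : ∀ q i hp tape n a p → p ≢ n → viewW a ≡ wcell hp tape n p → mainδ (fwd q i) a ≡ inj₁ (fwd q i , a , plus1)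
      fwd-moves q i hp tape n a zero    ne e = cong (fwdδ q i a) e
      fwd-moves q i hp tape n a (suc p) ne e = cong (fwdδ q i a) (trans e (wcell-in hp tape n p ne))

      to-clk : ∀ q i hp tape n k ts → k ≤ n → TapeOK ts (wcell hp tape n) n →
        Arrives n (inj₁ (fwd q i)) (tp WT) k ts (inj₁ (fwd q i)) (tp WT) n (wcell hp tape n) n
      to-clk q i hp tape n k ts kn ok = subst (λ z → Arrives n (inj₁ (fwd q i)) (tp WT) k ts (inj₁ (fwd q i)) (tp WT) z (wcell hp tape n) n) (ℕP.m+[n∸m]≡n kn)
        (arrive-weaken (ℕP.m∸n≤m n k) (walk-right (fwd q i) (wcell hp tape n) n (n ∸ k) k ts
          (λ a p _ hi e → fwd-moves q i hp tape n a p (λ pn → <-irrefl pn (≤-trans hi (≤-reflexive (ℕP.m+[n∸m]≡n kn)))) e)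
          (≤-trans (≤-reflexive (ℕP.m+[n∸m]≡n kn)) (n≤1+n n)) ok))

      at-clk : ∀ q i hp tape n ts → 1 ≤ n → TapeOK ts (wcell hp tape n) n → mainδ (fwd q i) (ts (tp WT) n) ≡ clkδ q i (kind q)
      at-clk q i hp tape n ts h ok = cong (fwdδ q i _) (trans (proj₁ ok n ≤-refl) (wcell-clk hp tape n h))

      -- Since cell `p` of `M` sits at `suc p`, this makes the tape of `M` blank from the clock
      -- onward. When the clock advances, the cell it frees may be filled with a blank.
      Blank : (ℕ → Sym gM) → ℕ → Set
      Blank tape n = ∀ p → n ≤ suc p → tape p ≡ zero

      headAt-no : ∀ {h p} → p ≢ h → headAt h p ≡ false
      headAt-no {h} {p} ne = dec-false (p ≟ h) ne

      headAt-yes : ∀ h → headAt h h ≡ true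
      headAt-yes h = dec-true (h ≟ h) refl

      extend : ∀ q i c h tape n ts → suc h < n → Blank tape n → TapeOK ts (wcell (headAt h) tape n) n →
        Arrives 2 (inj₁ (got q i c)) (tp WT) n ts (inj₁ (seek q i c)) (tp WT) n (wcell (headAt h) tape (suc n)) (suc n)
      extend q i c h tape (suc n) ts hn bl ok =
        arrive-via (once-right {cs = wcell (headAt h) tape (suc (suc n))} {suc n} refl
            (tape-write ts (suc n) (symW (cell false zero)) ok
              (trans (viewW-symW _) (sym (trans (wcell-in (headAt h) tape (suc (suc n)) n (λ e → <-irrefl e ≤-refl))
                (cong₂ cell (headAt-no (λ e → <-irrefl (sym e) (s≤s⁻¹ hn))) (bl n ≤-refl)))))
              (λ { zero _ _ → z≤n , refl
                 ; (suc p) pn ne → pn , trans (wcell-in (headAt h) tape (suc n) p ne)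
                     (sym (wcell-in (headAt h) tape (suc (suc n)) p (λ e → <-irrefl e (s≤s pn)))) })))
          (λ {ts'} ok' → once-left {ts = ts'} refl (tape-write ts' (suc (suc n)) (symW clk) ok'
              (trans (viewW-symW _) (sym (wcell-clk (headAt h) tape (suc (suc n)) (s≤s z≤n))))
              (λ p pn ne → s≤s⁻¹ (≤∧≢⇒< pn ne) , refl)))

      to-head : ∀ q i c h tape n ts → suc h < n → TapeOK ts (wcell (headAt h) tape (suc n)) (suc n) →
        Arrives n (inj₁ (seek q i c)) (tp WT) n ts (inj₁ (seek q i c)) (tp WT) (suc h) (wcell (headAt h) tape (suc n)) (suc n)
      to-head q i c h tape n ts hn ok = subst (λ z → Arrives n (inj₁ (seek q i c)) (tp WT) z ts (inj₁ (seek q i c)) (tp WT) (suc h) (wcell (headAt h) tape (suc n)) (suc n)) eq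
        (arrive-weaken (ℕP.m∸n≤m n (suc h)) (walk-left (seek q i c) (wcell (headAt h) tape (suc n)) (suc n) (n ∸ suc h) (suc h) ts moves
          (≤-trans (≤-reflexive eq) (n≤1+n n)) ok))
        where
        eq : suc h + (n ∸ suc h) ≡ n
        eq = ℕP.m+[n∸m]≡n (<⇒≤ hn)
        moves : ∀ a p → suc h < p → p ≤ suc h + (n ∸ suc h) → viewW a ≡ wcell (headAt h) tape (suc n) p →
          mainδ (seek q i c) a ≡ inj₁ (seek q i c , a , minus1)
        moves a (suc p) lo hi e = cong (seekδ q i c a) (trans e (trans
          (wcell-in (headAt h) tape (suc n) p (λ e' → <-irrefl e' (s≤s (≤-trans hi (≤-reflexive eq)))))
          (cong (λ b → cell b (tape p)) (headAt-no (λ e' → <-irrefl (sym e') (s≤s⁻¹ lo))))))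

      at-head : ∀ q i c h tape n ts → suc h < n → TapeOK ts (wcell (headAt h) tape (suc n)) (suc n) →
        mainδ (seek q i c) (ts (tp WT) (suc h)) ≡ headδ q i c (δM q (tape h))
      at-head q i c h tape n ts hn ok = cong (seekδ q i c _) (trans (proj₁ ok (suc h) (≤-trans (<⇒≤ hn) (n≤1+n n)))
        (trans (wcell-in (headAt h) tape (suc n) h (λ e → <-irrefl e (≤-trans hn (n≤1+n n)))) (cong (λ b → cell b (tape h)) (headAt-yes h))))

      place-head : ∀ q i h tape n ts → suc h < n → TapeOK ts (wcell noHead tape n) n →
        Arrives 1 (inj₁ (put q i)) (tp WT) (suc h) ts (inj₁ (fwd q i)) (tp WT) (suc (suc h)) (wcell (headAt h) tape n) n
      place-head q i h tape n ts hn ok = once-right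
        (cong liftA (cong (putδ q i _) (trans (proj₁ ok (suc h) (<⇒≤ hn)) (wcell-in noHead tape n h (λ e → <-irrefl e hn)))))
        (tape-write ts (suc h) (symW (cell true (tape h))) ok
          (trans (viewW-symW _) (sym (trans (wcell-in (headAt h) tape n h (λ e → <-irrefl e hn)) (cong (λ b → cell b (tape h)) (headAt-yes h)))))
          (λ p pn ne → pn , same p ne))
        where
        same : ∀ p → p ≢ suc h → wcell noHead tape n p ≡ wcell (headAt h) tape n p
        same zero    ne = refl
        same (suc p) ne = cong (λ b → if does (suc p ≟ n) then clk else cell b (tape p)) (sym (headAt-no (λ e → ne (cong suc e))))

      erase : ∀ h tape n b ts → suc h < n → TapeOK ts (wcell (headAt h) tape n) n →
        TapeOK (upd ts (tp WT) (suc h) (symW (cell false b))) (wcell noHead (writeTape tape h b) n) n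
      erase h tape n b ts hn ok = tape-write ts (suc h) (symW (cell false b)) ok
        (trans (viewW-symW _) (sym (trans (wcell-in noHead (writeTape tape h b) n h (λ e → <-irrefl e hn)) (cong (cell false) (if-≟-yes {p = h} refl)))))
        (λ p pn ne → pn , same p ne)
        where
        same : ∀ p → p ≢ suc h → wcell (headAt h) tape n p ≡ wcell noHead (writeTape tape h b) n p
        same zero    ne = refl
        same (suc p) ne = cong₂ (λ f a → if does (suc p ≟ n) then clk else cell f a) (headAt-no (λ e → ne (cong suc e))) (sym (if-≟-no (λ e → ne (cong suc e))))

      do-move : ∀ q i c h tape n ts q' b mv → suc h < n → TapeOK ts (wcell (headAt h) tape (suc n)) (suc n) →
        headδ q i c (δM q (tape h)) ≡ moveδ i (q' , b , mv) →
        Arrives 3 (inj₁ (seek q i c)) (tp WT) (suc h) ts (inj₁ (fwd q' i)) (tp WT) (suc (suc (moveHead mv h))) (wcell (headAt (moveHead mv h)) (writeTape tape h b) (suc n)) (suc n)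
      do-move q i c h tape n ts q' b right hn ok e = arrive-weaken (s≤s (s≤s z≤n))
        (arrive-via (once-right (cong liftA (trans (at-head q i c h tape n ts hn ok) e)) (erase h tape (suc n) b ts (≤-trans hn (n≤1+n n)) ok))
          (λ {ts'} → place-head q' i (suc h) (writeTape tape h b) (suc n) ts' (s≤s hn)))
      do-move q i c (suc h) tape n ts q' b left hn ok e = arrive-weaken (s≤s (s≤s z≤n))
        (arrive-via (once-left (cong liftA (trans (at-head q i c (suc h) tape n ts hn ok) e)) (erase (suc h) tape (suc n) b ts (≤-trans hn (n≤1+n n)) ok))
          (λ {ts'} → place-head q' i h (writeTape tape (suc h) b) (suc n) ts' (≤-trans (<⇒≤ hn) (n≤1+n n))))
      -- After the flag is erased the head stands on the sentinel, bounces back to position 1 and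
      -- sets the flag there. This case accounts for the bound 3.
      do-move q i c zero tape n ts q' b left hn ok e =
        arrive-via (once-left (cong liftA (trans (at-head q i c zero tape n ts hn ok) e)) (erase zero tape (suc n) b ts (≤-trans hn (n≤1+n n)) ok))
          (λ {ts'} ok' → arrive-via (once-right (cong liftA (cong (putδ q' i _) (proj₁ ok' 0 z≤n))) (tape-rewrite ts' 0 ok'))
            (λ {ts''} → place-head q' i zero (writeTape tape zero b) (suc n) ts'' (≤-trans hn (n≤1+n n))))

      verdict : Bool → Main
      verdict true  = accM
      verdict false = rejM

      data Decides (n : ℕ) (q : S) (t : τ) (k : ℕ) (ts : Tapes) (b : Bool) : Set where
        dcd : ∀ r → r ≤ n → PConf.state (iter r (pc q t k ts)) ≡ enc finS (inj₁ (verdict b)) → Decides n q t k ts b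

      decide-via : ∀ {a b q₀ t₀ k₀ ts₁ q t k cs L v} → Arrives a q₀ t₀ k₀ ts₁ q t k cs L →
        (∀ {ts} → TapeOK ts cs L → Decides b q t k ts v) → Decides (a + b) q₀ t₀ k₀ ts₁ v
      decide-via {q₀ = q₀} {t₀} {k₀} {ts₁} (arr r ts ra R ok) f with f ok
      ... | dcd r' rb e = dcd (r + r') (+-mono-≤ ra rb) (trans (cong PConf.state (trans (iter-+ r r' (pc q₀ t₀ k₀ ts₁)) (cong (iter r') R))) e)

      decide-weaken : ∀ {a b q t k ts v} → a ≤ b → Decides a q t k ts v → Decides b q t k ts v
      decide-weaken h (dcd r ra e) = dcd r (≤-trans ra h) e

      decide-now : ∀ {q t k ts v t'} → δ' q (ts t k) ≡ inj₂ (inj₁ (verdict v) , t') → Decides 1 q t k ts v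
      decide-now {q} {t} {k} {ts} e = dcd 1 ≤-refl (cong PConf.state (stepN-pc q t k ts e))

      module _ (ch : ℕ → ℕ → Symb) (ch-ok : ∀ i p → ts₀ (tp (blkT i)) p ≡ ch (toℕ i) p) where
        row : Blk → ℕ → ℕ → Symb
        row i b = ch (b + toℕ i)

        to-seek : ∀ q i κ h tape n k ts → kind q ≡ quant κ → suc h < n → Blank tape n → k ≤ n → TapeOK ts (wcell (headAt h) tape n) n →
          Arrives (n + (1 + (1 + (2 + n)))) (inj₁ (fwd q i)) (tp WT) k ts (inj₁ (seek q (blockOf i κ) (row (blockOf i κ) 0 n))) (tp WT) (suc h) (wcell (headAt h) tape (suc n)) (suc n)
        to-seek q i κ h tape n k ts kq hn bl kn ok =
          arrive-via (to-clk q i (headAt h) tape n k ts kn ok) (λ {ts₁} ok₁ →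
          arrive-via (once-switch (cong liftA (trans (at-clk q i (headAt h) tape n ts₁ (≤-trans (s≤s z≤n) hn) ok₁) (cong (clkδ q i) kq))) ok₁) (λ {ts₂} ok₂ →
          arrive-via (once-switch {q = inj₁ (rd q i')} {tp (blkT i')} (cong (λ a → inj₂ (inj₁ (got q i' a) , tp WT)) (trans (proj₂ ok₂ i' n) (ch-ok i' n))) ok₂) (λ {ts₃} ok₃ →
          arrive-via (extend q i' (row i' 0 n) h tape n ts₃ hn bl ok₃) (λ {ts₄} ok₄ → to-head q i' (row i' 0 n) h tape n ts₄ hn ok₄))))
          where
          i' : Blk
          i' = blockOf i κ

        -- Joins both cases, staying in a block and entering the next. `in-range` holds the block
        -- number plus the remaining alternations below `j'`, which keeps `nextB` from saturating.
        record Enter (t r : ℕ) (i : Blk) (κ : Quant) (n : ℕ) (c : Conf gM sM) : Set where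
          field
            left-over : ℕ
            in-range  : toℕ (blockOf i κ) + left-over ≤ j'
            parity    : qpar (toℕ (blockOf i κ)) ≡ κ
            alt-cont  : AltCont t left-over κ c
            play-eq   : playK t (qpar (toℕ i)) (row i) n c (quant κ) ≡ playB t κ (row (blockOf i κ)) n c

        enter : ∀ t r i κ n c → toℕ i + r ≤ j' → ATMSem.AltK M t r (qpar (toℕ i)) c (quant κ) → Enter t r i κ n c
        enter t r i κ n c rg al with sameQ (qpar (toℕ i)) κ in e
        ... | true = record { left-over = r ; in-range = ≤-trans (≤-reflexive (cong (λ z → toℕ z + r) bi)) rg
                            ; parity = trans (cong (qpar ∘ toℕ) bi) (sym (sameQ-true e)) ; alt-cont = al
                            ; play-eq = trans (cong-play e) (cong (λ z → playB t κ (row z) n c) (sym bi)) }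
          where
          bi : blockOf i κ ≡ i
          bi = cong (λ z → if z then i else nextB i) e
          cong-play : sameQ (qpar (toℕ i)) κ ≡ true → playK t (qpar (toℕ i)) (row i) n c (quant κ) ≡ playB t κ (row i) n c
          cong-play e rewrite e = refl
        enter t zero    i κ n c rg () | false
        enter t (suc r) i κ n c rg al | false =
          record { left-over = r ; in-range = ≤-trans (≤-reflexive (trans (cong (_+ r) ti) (sym (+-suc (toℕ i) r)))) rg
                 ; parity = trans (cong qpar ti) (sym (sameQ-false e)) ; alt-cont = al
                 ; play-eq = trans (cong-play e) (playB-ext t κ (row i ∘ suc) (row (blockOf i κ)) n c
                     (λ b p _ → cong (λ z → ch z p) (trans (sym (+-suc b (toℕ i))) (cong (b +_) (sym ti))))) }
          where
          bi : blockOf i κ ≡ nextB i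
          bi = cong (λ z → if z then i else nextB i) e
          ti : toℕ (blockOf i κ) ≡ suc (toℕ i)
          ti = trans (cong toℕ bi) (toℕ-nextB i (≤-trans (≤-trans (s≤s (m≤m+n (toℕ i) r)) (≤-reflexive (sym (+-suc (toℕ i) r)))) rg))
          cong-play : sameQ (qpar (toℕ i)) κ ≡ false → playK t (qpar (toℕ i)) (row i) n c (quant κ) ≡ playB t κ (row i ∘ suc) n c
          cong-play e rewrite e = refl

        stuck-verdict : ∀ κ t ch n c → stuckδ (quant κ) ≡ inj₂ (verdict (playS t κ ch n c []) , WT)
        stuck-verdict exQ  t ch n c = refl
        stuck-verdict allQ t ch n c = refl

        blank-step : ∀ tape h b n → suc h < n → Blank tape n → Blank (writeTape tape h b) (suc n)
        blank-step tape h b n hn bl p np = trans (if-≟-no (λ e → <-irrefl (sym e) (≤-trans (<⇒≤ hn) (s≤s⁻¹ np)))) (bl p (<⇒≤ np))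

        moveHead≤ : ∀ mv h → moveHead mv h ≤ suc h
        moveHead≤ left  zero    = z≤n
        moveHead≤ left  (suc h) = ≤-trans (n≤1+n h) (n≤1+n (suc h))
        moveHead≤ right h       = ≤-refl

        -- With the clock at `n`, a round costs at most `2 * n + 7`: a walk to the clock, two
        -- switches, two steps for the extension, a walk back, three for the move. The clock never
        -- passes `n + t`. The head of `M` stays left of the clock because it advances by at most
        -- one per round and the clock by exactly one.
        simulate : ∀ t r i q h tape n k ts → Halts t (conf q h tape) → AltOK t r (qpar (toℕ i)) (conf q h tape) → toℕ i + r ≤ j' →
          suc h < n → Blank tape n → k ≤ n → TapeOK ts (wcell (headAt h) tape n) n →
          Decides (suc t * (2 * (n + t) + 8)) (inj₁ (fwd q i)) (tp WT) k ts (play t (qpar (toℕ i)) (row i) n (conf q h tape))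
        simulateQ : ∀ t r i κ q h tape n k ts l → kind q ≡ quant κ → δM q (tape h) ≡ l →
          All (λ m → Halts t (applyMove m (conf q h tape))) l → All (λ m → AltOK t r κ (applyMove m (conf q h tape))) l → toℕ (blockOf i κ) + r ≤ j' →
          qpar (toℕ (blockOf i κ)) ≡ κ →
          suc h < n → Blank tape n → k ≤ n → TapeOK ts (wcell (headAt h) tape n) n →
          Decides (suc (suc t) * (2 * (n + suc t) + 8)) (inj₁ (fwd q i)) (tp WT) k ts (playS t κ (row (blockOf i κ)) n (conf q h tape) l)

        simulate t r i q h tape n k ts ha al rg hn bl kn ok with kind q in kq
        ... | accK = decide-weaken (≤-trans (≤-by 7 (lem n)) (≤-trans (+-monoˡ-≤ 8 (*-monoʳ-≤ 2 (m≤m+n n t))) (m≤m+n _ _)))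
          (decide-via (to-clk q i (headAt h) tape n k ts kn ok)
            (λ {ts₁} ok₁ → decide-weaken {1} {suc n} (s≤s z≤n) (decide-now (cong liftA (trans (at-clk q i (headAt h) tape n ts₁ (≤-trans (s≤s z≤n) hn) ok₁) (cong (clkδ q i) kq))))))
          where
          lem : ∀ n → n + suc n + 7 ≡ 2 * n + 8
          lem = solve-∀
        ... | rejK = decide-weaken (≤-trans (≤-by 7 (lem n)) (≤-trans (+-monoˡ-≤ 8 (*-monoʳ-≤ 2 (m≤m+n n t))) (m≤m+n _ _)))
          (decide-via (to-clk q i (headAt h) tape n k ts kn ok)
            (λ {ts₁} ok₁ → decide-weaken {1} {suc n} (s≤s z≤n) (decide-now (cong liftA (trans (at-clk q i (headAt h) tape n ts₁ (≤-trans (s≤s z≤n) hn) ok₁) (cong (clkδ q i) kq))))))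
          where
          lem : ∀ n → n + suc n + 7 ≡ 2 * n + 8
          lem = solve-∀
        simulate zero r i q h tape n k ts ha al rg hn bl kn ok | quant κ = ⊥-elim (no-halt kq ha)
          where
          no-halt : kind q ≡ quant κ → Halts 0 (conf q h tape) → ⊥
          no-halt e rewrite e = id
        simulate (suc t) r i q h tape n k ts ha al rg hn bl kn ok | quant κ =
          subst (Decides _ (inj₁ (fwd q i)) (tp WT) k ts) (sym play-eq)
            (simulateQ t left-over i κ q h tape n k ts (δM q (tape h)) kq refl (Halts-inv {t} {conf q h tape} kq ha) alt-cont in-range parity hn bl kn ok)
          where
          open Enter (enter (suc t) r i κ n (conf q h tape) rg al)

        simulateQ t r i κ q h tape n k ts [] kq dq ha al rg pa hn bl kn ok =
          decide-weaken (≤-trans (≤-by 3 (lem n)) (≤-trans (+-monoˡ-≤ 8 (*-monoʳ-≤ 2 (m≤m+n n (suc t)))) (m≤m+n _ _)))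
          (decide-via (to-seek q i κ h tape n k ts kq hn bl kn ok) (λ {ts₁} ok₁ →
            decide-now (cong liftA (trans (at-head q i' a h tape n ts₁ hn ok₁)
              (trans (cong (headδ q i' a) dq) (trans (cong stuckδ kq) (stuck-verdict κ t (row i') n (conf q h tape))))))))
          where
          i' : Blk
          i' = blockOf i κ
          a : Symb
          a = row i' 0 n
          lem : ∀ n → n + (1 + (1 + (2 + n))) + 1 + 3 ≡ 2 * n + 8
          lem = solve-∀
        simulateQ t r i κ q h tape n k ts (m ∷ ms) kq dq ha al rg pa hn bl kn ok =
          subst (Decides _ (inj₁ (fwd q i)) (tp WT) k ts) (trans (cong (λ z → play t z (row i') (suc n) c') pa) (sym (move-play κ t (row i') n (conf q h tape) m ms)))
          (decide-weaken (+-mono-≤ {n + (1 + (1 + (2 + n))) + 3} {2 * (n + suc t) + 8}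
              (≤-trans (≤-by 1 (lem n)) (+-monoˡ-≤ 8 (*-monoʳ-≤ 2 (m≤m+n n (suc t)))))
              (*-monoʳ-≤ (suc t) (+-monoˡ-≤ 8 (*-monoʳ-≤ 2 (≤-reflexive (sym (+-suc n t)))))))
          (decide-via (arrive-via (to-seek q i κ h tape n k ts kq hn bl kn ok) (λ {ts₁} ok₁ →
            do-move q i' a h tape n ts₁ (proj₁ ac) (proj₁ (proj₂ ac)) (proj₂ (proj₂ ac)) hn ok₁ (cong (headδ q i' a) dq)))
          (λ {ts₂} ok₂ → simulate t r i' (proj₁ ac) (moveHead (proj₂ (proj₂ ac)) h) (writeTape tape h (proj₁ (proj₂ ac))) (suc n) _ ts₂
            (pick-All ha (toℕ a)) (subst (λ z → AltOK t r z c') (sym pa) (pick-All al (toℕ a))) rg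
            (s≤s (≤-trans (s≤s (moveHead≤ (proj₂ (proj₂ ac)) h)) hn))
            (blank-step tape h (proj₁ (proj₂ ac)) n hn bl)
            (s≤s (≤-trans (s≤s (moveHead≤ (proj₂ (proj₂ ac)) h)) hn)) ok₂)))
          where
          i' : Blk
          i' = blockOf i κ
          a : Symb
          a = row i' 0 n
          ac : Fin sM × Sym gM × Move
          ac = pick m ms (toℕ a)
          c' : Conf gM sM
          c' = applyMove ac (conf q h tape)
          lem : ∀ n → n + (1 + (1 + (2 + n))) + 3 + 1 ≡ 2 * n + 8
          lem = solve-∀

      nthD : List WSym → ℕ → WSym
      nthD []      p       = clk
      nthD (y ∷ l) zero    = y
      nthD (y ∷ l) (suc p) = nthD l p

      nthD-++ : ∀ pre y l → nthD (pre ++ y ∷ l) (length pre) ≡ y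
      nthD-++ []        y l = refl
      nthD-++ (_ ∷ pre) y l = nthD-++ pre y l

      bot-++ : ∀ (pre : List WSym) y l → bot (pre ++ y ∷ l) (length l) ≡ just y
      bot-++ []        y l = bot-top y l
      bot-++ (z ∷ pre) y l = trans (bot-below z (pre ++ y ∷ l) (λ e → <-irrefl e (≤-trans (m≤n+m (suc (length l)) (length pre)) (≤-reflexive (sym (LP.length-++ pre)))))) (bot-++ pre y l)

      loaded : ℕ → ℕ → WSym
      loaded k p = if does (p <? k) then nthD P p else viewW (ts₀ (tp WT) p)

      loaded-in : ∀ k p → p < k → loaded k p ≡ nthD P p
      loaded-in k p h = cong (λ b → if b then nthD P p else viewW (ts₀ (tp WT) p)) (dec-true (p <? k) h)

      loaded-suc : ∀ k p → p ≢ k → loaded k p ≡ loaded (suc k) p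
      loaded-suc k p ne with p <? k
      ... | yes h = trans (loaded-in k p h) (sym (loaded-in (suc k) p (m≤n⇒m≤1+n h)))
      ... | no  h = trans (cong pickB (dec-false (p <? k) h)) (sym (cong pickB (dec-false (p <? suc k) (λ h' → h (≤∧≢⇒< (s≤s⁻¹ h') ne)))))
        where
        pickB : Bool → WSym
        pickB b = if b then nthD P p else viewW (ts₀ (tp WT) p)

      chain-run : ∀ pre l (r : Fin (suc m)) ts → P ≡ pre ++ l → toℕ r ≡ length l → TapeOK ts (loaded (length pre)) m →
        Arrives (length l) (inj₂ (chain r)) (tp WT) (length pre) ts back (tp WT) m (loaded m) m
      chain-run pre [] zero ts e lr ok =
        arr 0 ts z≤n (cong (λ k → pc back (tp WT) k ts) len) (subst (λ k → TapeOK ts (loaded k) m) len ok)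
        where
        len : length pre ≡ m
        len = cong length (sym (trans e (LP.++-identityʳ pre)))
      chain-run pre (y ∷ l) (suc i) ts e lr ok =
        arrive-via (once-right {q = inj₂ (inj₂ (inj₁ i))} refl (tape-write ts {cs' = loaded (suc (length pre))} (length pre) _ ok
            (trans (viewW-symW _) (trans sy (sym (trans (loaded-in (suc (length pre)) (length pre) ≤-refl) (trans (cong (λ z → nthD z (length pre)) e) (nthD-++ pre y l))))))
            (λ p pm ne → pm , loaded-suc (length pre) p ne)))
          (λ {ts'} ok' → subst (λ k → Arrives (length l) (inj₂ (chain (F.inject₁ i))) (tp WT) k ts' back (tp WT) m (loaded m) m) len
            (chain-run (pre ++ y ∷ []) l (F.inject₁ i) ts' (trans e (sym (LP.++-assoc pre (y ∷ []) l))) (trans (FP.toℕ-inject₁ i) (ℕP.suc-injective lr))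
              (subst (λ k → TapeOK ts' (loaded k) m) (sym len) ok')))
        where
        len : length (pre ++ y ∷ []) ≡ suc (length pre)
        len = trans (LP.length-++ pre) (+-comm (length pre) 1)
        sy : chainSym (toℕ i) ≡ y
        sy = cong (maybe id clk) (trans (cong₂ bot e (ℕP.suc-injective lr)) (bot-++ pre y l))

      start-run : ∀ n tape → m ≡ suc n → (∀ p → p ≤ n → nthD P p ≡ wcell (headAt 0) tape n p) →
        Arrives (1 + (m + 1)) initS zero 0 ts₀ (inj₁ (fwd qM zero)) (tp WT) n (wcell (headAt 0) tape n) n
      start-run n tape mn cells =
        arrive-via (once-switch {ts = ts₀} refl ((λ _ _ → refl) , (λ _ _ → refl)))
        (λ {ts₁} ok₁ → arrive-via (chain-run [] P (F.fromℕ m) ts₁ refl (FP.toℕ-fromℕ m) ok₁)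
        (λ {ts₂} ok₂ → last ts₂ m mn ok₂))
        where
        last : ∀ ts m' → m' ≡ suc n → TapeOK ts (loaded m) m → Arrives 1 back (tp WT) m' ts (inj₁ (fwd qM zero)) (tp WT) n (wcell (headAt 0) tape n) n
        last ts _ refl ok with tape-rewrite ts (suc n) ok
        ... | w , b = once-left refl ((λ p pn → trans (w p (≤-trans pn (≤-trans (n≤1+n n) (≤-reflexive (sym mn)))))
              (trans (loaded-in m p (≤-trans (s≤s pn) (≤-reflexive (sym mn)))) (cells p pn))) , b)

    absorb : ∀ v → (∀ a → mainδ v a ≡ inj₂ (v , zero)) → ∀ c → PConf.state c ≡ enc finS (inj₁ v) → PConf.state (stepN c) ≡ enc finS (inj₁ v)
    absorb v dv (pconf q t k ts) refl = cong PConf.state (stepN-pc (inj₁ v) t k ts (cong liftA (dv (ts t k))))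

    absorb* : ∀ v → (∀ a → mainδ v a ≡ inj₂ (v , zero)) → ∀ s c → PConf.state c ≡ enc finS (inj₁ v) → PConf.state (iter s c) ≡ enc finS (inj₁ v)
    absorb* v dv zero    c e = e
    absorb* v dv (suc s) c e = absorb* v dv s (stepN c) (absorb v dv c e)

    -- `AcceptsIn` asserts acceptance at some time. Reaching `rejM` refutes it because both verdicts
    -- are absorbing: at time `a + b` the machine would be in both states.
    not-both : ∀ a b c → PConf.state (iter a c) ≡ enc finS (inj₁ accM) → PConf.state (iter b c) ≡ enc finS (inj₁ rejM) → ⊥
    not-both a b c ea eb = impossible (trans (sym (dec-enc finS (inj₁ accM))) (trans (cong (dec finS) both) (dec-enc finS (inj₁ rejM))))
      where
      both : enc finS (inj₁ accM) ≡ enc finS (inj₁ rejM)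
      both = trans (sym (trans (cong PConf.state (iter-+ a b c)) (absorb* accM (λ _ → refl) b (iter a c) ea)))
        (trans (cong (λ z → PConf.state (iter z c)) (+-comm a b)) (trans (cong PConf.state (iter-+ b a c)) (absorb* rejM (λ _ → refl) a (iter b c) eb)))
      impossible : inj₁ accM ≡ inj₁ rejM → ⊥
      impossible ()

  -- The blank in front of the clock makes `suc h < n` true at the start even for the empty input.
  cellsOf : Bool → List Bool → List WSym
  cellsOf f []      = cell f zero ∷ clk ∷ []
  cellsOf f (b ∷ w) = cell f (bitSym b) ∷ cellsOf false w

  word : List Bool → List WSym
  word w = sent ∷ cellsOf true w

  length-cellsOf : ∀ f w → length (cellsOf f w) ≡ suc (suc (length w))
  length-cellsOf f []      = refl
  length-cellsOf f (b ∷ w) = cong suc (length-cellsOf false w)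

  -- n₀ is the initial position of the clock: a sentinel, the input and one blank precede it.
  module Start (w : List Bool) (x N : ℕ) (ws : Fin (suc (suc j') + x) → Vec Symb N) where
    open Loaded (word w) x
    open NSem T
    open Simulation (initTapes N ws)

    n₀ : ℕ
    n₀ = suc (suc (length w))

    c₀ : Conf gM sM
    c₀ = conf qM 0 (inputTape w)

    cellsOf-nth : ∀ f w p → p ≤ suc (length w) →
      nthD (cellsOf f w) p ≡ (if does (p ≟ suc (length w)) then clk else cell (if does (p ≟ 0) then f else false) (inputTape w p))
    cellsOf-nth f []      zero          h = refl
    cellsOf-nth f []      (suc zero)    h = refl
    cellsOf-nth f []      (suc (suc p)) (s≤s ())
    cellsOf-nth f (b ∷ w) zero          h = refl
    cellsOf-nth f (b ∷ w) (suc zero)    (s≤s h) = cellsOf-nth false w zero h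
    cellsOf-nth f (b ∷ w) (suc (suc p)) (s≤s h) = cellsOf-nth false w (suc p) h

    if-same : ∀ b → (if b then true else false) ≡ b
    if-same true  = refl
    if-same false = refl

    cells-ok : ∀ p → p ≤ n₀ → nthD (word w) p ≡ wcell (headAt 0) (inputTape w) n₀ p
    cells-ok zero    h       = refl
    cells-ok (suc p) (s≤s h) = trans (cellsOf-nth true w p h) (cong (λ z → if does (p ≟ suc (length w)) then clk else cell z (inputTape w p)) (if-same (does (p ≟ 0))))

    blank₀ : Blank (inputTape w) n₀
    blank₀ p h = go w p (s≤s⁻¹ h)
      where
      go : ∀ w p → suc (length w) ≤ p → inputTape {gM} w p ≡ zero
      go []      p       h       = refl
      go (b ∷ w) (suc p) (s≤s h) = go w p h

    time : ℕ → ℕ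
    time t = 1 + (suc n₀ + 1) + suc t * (2 * (n₀ + t) + 8)

    accepts⇔play : ∀ t ch → (∀ i p → initTapes N ws (tp (blkT i)) p ≡ ch (toℕ i) p) →
      Halts t c₀ → AltOK t j' exQ c₀ → time t ≤ N →
      AcceptsIn N N ws ⇔ (play t exQ ch n₀ c₀ ≡ true)
    accepts⇔play t ch ch-ok ha al tN = mk⇔ (to _ refl run) (from _ refl run)
      where
      len : length (word w) ≡ suc n₀
      len = cong suc (length-cellsOf true w)
      row₀ : ∀ b p → n₀ ≤ p → ch (b + 0) p ≡ ch b p
      row₀ b p _ = cong (λ z → ch z p) (+-identityʳ b)
      run : Decides (time t) initS zero 0 (initTapes N ws) (play t exQ ch n₀ c₀)
      run = decide-weaken (+-monoˡ-≤ (suc t * (2 * (n₀ + t) + 8)) (≤-reflexive (cong (λ z → 1 + (z + 1)) len)))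
        (decide-via (start-run n₀ (inputTape w) len cells-ok)
          (λ {ts} ok → subst (Decides (suc t * (2 * (n₀ + t) + 8)) (inj₁ (fwd qM zero)) (tp WT) n₀ ts) (play-ext t exQ _ ch n₀ c₀ row₀)
            (simulate ch ch-ok t j' zero qM 0 (inputTape w) n₀ n₀ ts ha al ≤-refl (s≤s (s≤s z≤n)) blank₀ ≤-refl ok)))
      to : ∀ b → play t exQ ch n₀ c₀ ≡ b → Decides (time t) initS zero 0 (initTapes N ws) (play t exQ ch n₀ c₀) → AcceptsIn N N ws → b ≡ true
      to true  e d acc = refl
      to false e (dcd r rb er) (i , iN , ei) = ⊥-elim (not-both i r _ ei (trans er (cong (λ b → enc finS (inj₁ (verdict b))) e)))
      from : ∀ b → play t exQ ch n₀ c₀ ≡ b → Decides (time t) initS zero 0 (initTapes N ws) (play t exQ ch n₀ c₀) → b ≡ true → AcceptsIn N N ws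
      from true e (dcd r rb er) _ = r , ≤-trans rb tN , trans er (cong (λ b → enc finS (inj₁ (verdict b))) e)

-- Choices along a quantifier prefix

evalQ-map : ∀ {W : Set} {n} (Q : Vec Quant n) {P P' : (Fin n → W) → Set} → (∀ ws → P ws → P' ws) → evalQ Q P → evalQ Q P'
evalQ-map []         f e       = f _ e
evalQ-map (exQ ∷ Q)  f (w , e) = w , evalQ-map Q (λ ws → f _) e
evalQ-map (allQ ∷ Q) f e       = λ w → evalQ-map Q (λ ws → f _) (e w)

evalQ-intro : ∀ {W : Set} {n} (Q : Vec Quant n) {P : (Fin n → W) → Set} → W → (∀ ws → P ws) → evalQ Q P
evalQ-intro []         w f = f _
evalQ-intro (exQ ∷ Q)  w f = w , evalQ-intro Q w (λ ws → f _)
evalQ-intro (allQ ∷ Q) w f = λ v → evalQ-intro Q w (λ ws → f _)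

evalQ-elim : ∀ {W : Set} {n} (Q : Vec Quant n) {P : (Fin n → W) → Set} → W → evalQ Q P → Σ (Fin n → W) P
evalQ-elim []         w e       = _ , e
evalQ-elim (exQ ∷ Q)  w (v , e) = let ws , p = evalQ-elim Q w e in consF v ws , p
evalQ-elim (allQ ∷ Q) w e       = let ws , p = evalQ-elim Q w (e w) in consF w ws , p

-- The prefix of length n that starts with q and alternates as early as possible, r times.
mutual
  qvec : Quant → ℕ → (n : ℕ) → Vec Quant n
  qvec q r zero    = []
  qvec q r (suc n) = q ∷ qrest q r n

  qrest : Quant → ℕ → (n : ℕ) → Vec Quant n
  qrest q zero    n = qvec q zero n
  qrest q (suc r) n = qvec (negQ q) r n

alt-qvec : ∀ q r n → r ≤ n → alt (qvec q r (suc n)) ≡ suc r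
alt-qvec q    zero    zero    h       = refl
alt-qvec exQ  zero    (suc n) h       = alt-qvec exQ zero n z≤n
alt-qvec allQ zero    (suc n) h       = alt-qvec allQ zero n z≤n
alt-qvec exQ  (suc r) (suc n) (s≤s h) = cong suc (alt-qvec allQ r n h)
alt-qvec allQ (suc r) (suc n) (s≤s h) = cong suc (alt-qvec exQ r n h)

atV : ∀ {A : Set} {n} → A → Vec A n → ℕ → A
atV {n = n} d v p with p <? n
... | yes h = lookup v (fromℕ< h)
... | no  _ = d

atV-upd : ∀ {A : Set} {n} (d : A) (v : Vec A n) p (h : p < n) a → atV d (v [ fromℕ< h ]≔ a) p ≡ a
atV-upd {n = n} d v p h a with p <? n
... | yes h' = trans (cong (lookup (v [ fromℕ< h ]≔ a)) (FP.fromℕ<-cong p p refl h' h)) (VP.lookup∘update (fromℕ< h) v a)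
... | no  nh = ⊥-elim (nh h)

atV-upd-other : ∀ {A : Set} {n} (d : A) (v : Vec A n) p (h : p < n) a {p'} → p' ≢ p → atV d (v [ fromℕ< h ]≔ a) p' ≡ atV d v p'
atV-upd-other {n = n} d v p h a {p'} ne with p' <? n
... | yes h' = VP.lookup∘update′ (λ e → ne (trans (sym (FP.toℕ-fromℕ< h')) (trans (cong toℕ e) (FP.toℕ-fromℕ< h)))) v a
... | no  _  = refl

pick-Any : ∀ {A : Set} {Pr : A → Set} x ys n → Pr (pick x ys n) → Any Pr (x ∷ ys)
pick-Any x ys       zero    p = here p
pick-Any x []       (suc n) p = here p
pick-Any x (y ∷ ys) (suc n) p = there (pick-Any y ys n p)

Any-pick : ∀ {A : Set} {Pr : A → Set} x ys → Any Pr (x ∷ ys) → Σ ℕ λ n → n < length (x ∷ ys) × Pr (pick x ys n)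
Any-pick x ys       (here p)  = 0 , s≤s z≤n , p
Any-pick x (y ∷ ys) (there a) = let n , h , p = Any-pick y ys a in suc n , s≤s h , p

All-pick : ∀ {A : Set} {Pr : A → Set} x ys → (∀ n → n < length (x ∷ ys) → Pr (pick x ys n)) → All Pr (x ∷ ys)
All-pick x []       f = f 0 (s≤s z≤n) ∷ []
All-pick x (y ∷ ys) f = f 0 (s≤s z≤n) ∷ All-pick y ys (λ n h → f (suc n) (s≤s h))

to-≡ : ∀ {A B C : Set} → B ≡ C → A ⇔ C → A ⇔ B
to-≡ refl e = e

module Prenex (M : ATM) (j' : ℕ) (N : ℕ) where
  open Hard M j'
  open ATM M renaming (g to gM; s to sM; init to qM; δ to δM)
  open ATMSem M using (Acc; Halts; AltOK; AltCont)

  Word : Set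
  Word = Vec Symb N

  anyWord : Word
  anyWord = V.replicate N zero

  chOf : ∀ {n} → (Fin n → Word) → ℕ → ℕ → Symb
  chOf {zero}  ws i       p = zero
  chOf {suc n} ws zero    p = atV zero (ws zero) p
  chOf {suc n} ws (suc i) p = chOf (ws ∘ suc) i p

  Mv : Set
  Mv = Fin sM × Sym gM × Move

  length≤branching : ∀ q a → length (δM q a) ≤ branching
  length≤branching q a = ≤-trans (≤sumFin (λ a → length (δM q a)) a) (≤sumFin (λ q → sumFin (3 + gM) (λ a → length (δM q a))) q)

  -- The alphabet has more than `branching` symbols, so the index of a successor is itself a symbol.
  idx : ∀ {l : ℕ} n → n < l → l ≤ branching → Symb
  idx n h b = fromℕ< (≤-trans (≤-trans h b) (≤-trans (m≤n+m branching (size finW)) (n≤1+n _)))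

  toℕ-idx : ∀ {l : ℕ} n (h : n < l) (b : l ≤ branching) → toℕ (idx n h b) ≡ n
  toℕ-idx n h b = FP.toℕ-fromℕ< _

  Claim : ℕ → Quant → ℕ → ℕ → Conf gM sM → ℕ → Set
  Claim t q r n c p = evalQ (qvec q r (suc n)) (λ ws → play t q (chOf ws) p c ≡ true) ⇔ Acc t c

  -- Overwriting the word of the current block at the current position selects a given successor.
  redirect : ∀ t κ n c p m ms (k : ℕ) (kl : k < length (m ∷ ms)) → length (m ∷ ms) ≤ branching → p < N →
    ∀ (Q : Vec Quant n) → Σ (Word → Word) λ up → ∀ (w : Word) →
      (evalQ Q (λ ws → play t κ (chOf (consF w ws)) (suc p) (applyMove (pick m ms k) c) ≡ true) →
       evalQ Q (λ ws → playS t κ (chOf (consF (up w) ws)) p c (m ∷ ms) ≡ true)) ×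
      (evalQ Q (λ ws → playS t κ (chOf (consF (up w) ws)) p c (m ∷ ms) ≡ true) →
       evalQ Q (λ ws → play t κ (chOf (consF w ws)) (suc p) (applyMove (pick m ms k) c) ≡ true))
  redirect t κ n c p m ms k kl lb pN Q = up , λ w →
      evalQ-map Q (λ ws e → trans (eq w ws) e) , evalQ-map Q (λ ws e → trans (sym (eq w ws)) e)
    where
    a : Symb
    a = idx k kl lb
    up : Word → Word
    up w = w [ fromℕ< pN ]≔ a
    agree : ∀ w ws b p' → suc p ≤ p' → chOf (consF (up w) ws) b p' ≡ chOf (consF w ws) b p'
    agree w ws zero    p' h = atV-upd-other zero w p pN a (λ e → <-irrefl (sym e) h)
    agree w ws (suc b) p' h = refl
    eq : ∀ w ws → playS t κ (chOf (consF (up w) ws)) p c (m ∷ ms) ≡ play t κ (chOf (consF w ws)) (suc p) (applyMove (pick m ms k) c)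
    eq w ws = trans (move-play κ t (chOf (consF (up w) ws)) p c m ms)
      (trans (cong (λ z → play t κ (chOf (consF (up w) ws)) (suc p) (applyMove (pick m ms z) c)) (trans (cong toℕ (atV-upd zero w p pN a)) (toℕ-idx k kl lb)))
        (play-ext t κ _ _ (suc p) _ (agree w ws)))

  AccList : Quant → ℕ → Conf gM sM → List Mv → Set
  AccList exQ  t c l = Any (λ m → Acc t (applyMove m c)) l
  AccList allQ t c l = All (λ m → Acc t (applyMove m c)) l

  -- One word serves all choices of a block, since the choice made at `p` occupies position `p` and
  -- later choices occupy later positions. A winning existential word arises from one for the
  -- successor by writing the index at `p`; dually, a universal statement is instantiated at the
  -- overwritten word.
  same-block : ∀ t κ r n c p l → length l ≤ branching → p < N → All (λ m → Claim t κ r n (applyMove m c) (suc p)) l →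
    evalQ (qvec κ r (suc n)) (λ ws → playS t κ (chOf ws) p c l ≡ true) ⇔ AccList κ t c l
  same-block t exQ  r n c p [] lb pN ih = mk⇔ (λ { (w , e) → case proj₂ (evalQ-elim (qrest exQ r n) anyWord e) of λ () }) (λ ())
  same-block t allQ r n c p [] lb pN ih = mk⇔ (λ _ → []) (λ _ → λ w → evalQ-intro (qrest allQ r n) anyWord (λ _ → refl))
  same-block t exQ  r n c p (m ∷ ms) lb pN ih = mk⇔
    (λ { (w , e) → pick-Any m ms (toℕ (atV zero w p)) (Equivalence.to (pick-All ih (toℕ (atV zero w p))) (w , e)) })
    (λ a → let k , kl , ac = Any-pick m ms a
               w , e = Equivalence.from (pick-All ih k) ac
               up , f = redirect t exQ n c p m ms k kl lb pN (qrest exQ r n)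
           in up w , proj₁ (f w) e)
  same-block t allQ r n c p (m ∷ ms) lb pN ih = mk⇔
    (λ e → All-pick m ms (λ k kl → let up , f = redirect t allQ n c p m ms k kl lb pN (qrest allQ r n)
                                   in Equivalence.to (pick-All ih k) (λ w → proj₂ (f w) (e (up w)))))
    (λ ac w → Equivalence.from (pick-All ih (toℕ (atV zero w p))) (pick-All ac (toℕ (atV zero w p))) w)

  Acc-quant : ∀ t c κ → kind (Conf.state c) ≡ quant κ → Acc (suc t) c ≡ AccList κ t c (δM (Conf.state c) (Conf.tape c (Conf.hd c)))
  Acc-quant t c exQ  e rewrite e = refl
  Acc-quant t c allQ e rewrite e = refl

  claim : ∀ t q r n c p → r ≤ n → p + t ≤ N → Halts t c → AltOK t r q c → Claim t q r n c p
  claim-block : ∀ t κ r n c p → r ≤ n → p + suc t ≤ N → All (λ m → Halts t (applyMove m c)) (δM (Conf.state c) (Conf.tape c (Conf.hd c))) →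
    AltCont (suc t) r κ c → evalQ (qvec κ r (suc n)) (λ ws → playB (suc t) κ (chOf ws) p c ≡ true) ⇔ AccList κ t c (δM (Conf.state c) (Conf.tape c (Conf.hd c)))

  claim-block t κ r n c p rn pN ha al = same-block t κ r n c p l (length≤branching _ _)
      (≤-trans (s≤s (m≤m+n p t)) (≤-trans (≤-reflexive (sym (+-suc p t))) pN)) (ihs l ha al)
    where
    l : List Mv
    l = δM (Conf.state c) (Conf.tape c (Conf.hd c))
    ihs : ∀ l → All (λ m → Halts t (applyMove m c)) l → All (λ m → AltOK t r κ (applyMove m c)) l → All (λ m → Claim t κ r n (applyMove m c) (suc p)) l
    ihs []      []       []       = []
    ihs (m ∷ l) (h ∷ hs) (a ∷ as) = claim t κ r n (applyMove m c) (suc p) rn (≤-trans (≤-reflexive (sym (+-suc p t))) pN) h a ∷ ihs l hs as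

  Acc-acc : ∀ t c → kind (Conf.state c) ≡ accK → Acc t c
  Acc-acc zero    c e rewrite e = tt
  Acc-acc (suc t) c e rewrite e = tt

  Acc-rej : ∀ t c → kind (Conf.state c) ≡ rejK → Acc t c → ⊥
  Acc-rej zero    c e rewrite e = id
  Acc-rej (suc t) c e rewrite e = id

  claim t q r n c p rn pN ha al with kind (Conf.state c) in kc
  ... | accK = mk⇔ (λ _ → Acc-acc t c kc) (λ _ → evalQ-intro (qvec q r (suc n)) anyWord (λ _ → refl))
  ... | rejK = mk⇔ (λ e → case proj₂ (evalQ-elim (qvec q r (suc n)) anyWord e) of λ ()) (λ a → ⊥-elim (Acc-rej t c kc a))
  claim zero q r n c p rn pN ha al | quant κ = ⊥-elim (no-halt kc ha)
    where
    no-halt : kind (Conf.state c) ≡ quant κ → Halts 0 c → ⊥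
    no-halt e rewrite e = id
  claim (suc t) q r n c p rn pN ha al | quant κ with sameQ q κ in e
  ... | true rewrite sameQ-true {q} {κ} e = to-≡ (Acc-quant t c q kc)
        (claim-block t q r n c p rn pN (Halts-inv {t} {c} kc ha) al)
  -- The word of the finished block is read no more, so its quantifier is vacuous over the inhabited
  -- type `Word`; `r ≤ n` provides the quantifier for the next block.
  claim (suc t) q (suc r) (suc n) c p (s≤s rn) pN ha al | quant κ | false rewrite sameQ-false {q} {κ} e = to-≡ (Acc-quant t c (negQ q) kc)
        (skip q (claim-block t (negQ q) r n c p rn pN (Halts-inv {t} {c} kc ha) al))
    where
    skip : ∀ q' {A : Set} → evalQ (qvec (negQ q) r (suc n)) (λ ws → playB (suc t) (negQ q) (chOf ws) p c ≡ true) ⇔ A →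
      evalQ {Word} (q' ∷ qvec (negQ q) r (suc n)) (λ ws → playB (suc t) (negQ q) (chOf ws ∘ suc) p c ≡ true) ⇔ A
    skip exQ  f = mk⇔ (λ { (w , ev) → Equivalence.to f ev }) (λ a → anyWord , Equivalence.from f a)
    skip allQ f = mk⇔ (λ ev → Equivalence.to f (ev anyWord)) (λ a w → Equivalence.from f a)

-- Parsing encoded instances

itr : ∀ {A : Set} → (A → A) → ℕ → A → A
itr f zero    x = x
itr f (suc n) x = f (itr f n x)

itr-suc : ∀ {A : Set} (f : A → A) n x → itr f (suc n) x ≡ itr f n (f x)
itr-suc f zero    x = refl
itr-suc f (suc n) x = cong f (itr-suc f n x)

pt-just : ∀ {A} → PT A (Ma A) just
pt-just {A} = pt-coe {Un ⊠ A} {Ma A} {λ p → just (proj₂ p)} (λ _ → refl) ∙ (pt-const tt & pt-id)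

Parser : Ty → Ty → Set
Parser E Y = El E × List Bool → Maybe (El Y × List Bool)

-- `sound` and `complete` together make the code uniquely decodable in front of any continuation.
-- `V` singles out the well-formed values, and `E` carries the fields parsed before.
record Parses (E Y : Ty) (p : Parser E Y) (en : El E → El Y → List Bool) (V : El E → El Y → Set) : Set where
  field
    sound    : ∀ e w {x w'} → p (e , w) ≡ just (x , w') → (w ≡ en e x ++ w') × V e x
    complete : ∀ e x w' → V e x → p (e , en e x ++ w') ≡ just (x , w')
    poly     : PT (E ⊠ Li Bo) (Ma (Y ⊠ Li Bo)) p
open Parses public

andThen : ∀ {A B C : Set} → (A → Maybe B) → (A × B → Maybe C) → A → Maybe C
andThen f g a = caseM (λ _ → nothing) g (a , f a)

pt-andThen : ∀ {A B C f g} → PT A (Ma B) f → PT (A ⊠ B) (Ma C) g → PT A (Ma C) (andThen f g)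
pt-andThen p q = pt-caseM (pt-const nothing) q ∙ (pt-id & p)

andThen-just : ∀ {A B C : Set} (f : A → Maybe B) (g : A × B → Maybe C) a {b c} → f a ≡ just b → g (a , b) ≡ c → andThen f g a ≡ c
andThen-just f g a e e' rewrite e = e'

andThen-inv : ∀ {A B C : Set} (f : A → Maybe B) (g : A × B → Maybe C) a {c} → andThen f g a ≡ just c → Σ B λ b → f a ≡ just b × g (a , b) ≡ just c
andThen-inv f g a e with f a
... | just b = b , refl , e

just-inj : ∀ {A : Set} {x y : A} → just x ≡ just y → x ≡ y
just-inj refl = refl

sucM : Maybe (ℕ × List Bool) → Maybe (ℕ × List Bool)
sucM m = caseM (λ _ → nothing) (λ p → just (suc (proj₁ (proj₂ p)) , proj₂ (proj₂ p))) (tt , m)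

pUnary : List Bool → Maybe (ℕ × List Bool)
pUnary []          = nothing
pUnary (false ∷ w) = just (0 , w)
pUnary (true ∷ w)  = sucM (pUnary w)

pUnary-sound : ∀ w {n w'} → pUnary w ≡ just (n , w') → w ≡ unary n ++ w'
pUnary-sound (false ∷ w) refl = refl
pUnary-sound (true ∷ w) e with pUnary w in eq
pUnary-sound (true ∷ w) refl | just (n , w') = cong (true ∷_) (pUnary-sound w eq)

pUnary-complete : ∀ n w' → pUnary (unary n ++ w') ≡ just (n , w')
pUnary-complete zero    w' = refl
pUnary-complete (suc n) w' = cong sucM (pUnary-complete n w')

sz-Bool : ∀ b → sz Bo b ≤ 3
sz-Bool false = s≤s z≤n
sz-Bool true  = ≤-refl

pUnary-size : ∀ w → sz (Ma (Nat ⊠ Li Bo)) (pUnary w) ≤ 4 + 2 * sz (Li Bo) w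
pUnary-size []          = s≤s z≤n
pUnary-size (false ∷ w) = ≤-by (4 + sz (Li Bo) w) (lem (sz (Li Bo) w))
  where
  lem : ∀ n → suc (1 + suc (1 + n)) + (4 + n) ≡ 4 + 2 * suc (1 + n)
  lem = solve-∀
pUnary-size (true ∷ w) with pUnary w | pUnary-size w
... | nothing      | h = s≤s z≤n
... | just (n , v) | h = ≤-trans (s≤s (s≤s h)) (≤-by 6 (lem (sz (Li Bo) w)))
  where
  lem : ∀ n → 2 + (4 + 2 * n) + 6 ≡ 4 + 2 * suc (3 + n)
  lem = solve-∀

pt-pUnary : PT (Li Bo) (Ma (Nat ⊠ Li Bo)) pUnary
pt-pUnary = pt-rec Un Bo (Ma (Nat ⊠ Li Bo)) (λ p → pUnary (proj₂ p)) (pt-const nothing)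
    (pt-if (pt-fst ∙ pt-snd)
      (pt-caseM (pt-const nothing) (pt-just ∙ ((pt-suc ∙ pt-fst ∙ pt-snd) & (pt-snd ∙ pt-snd))) ∙ (pt-const tt & (pt-snd ∙ pt-snd ∙ pt-snd)))
      (pt-just ∙ (pt-const 0 & (pt-fst ∙ pt-snd ∙ pt-snd))))
    (λ _ → refl) (λ { _ false _ → refl ; _ true _ → refl }) (con 4 ⊕ con 2 ⊗ X)
    (λ e w → ≤-trans (pUnary-size w) (+-monoʳ-≤ 4 (*-monoʳ-≤ 2 (n≤1+n _))))
  ∙ (pt-const tt & pt-id)

unaryP : ∀ {E} → Parser E Nat
unaryP (e , w) = pUnary w

unary-parses : ∀ {E} → Parses E Nat unaryP (λ _ → unary) (λ _ _ → ⊤)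
unary-parses = record
  { sound = λ e w h → pUnary-sound w h , tt
  ; complete = λ e n w' _ → pUnary-complete n w'
  ; poly = pt-pUnary ∙ pt-snd }

bitP : ∀ {E} → Parser E Bo
bitP = caseL (λ _ → nothing) (λ p → just (proj₂ p))

bit-parses : ∀ {E} → Parses E Bo bitP (λ _ b → b ∷ []) (λ _ _ → ⊤)
bit-parses = record
  { sound = λ { e (b ∷ w) refl → refl , tt }
  ; complete = λ _ _ _ _ → refl
  ; poly = pt-caseL (pt-const nothing) (pt-just ∙ pt-snd) }

-- Serves the direction bit, which a switch does not have. A missing bit is stored as `false`, so
-- that every action has exactly one raw form.
optP : ∀ {E} → (El E → Bool) → Parser E Bo
optP {E} c p = if c (proj₁ p) then bitP {E} p else just (false , proj₂ p)

optEnc : Bool → Bool → List Bool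
optEnc true  b = b ∷ []
optEnc false b = []

opt-parses : ∀ {E c} → PT E Bo c → Parses E Bo (optP {E} c) (λ e → optEnc (c e)) (λ e b → c e ≡ false → b ≡ false)
opt-parses {E} {c} pc = record { sound = snd ; complete = cmp ; poly = pt-if (pc ∙ pt-fst) (poly (bit-parses {E})) (pt-just ∙ (pt-const false & pt-snd)) }
  where
  snd : ∀ e w {x w'} → optP {E} c (e , w) ≡ just (x , w') → (w ≡ optEnc (c e) x ++ w') × (c e ≡ false → x ≡ false)
  snd e w h with c e
  snd e (b ∷ w) refl | true  = refl , λ ()
  snd e w       refl | false = refl , λ _ → refl
  cmp : ∀ e x w' → (c e ≡ false → x ≡ false) → optP {E} c (e , optEnc (c e) x ++ w') ≡ just (x , w')
  cmp e x w' v with c e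
  ... | true  = refl
  ... | false = cong (λ b → just (b , w')) (sym (v refl))

seqP : ∀ {E Y Z} → Parser E Y → Parser (E ⊠ Y) Z → Parser E (Y ⊠ Z)
seqP p q = andThen p (andThen (λ a → q ((proj₁ (proj₁ a) , proj₁ (proj₂ a)) , proj₂ (proj₂ a)))
                              (λ a → just ((proj₁ (proj₂ (proj₁ a)) , proj₁ (proj₂ a)) , proj₂ (proj₂ a))))

seq-parses : ∀ {E Y Z p q en en' V V'} → Parses E Y p en V → Parses (E ⊠ Y) Z q en' V' →
  Parses E (Y ⊠ Z) (seqP {E} {Y} {Z} p q) (λ e x → en e (proj₁ x) ++ en' (e , proj₁ x) (proj₂ x)) (λ e x → V e (proj₁ x) × V' (e , proj₁ x) (proj₂ x))
seq-parses {E} {Y} {Z} {p} {q} {en} {en'} {V} {V'} P Q = record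
  { sound = snd ; complete = cmp
  ; poly = pt-andThen (poly P) (pt-andThen (poly Q ∙ (((pt-fst ∙ pt-fst) & (pt-fst ∙ pt-snd)) & (pt-snd ∙ pt-snd)))
             (pt-just ∙ (((pt-fst ∙ pt-snd ∙ pt-fst) & (pt-fst ∙ pt-snd)) & (pt-snd ∙ pt-snd)))) }
  where
  g : (El E × List Bool) × (El Y × List Bool) → Maybe (El Z × List Bool)
  g a = q ((proj₁ (proj₁ a) , proj₁ (proj₂ a)) , proj₂ (proj₂ a))
  k : ((El E × List Bool) × (El Y × List Bool)) × (El Z × List Bool) → Maybe ((El Y × El Z) × List Bool)
  k a = just ((proj₁ (proj₂ (proj₁ a)) , proj₁ (proj₂ a)) , proj₂ (proj₂ a))
  snd : ∀ e w {x w'} → seqP {E} {Y} {Z} p q (e , w) ≡ just (x , w') →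
    (w ≡ (en e (proj₁ x) ++ en' (e , proj₁ x) (proj₂ x)) ++ w') × (V e (proj₁ x) × V' (e , proj₁ x) (proj₂ x))
  snd e w h with andThen-inv p (andThen g k) (e , w) h
  ... | (y , w₁) , e₁ , h₁ with andThen-inv g k ((e , w) , (y , w₁)) h₁
  ... | (z , w₂) , e₂ , refl with sound P e w e₁ | sound Q (e , y) w₁ e₂
  ... | a , v | b , v' = trans a (trans (cong (en e y ++_) b) (sym (LP.++-assoc (en e y) (en' (e , y) z) w₂))) , (v , v')
  cmp : ∀ e x w' → (V e (proj₁ x) × V' (e , proj₁ x) (proj₂ x)) → seqP {E} {Y} {Z} p q (e , (en e (proj₁ x) ++ en' (e , proj₁ x) (proj₂ x)) ++ w') ≡ just (x , w')
  cmp e (y , z) w' (v , v') = andThen-just p (andThen g k) (e , (en e y ++ en' (e , y) z) ++ w')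
    (trans (cong (λ l → p (e , l)) (LP.++-assoc (en e y) (en' (e , y) z) w')) (complete P e y (en' (e , y) z ++ w') v))
    (andThen-just g k _ (complete Q (e , y) z w' v') refl)

-- The count comes from fields parsed earlier. `frugal` keeps the parsed items linear in the bits
-- they consume, which yields the size bound that recursion on the count requires.
module Many {E Y : Ty} {p : Parser E Y} {en : El E → El Y → List Bool} {V : El E → El Y → Set} (P : Parses E Y p en V)
            {cnt : El E → ℕ} (pc : PT E Nat cnt) (C : ℕ) (frugal : ∀ e x → V e x → sz Y x + 1 ≤ C * length (en e x)) where

  S : Set
  S = Maybe (List (El Y) × List Bool)

  stepM : El E → S → S
  stepM e m = caseM (λ _ → nothing) (andThen (λ a → p (proj₁ a , proj₂ (proj₂ a))) (λ b → just (proj₁ (proj₂ b) ∷ proj₁ (proj₂ (proj₁ b)) , proj₂ (proj₂ b)))) (e , m)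

  states : (El E × List Bool) × ℕ → S
  states a = itr (stepM (proj₁ (proj₁ a))) (proj₂ a) (just ([] , proj₂ (proj₁ a)))

  manyP : Parser E (Li Y)
  manyP a = andThen (λ a → states (a , cnt (proj₁ a))) (λ b → just (reverse (proj₁ (proj₂ b)) , proj₂ (proj₂ b))) a

  itr-nothing : ∀ e n → itr (stepM e) n nothing ≡ nothing
  itr-nothing e zero    = refl
  itr-nothing e (suc n) rewrite itr-nothing e n = refl

  many-complete : ∀ e xs acc w' → All (V e) xs → itr (stepM e) (length xs) (just (acc , concat (map (en e) xs) ++ w')) ≡ just (xs ʳ++ acc , w')
  many-complete e []       acc w' []       = refl
  many-complete e (x ∷ xs) acc w' (v ∷ vs) = trans (itr-suc (stepM e) (length xs) _)
    (trans (cong (itr (stepM e) (length xs)) (andThen-just (λ a → p (proj₁ a , proj₂ (proj₂ a))) _ (e , _)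
        (trans (cong (λ l → p (e , l)) (LP.++-assoc (en e x) (concat (map (en e) xs)) w')) (complete P e x _ v)) refl))
      (many-complete e xs (x ∷ acc) w' vs))

  record Front (e : El E) (n : ℕ) (acc : List (El Y)) (w : List Bool) (acc' : List (El Y)) (w' : List Bool) : Set where
    constructor front
    field
      xs   : List (El Y)
      len  : length xs ≡ n
      acc≡ : acc' ≡ xs ʳ++ acc
      w≡   : w ≡ concat (map (en e) xs) ++ w'
      ok   : All (V e) xs

  many-sound : ∀ e n acc w {acc' w'} → itr (stepM e) n (just (acc , w)) ≡ just (acc' , w') → Front e n acc w acc' w'
  many-sound e zero    acc w refl = front [] refl refl refl []
  many-sound e (suc n) acc w h = go _ refl (trans (sym (itr-suc (stepM e) n _)) h)
    where
    go : ∀ m {acc' w'} → stepM e (just (acc , w)) ≡ m → itr (stepM e) n m ≡ just (acc' , w') → Front e (suc n) acc w acc' w'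
    go nothing s h with trans (sym (itr-nothing e n)) h
    ... | ()
    go (just (acc₁ , w₁)) s h with andThen-inv (λ a → p (proj₁ a , proj₂ (proj₂ a))) _ (e , acc , w) s
    ... | (x , w₂) , ex , refl with sound P e w ex | many-sound e n (x ∷ acc) w₂ h
    ... | we , v | front xs len acc≡ w≡ ok =
      front (x ∷ xs) (cong suc len) acc≡ (trans we (trans (cong (en e x ++_) w≡) (sym (LP.++-assoc (en e x) _ _)))) (v ∷ ok)

  sz-items : ∀ e xs → All (V e) xs → sz (Li Y) xs ≤ 1 + C * length (concat (map (en e) xs))
  sz-items e []       []       = s≤s z≤n
  sz-items e (x ∷ xs) (v ∷ vs) = ≤-trans (≤-reflexive (lem (sz Y x) (sz (Li Y) xs))) (≤-trans (+-mono-≤ (frugal e x v) (sz-items e xs vs))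
    (≤-reflexive (trans (lem₂ C (length (en e x)) (length (concat (map (en e) xs)))) (cong (λ z → 1 + C * z) (sym (LP.length-++ (en e x)))))))
    where
    lem : ∀ a b → suc (a + b) ≡ a + 1 + b
    lem = solve-∀
    lem₂ : ∀ c a b → c * a + (1 + c * b) ≡ 1 + c * (a + b)
    lem₂ = solve-∀

  states-size : ∀ a n → sz (Ma (Li Y ⊠ Li Bo)) (states (a , n)) ≤ 6 + (C + 4) * sz (E ⊠ Li Bo) a
  states-size (e , w) n with states ((e , w) , n) in eq
  ... | nothing = s≤s z≤n
  ... | just (acc , w') with many-sound e n [] w eq
  ... | front xs len refl refl ok =
    ≤-trans (s≤s (s≤s (s≤s (+-mono-≤ (≤-trans (≤-trans (≤-by 1 (trans (sz-ʳ++ Y xs []) refl)) (≤-reflexive (+-comm (sz (Li Y) xs) 1))) (s≤s (sz-items e xs ok))) (sz-bits w')))))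
    (≤-trans (≤-reflexive (lem C (length (concat (map (en e) xs))) (length w')))
    (+-monoʳ-≤ 6 (≤-trans (+-mono-≤ (*-monoʳ-≤ C a≤) (*-monoʳ-≤ 4 b≤)) (≤-reflexive (sym (*-distribʳ-+ _ C 4))))))
    where
    L : List Bool
    L = concat (map (en e) xs) ++ w'
    tot : length (concat (map (en e) xs)) + length w' ≤ sz (E ⊠ Li Bo) (e , L)
    tot = ≤-trans (≤-reflexive (sym (LP.length-++ (concat (map (en e) xs))))) (≤-trans (length≤sz Bo L) (≤-trans (m≤n+m _ (sz E e)) (n≤1+n _)))
    a≤ : length (concat (map (en e) xs)) ≤ sz (E ⊠ Li Bo) (e , L)
    a≤ = ≤-trans (m≤m+n _ _) tot
    b≤ : length w' ≤ sz (E ⊠ Li Bo) (e , L)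
    b≤ = ≤-trans (m≤n+m _ _) tot
    lem : ∀ c a b → suc (suc (suc (1 + (1 + c * a) + (4 * b + 1)))) ≡ 6 + (c * a + 4 * b)
    lem = solve-∀

  pt-states : PT ((E ⊠ Li Bo) ⊠ Nat) (Ma (Li Y ⊠ Li Bo)) states
  pt-states = pt-recℕ (E ⊠ Li Bo) (Ma (Li Y ⊠ Li Bo)) states
    (pt-just ∙ (pt-const [] & pt-snd))
    (pt-caseM (pt-const nothing) (pt-andThen (poly P ∙ (pt-fst & (pt-snd ∙ pt-snd)))
        (pt-just ∙ (((pt-fst ∙ pt-snd) ∷P (pt-fst ∙ pt-snd ∙ pt-fst)) & (pt-snd ∙ pt-snd))))
      ∙ ((pt-fst ∙ pt-fst) & (pt-snd ∙ pt-snd)))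
    (λ _ → refl) (λ _ _ → refl) (con 6 ⊕ (con C ⊕ con 4) ⊗ X)
    (λ a n → ≤-trans (states-size a n) (+-monoʳ-≤ 6 (*-monoʳ-≤ (C + 4) (m≤m+n _ _))))

  many-parses : Parses E (Li Y) manyP (λ e xs → concat (map (en e) xs)) (λ e xs → length xs ≡ cnt e × All (V e) xs)
  many-parses = record
    { sound = λ e w h → snd e w h
    ; complete = λ { e xs w' (len , ok) → andThen-just (λ a → states (a , cnt (proj₁ a))) _ (e , concat (map (en e) xs) ++ w')
        (trans (cong (λ n → itr (stepM e) n (just ([] , concat (map (en e) xs) ++ w'))) (sym len)) (many-complete e xs [] w' ok))
        (cong (λ l → just (l , w')) (trans (cong reverse (LP.ʳ++-defn xs)) (trans (cong reverse (LP.++-identityʳ (reverse xs))) (LP.reverse-involutive xs)))) }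
    ; poly = pt-andThen (pt-states ∙ (pt-id & (pc ∙ pt-fst))) (pt-just ∙ ((pt-reverse ∙ pt-fst ∙ pt-snd) & (pt-snd ∙ pt-snd))) }
    where
    snd : ∀ e w {x w'} → manyP (e , w) ≡ just (x , w') → (w ≡ concat (map (en e) x) ++ w') × (length x ≡ cnt e × All (V e) x)
    snd e w h with andThen-inv (λ a → states (a , cnt (proj₁ a))) _ (e , w) h
    ... | (acc , w₁) , e₁ , refl with many-sound e (cnt e) [] w e₁
    ... | front xs len refl w≡ ok = subst (λ l → (w ≡ concat (map (en e) l) ++ w₁) × (length l ≡ cnt e × All (V e) l))
      (sym (trans (cong reverse (LP.ʳ++-defn xs)) (trans (cong reverse (LP.++-identityʳ (reverse xs))) (LP.reverse-involutive xs)))) (w≡ , (len , ok))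

-- Tests and list access on encoded data

listCase : ∀ {Y B : Set} → B → (Y × List Y → B) → List Y → B
listCase z s xs = caseL {⊤} (λ _ → z) (λ p → s (proj₂ p)) (tt , xs)

pt-listCase : ∀ {Y B} (z : El B) {s : El Y × List (El Y) → El B} → PT (Y ⊠ Li Y) B s → PT (Li Y) B (listCase z s)
pt-listCase {Y} {B} z {s} p = pt-caseL {Un} {Y} {B} {λ _ → z} {λ p → s (proj₂ p)} (pt-const z) (p ∙ pt-snd) ∙ (pt-const tt & pt-id {Li Y})

pt-isZero : PT Nat Bo isZero
pt-isZero = pt-ext {f = λ n → listCase true (λ _ → false) (replicate n tt)} (λ { zero → refl ; (suc _) → refl })
  (pt-listCase {Un} {Bo} true (pt-const false) ∙ pt-coe cdℕ-replicate)

pt-monus : PT (Nat ⊠ Nat) Nat (λ p → proj₁ p ∸ proj₂ p)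
pt-monus = pt-recℕ Nat Nat (λ p → proj₁ p ∸ proj₂ p) pt-id (pt-pred ∙ pt-snd ∙ pt-snd) (λ _ → refl)
  (λ m n → sym (ℕP.pred[m∸n]≡m∸[1+n] m n)) X
  (λ m n → ≤-trans (≤-trans (≤-reflexive (sz-ℕ (m ∸ n))) (≤-trans (s≤s (*-monoʳ-≤ 2 (ℕP.m∸n≤m m n))) (≤-reflexive (sym (sz-ℕ m))))) (m≤m+n _ _))

leB ltB eqB : ℕ → ℕ → Bool
leB m n = isZero (m ∸ n)
ltB m n = leB (suc m) n
eqB m n = if leB m n then leB n m else false

leB-sound : ∀ {m n} → leB m n ≡ true → m ≤ n
leB-sound {m} {n} e = ℕP.m∸n≡0⇒m≤n (zero-of (m ∸ n) e)
  where
  zero-of : ∀ k → isZero k ≡ true → k ≡ 0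
  zero-of zero _ = refl

leB-complete : ∀ {m n} → m ≤ n → leB m n ≡ true
leB-complete h = cong isZero (ℕP.m≤n⇒m∸n≡0 h)

eqB-sound : ∀ {m n} → eqB m n ≡ true → m ≡ n
eqB-sound {m} {n} e with leB m n in e₁
... | true = ℕP.≤-antisym (leB-sound e₁) (leB-sound e)

eqB-complete : ∀ {m n} → m ≡ n → eqB m n ≡ true
eqB-complete {m} refl rewrite leB-complete (≤-refl {m}) = refl

module _ {A : Ty} {f g : El A → ℕ} (p : PT A Nat f) (q : PT A Nat g) where

  pt-leB : PT A Bo (λ a → leB (f a) (g a))
  pt-leB = pt-isZero ∙ pt-monus ∙ (p & q)

  pt-geB : PT A Bo (λ a → leB (g a) (f a))
  pt-geB = pt-isZero ∙ pt-monus ∙ (q & p)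

  pt-ltB : PT A Bo (λ a → ltB (f a) (g a))
  pt-ltB = pt-isZero ∙ pt-monus ∙ ((pt-suc ∙ p) & q)

  pt-eqB : PT A Bo (λ a → eqB (f a) (g a))
  pt-eqB = pt-if pt-leB pt-geB (pt-const false)

allB : ∀ {E Y : Set} → (E × Y → Bool) → E × List Y → Bool
allB f (e , [])     = true
allB f (e , x ∷ xs) = if f (e , x) then allB f (e , xs) else false

allB-sound : ∀ {E Y : Set} (f : E × Y → Bool) e xs → allB f (e , xs) ≡ true → All (λ x → f (e , x) ≡ true) xs
allB-sound f e []       h = []
allB-sound f e (x ∷ xs) h with f (e , x) in eq
... | true = eq ∷ allB-sound f e xs h

allB-complete : ∀ {E Y : Set} (f : E × Y → Bool) e xs → All (λ x → f (e , x) ≡ true) xs → allB f (e , xs) ≡ true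
allB-complete f e []       []       = refl
allB-complete f e (x ∷ xs) (h ∷ hs) rewrite h = allB-complete f e xs hs

pt-allB : ∀ {E Y f} → PT (E ⊠ Y) Bo f → PT (E ⊠ Li Y) Bo (allB f)
pt-allB {E} {Y} {f} p = pt-rec E Y Bo (allB f) (pt-const true)
  (pt-if (p ∙ (pt-fst & (pt-fst ∙ pt-snd))) (pt-snd ∙ pt-snd ∙ pt-snd) (pt-const false))
  (λ _ → refl) (λ _ _ _ → refl) (con 3) (λ e xs → sz-Bool (allB f (e , xs)))

tailL : ∀ {A : Set} → List A → List A
tailL []       = []
tailL (x ∷ xs) = xs

dropL : ∀ {A : Set} → ℕ → List A → List A
dropL n xs = itr tailL n xs

headL : ∀ {A : Set} → A → List A → A
headL d []      = d
headL d (x ∷ _) = x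

nthL : ∀ {A : Set} → A → List A → ℕ → A
nthL d xs n = headL d (dropL n xs)

abstract
  pt-tailL : ∀ {A} → PT (Li A) (Li A) tailL
  pt-tailL = mkPT tlF linPol (λ { [] → refl ; (_ ∷ _) → refl }) (λ _ → ≤-refl)

pt-headL : ∀ {A} d → PT (Li A) A (headL d)
pt-headL {A} d = pt-ext {f = listCase d proj₁} (λ { [] → refl ; (_ ∷ _) → refl }) (pt-listCase {A} {A} d pt-fst)

sz-tailL : ∀ A (xs : List (El A)) → sz (Li A) (tailL xs) ≤ sz (Li A) xs
sz-tailL A []       = ≤-refl
sz-tailL A (x ∷ xs) = ≤-trans (m≤n+m _ (sz A x)) (n≤1+n _)

sz-dropL : ∀ A n (xs : List (El A)) → sz (Li A) (dropL n xs) ≤ sz (Li A) xs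
sz-dropL A zero    xs = ≤-refl
sz-dropL A (suc n) xs = ≤-trans (sz-tailL A (dropL n xs)) (sz-dropL A n xs)

pt-dropL : ∀ {A} → PT (Li A ⊠ Nat) (Li A) (λ p → dropL (proj₂ p) (proj₁ p))
pt-dropL {A} = pt-recℕ (Li A) (Li A) (λ p → dropL (proj₂ p) (proj₁ p)) pt-id (pt-tailL ∙ pt-snd ∙ pt-snd)
  (λ _ → refl) (λ _ _ → refl) X (λ xs n → ≤-trans (sz-dropL A n xs) (m≤m+n _ _))

pt-nthL : ∀ {A B f g} d → PT B (Li A) f → PT B Nat g → PT B A (λ b → nthL d (f b) (g b))
pt-nthL d p q = pt-headL d ∙ pt-dropL ∙ (p & q)

nthL-suc : ∀ {A : Set} (d : A) x xs n → nthL d (x ∷ xs) (suc n) ≡ nthL d xs n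
nthL-suc d x xs n = cong (headL d) (itr-suc tailL n (x ∷ xs))

nthL-tabulate : ∀ {A : Set} (d : A) {n} (f : Fin n → A) i → nthL d (tabulate f) (toℕ i) ≡ f i
nthL-tabulate d f zero    = refl
nthL-tabulate d f (suc i) = trans (nthL-suc d (f zero) _ (toℕ i)) (nthL-tabulate d (f ∘ suc) i)

map-allFin : ∀ {A : Set} n (f : Fin n → A) → map f (allFin n) ≡ tabulate f
map-allFin n f = LP.map-tabulate id f

-- Raw instances: numbers and lists only

ActT RowT EnvT RawT : Ty
ActT = Bo ⊠ Nat ⊠ Nat ⊠ Bo
RowT = Li ActT
EnvT = ((((((Un ⊠ Nat) ⊠ Li Bo) ⊠ Nat) ⊠ Nat) ⊠ Nat) ⊠ Nat) ⊠ Nat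
RawT = Nat ⊠ Li Bo ⊠ Nat ⊠ Nat ⊠ Nat ⊠ Nat ⊠ Nat ⊠ Li RowT

RAct Raw : Set
RAct = El ActT
Raw  = El RawT

tagOf : ∀ {E : Set} → ((E × Bool) × ℕ) × ℕ → Bool
tagOf e = proj₂ (proj₁ (proj₁ e))

act-parses : ∀ {E} → Parses E ActT _ _ _
act-parses {E} = seq-parses {E} bit-parses (seq-parses unary-parses (seq-parses unary-parses
  (opt-parses {((E ⊠ Bo) ⊠ Nat) ⊠ Nat} {tagOf} (pt-snd ∙ pt-fst ∙ pt-fst))))

encRAct : RAct → List Bool
encRAct (t , q , x , d) = (t ∷ []) ++ (unary q ++ (unary x ++ optEnc t d))

WFAct : RAct → Set
WFAct (t , q , x , d) = ⊤ × (⊤ × (⊤ × (t ≡ false → d ≡ false)))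

length-unary : ∀ n → length (unary n) ≡ suc n
length-unary zero    = refl
length-unary (suc n) = cong suc (length-unary n)

frugal-act : ∀ (a : RAct) → sz ActT a + 1 ≤ 4 * length (encRAct a)
frugal-act (t , q , x , d) = ≤-trans
  (+-monoˡ-≤ 1 (s≤s (+-mono-≤ (sz-Bool t) (s≤s (+-mono-≤ (≤-reflexive (sz-ℕ q)) (s≤s (+-mono-≤ (≤-reflexive (sz-ℕ x)) (sz-Bool d))))))))
  (≤-trans (≤-by (2 * q + 2 * x) (lem q x)) (*-monoʳ-≤ 4 len))
  where
  lem : ∀ q x → suc (3 + suc (1 + 2 * q + suc (1 + 2 * x + 3))) + 1 + (2 * q + 2 * x) ≡ 4 * (1 + (suc q + suc x))
  lem = solve-∀
  len : 1 + (suc q + suc x) ≤ length (encRAct (t , q , x , d))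
  len = s≤s (≤-trans (+-mono-≤ (≤-reflexive (sym (length-unary q))) (≤-trans (≤-reflexive (sym (length-unary x)))
    (≤-trans (m≤m+n _ _) (≤-reflexive (sym (LP.length-++ (unary x))))))) (≤-reflexive (sym (LP.length-++ (unary q)))))

encRow : El RowT → List Bool
encRow r = concat (map encRAct r)

σ-of s-of : El EnvT → ℕ
σ-of e = proj₂ (proj₁ (proj₁ (proj₁ (proj₁ e))))
s-of e = proj₂ (proj₁ (proj₁ (proj₁ e)))

module ActM = Many (act-parses {EnvT}) {suc ∘ σ-of} (pt-suc ∙ pt-snd ∙ pt-fst ∙ pt-fst ∙ pt-fst ∙ pt-fst) 4 (λ e a _ → frugal-act a)

frugal-row : ∀ e r → (length r ≡ suc (σ-of e) × All WFAct r) → sz RowT r + 1 ≤ 6 * length (encRow r)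
-- A row holds `suc σ'` actions, so its code is nonempty and pays for the additive 2; thus the
-- factor 4 becomes 6.
frugal-row e r@(a ∷ r') (len , ok) = ≤-trans (+-monoˡ-≤ 1 (ActM.sz-items e r ok))
  (≤-trans (≤-reflexive (lem (length (encRow r)))) (≤-trans (+-monoˡ-≤ (4 * length (encRow r)) (*-monoʳ-≤ 2 {1} pos)) (≤-reflexive (lem₂ (length (encRow r))))))
  where
  pos : 1 ≤ length (encRow r)
  pos = s≤s z≤n
  lem : ∀ n → 1 + 4 * n + 1 ≡ 2 * 1 + 4 * n
  lem = solve-∀
  lem₂ : ∀ n → 2 * n + 4 * n ≡ 6 * n
  lem₂ = solve-∀

module RowM = Many ActM.many-parses {s-of} (pt-snd ∙ pt-fst ∙ pt-fst ∙ pt-fst) 6 frugal-row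
module BitM = Many (bit-parses {Un ⊠ Nat}) {suc ∘ proj₂} (pt-suc ∙ pt-snd) 4 (λ e b _ → +-monoˡ-≤ 1 (sz-Bool b))

raw-parses : Parses Un RawT _ _ _
raw-parses = seq-parses {Un} unary-parses (seq-parses BitM.many-parses (seq-parses unary-parses (seq-parses unary-parses
  (seq-parses unary-parses (seq-parses unary-parses (seq-parses unary-parses RowM.many-parses))))))

encRaw : Raw → List Bool
encRaw (n' , Q , σ' , s , qi , qa , qr , tab) =
  unary n' ++ (concat (map (λ b → b ∷ []) Q) ++ (unary σ' ++ (unary s ++ (unary qi ++ (unary qa ++ (unary qr ++ concat (map encRow tab)))))))

WFRaw : Raw → Set
WFRaw (n' , Q , σ' , s , qi , qa , qr , tab) = length Q ≡ suc n' × (length tab ≡ s × All (λ r → length r ≡ suc σ' × All WFAct r) tab)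

nullB : List Bool → Bool
nullB []      = true
nullB (_ ∷ _) = false

pt-nullB : PT (Li Bo) Bo nullB
pt-nullB = pt-ext {f = listCase true (λ _ → false)} (λ { [] → refl ; (_ ∷ _) → refl }) (pt-listCase {Bo} {Bo} true (pt-const false))

all-⊤ : ∀ {A : Set} (l : List A) → All (λ _ → ⊤) l
all-⊤ []      = []
all-⊤ (_ ∷ l) = tt ∷ all-⊤ l

rawP : Parser Un RawT
rawP = seqP {Un} unaryP (seqP BitM.manyP (seqP unaryP (seqP unaryP (seqP unaryP (seqP unaryP (seqP unaryP RowM.manyP))))))

atEnd : List Bool × (Raw × List Bool) → Maybe Raw
atEnd a = if nullB (proj₂ (proj₂ a)) then just (proj₁ (proj₂ a)) else nothing

parse : List Bool → Maybe Raw
parse = andThen (λ w → rawP (tt , w)) atEnd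

pt-parse : PT (Li Bo) (Ma RawT) parse
pt-parse = pt-andThen (poly raw-parses ∙ (pt-const tt & pt-id)) (pt-if (pt-nullB ∙ pt-snd ∙ pt-snd) (pt-just ∙ pt-fst ∙ pt-snd) (pt-const nothing))

parse-sound : ∀ w d → parse w ≡ just d → w ≡ encRaw d × WFRaw d
parse-sound w d h with andThen-inv (λ w → rawP (tt , w)) atEnd w h
parse-sound w d h | (d' , []) , e , refl with sound raw-parses tt w e
... | we , (_ , (lq , _) , _ , _ , _ , _ , _ , tb) = trans we (LP.++-identityʳ _) , lq , tb

parse-complete : ∀ d → WFRaw d → parse (encRaw d) ≡ just d
parse-complete d@(n' , Q , rest) (lq , tb) = andThen-just (λ w → rawP (tt , w)) atEnd (encRaw d) {d , []}
  (trans (cong (λ w → rawP (tt , w)) (sym (LP.++-identityʳ (encRaw d)))) (complete raw-parses tt d [] (tt , (lq , all-⊤ Q) , tt , tt , tt , tt , tt , tb))) refl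

rawAction : ∀ {n σ s} → Action n σ s → RAct
rawAction (write q b minus1) = true , toℕ q , toℕ b , false
rawAction (write q b plus1)  = true , toℕ q , toℕ b , true
rawAction (switch q i)       = false , toℕ q , toℕ i , false

encAction-raw : ∀ {n σ s} (a : Action n σ s) → encAction a ≡ encRAct (rawAction a)
encAction-raw (write q b minus1) = refl
encAction-raw (write q b plus1)  = refl
encAction-raw (switch q i)       = cong (λ l → false ∷ (unary (toℕ q) ++ l)) (sym (LP.++-identityʳ (unary (toℕ i))))

rawI : Instance → Raw
rawI I = n' , map encQ (toList Q) , σ' , s , toℕ qinit , toℕ qacc , toℕ qrej ,
         map (λ q → map (λ a → rawAction (δ q a)) (allFin (suc σ'))) (allFin s)
  where
  open Instance I
  open NDTM T

concat-singles : ∀ {A : Set} (l : List A) → concat (map (λ b → b ∷ []) l) ≡ l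
concat-singles []      = refl
concat-singles (x ∷ l) = cong (x ∷_) (concat-singles l)

encode-raw : ∀ I → encode I ≡ encRaw (rawI I)
encode-raw I = cong (unary n' ++_) (cong₂ _++_ (sym (concat-singles (map encQ (toList Q))))
    (cong (λ l → unary σ' ++ (unary s ++ (unary (toℕ qinit) ++ (unary (toℕ qacc) ++ (unary (toℕ qrej) ++ l))))) table))
  where
  open Instance I
  open NDTM T
  row : ∀ q → concat (map (λ a → encAction (δ q a)) (allFin (suc σ'))) ≡ encRow (map (λ a → rawAction (δ q a)) (allFin (suc σ')))
  row q = cong concat (trans (LP.map-cong (λ a → encAction-raw (δ q a)) (allFin (suc σ'))) (LP.map-∘ {g = encRAct} {f = λ a → rawAction (δ q a)} (allFin (suc σ'))))
  table : concat (map (λ q → concat (map (λ a → encAction (δ q a)) (allFin (suc σ')))) (allFin s)) ≡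
          concat (map encRow (map (λ q → map (λ a → rawAction (δ q a)) (allFin (suc σ'))) (allFin s)))
  table = cong concat (trans (LP.map-cong row (allFin s)) (LP.map-∘ {g = encRow} {f = λ q → map (λ a → rawAction (δ q a)) (allFin (suc σ'))} (allFin s)))

WF-rawAction : ∀ {n σ s} (a : Action n σ s) → WFAct (rawAction a)
WF-rawAction (write q b minus1) = tt , tt , tt , λ _ → refl
WF-rawAction (write q b plus1)  = tt , tt , tt , λ ()
WF-rawAction (switch q i)       = tt , tt , tt , λ _ → refl

length-map-allFin : ∀ {A : Set} n (f : Fin n → A) → length (map f (allFin n)) ≡ n
length-map-allFin n f = trans (LP.length-map f (allFin n)) (LP.length-tabulate id)

All-tabulate : ∀ {A : Set} {P : A → Set} {n} (f : Fin n → A) → (∀ i → P (f i)) → All P (tabulate f)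
All-tabulate {n = zero}  f h = []
All-tabulate {n = suc n} f h = h zero ∷ All-tabulate (f ∘ suc) (h ∘ suc)

All-map-allFin : ∀ {A : Set} {P : A → Set} {n} (f : Fin n → A) → (∀ i → P (f i)) → All P (map f (allFin n))
All-map-allFin {P = P} {n} f h = subst (All P) (sym (map-allFin n f)) (All-tabulate f h)

All-tabulate⁻ : ∀ {A : Set} {P : A → Set} {n} (f : Fin n → A) → All P (tabulate f) → ∀ i → P (f i)
All-tabulate⁻ f (h ∷ _)  zero    = h
All-tabulate⁻ f (_ ∷ hs) (suc i) = All-tabulate⁻ (f ∘ suc) hs i

WF-rawI : ∀ I → WFRaw (rawI I)
WF-rawI I = trans (LP.length-map encQ (toList Q)) (VP.length-toList Q) , length-map-allFin s _ ,
  All-map-allFin _ (λ q → length-map-allFin (suc σ') _ , All-map-allFin _ (λ a → WF-rawAction (δ q a)))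
  where
  open Instance I
  open NDTM T

-- Parsing inverts the encoding. The conclusion is about `rawI`, where the transition function is
-- listed out as a table and equality is decided by the bits.
encode-injective : ∀ I I' → encode I ≡ encode I' → rawI I ≡ rawI I'
encode-injective I I' e = just-inj (trans (sym (parse-complete (rawI I) (WF-rawI I)))
  (trans (cong parse (trans (sym (encode-raw I)) (trans e (encode-raw I')))) (parse-complete (rawI I') (WF-rawI I'))))

-- Validity of raw instances

∧-inv : ∀ a {b} → a ∧ b ≡ true → a ≡ true × b ≡ true
∧-inv true e = refl , e

∧-intro : ∀ {a b} → a ≡ true → b ≡ true → a ∧ b ≡ true
∧-intro refl e = e

infixr 6 _∧P_
_∧P_ : ∀ {A f g} → PT A Bo f → PT A Bo g → PT A Bo (λ a → f a ∧ g a)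
_∧P_ {f = f} p q = pt-ext (λ a → eq (f a)) (pt-if p q (pt-const false))
  where
  eq : ∀ b {c} → (if b then c else false) ≡ b ∧ c
  eq true  = refl
  eq false = refl

sameB : Bool → Bool → Bool
sameB a b = if a then b else (if b then false else true)

changeB : Bool × List Bool → ℕ
changeB = caseL (λ _ → 0) (λ p → if sameB (proj₁ p) (proj₁ (proj₂ p)) then 0 else 1)

altB : List Bool → ℕ
altB []      = 1
altB (b ∷ l) = changeB (b , l) + altB l

sameB-encQ : ∀ q q' → sameB (encQ q) (encQ q') ≡ sameQ q q'
sameB-encQ exQ  exQ  = refl
sameB-encQ exQ  allQ = refl
sameB-encQ allQ exQ  = refl
sameB-encQ allQ allQ = refl

altB-alt : ∀ {n} (Q : Vec Quant (suc n)) → altB (map encQ (toList Q)) ≡ alt Q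
altB-alt (q ∷ [])     = refl
altB-alt (q ∷ q' ∷ Q) = cong₂ (λ b n → (if b then 0 else 1) + n) (sameB-encQ q q') (altB-alt (q' ∷ Q))

pt-sameB : ∀ {A f g} → PT A Bo f → PT A Bo g → PT A Bo (λ a → sameB (f a) (g a))
pt-sameB p q = pt-if p q (pt-if q (pt-const false) (pt-const true))

changeB≤ : ∀ b l → changeB (b , l) ≤ 1
changeB≤ b []      = z≤n
changeB≤ b (c ∷ l) with sameB b c
... | true  = z≤n
... | false = ≤-refl

altB≤ : ∀ l → altB l ≤ 1 + length l
altB≤ []      = ≤-refl
altB≤ (b ∷ l) = +-mono-≤ (changeB≤ b l) (altB≤ l)

pt-altB : PT (Li Bo) Nat altB
pt-altB = pt-rec Un Bo Nat (λ p → altB (proj₂ p)) (pt-const 1)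
    ((pt-caseL (pt-const 0) (pt-if (pt-sameB pt-fst (pt-fst ∙ pt-snd)) (pt-const 0) (pt-const 1)) ∙ ((pt-fst ∙ pt-snd) & (pt-fst ∙ pt-snd ∙ pt-snd)))
      +P (pt-snd ∙ pt-snd ∙ pt-snd))
    (λ _ → refl) (λ _ _ _ → refl) (con 3 ⊕ con 2 ⊗ X)
    (λ e l → ≤-trans (≤-reflexive (sz-ℕ (altB l))) (≤-trans (s≤s (*-monoʳ-≤ 2 (≤-trans (altB≤ l) (s≤s (length≤sz Bo l)))))
       (≤-trans (n≤1+n _) (s≤s (n≤1+n _)))))
  ∙ (pt-const tt & pt-id {Li Bo})

-- The third field is a symbol in a write and a tape in a switch, hence the two bounds.
actOK : (ℕ × (ℕ × ℕ)) × RAct → Bool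
actOK p = ltB (proj₁ (proj₂ (proj₂ p))) (proj₂ (proj₂ (proj₁ p))) ∧
  (if proj₁ (proj₂ p) then ltB (proj₁ (proj₂ (proj₂ (proj₂ p)))) (suc (proj₁ (proj₂ (proj₁ p))))
                      else ltB (proj₁ (proj₂ (proj₂ (proj₂ p)))) (suc (proj₁ (proj₁ p))))

stayOK : ℕ × RAct → Bool
stayOK p = if proj₁ (proj₂ p) then false
           else (eqB (proj₁ (proj₂ (proj₂ p))) (proj₁ p) ∧ isZero (proj₁ (proj₂ (proj₂ (proj₂ p)))))

pt-actOK : PT ((Nat ⊠ Nat ⊠ Nat) ⊠ ActT) Bo actOK
pt-actOK = pt-ltB (pt-fst ∙ pt-snd ∙ pt-snd) (pt-snd ∙ pt-snd ∙ pt-fst) ∧P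
  pt-if (pt-fst ∙ pt-snd) (pt-ltB (pt-fst ∙ pt-snd ∙ pt-snd ∙ pt-snd) (pt-suc ∙ pt-fst ∙ pt-snd ∙ pt-fst))
                          (pt-ltB (pt-fst ∙ pt-snd ∙ pt-snd ∙ pt-snd) (pt-suc ∙ pt-fst ∙ pt-fst))

pt-stayOK : PT (Nat ⊠ ActT) Bo stayOK
pt-stayOK = pt-if (pt-fst ∙ pt-snd) (pt-const false)
  (pt-eqB (pt-fst ∙ pt-snd ∙ pt-snd) pt-fst ∧P (pt-isZero ∙ pt-fst ∙ pt-snd ∙ pt-snd ∙ pt-snd))

rn rσ rs ri ra rr : Raw → ℕ
rn d = proj₁ d
rσ d = proj₁ (proj₂ (proj₂ d))
rs d = proj₁ (proj₂ (proj₂ (proj₂ d)))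
ri d = proj₁ (proj₂ (proj₂ (proj₂ (proj₂ d))))
ra d = proj₁ (proj₂ (proj₂ (proj₂ (proj₂ (proj₂ d)))))
rr d = proj₁ (proj₂ (proj₂ (proj₂ (proj₂ (proj₂ (proj₂ d))))))

rQ : Raw → List Bool
rQ d = proj₁ (proj₂ d)

rtab : Raw → List (List RAct)
rtab d = proj₂ (proj₂ (proj₂ (proj₂ (proj₂ (proj₂ (proj₂ d))))))

pt-rn : PT RawT Nat rn
pt-rn = pt-fst
pt-rQ : PT RawT (Li Bo) rQ
pt-rQ = pt-fst ∙ pt-snd
pt-rσ : PT RawT Nat rσ
pt-rσ = pt-fst ∙ pt-snd ∙ pt-snd
pt-rs : PT RawT Nat rs
pt-rs = pt-fst ∙ pt-snd ∙ pt-snd ∙ pt-snd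
pt-ri : PT RawT Nat ri
pt-ri = pt-fst ∙ pt-snd ∙ pt-snd ∙ pt-snd ∙ pt-snd
pt-ra : PT RawT Nat ra
pt-ra = pt-fst ∙ pt-snd ∙ pt-snd ∙ pt-snd ∙ pt-snd ∙ pt-snd
pt-rr : PT RawT Nat rr
pt-rr = pt-fst ∙ pt-snd ∙ pt-snd ∙ pt-snd ∙ pt-snd ∙ pt-snd ∙ pt-snd
pt-rtab : PT RawT (Li RowT) rtab
pt-rtab = pt-snd ∙ pt-snd ∙ pt-snd ∙ pt-snd ∙ pt-snd ∙ pt-snd ∙ pt-snd

valid : ℕ → Raw → Bool
valid j d = ltB (ri d) (rs d) ∧ ltB (ra d) (rs d) ∧ ltB (rr d) (rs d) ∧ headL false (rQ d) ∧ eqB (altB (rQ d)) j ∧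
  allB (allB actOK) ((rn d , rσ d , rs d) , rtab d) ∧
  allB stayOK (ra d , nthL [] (rtab d) (ra d)) ∧ allB stayOK (rr d , nthL [] (rtab d) (rr d))

pt-valid : ∀ j → PT RawT Bo (valid j)
pt-valid j = pt-ltB pt-ri pt-rs ∧P pt-ltB pt-ra pt-rs ∧P pt-ltB pt-rr pt-rs ∧P (pt-headL false ∙ pt-rQ) ∧P pt-eqB (pt-altB ∙ pt-rQ) (pt-const j) ∧P
  (pt-allB (pt-allB pt-actOK) ∙ ((pt-rn & pt-rσ & pt-rs) & pt-rtab)) ∧P
  (pt-allB pt-stayOK ∙ (pt-ra & pt-nthL [] pt-rtab pt-ra)) ∧P (pt-allB pt-stayOK ∙ (pt-rr & pt-nthL [] pt-rtab pt-rr))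

act-complete : ∀ {n σ s} (a : Action (suc n) (suc σ) s) → actOK ((n , σ , s) , rawAction a) ≡ true
act-complete (write q b minus1) = ∧-intro (leB-complete (FP.toℕ<n q)) (leB-complete (FP.toℕ<n b))
act-complete (write q b plus1)  = ∧-intro (leB-complete (FP.toℕ<n q)) (leB-complete (FP.toℕ<n b))
act-complete (switch q i)       = ∧-intro (leB-complete (FP.toℕ<n q)) (leB-complete (FP.toℕ<n i))

act-sound : ∀ {n σ s} (a : RAct) → WFAct a → actOK ((n , σ , s) , a) ≡ true → Σ (Action (suc n) (suc σ) s) λ b → rawAction b ≡ a
act-sound {n} {σ} {s} (true , q , x , false) wf h with ∧-inv (ltB q s) h
... | hq , hx = write (fromℕ< (leB-sound hq)) (fromℕ< (leB-sound hx)) minus1 , cong₂ (λ q x → true , q , x , false) (FP.toℕ-fromℕ< _) (FP.toℕ-fromℕ< _)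
act-sound {n} {σ} {s} (true , q , x , true) wf h with ∧-inv (ltB q s) h
... | hq , hx = write (fromℕ< (leB-sound hq)) (fromℕ< (leB-sound hx)) plus1 , cong₂ (λ q x → true , q , x , true) (FP.toℕ-fromℕ< _) (FP.toℕ-fromℕ< _)
-- Excluded by `WFAct`: a switch carries no direction.
act-sound (false , q , x , true) (_ , _ , _ , wf) h with wf refl
... | ()
act-sound {n} {σ} {s} (false , q , x , false) wf h with ∧-inv (ltB q s) h
... | hq , hx = switch (fromℕ< (leB-sound hq)) (fromℕ< (leB-sound hx)) , cong₂ (λ q x → false , q , x , false) (FP.toℕ-fromℕ< _) (FP.toℕ-fromℕ< _)

stay-complete : ∀ {n σ s} (q : Fin s) (a : Action (suc n) σ s) → a ≡ switch q zero → stayOK (toℕ q , rawAction a) ≡ true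
stay-complete q _ refl = ∧-intro (eqB-complete {toℕ q} refl) refl

stay-sound : ∀ {n σ s} (q : Fin s) (a : Action (suc n) σ s) → stayOK (toℕ q , rawAction a) ≡ true → a ≡ switch q zero
stay-sound q (switch q' zero) h = cong (λ q → switch q zero) (FP.toℕ-injective (eqB-sound (proj₁ (∧-inv (eqB (toℕ q') (toℕ q)) h))))
stay-sound q (switch q' (suc i)) h with proj₂ (∧-inv (eqB (toℕ q') (toℕ q)) h)
... | ()
stay-sound q (write _ _ minus1) ()
stay-sound q (write _ _ plus1) ()

row-of : ∀ I q → nthL [] (rtab (rawI I)) (toℕ q) ≡ tabulate (λ a → rawAction (NDTM.δ (Instance.T I) q a))
row-of I q = trans (cong (λ l → nthL [] l (toℕ q)) (map-allFin s _)) (trans (nthL-tabulate [] _ q) (map-allFin (suc σ') _))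
  where open NDTM (Instance.T I)

valid-complete : ∀ j I → Valid I → alt (Instance.Q I) ≡ j → valid j (rawI I) ≡ true
valid-complete j I (hq , ha , hr) al = ∧-intro (leB-complete (FP.toℕ<n qinit)) (∧-intro (leB-complete (FP.toℕ<n qacc)) (∧-intro (leB-complete (FP.toℕ<n qrej))
  (∧-intro (hd Q hq) (∧-intro (eqB-complete (trans (altB-alt Q) al))
  (∧-intro (allB-complete _ _ _ (All-map-allFin _ (λ q → allB-complete _ _ _ (All-map-allFin (λ a → rawAction (δ q a)) (λ a → act-complete (δ q a))))))
  (∧-intro (stays qacc ha) (stays qrej hr)))))))
  where
  open Instance I
  open NDTM T
  hd : ∀ {n} (Q : Vec Quant (suc n)) → head Q ≡ exQ → headL false (map encQ (toList Q)) ≡ true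
  hd (exQ ∷ Q) refl = refl
  stays : ∀ q → (∀ a → δ q a ≡ switch q zero) → allB stayOK (toℕ q , nthL [] (rtab (rawI I)) (toℕ q)) ≡ true
  stays q h = allB-complete stayOK (toℕ q) _ (subst (All _) (sym (row-of I q)) (All-tabulate (λ a → rawAction (δ q a)) (λ a → stay-complete q (δ q a) (h a))))

gather : ∀ {A B : Set} (f : B → A) {n} (xs : List A) → length xs ≡ n → All (λ a → Σ B λ b → f b ≡ a) xs →
  Σ (Fin n → B) λ g → tabulate (λ i → f (g i)) ≡ xs
gather f []       refl []             = (λ ()) , refl
gather {A} {B} f (x ∷ xs) refl ((b , e) ∷ hs) with gather f xs refl hs
... | g , eg = g' , cong₂ _∷_ e eg
  where
  g' : Fin (suc (length xs)) → B
  g' zero    = b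
  g' (suc i) = g i

gatherQ : ∀ {n} (l : List Bool) → length l ≡ n → Σ (Vec Quant n) λ Q → map encQ (toList Q) ≡ l
gatherQ []          refl = [] , refl
gatherQ (true ∷ l)  refl = let Q , e = gatherQ l refl in exQ ∷ Q , cong (true ∷_) e
gatherQ (false ∷ l) refl = let Q , e = gatherQ l refl in allQ ∷ Q , cong (false ∷_) e

zipAll : ∀ {A : Set} {P Q R : A → Set} {xs} → (∀ x → P x → Q x → R x) → All P xs → All Q xs → All R xs
zipAll f []       []       = []
zipAll f (p ∷ ps) (q ∷ qs) = f _ p q ∷ zipAll f ps qs

valid-sound : ∀ j d → WFRaw d → valid j d ≡ true → Σ Instance λ I → rawI I ≡ d × Valid I × alt (Instance.Q I) ≡ j
valid-sound j d@(n , Qb , σ , s , qi , qa , qr , tab) (lq , lt , rows) h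
  with ∧-inv (ltB qi s) h
... | hi , h₁ with ∧-inv (ltB qa s) h₁
... | ha , h₂ with ∧-inv (ltB qr s) h₂
... | hr , h₃ with ∧-inv (headL false Qb) h₃
... | hh , h₄ with ∧-inv (eqB (altB Qb) j) h₄
... | hal , h₅ with ∧-inv (allB (allB actOK) ((n , σ , s) , tab)) h₅
... | hact , h₆ with ∧-inv (allB stayOK (qa , nthL [] tab qa)) h₆
... | hsa , hsr with gatherQ Qb lq
... | Q , refl with gather {B = Fin (suc σ) → Action (suc n) (suc σ) s} (λ g → map (λ a → rawAction (g a)) (allFin (suc σ))) tab lt
      (zipAll (λ r wf ok → row r wf (allB-sound actOK (n , σ , s) r ok)) rows (allB-sound (allB actOK) (n , σ , s) tab hact))
  where
  row : ∀ r → (length r ≡ suc σ × All WFAct r) → All (λ a → actOK ((n , σ , s) , a) ≡ true) r →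
    Σ (Fin (suc σ) → Action (suc n) (suc σ) s) λ g → map (λ a → rawAction (g a)) (allFin (suc σ)) ≡ r
  row r (len , wf) ok with gather rawAction r len (zipAll act-sound wf ok)
  ... | g , e = g , trans (map-allFin (suc σ) _) e
... | δ , refl = I , cong₂ (λ a b → n , map encQ (toList Q) , σ , s , a , b) (FP.toℕ-fromℕ< _)
          (cong₂ (λ a b → a , b) (FP.toℕ-fromℕ< _) (cong₂ (λ a b → a , b) (FP.toℕ-fromℕ< _) (map-allFin s _))) ,
        (hd Q hh , stays (fromℕ< (leB-sound ha)) qa (FP.toℕ-fromℕ< _) hsa , stays (fromℕ< (leB-sound hr)) qr (FP.toℕ-fromℕ< _) hsr) ,
        trans (sym (altB-alt Q)) (eqB-sound hal)
  where
  I : Instance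
  I = record { n' = n ; Q = Q ; T = record { σ' = σ ; s = s ; qinit = fromℕ< (leB-sound hi) ; qacc = fromℕ< (leB-sound ha) ; qrej = fromℕ< (leB-sound hr) ; δ = δ } }
  hd : ∀ {n} (Q : Vec Quant (suc n)) → headL false (map encQ (toList Q)) ≡ true → head Q ≡ exQ
  hd (exQ ∷ Q) refl = refl
  stays : ∀ (q : Fin s) k → toℕ q ≡ k → allB stayOK (k , nthL [] (tabulate (λ q → map (λ a → rawAction (δ q a)) (allFin (suc σ)))) k) ≡ true → ∀ a → δ q a ≡ switch q zero
  stays q _ refl h a = stay-sound q (δ q a) (All-tabulate⁻ (λ a → rawAction (δ q a))
    (subst (All _) (trans (nthL-tabulate [] _ q) (map-allFin (suc σ) _)) (allB-sound stayOK (toℕ q) _ h)) a)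

-- Simulation of a raw instance on guessed words; tape contents are kept as a log of writes

LogT CfgT SimT : Ty
LogT = Li (Nat ⊠ Nat ⊠ Nat)
CfgT = Nat ⊠ Nat ⊠ Nat ⊠ LogT
SimT = RawT ⊠ Nat ⊠ Li Bo

Cfg SimE : Set
Cfg  = El CfgT
SimE = El SimT

countS : ℕ × List Bool → ℕ × List Bool
countS p = (if headL false (proj₂ p) then suc (proj₁ p) else proj₁ p) , tailL (proj₂ p)

countN : ℕ → List Bool → ℕ
countN k xs = proj₁ (itr countS k (0 , xs))

count-inv : ∀ k xs → proj₁ (itr countS k (0 , xs)) ≤ k × proj₂ (itr countS k (0 , xs)) ≡ dropL k xs
count-inv zero    xs = z≤n , refl
count-inv (suc k) xs with itr countS k (0 , xs) | count-inv k xs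
... | c , ys | ck , refl with headL false ys
... | true  = s≤s ck , refl
... | false = m≤n⇒m≤1+n ck , refl

pt-countN : PT (Li Bo ⊠ Nat) Nat (λ p → countN (proj₂ p) (proj₁ p))
pt-countN = pt-fst ∙ pt-recℕ (Li Bo) (Nat ⊠ Li Bo) (λ p → itr countS (proj₂ p) (0 , proj₁ p)) (pt-const 0 & pt-id)
    (pt-if (pt-headL false ∙ pt-snd ∙ pt-snd ∙ pt-snd) (pt-suc ∙ pt-fst ∙ pt-snd ∙ pt-snd) (pt-fst ∙ pt-snd ∙ pt-snd) & (pt-tailL ∙ pt-snd ∙ pt-snd ∙ pt-snd))
    (λ _ → refl) (λ _ _ → refl) (con 1 ⊕ X)
    (λ xs n → s≤s (≤-trans (+-mono-≤ (≤-trans (≤-reflexive (sz-ℕ _)) (≤-trans (s≤s (*-monoʳ-≤ 2 (proj₁ (count-inv n xs)))) (≤-reflexive (sym (sz-ℕ n)))))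
        (≤-trans (≤-reflexive (cong (sz (Li Bo)) (proj₂ (count-inv n xs)))) (sz-dropL Bo n xs))) (≤-reflexive (+-comm (sz Nat n) _))))

eRaw : SimE → Raw
eRaw e = proj₁ e

eN : SimE → ℕ
eN e = proj₁ (proj₂ e)

eG : SimE → List Bool
eG e = proj₂ (proj₂ e)

-- A symbol takes `rσ` bits of the guess and a word takes `eN` symbols, so cell `p` of tape `i`
-- begins at `(i * eN + p) * rσ`.
initSym : SimE × (ℕ × ℕ) → ℕ
initSym a = countN (rσ (eRaw (proj₁ a)))
  (dropL (proj₁ (proj₂ a) * (eN (proj₁ a) * rσ (eRaw (proj₁ a))) + proj₂ (proj₂ a) * rσ (eRaw (proj₁ a))) (eG (proj₁ a)))

pt-eσ : PT SimT Nat (rσ ∘ eRaw)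
pt-eσ = pt-rσ ∙ pt-fst

pt-initSym : PT (SimT ⊠ Nat ⊠ Nat) Nat initSym
pt-initSym = pt-countN ∙ ((pt-dropL ∙ ((pt-snd ∙ pt-snd ∙ pt-fst) & ((pt-fst ∙ pt-snd) *P ((pt-fst ∙ pt-snd ∙ pt-fst) *P (pt-eσ ∙ pt-fst)) +P (pt-snd ∙ pt-snd) *P (pt-eσ ∙ pt-fst)))) & (pt-eσ ∙ pt-fst))

hits : (SimE × (ℕ × ℕ)) × (ℕ × (ℕ × ℕ)) → Bool
hits a = eqB (proj₁ (proj₂ (proj₁ a))) (proj₁ (proj₂ a)) ∧ eqB (proj₂ (proj₂ (proj₁ a))) (proj₁ (proj₂ (proj₂ a)))

readSym : (SimE × (ℕ × ℕ)) × List (ℕ × (ℕ × ℕ)) → ℕ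
readSym (a , [])      = initSym a
readSym (a , w ∷ log) = if hits (a , w) then proj₂ (proj₂ w) else readSym (a , log)

readSym-size : ∀ a log → sz Nat (readSym (a , log)) ≤ eval (X ⊕ pol pt-initSym) (sz (SimT ⊠ Nat ⊠ Nat) a + sz LogT log)
readSym-size a [] = ≤-trans (size-bnd pt-initSym a) (≤-trans (eval-mono (pol pt-initSym) (m≤m+n _ 1)) (m≤n+m _ _))
readSym-size a (w ∷ log) with hits (a , w)
... | true  = ≤-trans (≤-trans (≤-trans (m≤n+m (sz Nat (proj₂ (proj₂ w))) (suc (sz Nat (proj₁ w) + suc (sz Nat (proj₁ (proj₂ w)))))) (≤-reflexive (lem (sz Nat (proj₁ w)) (sz Nat (proj₁ (proj₂ w))) (sz Nat (proj₂ (proj₂ w))))))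
                (≤-trans (≤-trans (m≤m+n _ (sz LogT log)) (n≤1+n _)) (m≤n+m _ (sz (SimT ⊠ Nat ⊠ Nat) a)))) (m≤m+n _ _)
  where
  lem : ∀ a b c → suc (a + suc b) + c ≡ suc (a + suc (b + c))
  lem = solve-∀
... | false = ≤-trans (readSym-size a log) (eval-mono (X ⊕ pol pt-initSym) (+-monoʳ-≤ (sz (SimT ⊠ Nat ⊠ Nat) a) (≤-trans (m≤n+m _ (sz (Nat ⊠ Nat ⊠ Nat) w)) (n≤1+n _))))

pt-readSym : PT ((SimT ⊠ Nat ⊠ Nat) ⊠ LogT) Nat readSym
pt-readSym = pt-rec (SimT ⊠ Nat ⊠ Nat) (Nat ⊠ Nat ⊠ Nat) Nat readSym pt-initSym
  (pt-if (pt-eqB (pt-fst ∙ pt-snd ∙ pt-fst) (pt-fst ∙ pt-fst ∙ pt-snd) ∧P pt-eqB (pt-snd ∙ pt-snd ∙ pt-fst) (pt-fst ∙ pt-snd ∙ pt-fst ∙ pt-snd))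
    (pt-snd ∙ pt-snd ∙ pt-fst ∙ pt-snd) (pt-snd ∙ pt-snd ∙ pt-snd))
  (λ _ → refl) (λ _ _ _ → refl) (X ⊕ pol pt-initSym) readSym-size

cq cj cp : Cfg → ℕ
cq c = proj₁ c
cj c = proj₁ (proj₂ c)
cp c = proj₁ (proj₂ (proj₂ c))

clog : Cfg → List (ℕ × (ℕ × ℕ))
clog c = proj₂ (proj₂ (proj₂ c))

noAct : RAct
noAct = false , 0 , 0 , false

actR : SimE × Cfg → RAct
actR a = nthL noAct (nthL [] (rtab (eRaw (proj₁ a))) (cq (proj₂ a))) (readSym ((proj₁ a , (cj (proj₂ a) , cp (proj₂ a))) , clog (proj₂ a)))

logged : (SimE × Cfg) × RAct → List (ℕ × (ℕ × ℕ))
logged a = (cj (proj₂ (proj₁ a)) , cp (proj₂ (proj₁ a)) , proj₁ (proj₂ (proj₂ (proj₂ a)))) ∷ clog (proj₂ (proj₁ a))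

applyR : (SimE × Cfg) × RAct → Cfg
applyR a = if proj₁ (proj₂ a)
  then (if proj₂ (proj₂ (proj₂ (proj₂ a)))
        then (proj₁ (proj₂ (proj₂ a)) , cj (proj₂ (proj₁ a)) , suc (cp (proj₂ (proj₁ a))) , logged a)
        else (if isZero (cp (proj₂ (proj₁ a)))
              then (rr (eRaw (proj₁ (proj₁ a))) , 0 , 0 , clog (proj₂ (proj₁ a)))
              else (proj₁ (proj₂ (proj₂ a)) , cj (proj₂ (proj₁ a)) , pred (cp (proj₂ (proj₁ a))) , logged a)))
  else (proj₁ (proj₂ (proj₂ a)) , proj₁ (proj₂ (proj₂ (proj₂ a))) , cp (proj₂ (proj₁ a)) , clog (proj₂ (proj₁ a)))

stepR : SimE → Cfg → Cfg
stepR e c = applyR ((e , c) , actR (e , c))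

startR : SimE → Cfg
startR e = ri (eRaw e) , 0 , 0 , []

runR : SimE × ℕ → Cfg
runR a = itr (stepR (proj₁ a)) (proj₂ a) (startR (proj₁ a))

accR : SimE → Bool
accR e = eqB (cq (runR (e , eN e))) (ra (eRaw e))

pt-cj : PT CfgT Nat cj
pt-cj = pt-fst ∙ pt-snd
pt-cp : PT CfgT Nat cp
pt-cp = pt-fst ∙ pt-snd ∙ pt-snd
pt-clog : PT CfgT LogT clog
pt-clog = pt-snd ∙ pt-snd ∙ pt-snd

pt-actR : PT (SimT ⊠ CfgT) ActT actR
pt-actR = pt-nthL noAct (pt-nthL [] (pt-rtab ∙ pt-fst ∙ pt-fst) (pt-fst ∙ pt-snd))
  (pt-readSym ∙ ((pt-fst & ((pt-cj ∙ pt-snd) & (pt-cp ∙ pt-snd))) & (pt-clog ∙ pt-snd)))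

pt-logged : PT ((SimT ⊠ CfgT) ⊠ ActT) LogT logged
pt-logged = ((pt-cj ∙ pt-snd ∙ pt-fst) & (pt-cp ∙ pt-snd ∙ pt-fst) & (pt-fst ∙ pt-snd ∙ pt-snd ∙ pt-snd)) ∷P (pt-clog ∙ pt-snd ∙ pt-fst)

pt-applyR : PT ((SimT ⊠ CfgT) ⊠ ActT) CfgT applyR
pt-applyR = pt-if (pt-fst ∙ pt-snd)
  (pt-if (pt-snd ∙ pt-snd ∙ pt-snd ∙ pt-snd)
    (newq & (pt-cj ∙ pt-snd ∙ pt-fst) & (pt-suc ∙ pos) & pt-logged)
    (pt-if (pt-isZero ∙ pos) ((pt-rr ∙ pt-fst ∙ pt-fst ∙ pt-fst) & pt-const 0 & pt-const 0 & (pt-clog ∙ pt-snd ∙ pt-fst))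
      (newq & (pt-cj ∙ pt-snd ∙ pt-fst) & (pt-pred ∙ pos) & pt-logged)))
  (newq & (pt-fst ∙ pt-snd ∙ pt-snd ∙ pt-snd) & pos & (pt-clog ∙ pt-snd ∙ pt-fst))
  where
  newq : PT ((SimT ⊠ CfgT) ⊠ ActT) Nat (λ a → proj₁ (proj₂ (proj₂ a)))
  newq = pt-fst ∙ pt-snd ∙ pt-snd
  pos : PT ((SimT ⊠ CfgT) ⊠ ActT) Nat (λ a → cp (proj₂ (proj₁ a)))
  pos = pt-cp ∙ pt-snd ∙ pt-fst

sz-headL : ∀ A (d : El A) xs → sz A (headL d xs) ≤ sz A d + sz (Li A) xs
sz-headL A d []       = m≤m+n _ _
sz-headL A d (x ∷ xs) = ≤-trans (≤-trans (m≤m+n _ (sz (Li A) xs)) (n≤1+n _)) (m≤n+m _ (sz A d))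

sz-nthL : ∀ A (d : El A) xs n → sz A (nthL d xs n) ≤ sz A d + sz (Li A) xs
sz-nthL A d xs n = ≤-trans (sz-headL A d (dropL n xs)) (+-monoʳ-≤ (sz A d) (sz-dropL A n xs))

sz-rtab : ∀ d → sz (Li RowT) (rtab d) ≤ sz RawT d
sz-rtab (n' , Q , σ , s , qi , qa , qr , tab) =
  m≤n⇒m≤1+n (≤-trans (m≤n⇒m≤1+n (≤-trans (m≤n⇒m≤1+n (≤-trans (m≤n⇒m≤1+n (≤-trans (m≤n⇒m≤1+n (≤-trans (m≤n⇒m≤1+n (≤-trans (m≤n⇒m≤1+n
    (m≤n+m _ (sz Nat qr))) (m≤n+m _ (sz Nat qa)))) (m≤n+m _ (sz Nat qi)))) (m≤n+m _ (sz Nat s)))) (m≤n+m _ (sz Nat σ)))) (m≤n+m _ (sz (Li Bo) Q)))) (m≤n+m _ (sz Nat n')))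

sz-ri : ∀ d → sz Nat (ri d) ≤ sz RawT d
sz-ri (n' , Q , σ , s , qi , qa , qr , tab) =
  m≤n⇒m≤1+n (≤-trans (m≤n⇒m≤1+n (≤-trans (m≤n⇒m≤1+n (≤-trans (m≤n⇒m≤1+n (≤-trans (m≤n⇒m≤1+n (m≤m+n (sz Nat qi) _)) (m≤n+m _ (sz Nat s)))) (m≤n+m _ (sz Nat σ)))) (m≤n+m _ (sz (Li Bo) Q)))) (m≤n+m _ (sz Nat n')))

sz-rr : ∀ d → sz Nat (rr d) ≤ sz RawT d
sz-rr (n' , Q , σ , s , qi , qa , qr , tab) =
  m≤n⇒m≤1+n (≤-trans (m≤n⇒m≤1+n (≤-trans (m≤n⇒m≤1+n (≤-trans (m≤n⇒m≤1+n (≤-trans (m≤n⇒m≤1+n (≤-trans (m≤n⇒m≤1+n (≤-trans (m≤n⇒m≤1+n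
    (m≤m+n (sz Nat qr) _)) (m≤n+m _ (sz Nat qa)))) (m≤n+m _ (sz Nat qi)))) (m≤n+m _ (sz Nat s)))) (m≤n+m _ (sz Nat σ)))) (m≤n+m _ (sz (Li Bo) Q)))) (m≤n+m _ (sz Nat n')))

-- B bounds the size of every number taken from the instance.
record Small (B n : ℕ) (c : Cfg) : Set where
  constructor small
  field
    q≤   : sz Nat (cq c) ≤ B
    j≤   : sz Nat (cj c) ≤ B
    p≤   : cp c ≤ n
    log≤ : sz LogT (clog c) ≤ 1 + n * (4 + 2 * B + 2 * n)

bigAct : Raw → ℕ
bigAct d = 8 + sz RawT d

sz-actR : ∀ e c → sz ActT (actR (e , c)) ≤ bigAct (eRaw e)
sz-actR e c = ≤-trans (sz-nthL ActT noAct (nthL [] (rtab (eRaw e)) (cq c)) (readSym ((e , (cj c , cp c)) , clog c))) (≤-trans (+-monoʳ-≤ 7 (sz-nthL RowT [] (rtab (eRaw e)) (cq c))) (+-monoʳ-≤ 8 (sz-rtab (eRaw e))))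

small-step : ∀ B n e c a → sz ActT a ≤ B → sz Nat (rr (eRaw e)) ≤ B → 1 ≤ B → Small B n c → Small B (suc n) (applyR ((e , c) , a))
small-step B n e (q , j , p , log) (t , q' , x , d) aB rrB B1 (small q≤ j≤ p≤ log≤) = go t d (isZero p)
  where
  q'≤ : sz Nat q' ≤ B
  q'≤ = ≤-trans (m≤n⇒m≤1+n (≤-trans (m≤n⇒m≤1+n (m≤m+n (sz Nat q') _)) (m≤n+m _ (sz Bo t)))) aB
  x≤ : sz Nat x ≤ B
  x≤ = ≤-trans (m≤n⇒m≤1+n (≤-trans (m≤n⇒m≤1+n (≤-trans (m≤n⇒m≤1+n (m≤m+n (sz Nat x) _)) (m≤n+m _ (sz Nat q')))) (m≤n+m _ (sz Bo t)))) aB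
  mono : 1 + n * (4 + 2 * B + 2 * n) ≤ 1 + suc n * (4 + 2 * B + 2 * suc n)
  mono = s≤s (*-mono-≤ (n≤1+n n) (+-monoʳ-≤ (4 + 2 * B) (*-monoʳ-≤ 2 (n≤1+n n))))
  log' : sz LogT ((j , p , x) ∷ log) ≤ 1 + suc n * (4 + 2 * B + 2 * suc n)
  log' = ≤-trans (s≤s (+-mono-≤ (s≤s (+-mono-≤ j≤ (s≤s (+-mono-≤ (≤-trans (≤-reflexive (sz-ℕ p)) (s≤s (*-monoʳ-≤ 2 p≤))) x≤)))) log≤)) final
    where
    arith : ∀ B n → suc (suc (B + suc (1 + 2 * n + B)) + (1 + n * (4 + 2 * B + 2 * n))) + (2 + 2 * n) ≡ 1 + suc n * (4 + 2 * B + 2 * suc n)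
    arith = solve-∀
    final : suc (suc (B + suc (1 + 2 * n + B)) + (1 + n * (4 + 2 * B + 2 * n))) ≤ 1 + suc n * (4 + 2 * B + 2 * suc n)
    final = ≤-by (2 + 2 * n) (arith B n)
  res : Bool → Bool → Bool → Cfg
  res t d z = if t then (if d then (q' , j , suc p , (j , p , x) ∷ log) else (if z then (rr (eRaw e) , 0 , 0 , log) else (q' , j , pred p , (j , p , x) ∷ log))) else (q' , x , p , log)
  go : ∀ t d z → Small B (suc n) (res t d z)
  go false d     z     = small q'≤ x≤ (m≤n⇒m≤1+n p≤) (≤-trans log≤ mono)
  go true  true  z     = small q'≤ j≤ (s≤s p≤) log'
  go true  false true  = small rrB B1 z≤n (≤-trans log≤ mono)
  go true  false false = small q'≤ j≤ (m≤n⇒m≤1+n (≤-trans (ℕP.pred[n]≤n {p}) p≤)) log'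

small-run : ∀ e n → Small (bigAct (eRaw e)) n (runR (e , n))
small-run e zero    = small (≤-trans (sz-ri (eRaw e)) (m≤n+m _ 8)) (s≤s z≤n) z≤n (s≤s z≤n)
small-run e (suc n) = small-step (bigAct (eRaw e)) n e (runR (e , n)) (actR (e , runR (e , n))) (sz-actR e (runR (e , n)))
  (≤-trans (sz-rr (eRaw e)) (m≤n+m _ 8)) (s≤s z≤n) (small-run e n)

runPol : Pol
runPol = con 3 ⊕ (con 8 ⊕ X) ⊕ (con 8 ⊕ X) ⊕ (con 1 ⊕ con 2 ⊗ X) ⊕ (con 1 ⊕ X ⊗ (con 4 ⊕ con 2 ⊗ (con 8 ⊕ X) ⊕ con 2 ⊗ X))

-- The size bound that recursion on the number of steps requires. States, tapes and symbols come
-- from the instance, while the head position and the length of the log are at most the number of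
-- steps.
run-size : ∀ e n → sz CfgT (runR (e , n)) ≤ eval runPol (sz SimT e + sz Nat n)
run-size e n = bound (runR (e , n)) (small-run e n)
  where
  N : ℕ
  N = sz SimT e + sz Nat n
  B≤ : bigAct (eRaw e) ≤ 8 + N
  B≤ = +-monoʳ-≤ 8 (≤-trans (≤-trans (m≤m+n _ (sz (Nat ⊠ Li Bo) (proj₂ e))) (n≤1+n _)) (m≤m+n _ (sz Nat n)))
  n≤ : n ≤ N
  n≤ = ≤-trans (n≤sz n) (m≤n+m _ (sz SimT e))
  lem : ∀ a b c d → suc (a + suc (b + suc (c + d))) ≡ 3 + a + b + c + d
  lem = solve-∀
  bound : ∀ c → Small (bigAct (eRaw e)) n c → sz CfgT c ≤ eval runPol N
  bound (q , j , p , log) (small q≤ j≤ p≤ log≤) = ≤-trans (≤-reflexive (lem (sz Nat q) (sz Nat j) (sz Nat p) (sz LogT log)))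
    (+-mono-≤ (+-mono-≤ (+-mono-≤ (+-monoʳ-≤ 3 (≤-trans q≤ B≤)) (≤-trans j≤ B≤)) (≤-trans (≤-reflexive (sz-ℕ p)) (s≤s (*-monoʳ-≤ 2 (≤-trans p≤ n≤)))))
      (≤-trans log≤ (s≤s (*-mono-≤ n≤ (+-mono-≤ (+-monoʳ-≤ 4 (*-monoʳ-≤ 2 B≤)) (*-monoʳ-≤ 2 n≤))))))

pt-runR : PT (SimT ⊠ Nat) CfgT runR
pt-runR = pt-recℕ SimT CfgT runR (pt-ri ∙ pt-fst & pt-const 0 & pt-const 0 & pt-const [])
  (pt-applyR ∙ (pt-id & pt-actR) ∙ (pt-fst & (pt-snd ∙ pt-snd)))
  (λ _ → refl) (λ _ _ → refl) runPol run-size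

pt-accR : PT SimT Bo accR
pt-accR = pt-eqB (pt-fst ∙ pt-runR ∙ (pt-id & (pt-fst ∙ pt-snd))) (pt-ra ∙ pt-fst)

module RawSim (I : Instance) (N : ℕ) (G : List Bool) where
  open Instance I
  open NDTM T
  open NSem T

  e : SimE
  e = rawI I , N , G

  -- The log agrees with the tapes below `N` only; past that `initSym` would run into the next word.
  -- After `n` steps the head is at most at `n`, so `N` steps never read further.
  record Rel (n : ℕ) (c : PConf) (r : Cfg) : Set where
    constructor rel
    field
      q≡    : cq r ≡ toℕ (PConf.state c)
      j≡    : cj r ≡ toℕ (PConf.tp c)
      p≡    : cp r ≡ PConf.pos c
      p≤    : PConf.pos c ≤ n
      tape≡ : ∀ i p → p < N → readSym ((e , (toℕ i , p)) , clog r) ≡ toℕ (PConf.tapes c i p)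

  eqB-toℕ : ∀ {m} (i i' : Fin m) → eqB (toℕ i) (toℕ i') ≡ does (i F.≟ i')
  eqB-toℕ i i' with i F.≟ i'
  ... | yes refl = eqB-complete {toℕ i} refl
  ... | no  ne with eqB (toℕ i) (toℕ i') in eq
  ...   | true  = ⊥-elim (ne (FP.toℕ-injective (eqB-sound eq)))
  ...   | false = refl

  eqB-≟ : ∀ p p' → eqB p p' ≡ does (p ≟ p')
  eqB-≟ p p' with eqB p p' in eq
  ... | true  = sym (dec-true (p ≟ p') (eqB-sound eq))
  ... | false = sym (dec-false (p ≟ p') (λ { refl → case trans (sym (eqB-complete {p} refl)) eq of λ () }))

  read-upd : ∀ ts j k b log → (∀ i p → p < N → readSym ((e , (toℕ i , p)) , log) ≡ toℕ (ts i p)) →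
    ∀ i p → p < N → readSym ((e , (toℕ i , p)) , (toℕ j , k , toℕ b) ∷ log) ≡ toℕ (upd ts j k b i p)
  read-upd ts j k b log h i p pN rewrite eqB-toℕ i j | eqB-≟ p k with does (i F.≟ j) ∧ (p ≡ᵇ k)
  ... | true  = refl
  ... | false = h i p pN

  act≡ : ∀ q a → nthL noAct (nthL [] (rtab (rawI I)) (toℕ q)) (toℕ a) ≡ rawAction (δ q a)
  act≡ q a = trans (cong (λ l → nthL noAct l (toℕ a)) (row-of I q)) (nthL-tabulate noAct (λ a → rawAction (δ q a)) a)

  rel-step : ∀ n c r → n < N → Rel n c r → Rel (suc n) (stepN c) (stepR e r)
  rel-step n (pconf q j k ts) (.(toℕ q) , .(toℕ j) , .k , log) nN (rel refl refl refl p≤ tp) =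
    subst (λ a → Rel (suc n) (stepN (pconf q j k ts)) (applyR ((e , (toℕ q , toℕ j , k , log)) , a))) (sym eq) (go k p≤)
    where
    eq : actR (e , (toℕ q , toℕ j , k , log)) ≡ rawAction (δ q (ts j k))
    eq = trans (cong (nthL noAct (nthL [] (rtab (rawI I)) (toℕ q))) (tp j k (≤-trans (s≤s p≤) nN))) (act≡ q (ts j k))
    go : ∀ k → k ≤ n → Rel (suc n) (stepN (pconf q j k ts)) (applyR ((e , (toℕ q , toℕ j , k , log)) , rawAction (δ q (ts j k))))
    go k kn with δ q (ts j k)
    ... | switch q' i = rel refl refl refl (m≤n⇒m≤1+n kn) tp
    ... | write q' b plus1 = rel refl refl refl (s≤s kn) (read-upd ts j k b log tp)
    go zero    kn | write q' b minus1 = rel refl refl refl z≤n tp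
    go (suc k) kn | write q' b minus1 = rel refl refl refl (≤-trans (n≤1+n k) (m≤n⇒m≤1+n kn)) (read-upd ts j (suc k) b log tp)

  iter-itr : ∀ n c → iter n c ≡ itr stepN n c
  iter-itr zero    c = refl
  iter-itr (suc n) c = trans (iter-itr n (stepN c)) (sym (itr-suc stepN n c))

  rel-run : ∀ n c → n ≤ N → Rel 0 c (startR e) → Rel n (itr stepN n c) (runR (e , n))
  rel-run zero    c nN r = r
  rel-run (suc n) c nN r = rel-step n _ _ nN (rel-run n c (<⇒≤ nN) r)

  stay : (∀ a → δ qacc a ≡ switch qacc zero) → ∀ s c → PConf.state c ≡ qacc → PConf.state (iter s c) ≡ qacc
  stay h zero    c e = e
  stay h (suc s) (pconf q j k ts) refl = stay h s _ one-step
    where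
    one-step : PConf.state (stepN (pconf qacc j k ts)) ≡ qacc
    one-step rewrite h (ts j k) = refl

  iter-+ : ∀ a b c → iter (a + b) c ≡ iter b (iter a c)
  iter-+ zero    b c = refl
  iter-+ (suc a) b c = iter-+ a b (stepN c)

  accR⇔accepts : Valid I → (ws : Fin (suc n') → Vec (Fin (suc σ')) N) →
    (∀ i p → p < N → initSym (e , (toℕ i , p)) ≡ toℕ (initTapes N ws i p)) → AcceptsIn N N ws ⇔ (accR e ≡ true)
  accR⇔accepts (_ , ha , _) ws init = mk⇔ to from
    where
    c : PConf
    c = pconf qinit zero 0 (initTapes N ws)
    final : cq (runR (e , N)) ≡ toℕ (PConf.state (iter N c))
    final = trans (Rel.q≡ (rel-run N c ≤-refl (rel refl refl refl z≤n init))) (cong (λ z → toℕ (PConf.state z)) (sym (iter-itr N c)))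
    to : AcceptsIn N N ws → accR e ≡ true
    to (i , iN , ei) = eqB-complete (trans final (cong toℕ (trans (cong (λ z → PConf.state (iter z c)) (sym (ℕP.m+[n∸m]≡n iN)))
      (trans (cong PConf.state (iter-+ i (N ∸ i) c)) (stay ha (N ∸ i) (iter i c) ei)))))
    from : accR e ≡ true → AcceptsIn N N ws
    from h = N , ≤-refl , FP.toℕ-injective (trans (sym final) (eqB-sound h))

-- Guessing the words bit by bit: a symbol is guessed as the number of ones in a block of bits

-- A script drives the guessing: `true` asks for a bit in the current mode, `false` changes the
-- mode. `acc` collects the bits as a stack, the latest first.
Guess : Quant → List Bool → List Bool → (List Bool → Set) → Set
Guess m    []          acc P = P (reverse acc)
Guess m    (false ∷ s) acc P = Guess (negQ m) s acc P
Guess exQ  (true ∷ s)  acc P = Guess exQ s (false ∷ acc) P ⊎ Guess exQ s (true ∷ acc) P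
Guess allQ (true ∷ s)  acc P = Guess allQ s (false ∷ acc) P × Guess allQ s (true ∷ acc) P

OverQ : Quant → ∀ {W : Set} → (W → Set) → Set
OverQ exQ  {W} R = Σ W R
OverQ allQ {W} R = (w : W) → R w

_⇔∘_ : ∀ {A B C : Set} → A ⇔ B → B ⇔ C → A ⇔ C
f ⇔∘ g = mk⇔ (Equivalence.to g ∘ Equivalence.to f) (Equivalence.from f ∘ Equivalence.from g)

≡⇒⇔ : ∀ {A B : Set} → A ≡ B → A ⇔ B
≡⇒⇔ refl = mk⇔ id id

guess-block : ∀ m L s acc P → Guess m (replicate L true ++ s) acc P ⇔ OverQ m {Vec Bool L} (λ v → Guess m s (toList v ʳ++ acc) P)
guess-block exQ  zero    s acc P = mk⇔ (λ g → [] , g) (λ { ([] , g) → g })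
guess-block allQ zero    s acc P = mk⇔ (λ { g [] → g }) (λ f → f [])
guess-block exQ  (suc L) s acc P = mk⇔
  (λ { (inj₁ g) → let v , h = Equivalence.to (guess-block exQ L s (false ∷ acc) P) g in false ∷ v , h
     ; (inj₂ g) → let v , h = Equivalence.to (guess-block exQ L s (true ∷ acc) P) g in true ∷ v , h })
  (λ { (false ∷ v , h) → inj₁ (Equivalence.from (guess-block exQ L s (false ∷ acc) P) (v , h))
     ; (true ∷ v , h)  → inj₂ (Equivalence.from (guess-block exQ L s (true ∷ acc) P) (v , h)) })
guess-block allQ (suc L) s acc P = mk⇔
  (λ { (g , g') (false ∷ v) → Equivalence.to (guess-block allQ L s (false ∷ acc) P) g v
     ; (g , g') (true ∷ v)  → Equivalence.to (guess-block allQ L s (true ∷ acc) P) g' v })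
  (λ f → Equivalence.from (guess-block allQ L s (false ∷ acc) P) (λ v → f (false ∷ v)) ,
         Equivalence.from (guess-block allQ L s (true ∷ acc) P) (λ v → f (true ∷ v)))

-- `de` is onto, with section `se`, but typically not injective, as many bit blocks stand for one
-- word. Both kinds of quantification survive a surjection.
overQ-transfer : ∀ q {V W : Set} (de : V → W) (se : W → V) → (∀ w → de (se w) ≡ w) → {R : V → Set} {R' : W → Set} →
  (∀ v → R v ⇔ R' (de v)) → OverQ q R ⇔ OverQ q R'
overQ-transfer exQ  de se ds {R' = R'} f = mk⇔ (λ { (v , r) → de v , Equivalence.to (f v) r })
  (λ { (w , r) → se w , Equivalence.from (f (se w)) (subst R' (sym (ds w)) r) })
overQ-transfer allQ de se ds {R' = R'} f = mk⇔ (λ g w → subst R' (ds w) (Equivalence.to (f (se w)) (g (se w))))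
  (λ g v → Equivalence.from (f v) (g (de v)))

toggles : Bool × List Bool → List Bool
toggles = caseL (λ _ → []) (λ p → if sameB (proj₁ p) (proj₁ (proj₂ p)) then [] else false ∷ [])

script : ℕ × List Bool → List Bool
script (L , [])    = []
script (L , b ∷ l) = replicate L true ++ (toggles (b , l) ++ script (L , l))

ext : ∀ {L n} → List Bool → (Fin n → Vec Bool L) → List Bool
ext {n = zero}  acc vs = acc
ext {n = suc n} acc vs = ext (toList (vs zero) ʳ++ acc) (vs ∘ suc)

evalQ-over : ∀ {W : Set} q {n} (Q : Vec Quant n) (P : (Fin (suc n) → W) → Set) → evalQ (q ∷ Q) P ≡ OverQ q (λ w → evalQ Q (λ ws → P (consF w ws)))
evalQ-over exQ  Q P = refl
evalQ-over allQ Q P = refl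

guess-toggle : ∀ q q' s acc P → Guess q ((if sameB (encQ q) (encQ q') then [] else false ∷ []) ++ s) acc P ≡ Guess q' s acc P
guess-toggle exQ  exQ  s acc P = refl
guess-toggle exQ  allQ s acc P = refl
guess-toggle allQ exQ  s acc P = refl
guess-toggle allQ allQ s acc P = refl

-- The words `ws` are tied to the bit blocks `vs` pointwise, because families built by `consF` match
-- the decoded families at each index and not as functions.
guess-evalQ : ∀ {W : Set} {L} (de : Vec Bool L → W) (se : W → Vec Bool L) → (∀ w → de (se w) ≡ w) →
  ∀ {n} q (Q : Vec Quant n) acc P (Pr : (Fin (suc n) → W) → Set) →
  (∀ vs ws → (∀ i → ws i ≡ de (vs i)) → P (reverse (ext acc vs)) ⇔ Pr ws) →
  Guess q (script (L , map encQ (toList (q ∷ Q)))) acc P ⇔ evalQ (q ∷ Q) Pr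
guess-evalQ {W} {L} de se ds {n} q Q acc P Pr h =
  guess-block q L _ acc P ⇔∘ (overQ-transfer q de se ds (λ v → rest Q Pr h v) ⇔∘ ≡⇒⇔ (sym (evalQ-over q Q Pr)))
  where
  rest : ∀ {n} (Q : Vec Quant n) (Pr : (Fin (suc n) → W) → Set) →
    (∀ vs ws → (∀ i → ws i ≡ de (vs i)) → P (reverse (ext acc vs)) ⇔ Pr ws) → ∀ v →
    Guess q (toggles (encQ q , map encQ (toList Q)) ++ script (L , map encQ (toList Q))) (toList v ʳ++ acc) P ⇔ evalQ Q (λ ws → Pr (consF (de v) ws))
  rest []       Pr h v = h (consF v (λ ())) (consF (de v) (λ ())) (λ { zero → refl })
  rest (q' ∷ Q) Pr h v = ≡⇒⇔ (guess-toggle q q' _ (toList v ʳ++ acc) P) ⇔∘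
    guess-evalQ de se ds q' Q (toList v ʳ++ acc) P (λ ws → Pr (consF (de v) ws))
      (λ vs ws e → h (consF v vs) (consF (de v) ws) (λ { zero → refl ; (suc i) → e i }))

-- Counting ones maps `k` bits onto `suc k` symbols for every alphabet size. No bit block is
-- malformed, so neither player has invalid guesses that would need a rule.
ones : ∀ {k} → Vec Bool k → Fin (suc k)
ones []          = zero
ones (true ∷ v)  = suc (ones v)
ones (false ∷ v) = F.inject₁ (ones v)

onesInv : ∀ {k} → Fin (suc k) → Vec Bool k
onesInv {zero}  _       = []
onesInv {suc k} zero    = false ∷ onesInv zero
onesInv {suc k} (suc i) = true ∷ onesInv i

ones-onesInv : ∀ {k} (i : Fin (suc k)) → ones (onesInv i) ≡ i
ones-onesInv {zero}  zero    = refl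
ones-onesInv {suc k} zero    = cong F.inject₁ (ones-onesInv {k} zero)
ones-onesInv {suc k} (suc i) = cong suc (ones-onesInv i)

decW : ∀ {k} N → Vec Bool (N * k) → Vec (Fin (suc k)) N
decW         zero    v = []
decW {k} (suc N) v = ones (V.take k v) ∷ decW N (V.drop k v)

secW : ∀ {k N} → Vec (Fin (suc k)) N → Vec Bool (N * k)
secW []      = []
secW (a ∷ w) = onesInv a V.++ secW w

dec-secW : ∀ {k N} (w : Vec (Fin (suc k)) N) → decW N (secW w) ≡ w
dec-secW []          = refl
dec-secW {k} (a ∷ w) = cong₂ _∷_ (trans (cong ones (take-++ (onesInv a) (secW w))) (ones-onesInv a))
  (trans (cong (decW _) (drop-++ (onesInv a) (secW w))) (dec-secW w))
  where
  take-++ : ∀ {m n} (xs : Vec Bool m) (ys : Vec Bool n) → V.take m (xs V.++ ys) ≡ xs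
  take-++ []       ys = refl
  take-++ (x ∷ xs) ys = cong (x ∷_) (take-++ xs ys)
  drop-++ : ∀ {m n} (xs : Vec Bool m) (ys : Vec Bool n) → V.drop m (xs V.++ ys) ≡ ys
  drop-++ []       ys = refl
  drop-++ (x ∷ xs) ys = drop-++ xs ys

itr-+ : ∀ {A : Set} (f : A → A) a b x → itr f (a + b) x ≡ itr f b (itr f a x)
itr-+ f zero    b x = refl
itr-+ f (suc a) b x = trans (cong f (itr-+ f a b x)) (itr-suc f b (itr f a x))

dropL-++ : ∀ {A : Set} {n} (v : Vec A n) ys → dropL n (toList v ++ ys) ≡ ys
dropL-++ []      ys = refl
dropL-++ {n = suc n} (x ∷ v) ys = trans (itr-suc tailL n (x ∷ toList v ++ ys)) (dropL-++ v ys)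

split-drop : ∀ k N (v : Vec Bool (k + N)) ys → dropL k (toList v ++ ys) ≡ toList (V.drop k v) ++ ys
split-drop zero    N v       ys = refl
split-drop (suc k) N (x ∷ v) ys = trans (itr-suc tailL k (x ∷ toList v ++ ys)) (split-drop k N v ys)

count-from : ∀ {k N} c (v : Vec Bool (k + N)) ys → proj₁ (itr countS k (c , toList v ++ ys)) ≡ c + toℕ (ones (V.take k v))
count-from {zero}  c v           ys = sym (+-identityʳ c)
count-from {suc k} {N} c (true ∷ v)  ys = trans (cong proj₁ (itr-suc countS k (c , true ∷ toList v ++ ys))) (trans (count-from {k} {N} (suc c) v ys) (sym (+-suc c _)))
count-from {suc k} {N} c (false ∷ v) ys = trans (cong proj₁ (itr-suc countS k (c , false ∷ toList v ++ ys))) (trans (count-from {k} {N} c v ys) (cong (c +_) (sym (FP.toℕ-inject₁ _))))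

count-word : ∀ {k} N (v : Vec Bool (N * k)) ys p (h : p < N) → countN k (dropL (p * k) (toList v ++ ys)) ≡ toℕ (lookup (decW N v) (fromℕ< h))
count-word {k} (suc N) v ys zero    h       = count-from {k} {N * k} 0 v ys
count-word {k} (suc N) v ys (suc p) (s≤s h) = trans (cong (countN k) (trans (itr-+ tailL k (p * k) (toList v ++ ys)) (cong (dropL (p * k)) (split-drop k (N * k) v ys))))
  (count-word N (V.drop k v) ys p h)

flat : ∀ {L n} → (Fin n → Vec Bool L) → List Bool
flat {n = zero}  vs = []
flat {n = suc n} vs = toList (vs zero) ++ flat (vs ∘ suc)

reverse-ext : ∀ {L n} acc (vs : Fin n → Vec Bool L) → reverse (ext acc vs) ≡ reverse acc ++ flat vs
reverse-ext {n = zero}  acc vs = sym (LP.++-identityʳ _)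
reverse-ext {n = suc n} acc vs = trans (reverse-ext (toList (vs zero) ʳ++ acc) (vs ∘ suc))
  (trans (cong (_++ flat (vs ∘ suc)) (trans (LP.ʳ++-ʳ++ (toList (vs zero)) {acc} {[]}) (trans (LP.ʳ++-defn acc) (cong (reverse acc ++_) (LP.++-identityʳ _))))) (LP.++-assoc (reverse acc) (toList (vs zero)) _))

flat-drop : ∀ {L n} (vs : Fin n → Vec Bool L) i → Σ (List Bool) λ ys → dropL (toℕ i * L) (flat vs) ≡ toList (vs i) ++ ys
flat-drop         vs zero    = flat (vs ∘ suc) , refl
flat-drop {L} vs (suc i) = let ys , e = flat-drop (vs ∘ suc) i in
  ys , trans (itr-+ tailL L (toℕ i * L) (flat vs)) (trans (cong (dropL (toℕ i * L)) (dropL-++ (vs zero) (flat (vs ∘ suc)))) e)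

tower : ℕ → Raw → ℕ
tower k d = tetra k (suc (rn d))

Wins : ℕ → Raw → Set
Wins k d = Guess exQ (script (tower k d * rσ d , rQ d)) [] (λ G → accR (d , tower k d , G) ≡ true)

-- Expresses the truth of an instance by its raw form alone. It serves membership, and again
-- hardness, to compare two instances with the same code.
holds⇔guess : ∀ k I → Valid I → Holds k I ⇔ Wins k (rawI I)
holds⇔guess k I va@(hq , _) = go Q hq refl
  where
  open Instance I
  open NDTM T
  open NSem T
  N : ℕ
  N = tetra k (suc n')
  go : ∀ (Q' : Vec Quant (suc n')) → head Q' ≡ exQ → Q' ≡ Q →
    evalQ {Vec (Fin (suc σ')) N} Q' (λ ws → AcceptsIn N N ws) ⇔ Guess exQ (script (N * σ' , map encQ (toList Q'))) [] (λ G → accR (rawI I , N , G) ≡ true)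
  go (exQ ∷ Q') refl _ = mk⇔ (Equivalence.from eqv) (Equivalence.to eqv)
    where
    hyp : ∀ vs ws → (∀ i → ws i ≡ decW N (vs i)) → (accR (rawI I , N , reverse (ext [] vs)) ≡ true) ⇔ AcceptsIn N N ws
    hyp vs ws e = mk⇔ (Equivalence.from r) (Equivalence.to r)
      where
      init : ∀ i p → p < N → initSym ((rawI I , N , reverse (ext [] vs)) , (toℕ i , p)) ≡ toℕ (initTapes N ws i p)
      init i p h with p <? N
      ... | no  nh = ⊥-elim (nh h)
      ... | yes h' = let ys , ed = flat-drop vs i in
        trans (cong (λ G → countN σ' (dropL (toℕ i * (N * σ') + p * σ') G)) (reverse-ext [] vs))
        (trans (cong (countN σ') (trans (itr-+ tailL (toℕ i * (N * σ')) (p * σ') (flat vs)) (cong (dropL (p * σ')) ed)))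
        (trans (count-word N (vs i) ys p h') (cong (λ w → toℕ (lookup w (fromℕ< h'))) (sym (e i)))))
      r : AcceptsIn N N ws ⇔ (accR (rawI I , N , reverse (ext [] vs)) ≡ true)
      r = RawSim.accR⇔accepts I N (reverse (ext [] vs)) va ws init
    eqv : Guess exQ (script (N * σ' , map encQ (toList (exQ ∷ Q')))) [] (λ G → accR (rawI I , N , G) ≡ true) ⇔ evalQ {Vec (Fin (suc σ')) N} (exQ ∷ Q') (λ ws → AcceptsIn N N ws)
    eqv = guess-evalQ (decW N) secW dec-secW exQ Q' [] (λ G → accR (rawI I , N , G) ≡ true) (λ ws → AcceptsIn N N ws) hyp

-- Membership

falses : List Bool → ℕ
falses []          = 0
falses (true ∷ s)  = falses s
falses (false ∷ s) = suc (falses s)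

falses-++ : ∀ s s' → falses (s ++ s') ≡ falses s + falses s'
falses-++ []          s' = refl
falses-++ (true ∷ s)  s' = falses-++ s s'
falses-++ (false ∷ s) s' = cong suc (falses-++ s s')

falses-replicate : ∀ n → falses (replicate n true) ≡ 0
falses-replicate zero    = refl
falses-replicate (suc n) = falses-replicate n

falses-toggles : ∀ b l → falses (toggles (b , l)) ≡ changeB (b , l)
falses-toggles b []      = refl
falses-toggles b (c ∷ l) with sameB b c
... | true  = refl
... | false = refl

-- `altB` counts blocks, one more than the changes between them, and each change is one toggle.
falses-script : ∀ L l → suc (falses (script (L , l))) ≡ altB l
falses-script L []      = refl
falses-script L (b ∷ l) = trans (cong suc (trans (falses-++ (replicate L true) _) (trans (cong (_+ falses (toggles (b , l) ++ script (L , l))) (falses-replicate L))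
  (trans (falses-++ (toggles (b , l)) _) (cong (_+ falses (script (L , l))) (falses-toggles b l))))))
  (trans (sym (+-suc (changeB (b , l)) _)) (cong (changeB (b , l) +_) (falses-script L l)))

toggles-size : ∀ b l → sz (Li Bo) (toggles (b , l)) ≤ 3
toggles-size b []      = s≤s z≤n
toggles-size b (c ∷ l) with sameB b c
... | true  = s≤s z≤n
... | false = ≤-refl

script-size : ∀ L l → sz (Li Bo) (script (L , l)) ≤ 1 + length l * (2 + 4 * L)
script-size L []      = ≤-refl
script-size L (b ∷ l) = s≤s⁻¹ (s≤s⁻¹ (≤-trans (≤-reflexive (lem₁ S))
  (≤-trans (≤-reflexive (cong (_+ 1) (sz-++ Bo (replicate L true) _)))
  (≤-trans (≤-reflexive (trans (+-assoc (sz (Li Bo) (replicate L true)) _ 1) (cong (sz (Li Bo) (replicate L true) +_) (sz-++ Bo (toggles (b , l)) _))))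
  (≤-trans (+-mono-≤ (≤-reflexive (sz-replicate Bo true L)) (+-mono-≤ (toggles-size b l) (script-size L l)))
    (≤-reflexive (lem L (length l))))))))
  where
  S : ℕ
  S = sz (Li Bo) (replicate L true ++ (toggles (b , l) ++ script (L , l)))
  lem₁ : ∀ s → 2 + s ≡ s + 1 + 1
  lem₁ = solve-∀
  lem : ∀ L n → 1 + L * 4 + (3 + (1 + n * (2 + 4 * L))) ≡ 2 + (1 + suc n * (2 + 4 * L))
  lem = solve-∀

pt-script : PT (Nat ⊠ Li Bo) (Li Bo) script
pt-script = pt-rec Nat Bo (Li Bo) script (pt-const [])
  ((pt-replicate ∙ (pt-const true & pt-fst)) ++P
   ((pt-caseL (pt-const []) (pt-if (pt-sameB pt-fst (pt-fst ∙ pt-snd)) (pt-const []) (pt-const (false ∷ []))) ∙ ((pt-fst ∙ pt-snd) & (pt-fst ∙ pt-snd ∙ pt-snd))) ++P (pt-snd ∙ pt-snd ∙ pt-snd)))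
  (λ _ → refl) (λ _ _ _ → refl) (con 1 ⊕ X ⊗ (con 2 ⊕ con 4 ⊗ X))
  (λ L l → ≤-trans (script-size L l) (s≤s (*-mono-≤ (≤-trans (length≤sz Bo l) (m≤n+m _ (sz Nat L)))
     (+-monoʳ-≤ 2 (*-monoʳ-≤ 4 (≤-trans (n≤sz L) (m≤m+n (sz Nat L) _)))))))

-- Towers in time polynomial in their value

pt-double : PT Nat Nat (λ n → n + n)
pt-double = pt-id +P pt-id

-- Doubling 1 as often as the argument says. The result is exponential, so there is no `PT` for it;
-- its cost is bounded by a polynomial in the size of the value instead. `tlF` drops the list entry
-- that the fold hands to its body.
dblF expF : Fn
dblF = fn pt-double ∘F tlF
expF = foldF dblF ∘F ⟨ idF , constF (cdℕ 1) ⟩F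

sz-mono : ∀ {m n} → m ≤ n → sz Nat m ≤ sz Nat n
sz-mono {m} {n} h = ≤-trans (≤-reflexive (sz-ℕ m)) (≤-trans (s≤s (*-monoʳ-≤ 2 h)) (≤-reflexive (sym (sz-ℕ n))))

exp-sem : ∀ n m → foldD dblF (cdℕ n) (cdℕ m) ≡ cdℕ (m * 2 ^ n)
exp-sem zero    m = cong cdℕ (sym (*-identityʳ m))
exp-sem (suc n) m = trans (cong (foldD dblF (cdℕ n)) (sem pt-double m)) (trans (exp-sem n (m + m)) (cong cdℕ (lem m (2 ^ n))))
  where
  lem : ∀ m x → (m + m) * x ≡ m * (2 * x)
  lem = solve-∀

expStep : Pol
expStep = con 20 ⊗ (con 1 ⊕ X ⊕ X ⊕ con 1 ⊕ ((con 12 ⊗ (con 2 ⊕ X) ⊕ con 6) ⊕ pol pt-double))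

-- The accumulator only grows, so the bound `B` on the final value `m * 2 ^ n` bounds all
-- intermediate ones.
exp-cost : ∀ B n m → sz Nat n ≤ B → sz Nat (m * 2 ^ n) ≤ B → costFold dblF (cdℕ n) (cdℕ m) ≤ n * eval expStep B + suc B
exp-cost B zero    m nB mB = s≤s (≤-trans (≤-reflexive (cong (sz Nat) (sym (*-identityʳ m)))) mB)
exp-cost B (suc n) m nB mB = ≤-trans
  (+-mono-≤ (*-monoʳ-≤ 20 (+-mono-≤ (+-monoˡ-≤ 1 (+-mono-≤ (+-monoʳ-≤ 1 (≤-trans (n≤1+n _) (≤-trans (n≤1+n _) nB))) sm))
      (+-mono-≤ (+-monoˡ-≤ 6 (*-monoʳ-≤ 12 (+-monoʳ-≤ 2 sm))) (≤-trans (bnd pt-double m) (eval-mono (pol pt-double) sm)))))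
    (≤-trans (≤-reflexive (cong (costFold dblF (cdℕ n)) (sem pt-double m)))
      (exp-cost B n (m + m) (≤-trans (n≤1+n _) (≤-trans (n≤1+n _) nB)) (≤-trans (≤-reflexive (cong (sz Nat) (lem m (2 ^ n)))) mB))))
  (≤-reflexive (sym (+-assoc (eval expStep B) _ _)))
  where
  lem : ∀ m x → (m + m) * x ≡ m * (2 * x)
  lem = solve-∀
  sm : sz Nat m ≤ B
  sm = ≤-trans (sz-mono (≤-trans (≤-reflexive (sym (*-identityʳ m))) (*-monoʳ-≤ m (ℕP.m^n>0 2 (suc n))))) mB

expPol : Pol
expPol = con 20 ⊗ (X ⊕ con 1 ⊕ X ⊕ constPol (cdℕ 1)) ⊕ (con 1 ⊕ (X ⊗ expStep ⊕ (con 1 ⊕ X)))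

abstract
  tetraF : ℕ → Fn
  tetraF zero    = idF
  tetraF (suc k) = expF ∘F tetraF k

  towerPol : ℕ → Pol
  towerPol zero    = X
  towerPol (suc k) = towerPol k ⊕ expPol

  expF-sem : ∀ n → ⟦ expF ⟧ (cdℕ n) ≡ cdℕ (2 ^ n)
  expF-sem n = trans (cong (λ d → ⟦ foldF dblF ⟧ (cdℕ n · d)) (constF-sem (cdℕ 1) (cdℕ n))) (trans (exp-sem n 1) (cong cdℕ (+-identityʳ (2 ^ n))))

  expF-cost : ∀ n → cost expF (cdℕ n) ≤ eval expPol (sz Nat (2 ^ n))
  expF-cost n = +-mono-≤ (*-monoʳ-≤ 20 (+-mono-≤ (+-mono-≤ (+-monoˡ-≤ 1 nB) nB) (≤-trans (constF-bnd (cdℕ 1) (cdℕ n)) (eval-mono (constPol (cdℕ 1)) nB))))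
    (≤-trans (≤-reflexive (cong (λ d → cost (foldF dblF) (cdℕ n · d)) (constF-sem (cdℕ 1) (cdℕ n))))
      (s≤s (≤-trans (exp-cost (sz Nat (2 ^ n)) n 1 nB (≤-reflexive (cong (sz Nat) (+-identityʳ (2 ^ n)))))
        (+-monoˡ-≤ (suc (sz Nat (2 ^ n))) (*-monoˡ-≤ (eval expStep (sz Nat (2 ^ n))) (≤-trans (n≤sz n) nB))))))
    where
    nB : sz Nat n ≤ sz Nat (2 ^ n)
    nB = sz-mono (<⇒≤ (n<2^n n))

  tetraF-sem : ∀ k n → ⟦ tetraF k ⟧ (cdℕ n) ≡ cdℕ (tetra k n)
  tetraF-sem zero    n = refl
  tetraF-sem (suc k) n = trans (cong ⟦ expF ⟧ (tetraF-sem k n)) (expF-sem (tetra k n))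

  tetraF-cost : ∀ k n → cost (tetraF k) (cdℕ n) ≤ eval (towerPol k) (sz Nat (tetra k n))
  tetraF-cost zero    n = ≤-refl
  tetraF-cost (suc k) n = +-mono-≤ (≤-trans (tetraF-cost k n) (eval-mono (towerPol k) (sz-mono (<⇒≤ (n<2^n (tetra k n))))))
    (≤-trans (≤-reflexive (cong (cost expF) (tetraF-sem k n))) (expF-cost (tetra k n)))

-- `unload` leaves a list in `rI` with its last entry on top. `xferIC` turns it over, so `guessC`
-- meets the script from its front; the guessed bits pile up on `rB`.
xferIC guessC : Cmd
xferIC = each rI (pushC rC false) (pushC rC true)
guessC = each rC toggleC (flipC (pushC rB false) (pushC rB true))

xferIC-spec : ∀ i {a b c n} → Exec xferIC (env a b c n i) (2 * length i + 1) (env a b (i ʳ++ c) n [])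
xferIC-spec []      = x-each∅ refl
xferIC-spec (x ∷ i) {a} {b} {c} {n} = x-weaken (≤-reflexive (lem (length i))) (x-each x refl refl (body x) (xferIC-spec i))
  where
  body : ∀ x → Exec (if x then pushC rC true else pushC rC false) (env a b c n i) 1 (env a b (x ∷ c) n i)
  body true  = x-push refl
  body false = x-push refl
  lem : ∀ n → suc (1 + (2 * n + 1)) ≡ 2 * suc n + 1
  lem = solve-∀

xferIC-reversed : ∀ s {a} → Exec xferIC (env a [] [] [] (s ʳ++ [])) (2 * length s + 1) (env a [] s [] [])
xferIC-reversed s {a} = subst₂ (λ n l → Exec xferIC (env a [] [] [] (s ʳ++ [])) (2 * n + 1) (env a [] l [] []))
  (LP.length-reverse s) (trans (LP.ʳ++-ʳ++ s) (LP.++-identityʳ s)) (xferIC-spec (s ʳ++ []))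

loadB-reversed : ∀ acc {a} → Exec (load rB) (env a acc [] [] []) (5 * length acc + 2) (env (ser (cdL Bo (reverse acc)) ++ a) [] [] [] [])
loadB-reversed acc {a} = subst₂ (λ n l → Exec (load rB) (env a l [] [] []) (5 * n + 2) (env (ser (cdL Bo (reverse acc)) ++ a) [] [] [] []))
  (LP.length-reverse acc) (LP.reverse-involutive acc) (load-spec (slotB [] []) (reverse acc))

module Play (prog : Cmd) where
  open Program prog public

  game-conv : ∀ {m l ρ ρ' t b A} → ρ ≡ ρ' → Game m l ρ' t b A → Game m l ρ t b A
  game-conv refl g = g

  game-seq : ∀ {c d e x ρ t ρ' m u b A} → Exec c ρ t ρ' → Placed (c ⨾ d) e x →
    Game m (begin d (e ∘ inj₂) x) ρ' u b A → Game m (begin (c ⨾ d) e x) ρ (t + u) b A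
  game-seq d P g = exec-game d (P ∘ inj₁) g

  game-pop1 : ∀ {r a b c e x ρ v m u bu A} → Placed (popC r a b c) e x → lookup ρ r ≡ true ∷ v →
    Game m (begin c (e ∘ inj₂ ∘ inj₂ ∘ inj₂) x) (ρ [ r ]≔ v) u bu A → Game m (begin (popC r a b c) e x) ρ (suc u) bu A
  game-pop1 P h g = g-pop (P (inj₁ tt)) h g

  game-pop0 : ∀ {r a b c e x ρ v m u bu A} → Placed (popC r a b c) e x → lookup ρ r ≡ false ∷ v →
    Game m (begin b (e ∘ inj₂ ∘ inj₂ ∘ inj₁) x) (ρ [ r ]≔ v) u bu A → Game m (begin (popC r a b c) e x) ρ (suc u) bu A
  game-pop0 P h g = g-pop (P (inj₁ tt)) h g

  -- Follows the clauses of `Guess`; each `false` is one `toggle`, whence the budget `falses s`. The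
  -- continuation is required for every mode with budget 0, as it runs in the mode of the last
  -- block.
  guess-game : ∀ {e x a t P} → Placed guessC e x → ∀ s acc m →
    (∀ acc' m' → length acc' ≤ length s + length acc → Game m' x (env a acc' [] [] []) t 0 (P (reverse acc'))) →
    Game m (begin guessC e x) (env a acc s [] []) (3 * length s + 1 + t) (falses s) (Guess m s acc P)
  guess-game Pl [] acc m K = g-pop∅ (Pl (inj₁ tt)) refl (K acc m ≤-refl)
  guess-game {t = t} Pl (false ∷ s) acc m K = g-weaken (≤-by 1 (lem (length s) t)) ≤-refl
    (g-pop (Pl (inj₁ tt)) refl (g-toggle (Pl (inj₂ (inj₁ tt))) (guess-game Pl s acc (negQ m) (λ acc' m' h → K acc' m' (m≤n⇒m≤1+n h)))))
    where
    lem : ∀ n t → suc (suc (3 * n + 1 + t)) + 1 ≡ 3 * suc n + 1 + t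
    lem = solve-∀
  guess-game {e} {x} {a} {t} {P} Pl (true ∷ s) acc m K = g-weaken (≤-reflexive (lem (length s) t)) ≤-refl
    (g-pop (Pl (inj₁ tt)) refl (choose m))
    where
    lem : ∀ n t → suc (suc (suc (3 * n + 1 + t))) ≡ 3 * suc n + 1 + t
    lem = solve-∀
    K' : ∀ b acc' m' → length acc' ≤ length s + length (b ∷ acc) → Game m' x (env a acc' [] [] []) t 0 (P (reverse acc'))
    K' b acc' m' h = K acc' m' (≤-trans h (≤-reflexive (+-suc (length s) (length acc))))
    zeroB : ∀ m → Game m (e (inj₂ (inj₂ (inj₂ (inj₁ tt))))) (env a acc s [] []) (suc (3 * length s + 1 + t)) (falses s) (Guess m s (false ∷ acc) P)
    zeroB m = g-push (Pl (inj₂ (inj₂ (inj₂ (inj₁ tt))))) (guess-game Pl s (false ∷ acc) m (K' false))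
    oneB : ∀ m → Game m (e (inj₂ (inj₂ (inj₂ (inj₂ tt))))) (env a acc s [] []) (suc (3 * length s + 1 + t)) (falses s) (Guess m s (true ∷ acc) P)
    oneB m = g-push (Pl (inj₂ (inj₂ (inj₂ (inj₂ tt))))) (guess-game Pl s (true ∷ acc) m (K' true))
    choose : ∀ m → Game m (e (inj₂ (inj₂ (inj₁ tt)))) (env a acc s [] []) (suc (suc (3 * length s + 1 + t))) (falses s) (Guess m (true ∷ s) acc P)
    choose exQ  = g-ex (Pl (inj₂ (inj₂ (inj₁ tt)))) (zeroB exQ) (oneB exQ)
    choose allQ = g-all (Pl (inj₂ (inj₂ (inj₁ tt)))) (zeroB allQ) (oneB allQ)

-- The alternating machine for the prenex problem

module Member (k' j : ℕ) where

  k : ℕ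
  k = suc k'

  check : List Bool → Maybe Raw
  check = andThen parse (λ a → if valid j (proj₂ a) then just (proj₂ a) else nothing)

  scriptOf : Raw × ℕ → List Bool
  scriptOf a = script (proj₂ a * rσ (proj₁ a) , rQ (proj₁ a))

  abstract
    pt-check : PT (Li Bo) (Ma RawT) check
    pt-check = pt-andThen pt-parse (pt-if (pt-valid j ∙ pt-snd) (pt-just ∙ pt-snd) (pt-const nothing))

    pt-rn1 : PT RawT Nat (λ d → suc (rn d))
    pt-rn1 = pt-suc ∙ pt-rn

    pt-scriptOf : PT (RawT ⊠ Nat) (Li Bo ⊠ (RawT ⊠ Nat)) (λ a → scriptOf a , a)
    pt-scriptOf = (pt-script ∙ ((pt-snd *P (pt-rσ ∙ pt-fst)) & (pt-rQ ∙ pt-fst))) & pt-id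

    pt-final : PT (Li Bo ⊠ (RawT ⊠ Nat)) Bo (λ a → accR (proj₁ (proj₂ a) , proj₂ (proj₂ a) , proj₁ a))
    pt-final = pt-accR ∙ ((pt-fst ∙ pt-snd) & (pt-snd ∙ pt-snd) & pt-fst)

    towerF : Fn
    towerF = ⟨ idF , tetraF k ∘F fn pt-rn1 ⟩F

    towerF-sem : ∀ d → ⟦ towerF ⟧ (cd RawT d) ≡ cd (RawT ⊠ Nat) (d , tower k d)
    towerF-sem d = cong (cd RawT d ·_) (trans (cong ⟦ tetraF k ⟧ (sem pt-rn1 d)) (tetraF-sem k (suc (rn d))))

    towerF-cost : ∀ d → cost towerF (cd RawT d) ≤ 20 * (sz RawT d + 1 + sz RawT d + (eval (pol pt-rn1) (sz RawT d) + eval (towerPol k) (sz Nat (tower k d))))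
    towerF-cost d = *-monoʳ-≤ 20 (+-monoʳ-≤ (sz RawT d + 1 + sz RawT d) (+-mono-≤ (bnd pt-rn1 d)
      (≤-trans (≤-reflexive (cong (cost (tetraF k)) (sem pt-rn1 d))) (tetraF-cost k (suc (rn d))))))

  -- Constructors are matched by popping their leading bits from `rA`. After `check`, `false` is
  -- `nothing`, whereas `true` followed by the `false` of the inner `nil` is `just`. Similarly the
  -- pop in `body` opens the pair of script and data, and the push in `afterGuess` pairs the guess
  -- with the data.
  verdictC afterGuess afterScript body prog : Cmd
  verdictC    = popC rA skipC failC doneC
  afterGuess  = load rB ⨾ pushC rA true ⨾ comp (fn pt-final) ⨾ verdictC
  afterScript = unload ⨾ xferIC ⨾ guessC ⨾ afterGuess
  body        = comp towerF ⨾ comp (fn pt-scriptOf) ⨾ popC rA skipC skipC afterScript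
  prog        = load rI ⨾ comp (fn pt-check) ⨾ popC rA skipC failC (popC rA skipC body skipC)

  open Play prog

  rawPol numPol pairPol scriptPol finalPol guessPol bodyPol timePol : Pol
  rawPol    = pol pt-check ⊚ bitsPol
  numPol    = con 1 ⊕ con 2 ⊗ X
  pairPol   = con 1 ⊕ (rawPol ⊕ numPol)
  scriptPol = pol pt-scriptOf ⊚ pairPol
  finalPol  = pol pt-final ⊚ (con 1 ⊕ ((con 4 ⊗ scriptPol ⊕ con 1) ⊕ pairPol))
  guessPol  = (con 5 ⊗ scriptPol ⊕ con 2) ⊕ (con 1 ⊕ (finalPol ⊕ con 2))
  bodyPol   = con 20 ⊗ (rawPol ⊕ con 1 ⊕ rawPol ⊕ ((pol pt-rn1 ⊚ rawPol) ⊕ (towerPol k ⊚ numPol))) ⊕ (scriptPol ⊕ (con 1 ⊕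
    ((con 5 ⊗ scriptPol ⊕ con 1) ⊕ ((con 2 ⊗ scriptPol ⊕ con 1) ⊕ (con 3 ⊗ scriptPol ⊕ con 1 ⊕ guessPol)))))
  timePol   = (con 5 ⊗ X ⊕ con 2) ⊕ (rawPol ⊕ (con 2 ⊕ bodyPol))

  verdict-game : ∀ {e x} → Placed verdictC e x → ∀ v m {a} → Game m (begin verdictC e x) (idle (ser (cd Bo v) ++ a)) 2 0 (v ≡ true)
  verdict-game P true  m = game-pop1 {rA} {skipC} {failC} {doneC} P refl (g-equiv (mk⇔ (λ _ → tt) (λ _ → refl)) (g-done (P (inj₂ (inj₂ (inj₂ tt))))))
  verdict-game P false m = game-pop0 {rA} {skipC} {failC} {doneC} P refl (g-equiv (mk⇔ (λ ()) (λ ())) (g-fail (P (inj₂ (inj₂ (inj₁ tt))))))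

  comp-PT : ∀ {A B h} (p : PT A B h) x {a} → Exec (comp (fn p)) (idle (ser (cd A x) ++ a)) (cost (fn p) (cd A x)) (idle (ser (cd B (h x)) ++ a))
  comp-PT {A} p x {a} = subst (λ d → Exec (comp (fn p)) (idle (ser (cd A x) ++ a)) (cost (fn p) (cd A x)) (idle (ser d ++ a))) (sem p x) (comp-spec (fn p) (cd A x))

  -- `U` will be `tetra k (length w)`. It is at least the input length and the tower of the
  -- instance, so every cost becomes a polynomial in `U`.
  module Bounded (U : ℕ) (d : Raw) (dU : sz RawT d ≤ eval rawPol U) (NU : tower k d ≤ U) where


    num≤ : sz Nat (tower k d) ≤ eval numPol U
    num≤ = ≤-trans (≤-reflexive (sz-ℕ (tower k d))) (s≤s (*-monoʳ-≤ 2 NU))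

    pair≤ : sz (RawT ⊠ Nat) (d , tower k d) ≤ eval pairPol U
    pair≤ = s≤s (+-mono-≤ dU num≤)

    S : List Bool
    S = scriptOf (d , tower k d)

    cost-script : cost (fn pt-scriptOf) (cd (RawT ⊠ Nat) (d , tower k d)) ≤ eval scriptPol U
    cost-script = ≤-trans (bnd pt-scriptOf (d , tower k d)) (≤-trans (eval-mono (pol pt-scriptOf) pair≤) (≤-reflexive (sym (eval-⊚ (pol pt-scriptOf) pairPol U))))

    length-S : length S ≤ eval scriptPol U
    length-S = ≤-trans (length≤sz Bo S) (≤-trans (≤-trans (≤-trans (m≤m+n _ (sz (RawT ⊠ Nat) (d , tower k d))) (n≤1+n _)) (size-bnd pt-scriptOf (d , tower k d)))
      (≤-trans (eval-mono (pol pt-scriptOf) pair≤) (≤-reflexive (sym (eval-⊚ (pol pt-scriptOf) pairPol U)))))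

    guess-tail : ∀ {e x} → Placed afterGuess e x → ∀ acc m → length acc ≤ length S + 0 →
      Game m (begin afterGuess e x) (env (ser (cd (RawT ⊠ Nat) (d , tower k d)) ++ []) acc [] [] []) (eval guessPol U) 0 (accR (d , tower k d , reverse acc) ≡ true)
    guess-tail P acc m h =
      game-seq (x-weaken (+-monoˡ-≤ 2 (*-monoʳ-≤ 5 len)) (loadB-reversed acc)) P
      (game-seq (x-push (cong (λ l → idle (true ∷ l)) (sym (LP.++-assoc (ser (cdL Bo G)) (ser (cd (RawT ⊠ Nat) (d , tower k d))) [])))) (P ∘ inj₂)
      (game-seq (x-weaken fin≤ (comp-PT pt-final (G , d , tower k d))) (P ∘ inj₂ ∘ inj₂)
      (verdict-game (P ∘ inj₂ ∘ inj₂ ∘ inj₂) (accR (d , tower k d , G)) m)))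
      where
      G : List Bool
      G = reverse acc
      len : length acc ≤ eval scriptPol U
      len = ≤-trans h (≤-trans (≤-reflexive (+-identityʳ _)) length-S)
      fin≤ : cost (fn pt-final) (cd (Li Bo ⊠ (RawT ⊠ Nat)) (G , d , tower k d)) ≤ eval finalPol U
      fin≤ = ≤-trans (bnd pt-final (G , d , tower k d)) (≤-trans (eval-mono (pol pt-final) (s≤s (+-mono-≤ (≤-trans (sz-bits G) (+-monoˡ-≤ 1 (*-monoʳ-≤ 4 (≤-trans (≤-reflexive (LP.length-reverse acc)) len)))) pair≤)))
        (≤-reflexive (sym (eval-⊚ (pol pt-final) (con 1 ⊕ ((con 4 ⊗ scriptPol ⊕ con 1) ⊕ pairPol)) U))))

    body-game : ∀ {e x} → Placed body e x → Game exQ (begin body e x) (idle (ser (cd RawT d) ++ [])) (eval bodyPol U) (falses S) (Wins k d)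
    body-game P =
      game-seq (x-weaken tower≤ (subst (λ z → Exec (comp towerF) (idle (ser (cd RawT d) ++ [])) (cost towerF (cd RawT d)) (idle (ser z ++ []))) (towerF-sem d) (comp-spec towerF (cd RawT d)))) P
      (game-seq (x-weaken cost-script (comp-PT pt-scriptOf (d , tower k d))) (P ∘ inj₂)
      (game-pop1 {rA} {skipC} {skipC} {afterScript} (P ∘ inj₂ ∘ inj₂) refl
      (game-conv (cong idle (LP.++-assoc (ser (cdL Bo S)) (ser (cd (RawT ⊠ Nat) (d , tower k d))) []))
      (game-seq (x-weaken (+-monoˡ-≤ 1 (*-monoʳ-≤ 5 length-S)) (unload-spec S)) P'
      (game-seq (x-weaken (+-monoˡ-≤ 1 (*-monoʳ-≤ 2 length-S)) (xferIC-reversed S)) (P' ∘ inj₂)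
      (g-weaken (+-monoˡ-≤ (eval guessPol U) (+-monoˡ-≤ 1 (*-monoʳ-≤ 3 length-S))) ≤-refl
      (guess-game {P = λ G → accR (d , tower k d , G) ≡ true} (P' ∘ inj₂ ∘ inj₂ ∘ inj₁) S [] exQ (λ acc m h → guess-tail (P' ∘ inj₂ ∘ inj₂ ∘ inj₂) acc m h))))))))
      where
      P' : Placed afterScript _ _
      P' = P ∘ inj₂ ∘ inj₂ ∘ inj₂ ∘ inj₂ ∘ inj₂
      tower≤ : cost towerF (cd RawT d) ≤ 20 * (eval rawPol U + 1 + eval rawPol U + (eval (pol pt-rn1 ⊚ rawPol) U + eval (towerPol k ⊚ numPol) U))
      tower≤ = ≤-trans (towerF-cost d) (*-monoʳ-≤ 20 (+-mono-≤ (+-mono-≤ (+-monoˡ-≤ 1 dU) dU)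
        (+-mono-≤ (≤-trans (eval-mono (pol pt-rn1) dU) (≤-reflexive (sym (eval-⊚ (pol pt-rn1) rawPol U))))
                  (≤-trans (eval-mono (towerPol k) num≤) (≤-reflexive (sym (eval-⊚ (towerPol k) numPol U)))))))

  Accepted : List Bool → Set
  Accepted w = Σ Raw λ d → check w ≡ just d × Wins k d

  check-sound : ∀ w d → check w ≡ just d → w ≡ encRaw d × (WFRaw d × valid j d ≡ true)
  check-sound w d h with andThen-inv parse _ w h
  ... | d' , e , h' with valid j d' in v
  check-sound w d h | .d , e , refl | true = let a , b = parse-sound w d e in a , b , v

  -- The code begins with the number of tapes in unary; therefore the tower of the instance is at
  -- most `tetra k (length w)`.
  length≤w : ∀ w d → w ≡ encRaw d → suc (rn d) ≤ length w
  length≤w w d refl = ≤-trans (≤-reflexive (sym (length-unary (rn d)))) (≤-trans (m≤m+n _ _) (≤-reflexive (sym (LP.length-++ (unary (rn d))))))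

  program-game : ∀ w → Game exQ entryL (initEnv w) (eval timePol (tetra k (length w))) (j ∸ 1) (Accepted w)
  program-game w = game-seq (x-weaken (+-monoˡ-≤ 2 (*-monoʳ-≤ 5 wU)) (load-spec (slotI [] []) w)) placed-prog
    (game-seq (x-weaken check≤ (comp-PT pt-check w)) (placed-prog ∘ inj₂) (branch (check w) refl))
    where
    U : ℕ
    U = tetra k (length w)
    wU : length w ≤ U
    wU = n≤tetra k (length w)
    raw≤ : ∀ {n} → n ≤ eval (pol pt-check) (sz (Li Bo) w) → n ≤ eval rawPol U
    raw≤ h = ≤-trans h (≤-trans (eval-mono (pol pt-check) (≤-trans (sz-bits w) (+-monoˡ-≤ 1 (*-monoʳ-≤ 4 wU)))) (≤-reflexive (sym (eval-⊚ (pol pt-check) bitsPol U))))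
    check≤ : cost (fn pt-check) (cdL Bo w) ≤ eval rawPol U
    check≤ = raw≤ (bnd pt-check w)
    Pc : Placed (popC rA skipC failC (popC rA skipC body skipC)) (inj₁ ∘ inj₂ ∘ inj₂) (inj₂ tt)
    Pc = placed-prog ∘ inj₂ ∘ inj₂
    branch : ∀ m → check w ≡ m → Game exQ (begin (popC rA skipC failC (popC rA skipC body skipC)) (inj₁ ∘ inj₂ ∘ inj₂) (inj₂ tt))
      (idle (ser (cd (Ma RawT) m) ++ [])) (2 + eval bodyPol U) (j ∸ 1) (Accepted w)
    branch nothing e = game-pop0 {rA} {skipC} {failC} {popC rA skipC body skipC} Pc refl
      (g-equiv (mk⇔ (λ { (d , e' , _) → case trans (sym e) e' of λ () }) (λ ())) (g-fail (Pc (inj₂ (inj₂ (inj₁ tt))))))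
    branch (just d) e = game-pop1 {rA} {skipC} {failC} {popC rA skipC body skipC} Pc refl (game-pop0 {rA} {skipC} {body} {skipC} (Pc ∘ inj₂ ∘ inj₂ ∘ inj₂) refl
      (g-equiv (mk⇔ (λ { (d' , e' , g) → subst (Wins k) (just-inj (trans (sym e') e)) g }) (λ g → d , e , g))
        (g-weaken ≤-refl (≤-reflexive budget) (Bounded.body-game U d dU NU (Pc ∘ inj₂ ∘ inj₂ ∘ inj₂ ∘ inj₂ ∘ inj₂ ∘ inj₁)))))
      where
      cs : w ≡ encRaw d × (WFRaw d × valid j d ≡ true)
      cs = check-sound w d e
      dU : sz RawT d ≤ eval rawPol U
      dU = raw≤ (≤-trans (≤-trans (n≤1+n _) (n≤1+n _)) (subst (λ m → sz (Ma RawT) m ≤ eval (pol pt-check) (sz (Li Bo) w)) e (size-bnd pt-check w)))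
      NU : tower k d ≤ U
      NU = tetra-mono k (length≤w w d (proj₁ cs))
      alt≡ : altB (rQ d) ≡ j
      alt≡ with valid-sound j d (proj₁ (proj₂ cs)) (proj₂ (proj₂ cs))
      ... | I , refl , _ , al = trans (altB-alt (Instance.Q I)) al
      budget : falses (scriptOf (d , tower k d)) ≡ j ∸ 1
      -- A valid instance has `j` blocks, so the guessing toggles exactly as often as the class
      -- permits.
      budget = cong (_∸ 1) (trans (falses-script (tower k d * rσ d) (rQ d)) alt≡)

  prenex⇔accepted : ∀ w → PrenexTM k j w ⇔ Accepted w
  prenex⇔accepted w = mk⇔
    (λ { (I , refl , va , al , ho) → rawI I ,
         andThen-just parse _ (encode I) (trans (cong parse (encode-raw I)) (parse-complete (rawI I) (WF-rawI I)))
           (cong (λ b → if b then just (rawI I) else nothing) (valid-complete j I va al)) ,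
         Equivalence.to (holds⇔guess k I va) ho })
    (λ { (d , e , g) → back w d (check-sound w d e) g })
    where
    back : ∀ w d → w ≡ encRaw d × (WFRaw d × valid j d ≡ true) → Wins k d → PrenexTM k j w
    back w d (we , wf , v) g with valid-sound j d wf v
    ... | I , refl , va , al = I , trans (encode-raw I) (sym we) , va , al , Equivalence.from (holds⇔guess k I va) g

  member : InSigma k j (PrenexTM k j)
  member = atm , toPoly total , kind-cf start , λ w →
    let h , a , e = game-atm w (program-game w) (tetra k (evalPoly (toPoly total) (length w))) (fits w)
    in h , a , (prenex⇔accepted w ⇔∘ e)
    where
    total : Pol
    -- `machinePol timePol` is a polynomial in a tower; `tetraPol` turns it into a polynomial under
    -- the tower.
    total = tetraPol (machinePol timePol)
    fits : ∀ w → machine-time (length w) (eval timePol (tetra k (length w))) ≤ tetra k (evalPoly (toPoly total) (length w))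
    fits w = ≤-trans (s≤s (*-monoʳ-≤ (suc (eval timePol (tetra k (length w)))) (+-monoˡ-≤ 5 (*-monoʳ-≤ 2 (+-monoˡ-≤ (eval timePol (tetra k (length w))) (n≤tetra k (length w)))))))
      (≤-trans (tetraPol-bound k' (machinePol timePol) (length w)) (≤-reflexive (cong (tetra k) (sym (toPoly-eval total (length w))))))

-- Computing the reduction

pt-map : ∀ {Y Z f} → PT Y Z f → PT (Li Y) (Li Z) (map f)
pt-map {Y} {Z} {f} p = pt-rec Un Y (Li Z) (λ a → map f (proj₂ a)) (pt-const []) ((p ∙ pt-fst ∙ pt-snd) ∷P (pt-snd ∙ pt-snd ∙ pt-snd))
    (λ _ → refl) (λ _ _ _ → refl) (con 1 ⊕ X ⊗ (con 1 ⊕ pol p)) (λ _ l → bound (suc (sz (Li Y) l)) l (n≤1+n _))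
  ∙ (pt-const tt & pt-id {Li Y})
  where
  go : ∀ S l → sz (Li Y) l ≤ S → sz (Li Z) (map f l) ≤ 1 + length l * (1 + eval (pol p) S)
  go S []      h = ≤-refl
  go S (y ∷ l) h = ≤-trans (s≤s (+-mono-≤ (≤-trans (size-bnd p y) (eval-mono (pol p) (≤-trans (m≤n⇒m≤1+n (m≤m+n _ (sz (Li Y) l))) h)))
      (go S l (≤-trans (m≤n⇒m≤1+n (m≤n+m _ (sz Y y))) h))))
    (≤-reflexive (lem (eval (pol p) S) (length l)))
    where
    lem : ∀ e n → suc (e + (1 + n * (1 + e))) ≡ 1 + suc n * (1 + e)
    lem = solve-∀
  bound : ∀ S l → sz (Li Y) l ≤ S → sz (Li Z) (map f l) ≤ 1 + S * (1 + eval (pol p) S)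
  bound S l h = ≤-trans (go S l h) (s≤s (*-monoˡ-≤ (1 + eval (pol p) S) (≤-trans (length≤sz Y l) h)))

copies : ∀ {A : Set} → ℕ → List A → List A
copies zero    l = []
copies (suc n) l = l ++ copies n l

pt-copies : ∀ {A B f} n → PT A (Li B) f → PT A (Li B) (λ a → copies n (f a))
pt-copies zero    p = pt-const []
pt-copies (suc n) p = p ++P pt-copies n p

concat-const : ∀ {A : Set} n (l : List A) → concat (map (λ (_ : Fin n) → l) (allFin n)) ≡ copies n l
concat-const n l = trans (cong concat (map-allFin n (λ _ → l))) (go n)
  where
  go : ∀ n → concat (tabulate {n = n} (λ _ → l)) ≡ copies n l
  go zero    = refl
  go (suc n) = cong (l ++_) (go n)

tabulate-+ : ∀ {A : Set} m {n} (f : Fin (m + n) → A) → tabulate f ≡ tabulate (λ i → f (i ↑ˡ n)) ++ tabulate (λ i → f (m ↑ʳ i))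
tabulate-+ zero    f = refl
tabulate-+ (suc m) f = cong (f zero ∷_) (tabulate-+ m (f ∘ suc))

concat-tabulate-+ : ∀ {A : Set} m {n} (f : Fin (m + n) → List A) →
  concat (tabulate f) ≡ concat (tabulate (λ i → f (i ↑ˡ n))) ++ concat (tabulate (λ i → f (m ↑ʳ i)))
concat-tabulate-+ m {n} f = trans (cong concat (tabulate-+ m f)) (sym (LP.concat-++ (tabulate (λ i → f (i ↑ˡ n))) (tabulate (λ i → f (m ↑ʳ i)))))

-- Grows at the back, matching `chainRows`, which appends the row of a longer suffix after those of
-- the shorter ones.
catUpTo : ∀ {A : Set} → (ℕ → List A) → ℕ → List A
catUpTo g zero    = []
catUpTo g (suc n) = catUpTo g n ++ g n

catUpTo-front : ∀ {A : Set} (g : ℕ → List A) n → g 0 ++ catUpTo (g ∘ suc) n ≡ catUpTo g (suc n)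
catUpTo-front g zero    = LP.++-identityʳ (g 0)
catUpTo-front g (suc n) = trans (sym (LP.++-assoc (g 0) (catUpTo (g ∘ suc) n) (g (suc n)))) (cong (_++ g (suc n)) (catUpTo-front g n))

catUpTo-tabulate : ∀ {A : Set} (g : ℕ → List A) n → concat (tabulate {n = n} (λ i → g (toℕ i))) ≡ catUpTo g n
catUpTo-tabulate g zero    = refl
catUpTo-tabulate g (suc n) = trans (cong (g 0 ++_) (catUpTo-tabulate (g ∘ suc) n)) (catUpTo-front g n)

catUpTo-cong : ∀ {A : Set} (g g' : ℕ → List A) n → (∀ i → i < n → g i ≡ g' i) → catUpTo g n ≡ catUpTo g' n
catUpTo-cong g g' zero    h = refl
catUpTo-cong g g' (suc n) h = cong₂ _++_ (catUpTo-cong g g' n (λ i l → h i (m≤n⇒m≤1+n l))) (h n ≤-refl)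

dec-⊎ˡ : ∀ {A B} (a : Finite A) (b : Finite B) i → dec (fin-⊎ a b) (i ↑ˡ size b) ≡ inj₁ (dec a i)
dec-⊎ˡ a b i rewrite FP.splitAt-↑ˡ (size a) i (size b) = refl

dec-⊎ʳ : ∀ {A B} (a : Finite A) (b : Finite B) i → dec (fin-⊎ a b) (size a ↑ʳ i) ≡ inj₂ (dec b i)
dec-⊎ʳ a b i rewrite FP.splitAt-↑ʳ (size a) (size b) i = refl

altList : Quant → ℕ → List Bool
altList q zero    = []
altList q (suc r) = encQ q ∷ altList (negQ q) r

lastQ : Quant → ℕ → Quant
lastQ q zero    = q
lastQ q (suc r) = lastQ (negQ q) r

qvec-bits : ∀ q r m → map encQ (toList (qvec q r (r + m))) ≡ altList q r ++ replicate m (encQ (lastQ q r))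
qvec-bits q zero    zero    = refl
qvec-bits q zero    (suc m) = cong (encQ q ∷_) (qvec-bits q zero m)
qvec-bits q (suc r) m       = cong (encQ q ∷_) (qvec-bits (negQ q) r m)

dirBit : Dir → Bool
dirBit minus1 = false
dirBit plus1  = true

module Reduce (M : ATM) (j' : ℕ) where
  open Hard M j'
  open ATM M renaming (g to gM; s to sM; init to qM; δ to δM)

  -- States of `Main` come first in the numbering, so their numbers and most of the table are the
  -- same for every input. The chain state with `r` symbols left has number `c' + r`.
  c' : ℕ
  c' = size finMain

  bitsW : ℕ → ℕ → Bool → List Bool
  bitsW q b d = true ∷ (unary q ++ unary b ++ (d ∷ []))

  bitsS : ℕ → ℕ → List Bool
  bitsS q i = false ∷ (unary q ++ unary i)

  mainBits : Act Main Tape → List Bool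
  mainBits (inj₁ (q , b , d)) = bitsW (toℕ (enc finMain q)) (toℕ b) (dirBit d)
  mainBits (inj₂ (q , i))     = bitsS (toℕ (enc finMain q)) (toℕ i)

  symbols : List Symb
  symbols = allFin (suc σW)

  mainTable backRow : List Bool
  mainTable = concat (tabulate (λ q → concat (map (λ a → mainBits (mainδ (dec finMain q) a)) symbols)))
  backRow   = concat (map (λ a → bitsW (toℕ (enc finMain (fwd qM zero))) (toℕ a) false) symbols)

  chainRow : ℕ × ℕ → List Bool
  chainRow p = copies (suc σW) (bitsW (c' + proj₁ p) (proj₂ p) true)

  chainRows : List ℕ → List Bool
  chainRows []      = []
  chainRows (y ∷ l) = chainRows l ++ chainRow (length l , y)

  sy : WSym → ℕ
  sy u = toℕ (symW u)

  bitSy : Bool → Bool → ℕ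
  bitSy f b = if b then sy (cell f (suc (suc zero))) else sy (cell f (suc zero))

  cellsN : List Bool → List ℕ
  cellsN w = map (bitSy false) w ++ (sy (cell false zero) ∷ sy clk ∷ [])

  wordN : List Bool → List ℕ
  wordN w = sy sent ∷ listCase (sy (cell true zero) ∷ sy clk ∷ []) (λ p → bitSy true (proj₁ p) ∷ cellsN (proj₂ p)) w

  sy-bit : ∀ f b → sy (cell f (bitSym b)) ≡ bitSy f b
  sy-bit f true  = refl
  sy-bit f false = refl

  cells-num : ∀ w → map sy (cellsOf false w) ≡ cellsN w
  cells-num []      = refl
  cells-num (b ∷ w) = cong₂ _∷_ (sy-bit false b) (cells-num w)

  word-num : ∀ w → map sy (word w) ≡ wordN w
  word-num []      = refl
  word-num (b ∷ w) = cong (sy sent ∷_) (cong₂ _∷_ (sy-bit true b) (cells-num w))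

  length-wordN : ∀ w → length (wordN w) ≡ length (word w)
  length-wordN w = trans (cong length (sym (word-num w))) (LP.length-map sy (word w))

  pt-bitsW : ∀ {A f g} d → PT A Nat f → PT A Nat g → PT A (Li Bo) (λ a → bitsW (f a) (g a) d)
  pt-bitsW d p q = pt-const true ∷P ((pt-unary ∙ p) ++P ((pt-unary ∙ q) ++P pt-const (d ∷ [])))

  pt-chainRow : PT (Nat ⊠ Nat) (Li Bo) chainRow
  pt-chainRow = pt-copies (suc σW) (pt-bitsW true (pt-const c' +P pt-fst) pt-snd)

  chainRows-size : ∀ S l → sz (Li Nat) l ≤ S → sz (Li Bo) (chainRows l) ≤ 1 + length l * eval (pol pt-chainRow) (1 + (S + S + 1 + S))
  chainRows-size S []      h = ≤-refl
  chainRows-size S (y ∷ l) h = ≤-trans (≤-by 1 (sz-++ Bo (chainRows l) (chainRow (length l , y))))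
    (≤-trans (+-mono-≤ (chainRows-size S l hl) (≤-trans (size-bnd pt-chainRow (length l , y)) (eval-mono (pol pt-chainRow) arg)))
      (≤-reflexive (cong suc (+-comm (length l * K′) K′))))
    where
    K′ : ℕ
    K′ = eval (pol pt-chainRow) (1 + (S + S + 1 + S))
    hl : sz (Li Nat) l ≤ S
    hl = ≤-trans (m≤n⇒m≤1+n (m≤n+m _ (sz Nat y))) h
    lem : ∀ n → 1 + 2 * n ≡ n + n + 1
    lem = solve-∀
    len : length l ≤ S
    len = ≤-trans (length≤sz Nat l) hl
    arg : sz (Nat ⊠ Nat) (length l , y) ≤ 1 + (S + S + 1 + S)
    arg = s≤s (+-mono-≤ (≤-trans (≤-reflexive (trans (sz-ℕ (length l)) (lem (length l)))) (+-monoˡ-≤ 1 (+-mono-≤ len len))) (≤-trans (m≤n⇒m≤1+n (m≤m+n _ (sz (Li Nat) l))) h))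

  pt-chainRows : PT (Li Nat) (Li Bo) chainRows
  pt-chainRows = pt-rec Un Nat (Li Bo) (λ a → chainRows (proj₂ a)) (pt-const [])
      ((pt-snd ∙ pt-snd ∙ pt-snd) ++P (pt-chainRow ∙ ((pt-length ∙ pt-fst ∙ pt-snd ∙ pt-snd) & (pt-fst ∙ pt-snd))))
      (λ _ → refl) (λ _ _ _ → refl) (con 1 ⊕ X ⊗ (pol pt-chainRow ⊚ (con 1 ⊕ (X ⊕ X ⊕ con 1 ⊕ X))))
      (λ _ l → bound (suc (sz (Li Nat) l)) l (n≤1+n _))
    ∙ (pt-const tt & pt-id {Li Nat})
    where
    bound : ∀ S l → sz (Li Nat) l ≤ S → sz (Li Bo) (chainRows l) ≤ 1 + S * eval (pol pt-chainRow ⊚ (con 1 ⊕ (X ⊕ X ⊕ con 1 ⊕ X))) S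
    bound S l h = ≤-trans (chainRows-size S l h) (s≤s (*-mono-≤ (≤-trans (length≤sz Nat l) h) (≤-reflexive (sym (eval-⊚ (pol pt-chainRow) (con 1 ⊕ (X ⊕ X ⊕ con 1 ⊕ X)) S)))))

  pt-cellsN : PT (Li Bo) (Li Nat) cellsN
  pt-cellsN = pt-map (pt-if pt-id (pt-const _) (pt-const _)) ++P pt-const (sy (cell false zero) ∷ sy clk ∷ [])

  pt-wordN : PT (Li Bo) (Li Nat) wordN
  pt-wordN = pt-const (sy sent) ∷P pt-listCase (sy (cell true zero) ∷ sy clk ∷ []) (pt-if pt-fst (pt-const _) (pt-const _) ∷P (pt-cellsN ∙ pt-snd))

  inst : (List Bool → ℕ) → List Bool → Instance
  inst ex w = record { n' = suc j' + ex w ; Q = qvec exQ j' (suc (suc j' + ex w)) ; T = Loaded.T (word w) (ex w) }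

  -- Writes the code directly, without building the instance. The table of `Main` and the row of
  -- `back` are constants; only a few numbers, the quantifier padding, the chain rows and the row of
  -- the initial state vary with `w`.
  outBits : (List Bool → ℕ) → List Bool → List Bool
  outBits ex w = unary (suc j' + ex w) ++ ((altList exQ j' ++ replicate (2 + ex w) (encQ (lastQ exQ j'))) ++ (unary σW ++
    (unary (c' + (1 + (length (wordN w) + 1))) ++ (unary (c' + (1 + (length (wordN w) + 0))) ++
    (unary (toℕ (enc finMain accM)) ++ (unary (toℕ (enc finMain rejM)) ++
    (mainTable ++ (backRow ++ (chainRows (wordN w) ++ copies (suc σW) (bitsS (c' + length (wordN w)) (toℕ WT)))))))))))

  pt-outBits : ∀ {ex} → PT (Li Bo) Nat ex → PT (Li Bo) (Li Bo) (outBits ex)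
  pt-outBits pe = (pt-unary ∙ (pt-const (suc j') +P pe)) ++P
    (pt-const (altList exQ j') ++P (pt-replicate ∙ (pt-const _ & (pt-const 2 +P pe)))) ++P
    pt-const (unary σW) ++P
    (pt-unary ∙ (pt-const c' +P (pt-const 1 +P (lw +P pt-const 1)))) ++P
    (pt-unary ∙ (pt-const c' +P (pt-const 1 +P (lw +P pt-const 0)))) ++P
    pt-const (unary (toℕ (enc finMain accM))) ++P pt-const (unary (toℕ (enc finMain rejM))) ++P pt-const mainTable ++P pt-const backRow ++P (pt-chainRows ∙ pt-wordN) ++P
    pt-copies (suc σW) (pt-const false ∷P ((pt-unary ∙ (pt-const c' +P lw)) ++P pt-const (unary (toℕ WT))))
    where
    lw : PT (Li Bo) Nat (λ w → length (wordN w))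
    lw = pt-length ∙ pt-wordN

  module _ (ex : List Bool → ℕ) (w : List Bool) where
    open Loaded (word w) (ex w)

    encAct-main : ∀ a → encAction (encAct (liftA a)) ≡ mainBits a
    encAct-main (inj₁ (q , b , minus1)) = cong (λ n → bitsW n (toℕ b) false) (FP.toℕ-↑ˡ (enc finMain q) _)
    encAct-main (inj₁ (q , b , plus1))  = cong (λ n → bitsW n (toℕ b) true) (FP.toℕ-↑ˡ (enc finMain q) _)
    encAct-main (inj₂ (q , i))          = cong₂ bitsS (FP.toℕ-↑ˡ (enc finMain q) _) (FP.toℕ-↑ˡ i (ex w))

    rowOf : S → List Bool
    rowOf q = concat (map (λ a → encAction (encAct (δ' q a))) symbols)

    toℕ-chain : ∀ (r : Fin (suc m)) → toℕ (enc finS (inj₂ (chain r))) ≡ c' + toℕ r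
    toℕ-chain zero    = FP.toℕ-↑ʳ c' _
    toℕ-chain (suc i) = trans (FP.toℕ-↑ʳ c' _) (cong (λ n → c' + suc n) (FP.toℕ-↑ˡ i 1))

    row-main : ∀ q → rowOf (inj₁ q) ≡ concat (map (λ a → mainBits (mainδ q a)) symbols)
    row-main q = cong concat (LP.map-cong (λ a → encAct-main (mainδ q a)) symbols)

    row-back : rowOf back ≡ backRow
    row-back = cong concat (LP.map-cong (λ a → encAct-main (inj₁ (fwd qM zero , a , minus1))) symbols)

    row-chain : ∀ i → rowOf (inj₂ (inj₂ (inj₁ i))) ≡ chainRow (toℕ i , sy (chainSym (toℕ i)))
    row-chain i = trans (cong concat (LP.map-cong (λ a → cong (λ n → bitsW n (sy (chainSym (toℕ i))) true) (trans (toℕ-chain (F.inject₁ i)) (cong (c' +_) (FP.toℕ-inject₁ i)))) symbols))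
      (concat-const (suc σW) _)

    row-init : rowOf initS ≡ copies (suc σW) (bitsS (c' + m) (toℕ WT))
    row-init = trans (cong concat (LP.map-cong (λ a → cong₂ bitsS (trans (toℕ-chain (F.fromℕ m)) (cong (c' +_) (FP.toℕ-fromℕ m))) (FP.toℕ-↑ˡ WT (ex w))) symbols))
      (concat-const (suc σW) _)

    chain-rows : ∀ (P : List WSym) → catUpTo (λ r → chainRow (r , sy (maybe id clk (bot P r)))) (length P) ≡ chainRows (map sy P)
    chain-rows []      = refl
    chain-rows (y ∷ P) = cong₂ _++_
      (trans (catUpTo-cong _ _ (length P) (λ i h → cong (λ z → chainRow (i , sy (maybe id clk z))) (bot-below y P (λ e → <-irrefl e h)))) (chain-rows P))
      (cong₂ (λ n z → chainRow (n , sy (maybe id clk z))) (sym (LP.length-map sy P)) (bot-top y P))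

    table-bits : concat (map (λ q → concat (map (λ a → encAction (NDTM.δ T q a)) symbols)) (allFin (size finS))) ≡
      mainTable ++ (backRow ++ (chainRows (wordN w) ++ copies (suc σW) (bitsS (c' + length (wordN w)) (toℕ WT))))
    table-bits = trans (cong concat (map-allFin (size finS) (λ q → rowOf (dec finS q))))
      (trans (concat-tabulate-+ c' (λ q → rowOf (dec finS q)))
      (cong₂ _++_ (cong concat (LP.tabulate-cong (λ i → trans (cong rowOf (dec-⊎ˡ finMain _ i)) (row-main (dec finMain i)))))
      (trans (cong concat (LP.tabulate-cong (λ i → cong rowOf (dec-⊎ʳ finMain fin₂ i))))
      (trans (concat-tabulate-+ 1 (λ i → rowOf (inj₂ (dec fin₂ i))))
      (cong₂ _++_ (trans (LP.++-identityʳ _) row-back)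
      (trans (cong concat (LP.tabulate-cong (λ i → cong (λ z → rowOf (inj₂ z)) (dec-⊎ʳ fin-⊤ fin₃ i))))
      (trans (concat-tabulate-+ m (λ i → rowOf (inj₂ (inj₂ (dec fin₃ i)))))
      (cong₂ _++_
        (trans (cong concat (LP.tabulate-cong (λ i → trans (cong (λ z → rowOf (inj₂ (inj₂ z))) (dec-⊎ˡ (fin-Fin m) fin-⊤ i)) (row-chain i))))
          (trans (catUpTo-tabulate (λ r → chainRow (r , sy (chainSym r))) m) (trans (chain-rows (word w)) (cong chainRows (word-num w)))))
        (trans (LP.++-identityʳ _) (trans (cong (λ z → rowOf (inj₂ (inj₂ z))) (dec-⊎ʳ (fin-Fin m) fin-⊤ zero))
          (trans row-init (cong (λ n → copies (suc σW) (bitsS (c' + n) (toℕ WT))) (sym (length-wordN w))))))))))))))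
      where
      fin₃ : Finite (Fin m ⊎ ⊤)
      fin₃ = fin-⊎ (fin-Fin m) fin-⊤
      fin₂ : Finite (⊤ ⊎ (Fin m ⊎ ⊤))
      fin₂ = fin-⊎ fin-⊤ fin₃

    outBits-encode : outBits ex w ≡ encode (inst ex w)
    outBits-encode = cong (unary (suc j' + ex w) ++_) (cong₂ _++_ prefix
      (cong (unary σW ++_) (cong₂ _++_ (cong unary (cong (λ n → c' + (1 + (n + 1))) (length-wordN w)))
      (cong₂ _++_ (cong unary initN) (cong₂ _++_ (cong unary (sym (FP.toℕ-↑ˡ (enc finMain accM) _))) (cong₂ _++_ (cong unary (sym (FP.toℕ-↑ˡ (enc finMain rejM) _))) (sym table-bits)))))))
      where
      prefix : altList exQ j' ++ replicate (2 + ex w) (encQ (lastQ exQ j')) ≡ map encQ (toList (qvec exQ j' (suc (suc j' + ex w))))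
      prefix = trans (sym (qvec-bits exQ j' (2 + ex w))) (cong (λ n → map encQ (toList (qvec exQ j' n))) (trans (+-suc j' (1 + ex w)) (cong suc (+-suc j' (ex w)))))
      initN : c' + (1 + (length (wordN w) + 0)) ≡ toℕ (enc finS initS)
      initN = trans (cong (λ n → c' + (1 + (n + 0))) (length-wordN w)) (sym (trans (FP.toℕ-↑ʳ c' _) (cong (λ n → c' + (1 + n)) (FP.toℕ-↑ʳ m zero))))

    valid-inst : Valid (inst ex w)
    valid-inst = refl , (λ a → δ-stay accM a refl) , (λ a → δ-stay rejM a refl)

    alt-inst : alt (Instance.Q (inst ex w)) ≡ suc j'
    alt-inst = alt-qvec exQ j' (suc j' + ex w) (≤-trans (n≤1+n j') (m≤m+n (suc j') (ex w)))

-- Size of the padding and correctness of the reduction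

module Hardness (k' j' : ℕ) (M : ATM) (p : Poly) where
  open Hard M j'
  open Reduce M j'

  k : ℕ
  k = suc k'

  -- `simPol` is the simulation time when one number bounds both the input length and the running
  -- time of `M`. That number is a tower over `p` plus the length; `tetraPol` moves `simPol` under
  -- the tower and so tells how many padding tapes suffice.
  startPol simPol extraPol : Pol
  startPol = con 2 ⊕ X
  simPol   = con 1 ⊕ (con 1 ⊕ startPol ⊕ con 1) ⊕ (con 1 ⊕ X) ⊗ (con 2 ⊗ (startPol ⊕ X) ⊕ con 8)
  extraPol = tetraPol simPol ⊚ (fromPoly p ⊕ X)

  extra : List Bool → ℕ
  extra w = eval extraPol (length w)

  steps : List Bool → ℕ
  steps w = tetra k (evalPoly p (length w))

  width : List Bool → ℕ
  width w = tetra k (suc (suc j' + extra w))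

  time-fits : ∀ w → 1 + (suc (suc (suc (length w))) + 1) + suc (steps w) * (2 * (suc (suc (length w)) + steps w) + 8) ≤ width w
  time-fits w = ≤-trans (+-mono-≤ (+-monoʳ-≤ 1 (+-monoˡ-≤ 1 (s≤s n₀≤)))
      (*-mono-≤ (s≤s t≤) (+-monoˡ-≤ 8 (*-monoʳ-≤ 2 (+-mono-≤ n₀≤ t≤)))))
    (≤-trans (tetraPol-bound k' simPol z) (tetra-mono k (≤-trans (≤-reflexive (sym extra≡)) (m≤n+m (extra w) (suc (suc j'))))))
    where
    z : ℕ
    z = evalPoly p (length w) + length w
    t≤ : steps w ≤ tetra k z
    t≤ = tetra-mono k (m≤m+n _ (length w))
    n₀≤ : suc (suc (length w)) ≤ 2 + tetra k z
    n₀≤ = +-monoʳ-≤ 2 (≤-trans (m≤n+m (length w) (evalPoly p (length w))) (n≤tetra k z))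
    extra≡ : extra w ≡ eval (tetraPol simPol) z
    extra≡ = trans (eval-⊚ (tetraPol simPol) (fromPoly p ⊕ X) (length w)) (cong (λ n → eval (tetraPol simPol) (n + length w)) (fromPoly-eval p (length w)))

  module _ (w : List Bool) (ha : ATMSem.Halts M (steps w) (ATMSem.initConf M w)) (al : ATMSem.AltOK M (steps w) j' exQ (ATMSem.initConf M w)) where
    open Prenex M j' (width w)

    T : NDTM (suc (suc j') + extra w)
    T = Loaded.T (word w) (extra w)

    chOf-lookup : ∀ {n} (ws : Fin n → Word) i q → chOf ws (toℕ i) q ≡ atV zero (ws i) q
    chOf-lookup ws zero    q = refl
    chOf-lookup ws (suc i) q = chOf-lookup (ws ∘ suc) i q

    init-lookup : ∀ (ws : Fin (suc (suc j') + extra w) → Word) i q → NSem.initTapes T (width w) ws i q ≡ atV zero (ws i) q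
    init-lookup ws i q with q <? width w
    ... | yes _ = refl
    ... | no  _ = refl

    choices : ∀ (ws : Fin (suc (suc j') + extra w) → Word) i q → NSem.initTapes T (width w) ws (blkT i ↑ˡ extra w) q ≡ chOf ws (toℕ i) q
    choices ws i q = trans (init-lookup ws (blkT i ↑ˡ extra w) q) (trans (sym (chOf-lookup ws (blkT i ↑ˡ extra w) q))
      (cong (λ n → chOf ws n q) (trans (FP.toℕ-↑ˡ (blkT i) (extra w)) (FP.toℕ-inject₁ i))))

    accepts : ∀ ws → NSem.AcceptsIn T (width w) (width w) ws ⇔ (play (steps w) exQ (chOf ws) (suc (suc (length w))) (ATMSem.initConf M w) ≡ true)
    accepts ws = Start.accepts⇔play w (extra w) (width w) ws (steps w) (chOf ws) (choices ws) ha al (time-fits w)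

    holds⇔acc : Holds k (inst extra w) ⇔ ATMSem.Acc M (steps w) (ATMSem.initConf M w)
    holds⇔acc = mk⇔ (evalQ-map Q (λ ws → Equivalence.to (accepts ws))) (evalQ-map Q (λ ws → Equivalence.from (accepts ws))) ⇔∘
      claim (steps w) exQ j' (suc j' + extra w) (ATMSem.initConf M w) (suc (suc (length w))) (≤-trans (n≤1+n j') (m≤m+n (suc j') (extra w)))
        (≤-trans fits (time-fits w)) ha al
      where
      Q : Vec Quant (suc (suc j' + extra w))
      Q = qvec exQ j' (suc (suc j' + extra w))
      n₀ : ℕ
      n₀ = suc (suc (length w))
      lem : ∀ n t → n + t + (3 + t * (2 * n + 2 * t + 8) + n + n + t + 8) ≡ 1 + (suc n + 1) + suc t * (2 * (n + t) + 8)
      lem = solve-∀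
      fits : n₀ + steps w ≤ 1 + (suc n₀ + 1) + suc (steps w) * (2 * (n₀ + steps w) + 8)
      fits = ≤-by _ (lem n₀ (steps w))

  reduction : ∀ (L : Problem) →
    (∀ w → ATMSem.Halts M (steps w) (ATMSem.initConf M w) × ATMSem.AltOK M (steps w) j' exQ (ATMSem.initConf M w) × (L w ⇔ ATMSem.Acc M (steps w) (ATMSem.initConf M w))) →
    L ≤p PrenexTM k (suc j')
  reduction L h = (λ w → encode (inst extra w)) , PT⇒polytime _ (pt-ext (outBits-encode extra) (pt-outBits (pt-eval extraPol ∙ pt-length))) , λ w →
    let ha , al , e = h w in mk⇔
      (λ l → inst extra w , refl , valid-inst extra w , alt-inst extra w , Equivalence.from (holds⇔acc w ha al) (Equivalence.to e l))
      (λ { (I , ei , va , _ , ho) → Equivalence.from e (Equivalence.to (holds⇔acc w ha al) (same-holds I (inst extra w) va (valid-inst extra w) ei ho)) })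
    where
    -- A witness for `PrenexTM` is some instance with the same code as `inst extra w`, so truth is
    -- carried over through the common raw form.
    same-holds : ∀ I I' → Valid I → Valid I' → encode I ≡ encode I' → Holds k I → Holds k I'
    same-holds I I' va va' e ho = Equivalence.from (holds⇔guess k I' va')
      (subst (Wins k) (encode-injective I I' e) (Equivalence.to (holds⇔guess k I va) ho))

theorem3 : (k j : ℕ) → 1 ≤ k → 1 ≤ j → Complete k j (PrenexTM k j)
theorem3 (suc k') (suc j') _ _ = Member.member k' (suc j') ,
  λ { L (M , p , _ , h) → Hardness.reduction k' j' M p L h }
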